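{- Let $y,t,a,x$ be non-negative integers. Then the number of lozenge tilings of $\mathcal{H}_{2t,y}(2a,2x)$ that are invariant under rotation by $120^\circ$ and under reflection across the vertical symmetry axis of the region equals $P_1(x+1,y,t-y-1,a)$.
   Context: Regions live on the triangular lattice drawn with one family of lattice lines horizontal; a lozenge is the union of two unit triangles sharing an edge, and a tiling is a covering by lozenges without gaps or overlaps. For non-negative integers $t,y,a,x$, $\mathcal{H}_{t,y}(a,x)$ is the region obtained from the hexagon with all angles $120^\circ$ and side-lengths $t+x+3a,\ t,\ t+x+3a,\ t,\ t+x+3a,\ t$ (clockwise, starting from the northwestern side) by removing an up-pointing triangle of side-length $x$ at the center and three up-pointing triangles of side-length $a$ located along the segments connecting the center to the midpoints of the southern, northeastern and northwestern sides, such that the distance from the central hole to each satellite hole is $2y$. Pochhammer symbols: for $n>0$, $(x)_n=x(x+1)\cdots(x+n-1)$, $(x)_0=1$, $(x)_{ -n}=\frac{1}{(x-1)\cdots(x-n)}$; $[x]_n=x(x+2)\cdots(x+2(n-1))$ for $n>0$, $[x]_0=1$, $[x]_n=\frac{1}{(x-2)(x-4)\cdots(x+2n)}$ for $n<0$. \[P_1(x,y,z,a)=\frac{1}{2^{y+z}}\prod_{i=1}^{y+z}\frac{(2x+6a+2i)_i[2x+6a+4i+1]_{i-1}}{(i)_i[2x+6a+2i+1]_{i-1}}\prod_{i=1}^{a}\frac{(z+i)_{y+a-2i+1}(x+y+2z+2a+2i)_{2y+2a-4i+2}(x+3i-2)_{y-i+1}(x+3y+2i-1)_{i-1}}{(i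)_y(y+2z+2i-1)_{y+2a-4i+3}(2z+2i)_{y+2a-4i+1}(x+y+z+2a+i)_{y+a-2i+1}}.\]
   Formalization: The hypothesis y < t is added: for y ≥ t the argument t−y−1 is negative and P_1 is in general undefined (for example t = y = 2, a = 1 gives a zero denominator), or the satellite holes leave the region. -}

module Defs where

open import Data.Nat as ℕ using (ℕ; zero; suc)
open import Data.Integer as ℤ using (ℤ; +_; -[1+_])
open import Data.Rational as ℚ using (ℚ; 0ℚ; 1ℚ)
open import Data.Rational.Properties as ℚP using ()
open import Data.Fin using (Fin)
open import Data.Bool using (Bool; true)
open import Data.Product using (Σ; _×_; _,_; ∃)
open import Data.Sum using (_⊎_)
open import Relation.Nullary using (¬_; yes; no)
open import Relation.Binary.PropositionalEquality using (_≡_)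

ι : ℤ → ℚ
ι i = i ℚ./ 1

-- total reciprocal; 1/0 := 0 (never used on 0 inside the theorem's range)
inv : ℚ → ℚ
inv q with q ℚP.≟ 0ℚ
... | yes _  = 0ℚ
... | no q≢0 = ℚ.1/_ q {{ℚ.≢-nonZero q≢0}}

∏₁ : ℕ → (ℕ → ℚ) → ℚ
∏₁ zero    f = 1ℚ
∏₁ (suc n) f = ∏₁ n f ℚ.* f (suc n)

ascℤ : ℤ → ℕ → ℕ → ℤ
ascℤ x s zero    = + 1
ascℤ x s (suc n) = ascℤ x s n ℤ.* (x ℤ.+ + (s ℕ.* n))

descℤ : ℤ → ℕ → ℕ → ℤ
descℤ x s zero    = + 1
descℤ x s (suc n) = descℤ x s n ℤ.* (x ℤ.- + (s ℕ.* suc n))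

poch : ℤ → ℤ → ℚ
poch x (+ n)      = ι (ascℤ x 1 n)
poch x -[1+ n ]   = inv (ι (descℤ x 1 (suc n)))

poch₂ : ℤ → ℤ → ℚ
poch₂ x (+ n)     = ι (ascℤ x 2 n)
poch₂ x -[1+ n ]  = inv (ι (descℤ x 2 (suc n)))

ℓ : ℕ → ℤ
ℓ n = + n

P₁ : ℕ → ℕ → ℕ → ℕ → ℚ
P₁ x y z a =
  inv (ι (+ (2 ℕ.^ (y ℕ.+ z))))
  ℚ.* ∏₁ (y ℕ.+ z) (λ i →
        (poch (X ℤ.+ ℓ (2 ℕ.* i)) (ℓ i)
          ℚ.* poch₂ (X ℤ.+ ℓ (4 ℕ.* i ℕ.+ 1)) (ℓ i ℤ.- ℓ 1))
        ℚ.* inv (poch (ℓ i) (ℓ i)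
          ℚ.* poch₂ (X ℤ.+ ℓ (2 ℕ.* i ℕ.+ 1)) (ℓ i ℤ.- ℓ 1)))
  ℚ.* ∏₁ a (λ i →
        (poch (ℓ z ℤ.+ ℓ i) (ℓ y ℤ.+ ℓ a ℤ.- ℓ (2 ℕ.* i) ℤ.+ ℓ 1)
          ℚ.* poch (ℓ x ℤ.+ ℓ y ℤ.+ ℓ (2 ℕ.* z) ℤ.+ ℓ (2 ℕ.* a) ℤ.+ ℓ (2 ℕ.* i))
                   (ℓ (2 ℕ.* y) ℤ.+ ℓ (2 ℕ.* a) ℤ.- ℓ (4 ℕ.* i) ℤ.+ ℓ 2)
          ℚ.* poch (ℓ x ℤ.+ ℓ (3 ℕ.* i) ℤ.- ℓ 2) (ℓ y ℤ.- ℓ i ℤ.+ ℓ 1)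
          ℚ.* poch (ℓ x ℤ.+ ℓ (3 ℕ.* y) ℤ.+ ℓ (2 ℕ.* i) ℤ.- ℓ 1) (ℓ i ℤ.- ℓ 1))
        ℚ.* inv (poch (ℓ i) (ℓ y)
          ℚ.* poch (ℓ y ℤ.+ ℓ (2 ℕ.* z) ℤ.+ ℓ (2 ℕ.* i) ℤ.- ℓ 1)
                   (ℓ y ℤ.+ ℓ (2 ℕ.* a) ℤ.- ℓ (4 ℕ.* i) ℤ.+ ℓ 3)
          ℚ.* poch (ℓ (2 ℕ.* z) ℤ.+ ℓ (2 ℕ.* i))
                   (ℓ y ℤ.+ ℓ (2 ℕ.* a) ℤ.- ℓ (4 ℕ.* i) ℤ.+ ℓ 1)
          ℚ.* poch (ℓ x ℤ.+ ℓ y ℤ.+ ℓ z ℤ.+ ℓ (2 ℕ.* a) ℤ.+ ℓ i)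
                   (ℓ y ℤ.+ ℓ a ℤ.- ℓ (2 ℕ.* i) ℤ.+ ℓ 1)))
  where
  X : ℤ
  X = ℓ (2 ℕ.* x ℕ.+ 6 ℕ.* a)

-- A unit triangle of the triangular lattice (one family of lattice lines
-- horizontal) is recorded by its three "strip coordinates" (u₁,u₂,u₃):
-- uₖ is the index of the strip, between consecutive lattice lines of the
-- k-th family, containing the triangle, counted as the distance from a
-- fixed reference line of that family (family 1 = horizontal lines,
-- measured upward from the southern side of the reference big triangle;
-- family 2 = lines parallel to its north-western side, measured from it;
-- family 3 = lines parallel to its north-eastern side, measured from it).
-- For a reference up-pointing triangle of side L, the unit triangles are
-- exactly the triples with u₁+u₂+u₃ = L-1 (up-pointing) or L-2
-- (down-pointing).
record Tri : Set where
  constructor tri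
  field
    u₁ u₂ u₃ : ℤ
open Tri public

usum : Tri → ℤ
usum τ = u₁ τ ℤ.+ u₂ τ ℤ.+ u₃ τ

IsUnitTriangle : ℤ → Tri → Set
IsUnitTriangle L τ = usum τ ≡ L ℤ.- ℓ 1 ⊎ usum τ ≡ L ℤ.- ℓ 2

-- τ lies in the up-pointing lattice triangle cut out by the half-planes
-- uₖ ≥ bₖ (its side is L - (b₁+b₂+b₃) when the reference triangle has side L)
InUpTri : Tri → Tri → Set
InUpTri b τ = (u₁ b ℤ.≤ u₁ τ) × (u₂ b ℤ.≤ u₂ τ) × (u₃ b ℤ.≤ u₃ τ)

-- the three down-pointing neighbours of an up-pointing triangle
-- (across its southern, north-western and north-eastern edges)
-- A lozenge is a pair (up-triangle τ, down-triangle σ) with Adjacent τ σ.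
Adjacent : Tri → Tri → Set
Adjacent (tri a b c) σ =
  σ ≡ tri (a ℤ.- ℓ 1) b c ⊎ σ ≡ tri a (b ℤ.- ℓ 1) c ⊎ σ ≡ tri a b (c ℤ.- ℓ 1)

Region : Set₁
Region = Tri → Set

LozengeSet : Set
LozengeSet = Tri → Tri → Bool

_∈L_ : Tri → Tri × Tri → Set
ρ ∈L (τ , σ) = ρ ≡ τ ⊎ ρ ≡ σ

IsTiling : Region → LozengeSet → Set
IsTiling R S =
  (∀ τ σ → S τ σ ≡ true → Adjacent τ σ × R τ × R σ)
  × (∀ ρ → R ρ → Σ Tri λ τ → Σ Tri λ σ → S τ σ ≡ true × ρ ∈L (τ , σ))
  × (∀ ρ τ σ τ' σ' → S τ σ ≡ true → S τ' σ' ≡ true →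
       ρ ∈L (τ , σ) → ρ ∈L (τ' , σ') → (τ ≡ τ' × σ ≡ σ'))

-- rotation by 120° about the centre of the reference triangle
-- (cyclically permutes the distances to its three sides)
rot120 : Tri → Tri
rot120 (tri a b c) = tri b c a

-- reflection across the vertical axis of the reference triangle
-- (fixes the distance to the southern side, swaps the other two)
reflV : Tri → Tri
reflV (tri a b c) = tri a c b

InvariantUnder : (Tri → Tri) → LozengeSet → Set
InvariantUnder f S = ∀ τ σ → S (f τ) (f σ) ≡ S τ σ

-- The region 𝓗_{2t,y}(2a,2x).
-- Reference up-pointing triangle of side L = 6t+2x+6a; cutting off its three
-- corners (up-triangles of side 2t) leaves the hexagon with sides
-- 2t+2x+6a, 2t, 2t+2x+6a, 2t, 2t+2x+6a, 2t.  Holes: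
--   central up-triangle of side 2x : uₖ ≥ 2t+2a (k=1,2,3), centroid = centre;
--   satellites (side 2a), with c = 2t+2a+x+y:
--     southern      : u ≥ (2t-2y, c, c)
--     north-western : u ≥ (c, 2t-2y, c)
--     north-eastern : u ≥ (c, c, 2t-2y)
--   (each satellite's vertex facing the central hole is at lattice distance
--    2y from the facing side of the central hole, on the segment from the
--    centre to the midpoint of the corresponding long side).
ℋ₂ : ℕ → ℕ → ℕ → ℕ → Region
ℋ₂ t y a x τ =
  IsUnitTriangle L τ
  × InUpTri (tri (ℓ 0) (ℓ 0) (ℓ 0)) τ
  × ¬ InUpTri (tri (ℓ 0) (ℓ 0) (L ℤ.- ℓ (2 ℕ.* t))) τ
  × ¬ InUpTri (tri (ℓ 0) (L ℤ.- ℓ (2 ℕ.* t)) (ℓ 0)) τ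
  × ¬ InUpTri (tri (L ℤ.- ℓ (2 ℕ.* t)) (ℓ 0) (ℓ 0)) τ
  × ¬ InUpTri (tri m m m) τ
  × ¬ InUpTri (tri d c c) τ
  × ¬ InUpTri (tri c d c) τ
  × ¬ InUpTri (tri c c d) τ
  where
  L m c d : ℤ
  L = ℓ (6 ℕ.* t ℕ.+ 2 ℕ.* x ℕ.+ 6 ℕ.* a)
  m = ℓ (2 ℕ.* t ℕ.+ 2 ℕ.* a)
  c = ℓ (2 ℕ.* t ℕ.+ 2 ℕ.* a ℕ.+ x ℕ.+ y)
  d = ℓ (2 ℕ.* t) ℤ.- ℓ (2 ℕ.* y)

SymTiling : Region → Set
SymTiling R =
  Σ LozengeSet λ S → IsTiling R S × InvariantUnder rot120 S × InvariantUnder reflV S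

_≈T_ : ∀ {R} → SymTiling R → SymTiling R → Set
(S , _) ≈T (S' , _) = ∀ τ σ → S τ σ ≡ S' τ σ

HasCardinality : (A : Set) → (A → A → Set) → ℕ → Set
HasCardinality A _≈_ n =
  Σ (Fin n → A) λ e →
    (∀ i j → e i ≈ e j → i ≡ j) × (∀ s → ∃ λ i → s ≈ e i)

NumSymTilings : Region → ℕ → Set
NumSymTilings R N = HasCardinality (SymTiling R) (_≈T_ {R}) N

module Submission where

-- A symmetric tiling is determined by the lozenges in a fundamental domain of the symmetry group of the triangle.
-- Read strip by strip, these form families of non-intersecting lattice paths that enter along the boundary, at the
-- central hole and at one satellite.  A Lindström–Gessel–Viennot argument, carried out one strip at a time, turns
-- their number into a determinant with binomial entries.  Condensation (a Plücker relation) reduces the determinant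
-- to the case without satellite, which is evaluated through an explicit vector in the kernel of its rows.

open import Defs
open import Data.Nat as ℕ using (ℕ; zero; suc; z≤n; s≤s)
import Data.Nat.Properties as NP
open NP using (+-mono-≤; +-monoʳ-≤; +-suc; <-asym; <-irrefl; <-trans; <⇒≢; <⇒≤; <⇒≱; m*n≡0⇒m≡0∨n≡0; m+[n∸m]≡n; m+n≡0⇒n≡0; m<m+n; m<n⇒m<1+n; m∸n+n≡m; m≤m+n; m≤n⇒m<n∨m≡n; m≤n⇒m≤1+n; n≤1+n; ≤-pred; ≤-refl; ≤-reflexive; ≤-total; ≤-trans; ≤ᵇ⇒≤; ≤∧≢⇒<; ≮⇒≥)
open import Data.Nat.Tactic.RingSolver using () renaming (solve-∀ to solve-ℕ)
open import Data.Integer as ℤ using (ℤ; +_; -[1+_])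
import Data.Integer.Properties as ZP
open import Data.Integer.Tactic.RingSolver using () renaming (solve-∀ to solve-ℤ)
open import Data.Rational as ℚ using (ℚ; 0ℚ; 1ℚ)
import Data.Rational.Properties as QP
open import Data.Bool as Bool using (Bool; true; false)
open import Data.List as List using (List; []; _∷_; _++_; length; [_]; map; concatMap)
import Data.List.Properties as LP
open import Data.List.Membership.Propositional using (_∈_)
open import Data.List.Membership.Propositional.Properties using (∈-++⁺ˡ; ∈-++⁺ʳ; ∈-++⁻; ∈-map⁺; ∈-map⁻)
open import Data.List.Relation.Unary.Any using (here; there)
open import Data.List.Relation.Unary.All as All using (All; []; _∷_)
import Data.List.Relation.Unary.All.Properties as AllP
open import Data.List.Relation.Binary.Pointwise as PW using (Pointwise; []; _∷_)
open import Data.Product using (Σ; ∃; _×_; _,_; proj₁; proj₂)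
open import Data.Sum using (_⊎_; inj₁; inj₂)
open import Data.Empty using (⊥; ⊥-elim)
open import Relation.Nullary using (¬_; Dec; yes; no; does)
open import Relation.Nullary.Decidable using (_×-dec_; _⊎-dec_; ¬?; map′)
open import Relation.Binary.PropositionalEquality hiding ([_])

-- All lengths of the region are even, and this decides the first step: the triangles bisected by a
-- symmetry axis are forced to pair up along it, so the open chamber `A < b < c` of strip
-- coordinates is tiled by itself. The obstacle is the satellite. A path may run into it, but its
-- row is then a combination of the rows of the paths that start on the satellite, so such a step
-- contributes nothing. Condensation lowers the size `a` of the satellite and needs the sizes 0 and
-- 1 to start from. Size 1 adds a single row to the matrix of the core, and Cramer's rule with the
-- kernel vector evaluates it. The same vector evaluates the core: a touching satellite merges with
-- the core and raises `x` by 3, and comparing the two readings of this one determinant gives a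
-- recurrence of `M` from `x` to `x + 3`. The closed form is then carried through condensation as a
-- factor on top of a core determinant; once all factorials have cancelled, one polynomial identity
-- in four variables is left.

-- Arithmetic of the rationals: embedding of the integers, reciprocals, cancellation.

module Embedding where
 open import Data.Rational using (_+_; _*_; -_; _-_)
 open import Data.Rational.Unnormalised as ℚᵘ using (mkℚᵘ; *≡*)
 import Data.Rational.Unnormalised.Properties as ℚᵘP
 open import Relation.Nullary.Decidable using (dec⇒maybe)
 open import Tactic.RingSolver.Core.AlmostCommutativeRing using (AlmostCommutativeRing; fromCommutativeRing)
 open import Level using (0ℓ)

 ℚ-ring : AlmostCommutativeRing 0ℓ 0ℓ
 ℚ-ring = fromCommutativeRing QP.+-*-commutativeRing (λ p → dec⇒maybe (0ℚ QP.≟ p))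

 open import Tactic.RingSolver.NonReflective ℚ-ring using (solve; _⊕_; _⊗_; ⊝_; Κ; Expr) public

 infix 4 _⊜_
 _⊜_ : ∀ {n} → Expr ℚ n → Expr ℚ n → Expr ℚ n × Expr ℚ n
 _⊜_ = _,_

 infixl 6 _⊖_
 _⊖_ : ∀ {n} → Expr ℚ n → Expr ℚ n → Expr ℚ n
 p ⊖ q = p ⊕ (⊝ q)

 -- Transfers the homomorphism laws to unnormalised fractions, where they are identities between
 -- integers.
 ι≡ : ∀ i → ι i ≡ ℚ.fromℚᵘ (mkℚᵘ i 0)
 ι≡ (+ n) = refl
 ι≡ -[1+ n ] = refl

 ι-+ : ∀ i j → ι (i ℤ.+ j) ≡ ι i + ι j
 ι-+ i j = QP.toℚᵘ-injective (begin
  ℚ.toℚᵘ (ι (i ℤ.+ j)) ≈⟨ u (i ℤ.+ j) ⟩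
  mkℚᵘ (i ℤ.+ j) 0 ≈⟨ *≡* (cong (ℤ._* + 1) (cong₂ ℤ._+_ (sym (ZP.*-identityʳ i)) (sym (ZP.*-identityʳ j)))) ⟩
  mkℚᵘ i 0 ℚᵘ.+ mkℚᵘ j 0 ≈⟨ ℚᵘP.+-cong (u i) (u j) ⟨
  ℚ.toℚᵘ (ι i) ℚᵘ.+ ℚ.toℚᵘ (ι j) ≈⟨ QP.toℚᵘ-homo-+ (ι i) (ι j) ⟨
  ℚ.toℚᵘ (ι i + ι j) ∎)
  where
  open ℚᵘP.≃-Reasoning
  u : ∀ i → ℚ.toℚᵘ (ι i) ℚᵘ.≃ mkℚᵘ i 0
  u i = subst (λ p → ℚ.toℚᵘ p ℚᵘ.≃ mkℚᵘ i 0) (sym (ι≡ i)) (QP.toℚᵘ-fromℚᵘ (mkℚᵘ i 0))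

 ι-* : ∀ i j → ι (i ℤ.* j) ≡ ι i * ι j
 ι-* i j = QP.toℚᵘ-injective (begin
  ℚ.toℚᵘ (ι (i ℤ.* j)) ≈⟨ u (i ℤ.* j) ⟩
  mkℚᵘ (i ℤ.* j) 0 ≈⟨ *≡* refl ⟩
  mkℚᵘ i 0 ℚᵘ.* mkℚᵘ j 0 ≈⟨ ℚᵘP.*-cong (u i) (u j) ⟨
  ℚ.toℚᵘ (ι i) ℚᵘ.* ℚ.toℚᵘ (ι j) ≈⟨ QP.toℚᵘ-homo-* (ι i) (ι j) ⟨
  ℚ.toℚᵘ (ι i * ι j) ∎)
  where
  open ℚᵘP.≃-Reasoning
  u : ∀ i → ℚ.toℚᵘ (ι i) ℚᵘ.≃ mkℚᵘ i 0
  u i = subst (λ p → ℚ.toℚᵘ p ℚᵘ.≃ mkℚᵘ i 0) (sym (ι≡ i)) (QP.toℚᵘ-fromℚᵘ (mkℚᵘ i 0))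

 ι-neg : ∀ i → ι (ℤ.- i) ≡ - ι i
 ι-neg i = begin
  ι (ℤ.- i) ≡⟨ solve 2 (λ a b → a ⊜ ((a ⊕ b) ⊖ b)) refl (ι (ℤ.- i)) (ι i) ⟩
  ι (ℤ.- i) + ι i - ι i ≡⟨ cong (_- ι i) (trans (sym (ι-+ (ℤ.- i) i)) (cong ι (ZP.+-inverseˡ i))) ⟩
  0ℚ - ι i ≡⟨ QP.+-identityˡ _ ⟩
  - ι i ∎
  where open ≡-Reasoning

 ι-- : ∀ i j → ι (i ℤ.- j) ≡ ι i - ι j
 ι-- i j = trans (ι-+ i (ℤ.- j)) (cong (λ k → ι i + k) (ι-neg j))

 ι-injective : ∀ i j → ι i ≡ ι j → i ≡ j
 ι-injective i j e = begin
  i ≡⟨ ZP.*-identityʳ i ⟨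
  i ℤ.* + 1 ≡⟨ drop (QP.fromℚᵘ-injective (trans (sym (ι≡ i)) (trans e (ι≡ j)))) ⟩
  j ℤ.* + 1 ≡⟨ ZP.*-identityʳ j ⟩
  j ∎
  where
  open ≡-Reasoning
  drop : mkℚᵘ i 0 ℚᵘ.≃ mkℚᵘ j 0 → i ℤ.* + 1 ≡ j ℤ.* + 1
  drop (*≡* p) = p

 q : ℕ → ℚ
 q n = ι (+ n)

 q-+ : ∀ m n → q (m ℕ.+ n) ≡ q m + q n
 q-+ m n = ι-+ (+ m) (+ n)

 q-* : ∀ m n → q (m ℕ.* n) ≡ q m * q n
 q-* m n = trans (cong ι (ZP.pos-* m n)) (ι-* (+ m) (+ n))

 q-suc : ∀ n → q (suc n) ≡ 1ℚ + q n
 q-suc n = q-+ 1 n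

 q-suc≢0 : ∀ n → q (suc n) ≢ 0ℚ
 q-suc≢0 n e with ι-injective (+ suc n) (+ 0) e
 ... | ()

 inv-inverseʳ : ∀ {x} → x ≢ 0ℚ → x * inv x ≡ 1ℚ
 inv-inverseʳ {x} x≢0 with x QP.≟ 0ℚ
 ... | yes e = ⊥-elim (x≢0 e)
 ... | no n = QP.*-inverseʳ x {{ℚ.≢-nonZero n}}

 -- The tool for all quotients below: an identity between ratios is multiplied by something nonzero,
 -- proved as an identity of products, and cancelled here.
 *-cancelˡ : ∀ {c x y} → c ≢ 0ℚ → c * x ≡ c * y → x ≡ y
 *-cancelˡ {c} {x} {y} c≢0 e = begin
  x ≡⟨ back x ⟩
  inv c * (c * x) ≡⟨ cong (inv c *_) e ⟩
  inv c * (c * y) ≡⟨ back y ⟨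
  y ∎
  where
  open ≡-Reasoning
  back : ∀ z → z ≡ inv c * (c * z)
  back z = begin
   z ≡⟨ QP.*-identityˡ z ⟨
   1ℚ * z ≡⟨ cong (_* z) (inv-inverseʳ c≢0) ⟨
   c * inv c * z ≡⟨ solve 3 (λ a b d → a ⊗ b ⊗ d ⊜ b ⊗ (a ⊗ d)) refl c (inv c) z ⟩
   inv c * (c * z) ∎

 *-≢0 : ∀ {x y} → x ≢ 0ℚ → y ≢ 0ℚ → x * y ≢ 0ℚ
 *-≢0 {x} {y} x≢0 y≢0 e = y≢0 (*-cancelˡ x≢0 (trans e (sym (QP.*-zeroʳ x))))

 inv-≢0 : ∀ {x} → x ≢ 0ℚ → inv x ≢ 0ℚ
 inv-≢0 {x} x≢0 e with trans (sym (inv-inverseʳ x≢0)) (trans (cong (x *_) e) (QP.*-zeroʳ x))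
 ... | ()

-- Determinants as exterior products of columns: Plücker relation and Cramer's rule.

module Determinants where
 open import Data.Rational using (_+_; _*_; -_; _-_)
 open Embedding

 Row : Set
 Row = ℕ → ℚ

 Form : Set
 Form = List Row → ℚ

 infixr 6 _∧_
 -- Laplace expansion along one more column, whose entries are the values of `φ`: either the row `r`
 -- is struck out, or it is handed on to `Ψ` at the cost of a sign. Rows form a list, so that
 -- removing and moving them are list operations.
 _∧_ : (Row → ℚ) → Form → Form
 (φ ∧ Ψ) [] = 0ℚ
 (φ ∧ Ψ) (r ∷ rs) = φ r * Ψ rs - (φ ∧ λ l → Ψ (r ∷ l)) rs

 col : ℕ → Row → ℚ
 col j r = r j

 -- Nonzero on the empty list alone; hence `D j n` is zero unless it is given exactly `n` rows.
 unit : Form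
 unit [] = 1ℚ
 unit (_ ∷ _) = 0ℚ

 -- The determinant on the columns j, …, j + n − 1.
 D : ℕ → ℕ → Form
 D j zero = unit
 D j (suc n) = col j ∧ D (suc j) n

 ∧-cong : ∀ {φ χ Ψ Ω} → (∀ r → φ r ≡ χ r) → (∀ l → Ψ l ≡ Ω l) → ∀ l → (φ ∧ Ψ) l ≡ (χ ∧ Ω) l
 ∧-cong p e [] = refl
 ∧-cong p e (r ∷ rs) = cong₂ _-_ (cong₂ _*_ (p r) (e rs)) (∧-cong p (λ l → e (r ∷ l)) rs)

 ∧-linʳ : ∀ {φ Ψ Ω} a b l → (φ ∧ λ l → a * Ψ l + b * Ω l) l ≡ a * (φ ∧ Ψ) l + b * (φ ∧ Ω) l
 ∧-linʳ a b [] = solve 2 (λ a b → Κ 0ℚ ⊜ (a ⊗ Κ 0ℚ) ⊕ (b ⊗ Κ 0ℚ)) refl a b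
 ∧-linʳ {φ} {Ψ} {Ω} a b (r ∷ rs) = trans
  (cong (λ z → φ r * (a * Ψ rs + b * Ω rs) - z) (∧-linʳ a b rs))
  (solve 7 (λ a b f p o u v → (f ⊗ ((a ⊗ p) ⊕ (b ⊗ o)) ⊖ ((a ⊗ u) ⊕ (b ⊗ v)))
    ⊜ ((a ⊗ ((f ⊗ p) ⊖ u)) ⊕ (b ⊗ ((f ⊗ o) ⊖ v)))) refl a b (φ r) (Ψ rs) (Ω rs) _ _)

 ∧-linˡ : ∀ {φ χ Ψ} a b l → ((λ r → a * φ r + b * χ r) ∧ Ψ) l ≡ a * (φ ∧ Ψ) l + b * (χ ∧ Ψ) l
 ∧-linˡ a b [] = solve 2 (λ a b → Κ 0ℚ ⊜ (a ⊗ Κ 0ℚ) ⊕ (b ⊗ Κ 0ℚ)) refl a b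
 ∧-linˡ {φ} {χ} {Ψ} a b (r ∷ rs) = trans
  (cong (λ z → (a * φ r + b * χ r) * Ψ rs - z) (∧-linˡ a b rs))
  (solve 7 (λ a b f g p u v → (((a ⊗ f) ⊕ (b ⊗ g)) ⊗ p ⊖ ((a ⊗ u) ⊕ (b ⊗ v)))
    ⊜ ((a ⊗ ((f ⊗ p) ⊖ u)) ⊕ (b ⊗ ((g ⊗ p) ⊖ v)))) refl a b (φ r) (χ r) (Ψ rs) _ _)

 ∧-scaleʳ : ∀ {φ Ψ} a l → (φ ∧ λ l → a * Ψ l) l ≡ a * (φ ∧ Ψ) l
 ∧-scaleʳ {φ} {Ψ} a l = begin
  (φ ∧ λ l → a * Ψ l) l ≡⟨ ∧-cong {φ} (λ _ → refl) (λ l → solve 2 (λ a p → (a ⊗ p) ⊜ ((a ⊗ p) ⊕ (Κ 0ℚ ⊗ p))) refl a (Ψ l)) l ⟩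
  (φ ∧ λ l → a * Ψ l + 0ℚ * Ψ l) l ≡⟨ ∧-linʳ a 0ℚ l ⟩
  a * (φ ∧ Ψ) l + 0ℚ * (φ ∧ Ψ) l ≡⟨ solve 2 (λ a p → (a ⊗ p) ⊜ ((a ⊗ p) ⊕ (Κ 0ℚ ⊗ p))) refl a ((φ ∧ Ψ) l) ⟨
  a * (φ ∧ Ψ) l ∎
  where open ≡-Reasoning

 ∧-zeroʳ : ∀ {φ Ψ} → (∀ l → Ψ l ≡ 0ℚ) → ∀ l → (φ ∧ Ψ) l ≡ 0ℚ
 ∧-zeroʳ e [] = refl
 ∧-zeroʳ {φ} e (r ∷ rs) = trans (cong₂ (λ u v → φ r * u - v) (e rs) (∧-zeroʳ (λ l → e (r ∷ l)) rs))
  (solve 1 (λ a → ((a ⊗ Κ 0ℚ) ⊖ Κ 0ℚ) ⊜ Κ 0ℚ) refl (φ r))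

 ∧-zeroˡ : ∀ {φ Ψ l} → All (λ r → φ r ≡ 0ℚ) l → (φ ∧ Ψ) l ≡ 0ℚ
 ∧-zeroˡ [] = refl
 ∧-zeroˡ {φ} {Ψ} {r ∷ rs} (e ∷ es) = trans (cong₂ (λ u v → u * Ψ rs - v) e (∧-zeroˡ es))
  (solve 1 (λ a → ((Κ 0ℚ ⊗ a) ⊖ Κ 0ℚ) ⊜ Κ 0ℚ) refl (Ψ rs))

 -- Splitting off the first row in both expansions gives one term with `φ r` and one with `χ r`,
 -- which trade places with opposite signs; the remainder is the same claim for a shorter list.
 ∧-anticomm : ∀ φ χ Ψ l → (φ ∧ χ ∧ Ψ) l ≡ - (χ ∧ φ ∧ Ψ) l
 ∧-anticomm φ χ Ψ [] = refl
 ∧-anticomm φ χ Ψ (r ∷ rs) = begin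
  φ r * (χ ∧ Ψ) rs - (φ ∧ λ l → (χ r * Ψ l - (χ ∧ λ l → Ψ (r ∷ l)) l)) rs
   ≡⟨ cong (λ z → φ r * (χ ∧ Ψ) rs - z) (inner φ χ) ⟩
  φ r * (χ ∧ Ψ) rs - (χ r * (φ ∧ Ψ) rs - (φ ∧ χ ∧ λ l → Ψ (r ∷ l)) rs)
   ≡⟨ cong (λ z → φ r * (χ ∧ Ψ) rs - (χ r * (φ ∧ Ψ) rs - z)) (∧-anticomm φ χ (λ l → Ψ (r ∷ l)) rs) ⟩
  φ r * (χ ∧ Ψ) rs - (χ r * (φ ∧ Ψ) rs - - (χ ∧ φ ∧ λ l → Ψ (r ∷ l)) rs)
   ≡⟨ solve 5 (λ f u g v w → (f ⊗ u ⊖ (g ⊗ v ⊖ (⊝ w))) ⊜ (⊝ (g ⊗ v ⊖ (f ⊗ u ⊖ w)))) refl (φ r) ((χ ∧ Ψ) rs) (χ r) ((φ ∧ Ψ) rs) _ ⟩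
  - (χ r * (φ ∧ Ψ) rs - (φ r * (χ ∧ Ψ) rs - (χ ∧ φ ∧ λ l → Ψ (r ∷ l)) rs))
   ≡⟨ cong (λ z → - (χ r * (φ ∧ Ψ) rs - z)) (inner χ φ) ⟨
  - (χ ∧ φ ∧ Ψ) (r ∷ rs) ∎
  where
  open ≡-Reasoning
  inner : ∀ φ χ → (φ ∧ λ l → (χ r * Ψ l - (χ ∧ λ l → Ψ (r ∷ l)) l)) rs
     ≡ χ r * (φ ∧ Ψ) rs - (φ ∧ χ ∧ λ l → Ψ (r ∷ l)) rs
  inner φ χ = begin
   (φ ∧ λ l → (χ r * Ψ l - (χ ∧ λ l → Ψ (r ∷ l)) l)) rs
    ≡⟨ ∧-cong {φ} (λ _ → refl) (λ l → solve 3 (λ a b c → (a ⊗ b ⊖ c) ⊜ (a ⊗ b ⊕ (Κ (- 1ℚ) ⊗ c))) refl (χ r) (Ψ l) _) rs ⟩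
   (φ ∧ λ l → (χ r * Ψ l + (- 1ℚ) * (χ ∧ λ l → Ψ (r ∷ l)) l)) rs
    ≡⟨ ∧-linʳ (χ r) (- 1ℚ) rs ⟩
   χ r * (φ ∧ Ψ) rs + (- 1ℚ) * (φ ∧ χ ∧ λ l → Ψ (r ∷ l)) rs
    ≡⟨ solve 3 (λ a b c → (a ⊗ b ⊖ c) ⊜ (a ⊗ b ⊕ (Κ (- 1ℚ) ⊗ c))) refl (χ r) _ _ ⟨
   χ r * (φ ∧ Ψ) rs - (φ ∧ χ ∧ λ l → Ψ (r ∷ l)) rs ∎

 x≡-x⇒x≡0 : ∀ {x} → x ≡ - x → x ≡ 0ℚ
 x≡-x⇒x≡0 {x} e = *-cancelˡ (q-suc≢0 1) (trans
  (solve 1 (λ x → (Κ (q 2) ⊗ x) ⊜ (x ⊖ (⊝ x))) refl x)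
  (trans (cong (λ z → x - z) (sym e)) (solve 1 (λ x → (x ⊖ x) ⊜ (Κ (q 2) ⊗ Κ 0ℚ)) refl x)))

 -- The coefficient-free way to say that `θ` is a linear combination of the columns `j`, ...,
 -- `j + n − 1`.
 Kills : ℕ → ℕ → (Row → ℚ) → Set
 Kills j n θ = ∀ l → (θ ∧ D j n) l ≡ 0ℚ

 -- For the leading column, anticommutativity makes the product its own negative; any other column
 -- is first moved past the leading one.
 col-kills : ∀ j n k → j ℕ.≤ k → k ℕ.< j ℕ.+ n → Kills j n (col k)
 col-kills j zero k j≤k k<j l with () ← <⇒≱ (subst (k ℕ.<_) (NP.+-identityʳ j) k<j) j≤k
 col-kills j (suc n) k j≤k k<j+n l with j NP.≟ k
 ... | yes refl = x≡-x⇒x≡0 (∧-anticomm (col j) (col j) (D (suc j) n) l)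
 ... | no j≢k = trans (∧-anticomm (col k) (col j) (D (suc j) n) l)
  (cong -_ (∧-zeroʳ {col j} (col-kills (suc j) n k (≤∧≢⇒< j≤k j≢k) (subst (k ℕ.<_) (+-suc j n) k<j+n)) l))

 Kills-lin : ∀ {j n θ η} a b → Kills j n θ → Kills j n η → Kills j n (λ r → a * θ r + b * η r)
 Kills-lin a b p r l = trans (∧-linˡ a b l) (trans (cong₂ (λ u v → a * u + b * v) (p l) (r l))
  (solve 2 (λ a b → (a ⊗ Κ 0ℚ ⊕ b ⊗ Κ 0ℚ) ⊜ Κ 0ℚ) refl a b))

 Kills-resp : ∀ {j n θ η} → (∀ r → θ r ≡ η r) → Kills j n θ → Kills j n η
 Kills-resp e p l = trans (∧-cong (λ r → sym (e r)) (λ _ → refl) l) (p l)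

 -- Expansion along further rows only forms combinations of the functionals `Ψ X` with coefficients
 -- free of `X`.
 ∧-kills : ∀ {j n φ} (Ψ : Row → Form) → (∀ l → Kills j n (λ X → Ψ X l)) → ∀ l → Kills j n (λ X → (φ ∧ Ψ X) l)
 ∧-kills {j} {n} Ψ p [] l′ = ∧-zeroˡ (All.universal (λ _ → refl) l′)
 ∧-kills {j} {n} {φ} Ψ p (r ∷ rs) = Kills-resp {j} {n}
  (λ X → solve 3 (λ f u v → (f ⊗ u ⊕ (Κ (- 1ℚ) ⊗ v)) ⊜ (f ⊗ u ⊖ v)) refl (φ r) (Ψ X rs) _)
  (Kills-lin {j} {n} (φ r) (- 1ℚ) (p rs) (∧-kills {j} {n} (λ X l → Ψ X (r ∷ l)) (λ l → p (r ∷ l)) rs))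

 -- Expansion along its first row writes a minor as a combination of the columns that it uses, and
 -- these are among `j`, ..., `j + n − 1`.
 D-head-kills : ∀ j n i m → j ℕ.≤ i → i ℕ.+ m ℕ.≤ j ℕ.+ n → ∀ K → Kills j n (λ X → D i m (X ∷ K))
 D-head-kills j n i zero j≤i _ K l = ∧-zeroˡ (All.universal (λ _ → refl) l)
 D-head-kills j n i (suc m) j≤i le K = Kills-resp {j} {n}
  (λ X → solve 3 (λ f u v → (u ⊗ f ⊕ (Κ (- 1ℚ) ⊗ v)) ⊜ (f ⊗ u ⊖ v)) refl (X i) (D (suc i) m K) _)
  (Kills-lin {j} {n} (D (suc i) m K) (- 1ℚ)
   (col-kills j n i j≤i (≤-trans (s≤s (m≤m+n i m)) le′))
   (∧-kills {j} {n} (λ X l → D (suc i) m (X ∷ l)) (λ l → D-head-kills j n (suc i) m (m≤n⇒m≤1+n j≤i) le′ l) K))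
  where
  le′ : suc i ℕ.+ m ℕ.≤ j ℕ.+ n
  le′ = subst (ℕ._≤ j ℕ.+ n) (+-suc i m) le

 Alternating : Form → Set
 Alternating Ψ = ∀ pre r post → Ψ (pre ++ r ∷ r ∷ post) ≡ 0ℚ

 ∧-alternating : ∀ {φ Ψ} → Alternating Ψ → Alternating (φ ∧ Ψ)
 ∧-alternating {φ} {Ψ} alt [] r post = trans
  (cong (λ z → φ r * Ψ (r ∷ post) - (φ r * Ψ (r ∷ post) - z)) (∧-zeroʳ (λ l → alt [] r l) post))
  (solve 1 (λ a → (a ⊖ (a ⊖ Κ 0ℚ)) ⊜ Κ 0ℚ) refl (φ r * Ψ (r ∷ post)))
 ∧-alternating {φ} {Ψ} alt (p ∷ pre) r post = trans
  (cong₂ (λ u v → φ p * u - v) (alt pre r post) (∧-alternating (λ pre → alt (p ∷ pre)) pre r post))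
  (solve 1 (λ a → ((a ⊗ Κ 0ℚ) ⊖ Κ 0ℚ) ⊜ Κ 0ℚ) refl (φ p))

 D-alternating : ∀ j n → Alternating (D j n)
 D-alternating j zero [] r post = refl
 D-alternating j zero (_ ∷ _) r post = refl
 D-alternating j (suc n) = ∧-alternating (D-alternating (suc j) n)

 LinearAt : ℚ → ℚ → Row → Row → Row → Form → Set
 LinearAt a b t r s Ψ = ∀ pre post → Ψ (pre ++ t ∷ post) ≡ a * Ψ (pre ++ r ∷ post) + b * Ψ (pre ++ s ∷ post)

 ∧-linearAt : ∀ {a b t r s φ Ψ} → φ t ≡ a * φ r + b * φ s → LinearAt a b t r s Ψ → LinearAt a b t r s (φ ∧ Ψ)
 ∧-linearAt {a} {b} {t} {r} {s} {φ} {Ψ} e lin [] post = trans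
  (cong₂ (λ u v → u * Ψ post - v) e (trans (∧-cong {φ} (λ _ → refl) (lin []) post) (∧-linʳ a b post)))
  (solve 7 (λ a b f g p u v → (((a ⊗ f) ⊕ (b ⊗ g)) ⊗ p ⊖ ((a ⊗ u) ⊕ (b ⊗ v)))
    ⊜ ((a ⊗ ((f ⊗ p) ⊖ u)) ⊕ (b ⊗ ((g ⊗ p) ⊖ v)))) refl a b (φ r) (φ s) (Ψ post) _ _)
 ∧-linearAt {a} {b} {t} {r} {s} {φ} {Ψ} e lin (p ∷ pre) post = trans
  (cong₂ (λ u v → φ p * u - v) (lin pre post)
   (∧-linearAt {a} {b} {t} {r} {s} {φ} {λ l → Ψ (p ∷ l)} e (λ pre → lin (p ∷ pre)) pre post))
  (solve 7 (λ a b f p o u v → (f ⊗ ((a ⊗ p) ⊕ (b ⊗ o)) ⊖ ((a ⊗ u) ⊕ (b ⊗ v)))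
    ⊜ ((a ⊗ ((f ⊗ p) ⊖ u)) ⊕ (b ⊗ ((f ⊗ o) ⊖ v)))) refl a b (φ p) (Ψ (pre ++ r ∷ post)) (Ψ (pre ++ s ∷ post)) _ _)

 -- The relation between the rows is asked for only on the columns that the determinant reads; rows
 -- of binomials often vanish or satisfy Pascal's rule on such a range only.
 D-linearAt : ∀ {a b t r s} j n → (∀ k → j ℕ.≤ k → k ℕ.< j ℕ.+ n → t k ≡ a * r k + b * s k) → LinearAt a b t r s (D j n)
 D-linearAt {a} {b} j zero e [] post = solve 2 (λ a b → Κ 0ℚ ⊜ (a ⊗ Κ 0ℚ ⊕ b ⊗ Κ 0ℚ)) refl a b
 D-linearAt {a} {b} j zero e (_ ∷ _) post = solve 2 (λ a b → Κ 0ℚ ⊜ (a ⊗ Κ 0ℚ ⊕ b ⊗ Κ 0ℚ)) refl a b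
 D-linearAt {a} {b} {t} {r} {s} j (suc n) e = ∧-linearAt {a} {b} {t} {r} {s} {col j} {D (suc j) n} (e j ≤-refl (m<m+n j (s≤s z≤n)))
  (D-linearAt {a} {b} {t} {r} {s} (suc j) n (λ k j<k k< → e k (<⇒≤ j<k) (subst (k ℕ.<_) (sym (+-suc j n)) k<)))

 D-zero-row : ∀ {t} j n → (∀ k → j ℕ.≤ k → k ℕ.< j ℕ.+ n → t k ≡ 0ℚ) → ∀ pre post → D j n (pre ++ t ∷ post) ≡ 0ℚ
 D-zero-row {t} j n e pre post = trans
  (D-linearAt {0ℚ} {0ℚ} {t} {t} {t} j n (λ k p r → trans (e k p r) (solve 1 (λ x → Κ 0ℚ ⊜ (Κ 0ℚ ⊗ x ⊕ Κ 0ℚ ⊗ x)) refl (t k))) pre post)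
  (solve 1 (λ x → (Κ 0ℚ ⊗ x ⊕ Κ 0ℚ ⊗ x) ⊜ Κ 0ℚ) refl (D j n (pre ++ t ∷ post)))

 D-add-row : ∀ {t r s} j n → (∀ k → j ℕ.≤ k → k ℕ.< j ℕ.+ n → t k ≡ r k + s k) → ∀ pre post →
  D j n (pre ++ t ∷ post) ≡ D j n (pre ++ r ∷ post) + D j n (pre ++ s ∷ post)
 D-add-row {t} {r} {s} j n e pre post = trans
  (D-linearAt {1ℚ} {1ℚ} {t} {r} {s} j n (λ k p l → trans (e k p l) (solve 2 (λ x y → (x ⊕ y) ⊜ (Κ 1ℚ ⊗ x ⊕ Κ 1ℚ ⊗ y)) refl (r k) (s k))) pre post)
  (solve 2 (λ x y → (Κ 1ℚ ⊗ x ⊕ Κ 1ℚ ⊗ y) ⊜ (x ⊕ y)) refl (D j n (pre ++ r ∷ post)) (D j n (pre ++ s ∷ post)))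

 Swapping : Form → Set
 Swapping Ψ = ∀ pre r s post → Ψ (pre ++ r ∷ s ∷ post) ≡ - Ψ (pre ++ s ∷ r ∷ post)

 -- Polarisation: with `r + s` in both places the alternating determinant is zero, and expanding it
 -- leaves the two orders with sum zero.
 D-swapping : ∀ j n → Swapping (D j n)
 D-swapping j n pre r s post = begin
  rs ≡⟨ solve 2 (λ x y → x ⊜ (((Κ 0ℚ ⊕ x) ⊕ (y ⊕ Κ 0ℚ)) ⊖ y)) refl rs sr ⟩
  (0ℚ + rs) + (sr + 0ℚ) - sr ≡⟨ cong₂ (λ u v → (u + rs) + (sr + v) - sr) (alt pre r post) (alt pre s post) ⟨
  (D j n (pre ++ r ∷ r ∷ post) + rs) + (sr + D j n (pre ++ s ∷ s ∷ post)) - sr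
   ≡⟨ cong (_- sr) (cong₂ _+_ (snd r) (snd s)) ⟨
  D j n (pre ++ r ∷ t ∷ post) + D j n (pre ++ s ∷ t ∷ post) - sr
   ≡⟨ cong (_- sr) (D-add-row {t} {r} {s} j n (λ _ _ _ → refl) pre (t ∷ post)) ⟨
  D j n (pre ++ t ∷ t ∷ post) - sr ≡⟨ cong (_- sr) (alt pre t post) ⟩
  0ℚ - sr ≡⟨ QP.+-identityˡ _ ⟩
  - sr ∎
  where
  open ≡-Reasoning
  alt = D-alternating j n
  t : Row
  t k = r k + s k
  rs = D j n (pre ++ r ∷ s ∷ post)
  sr = D j n (pre ++ s ∷ r ∷ post)
  snd : ∀ u → D j n (pre ++ u ∷ t ∷ post) ≡ D j n (pre ++ u ∷ r ∷ post) + D j n (pre ++ u ∷ s ∷ post)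
  snd u = subst₂ _≡_ (cong (D j n) (LP.++-assoc pre [ u ] (t ∷ post)))
   (cong₂ _+_ (cong (D j n) (LP.++-assoc pre [ u ] (r ∷ post))) (cong (D j n) (LP.++-assoc pre [ u ] (s ∷ post))))
   (D-add-row {t} {r} {s} j n (λ _ _ _ → refl) (pre ++ [ u ]) post)

 sgn : ℕ → ℚ
 sgn zero = 1ℚ
 sgn (suc n) = - sgn n

 sgn-sq : ∀ n → sgn n * sgn n ≡ 1ℚ
 sgn-sq zero = refl
 sgn-sq (suc n) = trans (solve 1 (λ x → ((⊝ x) ⊗ (⊝ x)) ⊜ (x ⊗ x)) refl (sgn n)) (sgn-sq n)

 sgn-+ : ∀ m n → sgn (m ℕ.+ n) ≡ sgn m * sgn n
 sgn-+ zero n = sym (QP.*-identityˡ _)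
 sgn-+ (suc m) n = trans (cong -_ (sgn-+ m n)) (solve 2 (λ x y → (⊝ (x ⊗ y)) ⊜ ((⊝ x) ⊗ y)) refl (sgn m) (sgn n))

 move-front : ∀ {Ψ} → Swapping Ψ → ∀ p X r → Ψ (p ++ X ∷ r) ≡ sgn (length p) * Ψ (X ∷ p ++ r)
 move-front sw [] X r = sym (QP.*-identityˡ _)
 move-front {Ψ} sw (x ∷ p) X r = trans
  (move-front {λ l → Ψ (x ∷ l)} (λ pre → sw (x ∷ pre)) p X r)
  (trans (cong (sgn (length p) *_) (sw [] x X (p ++ r)))
   (solve 2 (λ s v → (s ⊗ (⊝ v)) ⊜ ((⊝ s) ⊗ v)) refl (sgn (length p)) _))

 D-front : ∀ j n p X r → D j n (p ++ X ∷ r) ≡ sgn (length p) * D j n (X ∷ p ++ r)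
 D-front j n = move-front {D j n} (D-swapping j n)

 D-repeat : ∀ j n K → All (λ r → D j n (r ∷ K) ≡ 0ℚ) K
 D-repeat j n K = go [] K
  where
  go : ∀ p s → All (λ r → D j n (r ∷ p ++ s) ≡ 0ℚ) s
  go p [] = []
  go p (r ∷ s) = trans (D-front j n (r ∷ p) r s)
    (trans (cong (sgn (length (r ∷ p)) *_) (D-alternating j n [] r (p ++ s))) (QP.*-zeroʳ (sgn (length (r ∷ p)))))
   ∷ subst (λ K → All (λ r → D j n (r ∷ K) ≡ 0ℚ) s) (LP.++-assoc p [ r ] s) (go (p ++ [ r ]) s)

 -- The minor `Θ X` with first row `X` over `K` is a combination of columns already present in
 -- `D j (suc n)`, so their exterior product vanishes at `A`, `B`, `C`, `K`. Expanding along `Θ`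
 -- leaves three terms, since `Θ` is zero on the rows of `K`.
 three-term : ∀ j n A B C K →
  D j n (A ∷ K) * D j (suc n) (B ∷ C ∷ K) - D j n (B ∷ K) * D j (suc n) (A ∷ C ∷ K) + D j n (C ∷ K) * D j (suc n) (A ∷ B ∷ K) ≡ 0ℚ
 three-term j n A B C K = begin
  a * bc - b * ac + c * ab ≡⟨ solve 6 (λ a bc b ac c ab → (a ⊗ bc ⊖ b ⊗ ac ⊕ c ⊗ ab) ⊜ (a ⊗ bc ⊖ (b ⊗ ac ⊖ (c ⊗ ab ⊖ Κ 0ℚ)))) refl a bc b ac c ab ⟩
  a * bc - (b * ac - (c * ab - 0ℚ)) ≡⟨ cong (λ z → a * bc - (b * ac - (c * ab - z))) (∧-zeroˡ {Θ} {λ l → D j (suc n) (A ∷ B ∷ C ∷ l)} (D-repeat j n K)) ⟨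
  (Θ ∧ D j (suc n)) (A ∷ B ∷ C ∷ K) ≡⟨ D-head-kills j (suc n) j n ≤-refl (+-monoʳ-≤ j (n≤1+n n)) K (A ∷ B ∷ C ∷ K) ⟩
  0ℚ ∎
  where
  open ≡-Reasoning
  Θ : Row → ℚ
  Θ X = D j n (X ∷ K)
  a = D j n (A ∷ K)
  b = D j n (B ∷ K)
  c = D j n (C ∷ K)
  bc = D j (suc n) (B ∷ C ∷ K)
  ac = D j (suc n) (A ∷ C ∷ K)
  ab = D j (suc n) (A ∷ B ∷ K)

 -- The Plücker relation behind Kuo's graphical condensation, with the rows kept in place.
 condensation : ∀ j n p r s A B C →
  D j (suc n) (p ++ A ∷ r ++ B ∷ s) * D j n (p ++ r ++ s ++ [ C ])
  ≡ D j (suc n) (p ++ A ∷ r ++ s ++ [ C ]) * D j n (p ++ r ++ B ∷ s)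
  - D j (suc n) (p ++ r ++ B ∷ s ++ [ C ]) * D j n (p ++ A ∷ r ++ s)
 condensation j n p r s A B C = begin
  D j (suc n) (p ++ A ∷ r ++ B ∷ s) * D j n (p ++ r ++ s ++ [ C ])
   ≡⟨ cong₂ _*_ frontAB frontC ⟩
  (P * (P * R * ab)) * (P * R * S * c)
   ≡⟨ solve 9 (λ P R S a b c ab ac bc → ((P ⊗ (P ⊗ R ⊗ ab)) ⊗ (P ⊗ R ⊗ S ⊗ c))
     ⊜ ((P ⊗ P ⊗ P ⊗ R ⊗ R ⊗ S) ⊗ (((a ⊗ bc) ⊖ (b ⊗ ac) ⊕ (c ⊗ ab)) ⊕ ((b ⊗ ac) ⊖ (a ⊗ bc)))))
     refl P R S a b c ab ac bc ⟩
  -- Bringing the rows to the front costs the same total sign in all three products, so only the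
  -- three-term relation is left.
  P * P * P * R * R * S * ((a * bc - b * ac + c * ab) + (b * ac - a * bc))
   ≡⟨ cong (λ v → P * P * P * R * R * S * (v + (b * ac - a * bc))) (three-term j n A B C K) ⟩
  P * P * P * R * R * S * (0ℚ + (b * ac - a * bc))
   ≡⟨ solve 7 (λ P R S a b ac bc → ((P ⊗ P ⊗ P ⊗ R ⊗ R ⊗ S) ⊗ (Κ 0ℚ ⊕ ((b ⊗ ac) ⊖ (a ⊗ bc))))
     ⊜ (((P ⊗ (P ⊗ R ⊗ S ⊗ ac)) ⊗ (P ⊗ R ⊗ b)) ⊖ (P ⊗ R ⊗ (P ⊗ R ⊗ S ⊗ bc) ⊗ (P ⊗ a)))) refl P R S a b ac bc ⟩
  (P * (P * R * S * ac)) * (P * R * b) - P * R * (P * R * S * bc) * (P * a)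
   ≡⟨ cong₂ _-_ (cong₂ _*_ frontAC frontB) (cong₂ _*_ frontBC frontA) ⟨
  D j (suc n) (p ++ A ∷ r ++ s ++ [ C ]) * D j n (p ++ r ++ B ∷ s)
   - D j (suc n) (p ++ r ++ B ∷ s ++ [ C ]) * D j n (p ++ A ∷ r ++ s) ∎
  where
  open ≡-Reasoning
  K = p ++ r ++ s
  P = sgn (length p)
  R = sgn (length r)
  S = sgn (length s)
  a = D j n (A ∷ K)
  b = D j n (B ∷ K)
  c = D j n (C ∷ K)
  bc = D j (suc n) (B ∷ C ∷ K)
  ac = D j (suc n) (A ∷ C ∷ K)
  ab = D j (suc n) (A ∷ B ∷ K)
  front₂ : ∀ {Ψ} → Swapping Ψ → ∀ X t → Ψ (p ++ r ++ X ∷ t) ≡ P * R * Ψ (X ∷ p ++ r ++ t)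
  front₂ {Ψ} sw X t = begin
   Ψ (p ++ r ++ X ∷ t) ≡⟨ cong Ψ (LP.++-assoc p r (X ∷ t)) ⟨
   Ψ ((p ++ r) ++ X ∷ t) ≡⟨ move-front {Ψ} sw (p ++ r) X t ⟩
   sgn (length (p ++ r)) * Ψ (X ∷ (p ++ r) ++ t)
    ≡⟨ cong₂ _*_ (trans (cong sgn (LP.length-++ p)) (sgn-+ (length p) (length r))) (cong (λ l → Ψ (X ∷ l)) (LP.++-assoc p r t)) ⟩
   P * R * Ψ (X ∷ p ++ r ++ t) ∎
  front₃ : ∀ {Ψ} → Swapping Ψ → ∀ X → Ψ (p ++ r ++ s ++ [ X ]) ≡ P * R * S * Ψ (X ∷ K)
  front₃ {Ψ} sw X = begin
   Ψ (p ++ r ++ s ++ [ X ]) ≡⟨ cong Ψ (trans (LP.++-assoc (p ++ r) s [ X ]) (LP.++-assoc p r (s ++ [ X ]))) ⟨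
   Ψ (((p ++ r) ++ s) ++ [ X ]) ≡⟨ move-front {Ψ} sw ((p ++ r) ++ s) X [] ⟩
   sgn (length ((p ++ r) ++ s)) * Ψ (X ∷ ((p ++ r) ++ s) ++ [])
    ≡⟨ cong₂ _*_ (trans (cong sgn (trans (LP.length-++ (p ++ r)) (cong (ℕ._+ length s) (LP.length-++ p))))
       (trans (sgn-+ (length p ℕ.+ length r) (length s)) (cong (_* S) (sgn-+ (length p) (length r)))))
      (cong (λ l → Ψ (X ∷ l)) (trans (LP.++-identityʳ _) (LP.++-assoc p r s))) ⟩
   P * R * S * Ψ (X ∷ K) ∎
  frontA : D j n (p ++ A ∷ r ++ s) ≡ P * a
  frontA = D-front j n p A (r ++ s)
  frontB : D j n (p ++ r ++ B ∷ s) ≡ P * R * b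
  frontB = front₂ {D j n} (D-swapping j n) B s
  frontC : D j n (p ++ r ++ s ++ [ C ]) ≡ P * R * S * c
  frontC = front₃ {D j n} (D-swapping j n) C
  frontAB : D j (suc n) (p ++ A ∷ r ++ B ∷ s) ≡ P * (P * R * ab)
  frontAB = trans (D-front j (suc n) p A (r ++ B ∷ s))
   (cong (P *_) (front₂ {λ l → D j (suc n) (A ∷ l)} (λ pre → D-swapping j (suc n) (A ∷ pre)) B s))
  frontAC : D j (suc n) (p ++ A ∷ r ++ s ++ [ C ]) ≡ P * (P * R * S * ac)
  frontAC = trans (D-front j (suc n) p A (r ++ s ++ [ C ]))
   (cong (P *_) (front₃ {λ l → D j (suc n) (A ∷ l)} (λ pre → D-swapping j (suc n) (A ∷ pre)) C))
  frontBC : D j (suc n) (p ++ r ++ B ∷ s ++ [ C ]) ≡ P * R * (P * R * S * bc)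
  frontBC = trans (front₂ {D j (suc n)} (D-swapping j (suc n)) B (s ++ [ C ]))
   (cong (P * R *_) (front₃ {λ l → D j (suc n) (B ∷ l)} (λ pre → D-swapping j (suc n) (B ∷ pre)) C))

 D-pop : ∀ j n {r rs} → r j ≡ 1ℚ → All (λ s → s j ≡ 0ℚ) rs → D j (suc n) (r ∷ rs) ≡ D (suc j) n rs
 D-pop j n {r} {rs} e es = trans (cong₂ (λ u v → u * D (suc j) n rs - v) e (∧-zeroˡ es))
  (solve 1 (λ x → (Κ 1ℚ ⊗ x ⊖ Κ 0ℚ) ⊜ x) refl _)

 -- The last column is carried past the `n` others, one sign each.
 D-last-column : ∀ j n l → D j (suc n) l ≡ sgn n * (col (j ℕ.+ n) ∧ D j n) l
 D-last-column j zero l = trans (cong (λ k → (col k ∧ unit) l) (sym (NP.+-identityʳ j))) (sym (QP.*-identityˡ _))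
 D-last-column j (suc n) l = begin
  (col j ∧ D (suc j) (suc n)) l ≡⟨ ∧-cong {col j} (λ _ → refl) (D-last-column (suc j) n) l ⟩
  (col j ∧ λ l → sgn n * (col (suc j ℕ.+ n) ∧ D (suc j) n) l) l ≡⟨ ∧-scaleʳ {col j} (sgn n) l ⟩
  sgn n * (col j ∧ col (suc j ℕ.+ n) ∧ D (suc j) n) l ≡⟨ cong (sgn n *_) (∧-anticomm (col j) (col (suc j ℕ.+ n)) (D (suc j) n) l) ⟩
  sgn n * - (col (suc j ℕ.+ n) ∧ col j ∧ D (suc j) n) l ≡⟨ solve 2 (λ u v → (u ⊗ (⊝ v)) ⊜ ((⊝ u) ⊗ v)) refl (sgn n) _ ⟩
  - sgn n * (col (suc j ℕ.+ n) ∧ D j (suc n)) l ≡⟨ cong (λ k → - sgn n * (col k ∧ D j (suc n)) l) (+-suc j n) ⟨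
  - sgn n * (col (j ℕ.+ suc n) ∧ D j (suc n)) l ∎
  where open ≡-Reasoning

 Σ₀ : ℕ → (ℕ → ℚ) → ℚ
 Σ₀ zero f = 0ℚ
 Σ₀ (suc n) f = Σ₀ n f + f n

 pair : ℕ → ℕ → (ℕ → ℚ) → Row → ℚ
 pair j n c r = Σ₀ n (λ i → c (j ℕ.+ i) * r (j ℕ.+ i))

 pair-kills : ∀ j n c m → m ℕ.≤ n → Kills j n (pair j m c)
 pair-kills j n c zero m≤n l = ∧-zeroˡ (All.universal (λ _ → refl) l)
 pair-kills j n c (suc m) m<n = Kills-resp {j} {n}
  (λ r → solve 2 (λ a b → (Κ 1ℚ ⊗ a ⊕ b) ⊜ (a ⊕ b)) refl (pair j m c r) (c (j ℕ.+ m) * r (j ℕ.+ m)))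
  (Kills-lin {j} {n} 1ℚ (c (j ℕ.+ m)) (pair-kills j n c m (<⇒≤ m<n))
   (col-kills j n (j ℕ.+ m) (m≤m+n j m) (NP.+-monoʳ-< j m<n)))

 -- Cramer's rule for a vector c annihilated by all the rows but the first.
 D-kernel : ∀ j n c f rs → All (λ r → pair j (suc n) c r ≡ 0ℚ) rs →
  c (j ℕ.+ n) * D j (suc n) (f ∷ rs) ≡ sgn n * pair j (suc n) c f * D j n rs
 D-kernel j n c f rs es = begin
  cₙ * D j (suc n) (f ∷ rs) ≡⟨ cong (cₙ *_) (D-last-column j n (f ∷ rs)) ⟩
  cₙ * (sgn n * (col (j ℕ.+ n) ∧ D j n) (f ∷ rs)) ≡⟨ solve 3 (λ a b d → (a ⊗ (b ⊗ d)) ⊜ (b ⊗ (Κ 1ℚ ⊗ Κ 0ℚ ⊕ a ⊗ d))) refl cₙ (sgn n) _ ⟩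
  sgn n * (1ℚ * 0ℚ + cₙ * (col (j ℕ.+ n) ∧ D j n) (f ∷ rs))
   -- The pairing over the first `n` columns has zero product with `D j n` and may be added freely.
   -- It completes the last column to the full pairing with `c`, which is zero on every row of `rs`.
   ≡⟨ cong (λ z → sgn n * (1ℚ * z + cₙ * (col (j ℕ.+ n) ∧ D j n) (f ∷ rs))) (pair-kills j n c n ≤-refl (f ∷ rs)) ⟨
  sgn n * (1ℚ * (pair j n c ∧ D j n) (f ∷ rs) + cₙ * (col (j ℕ.+ n) ∧ D j n) (f ∷ rs))
   ≡⟨ cong (sgn n *_) (∧-linˡ {pair j n c} {col (j ℕ.+ n)} {D j n} 1ℚ cₙ (f ∷ rs)) ⟨
  sgn n * ((λ r → 1ℚ * pair j n c r + cₙ * r (j ℕ.+ n)) ∧ D j n) (f ∷ rs)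
   ≡⟨ cong (sgn n *_) (∧-cong {Ψ = D j n} (λ r → solve 2 (λ a b → (Κ 1ℚ ⊗ a ⊕ b) ⊜ (a ⊕ b)) refl (pair j n c r) (cₙ * r (j ℕ.+ n))) (λ _ → refl) (f ∷ rs)) ⟩
  sgn n * (pair j (suc n) c ∧ D j n) (f ∷ rs)
   ≡⟨ cong (λ z → sgn n * (pair j (suc n) c f * D j n rs - z)) (∧-zeroˡ {pair j (suc n) c} {λ l → D j n (f ∷ l)} es) ⟩
  sgn n * (pair j (suc n) c f * D j n rs - 0ℚ)
   ≡⟨ solve 3 (λ a b d → (a ⊗ (b ⊗ d ⊖ Κ 0ℚ)) ⊜ (a ⊗ b ⊗ d)) refl (sgn n) _ _ ⟩
  sgn n * pair j (suc n) c f * D j n rs ∎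
  where
  open ≡-Reasoning
  cₙ = c (j ℕ.+ n)

-- Rows of binomial coefficients and the determinants `Q` and `M`.

module PathRows where
 open import Data.Rational using (_+_; _*_; -_; _-_)
 open Embedding
 open Determinants

 -- The lower index is an integer, so that Pascal's rule is the definition and has no boundary
 -- cases.
 bin : ℕ → ℤ → ℚ
 bin zero (+ zero) = 1ℚ
 bin zero _ = 0ℚ
 bin (suc n) r = bin n r + bin n (r ℤ.- + 1)

 -- The absorption identity, valid for every integer `r`; it can therefore be applied without
 -- locating `r` in the range of nonzero values.
 bin-next : ∀ n r → (q n - ι r) * bin n r ≡ ι (r ℤ.+ + 1) * bin n (r ℤ.+ + 1)
 bin-next zero (+ zero) = refl
 bin-next zero (+ suc r) = trans (QP.*-zeroʳ (q 0 - ι (+ suc r))) (sym (QP.*-zeroʳ (ι (+ suc r ℤ.+ + 1))))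
 bin-next zero -[1+ zero ] = refl
 bin-next zero -[1+ suc r ] = trans (QP.*-zeroʳ (q 0 - ι -[1+ suc r ])) (sym (QP.*-zeroʳ (ι (-[1+ suc r ] ℤ.+ + 1))))
 bin-next (suc n) r = begin
  (q (suc n) - ι r) * (b + b⁻)
   ≡⟨ cong (λ u → (u - ι r) * (b + b⁻)) (q-suc n) ⟩
  (1ℚ + q n - ι r) * (b + b⁻)
   ≡⟨ solve 4 (λ N R B C → (Κ 1ℚ ⊕ N ⊖ R) ⊗ (B ⊕ C) ⊜ ((N ⊖ R) ⊗ B ⊕ B) ⊕ (N ⊖ (R ⊖ Κ 1ℚ)) ⊗ C) refl (q n) (ι r) b b⁻ ⟩
  (q n - ι r) * b + b + (q n - (ι r - 1ℚ)) * b⁻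
   ≡⟨ cong₂ (λ u v → u + b + v) (bin-next n r) (trans (cong (λ u → (q n - u) * b⁻) (sym (ι-- r (+ 1)))) (trans (bin-next n (r ℤ.- + 1)) (cong (λ k → ι k * bin n k) (e r)))) ⟩
  ι (r ℤ.+ + 1) * b⁺ + b + ι r * b
   ≡⟨ cong (λ u → u * b⁺ + b + ι r * b) (ι-+ r (+ 1)) ⟩
  (ι r + 1ℚ) * b⁺ + b + ι r * b
   ≡⟨ solve 3 (λ R B C → (R ⊕ Κ 1ℚ) ⊗ C ⊕ B ⊕ R ⊗ B ⊜ (R ⊕ Κ 1ℚ) ⊗ (C ⊕ B)) refl (ι r) b b⁺ ⟩
  (ι r + 1ℚ) * (b⁺ + b)
   ≡⟨ cong₂ (λ u k → u * (b⁺ + bin n k)) (ι-+ r (+ 1)) (e′ r) ⟨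
  ι (r ℤ.+ + 1) * bin (suc n) (r ℤ.+ + 1) ∎
  where
  open ≡-Reasoning
  b = bin n r
  b⁻ = bin n (r ℤ.- + 1)
  b⁺ = bin n (r ℤ.+ + 1)
  e : ∀ r → r ℤ.- + 1 ℤ.+ + 1 ≡ r
  e = solve-ℤ
  e′ : ∀ r → r ℤ.+ + 1 ℤ.- + 1 ≡ r
  e′ = solve-ℤ

 bin-up-right : ∀ n r → (1ℚ + q n) * bin n r ≡ (ι r + 1ℚ) * bin (suc n) (r ℤ.+ + 1)
 bin-up-right n r = begin
  (1ℚ + q n) * bin n r
   ≡⟨ solve 3 (λ N R B → (Κ 1ℚ ⊕ N) ⊗ B ⊜ (N ⊖ R) ⊗ B ⊕ (R ⊕ Κ 1ℚ) ⊗ B) refl (q n) (ι r) (bin n r) ⟩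
  (q n - ι r) * bin n r + (ι r + 1ℚ) * bin n r
   ≡⟨ cong₂ (λ u k → u + (ι r + 1ℚ) * bin n k) (trans (bin-next n r) (cong (_* bin n (r ℤ.+ + 1)) (ι-+ r (+ 1)))) (sym (e r)) ⟩
  (ι r + 1ℚ) * bin n (r ℤ.+ + 1) + (ι r + 1ℚ) * bin n (r ℤ.+ + 1 ℤ.- + 1)
   ≡⟨ QP.*-distribˡ-+ (ι r + 1ℚ) _ _ ⟨
  (ι r + 1ℚ) * bin (suc n) (r ℤ.+ + 1) ∎
  where
  open ≡-Reasoning
  e : ∀ r → r ℤ.+ + 1 ℤ.- + 1 ≡ r
  e = solve-ℤ

 bin-up : ∀ n r → (1ℚ + q n) * bin n r ≡ (1ℚ + q n - ι r) * bin (suc n) r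
 bin-up n r = trans (bin-up-right n r) (sym (begin
  (1ℚ + q n - ι r) * bin (suc n) r ≡⟨ cong (λ u → (u - ι r) * bin (suc n) r) (q-suc n) ⟨
  (q (suc n) - ι r) * bin (suc n) r ≡⟨ bin-next (suc n) r ⟩
  ι (r ℤ.+ + 1) * bin (suc n) (r ℤ.+ + 1) ≡⟨ cong (_* bin (suc n) (r ℤ.+ + 1)) (ι-+ r (+ 1)) ⟩
  (ι r + 1ℚ) * bin (suc n) (r ℤ.+ + 1) ∎))
  where open ≡-Reasoning

 -- The binomial coefficient of `c + j` over `s − j`: the number of ways in which a path reaches the
 -- exit `j` when it has `c + j` strips to cross and has to move in `s − j` of them.
 v : ℕ → ℕ → Row
 v s c j = bin (c ℕ.+ j) (+ s ℤ.- + j)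

 v-pascal : ∀ s c j → v (suc s) (suc c) j ≡ v (suc s) c j + v s c j
 v-pascal s c j = cong (λ k → v (suc s) c j + bin (c ℕ.+ j) k) (e (+ s) (+ j))
  where
  e : ∀ s j → (+ 1 ℤ.+ s) ℤ.- j ℤ.- + 1 ≡ s ℤ.- j
  e = solve-ℤ

 -- Deleting a column lowers `s` and raises `c`; this is why splitting off unit rows leads back to
 -- determinants of the same family.
 v-shift : ∀ s c j → v (suc s) c (suc j) ≡ v s (suc c) j
 v-shift s c j = cong₂ bin (+-suc c j) (e (+ s) (+ j))
  where
  e : ∀ s j → (+ 1 ℤ.+ s) ℤ.- (+ 1 ℤ.+ j) ≡ s ℤ.- j
  e = solve-ℤ

 bin-zero : ∀ n → bin n (+ 0) ≡ 1ℚ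
 bin-neg : ∀ n r → bin n -[1+ r ] ≡ 0ℚ
 bin-neg zero r = refl
 bin-neg (suc n) r = cong₂ _+_ (bin-neg n r) (bin-neg n (suc (r ℕ.+ 0)))
 bin-zero zero = refl
 bin-zero (suc n) = cong₂ _+_ (bin-zero n) (bin-neg n 0)

 v-0-0 : ∀ c → v 0 c 0 ≡ 1ℚ
 v-0-0 c = bin-zero (c ℕ.+ 0)

 v-0-suc : ∀ c j → v 0 c (suc j) ≡ 0ℚ
 v-0-suc c j = bin-neg (c ℕ.+ suc j) j

 ∧-pointwise : ∀ {R : Row → Row → Set} {φ χ Ψ Ω} → (∀ {r s} → R r s → φ r ≡ χ s) →
  (∀ {l m} → Pointwise R l m → Ψ l ≡ Ω m) → ∀ {l m} → Pointwise R l m → (φ ∧ Ψ) l ≡ (χ ∧ Ω) m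
 ∧-pointwise p e [] = refl
 ∧-pointwise p e (r ∷ rs) = cong₂ _-_ (cong₂ _*_ (p r) (e rs)) (∧-pointwise p (λ l → e (r ∷ l)) rs)

 D-pointwise : ∀ i j n {l m} → Pointwise (λ r s → ∀ k → k ℕ.< n → r (i ℕ.+ k) ≡ s (j ℕ.+ k)) l m → D i n l ≡ D j n m
 D-pointwise i j zero [] = refl
 D-pointwise i j zero (_ ∷ _) = refl
 D-pointwise i j (suc n) p = ∧-pointwise
  {R = λ r s → ∀ k → k ℕ.< suc n → r (i ℕ.+ k) ≡ s (j ℕ.+ k)}
  (λ {r} {s} e → subst₂ (λ a b → r a ≡ s b) (NP.+-identityʳ i) (NP.+-identityʳ j) (e 0 (s≤s z≤n)))
  (λ pw → D-pointwise (suc i) (suc j) n (PW.map (λ {r} {s} e k k<n →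
    subst₂ (λ a b → r a ≡ s b) (+-suc i k) (+-suc j k) (e (suc k) (s≤s k<n))) pw)) p

 D-unit-row : ∀ j n r l → r j ≡ 1ℚ → (∀ k → j ℕ.< k → r k ≡ 0ℚ) → D j (suc n) (r ∷ l) ≡ D (suc j) n l
 D-unit-row j n r l e z = trans
  (cong₂ (λ u v → u * D (suc j) n l - v) e (∧-zeroʳ {col j} (λ m → D-zero-row (suc j) n (λ k p _ → z k p) [] m) l))
  (solve 1 (λ x → (Κ 1ℚ ⊗ x ⊖ Κ 0ℚ) ⊜ x) refl _)

 -- Row of a path that starts at the symmetry axis. One strip higher along the axis, `c` grows by
 -- one and `s` by two.
 Z : ℕ → ℕ → Row
 Z x i = v (i ℕ.+ i) (x ℕ.+ i)

 -- Rows of paths that start along a side of the satellite: they share a strip, hence `c`, and their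
 -- positions are consecutive.
 sat : ℕ → ℕ → ℕ → List Row
 sat s c zero = []
 sat s c (suc n) = v s c ∷ sat (suc s) c n

 Zs : ℕ → ℕ → ℕ → List Row
 Zs x i zero = []
 Zs x i (suc n) = Z x i ∷ Zs x (suc i) n

 Zs-++ : ∀ x i m n → Zs x i (m ℕ.+ n) ≡ Zs x i m ++ Zs x (i ℕ.+ m) n
 Zs-++ x i zero n = cong (λ k → Zs x k n) (sym (NP.+-identityʳ i))
 Zs-++ x i (suc m) n = cong (Z x i ∷_) (trans (Zs-++ x (suc i) m n) (cong (λ k → Zs x (suc i) m ++ Zs x k n) (sym (+-suc i m))))

 sat-++ : ∀ s c m n → sat s c (m ℕ.+ n) ≡ sat s c m ++ sat (s ℕ.+ m) c n
 sat-++ s c zero n = cong (λ k → sat k c n) (sym (NP.+-identityʳ s))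
 sat-++ s c (suc m) n = cong (v s c ∷_) (trans (sat-++ (suc s) c m n) (cong (λ k → sat (suc s) c m ++ sat k c n) (sym (+-suc s m))))

 length-Zs : ∀ x i n → length (Zs x i n) ≡ n
 length-Zs x i zero = refl
 length-Zs x i (suc n) = cong suc (length-Zs x (suc i) n)

 -- The satellite covers the axis starts `y`, ..., `y + a − 1` and brings `2a` starts of its own.
 Qrows : ℕ → ℕ → ℕ → ℕ → List Row
 Qrows x y z a = Zs x 0 y ++ sat (y ℕ.+ y) (x ℕ.+ y) (a ℕ.+ a) ++ Zs x (y ℕ.+ a) (suc z)

 Q : ℕ → ℕ → ℕ → ℕ → ℚ
 Q x y z a = D 0 (suc (y ℕ.+ z ℕ.+ (a ℕ.+ a))) (Qrows x y z a)

 M : ℕ → ℕ → ℚ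
 M x T = D 0 T (Zs x 0 T)

 D-repeat-inside : ∀ j n p r s t → D j n (p ++ r ∷ s ++ r ∷ t) ≡ 0ℚ
 D-repeat-inside j n p r s t = trans (D-front j n p r (s ++ r ∷ t))
  (trans (cong (sgn (length p) *_) (All.lookup (D-repeat j n (p ++ s ++ r ∷ t)) (∈-++⁺ʳ p (∈-++⁺ʳ s (here refl)))))
   (QP.*-zeroʳ (sgn (length p))))

 -- A satellite row may be moved one step to the right modulo the row above it.
 sat-shift : ∀ m pre s c n post →
  D 0 m (pre ++ v s c ∷ sat (suc s) (suc c) n ++ post) ≡ D 0 m (pre ++ v s c ∷ sat (suc s) c n ++ post)
 sat-shift m pre s c zero post = refl
 sat-shift m pre s c (suc n) post = begin
  D 0 m (pre ++ v s c ∷ v (suc s) (suc c) ∷ rest)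
   ≡⟨ cong (D 0 m) (LP.++-assoc pre [ v s c ] _) ⟨
  D 0 m ((pre ++ [ v s c ]) ++ v (suc s) (suc c) ∷ rest)
   ≡⟨ D-add-row 0 m (λ k _ _ → v-pascal s c k) (pre ++ [ v s c ]) rest ⟩
  D 0 m ((pre ++ [ v s c ]) ++ v (suc s) c ∷ rest) + D 0 m ((pre ++ [ v s c ]) ++ v s c ∷ rest)
   ≡⟨ cong₂ _+_ (sat-shift m (pre ++ [ v s c ]) (suc s) c n post) (trans (cong (D 0 m) (LP.++-assoc pre [ v s c ] _)) (D-alternating 0 m pre (v s c) rest)) ⟩
  D 0 m ((pre ++ [ v s c ]) ++ v (suc s) c ∷ sat (suc (suc s)) c n ++ post) + 0ℚ
   ≡⟨ trans (QP.+-identityʳ _) (cong (D 0 m) (LP.++-assoc pre [ v s c ] _)) ⟩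
  D 0 m (pre ++ v s c ∷ v (suc s) c ∷ sat (suc (suc s)) c n ++ post) ∎
  where
  open ≡-Reasoning
  rest = sat (suc (suc s)) (suc c) n ++ post

 sat-repeat : ∀ m pre s c n i post → i ℕ.< n → D 0 m (pre ++ sat s c n ++ v (s ℕ.+ i) c ∷ post) ≡ 0ℚ
 sat-repeat m pre s c (suc n) zero post _ = trans
  (cong (λ k → D 0 m (pre ++ v s c ∷ sat (suc s) c n ++ v k c ∷ post)) (NP.+-identityʳ s))
  (D-repeat-inside 0 m pre (v s c) (sat (suc s) c n) post)
 sat-repeat m pre s c (suc n) (suc i) post (s≤s i<n) = begin
  D 0 m (pre ++ v s c ∷ sat (suc s) c n ++ v (s ℕ.+ suc i) c ∷ post)
   ≡⟨ cong (λ k → D 0 m (pre ++ v s c ∷ sat (suc s) c n ++ v k c ∷ post)) (+-suc s i) ⟩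
  D 0 m (pre ++ v s c ∷ sat (suc s) c n ++ v (suc s ℕ.+ i) c ∷ post)
   ≡⟨ cong (D 0 m) (LP.++-assoc pre [ v s c ] _) ⟨
  D 0 m ((pre ++ [ v s c ]) ++ sat (suc s) c n ++ v (suc s ℕ.+ i) c ∷ post)
   ≡⟨ sat-repeat m (pre ++ [ v s c ]) (suc s) c n i post i<n ⟩
  0ℚ ∎
  where open ≡-Reasoning

 -- By Pascal's rule the row `v (s + i) (k + c)` is a combination of `v s c`, ..., `v (s + i) c`,
 -- all of which are satellite rows. Later this removes the paths that would step into the
 -- satellite.
 sat-span : ∀ m pre s c n i k post → i ℕ.< n → k ℕ.≤ i → D 0 m (pre ++ sat s c n ++ v (s ℕ.+ i) (k ℕ.+ c) ∷ post) ≡ 0ℚ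
 sat-span m pre s c n i zero post i<n _ = sat-repeat m pre s c n i post i<n
 sat-span m pre s c n (suc i) (suc k) post i<n (s≤s k≤i) = begin
  D 0 m (pre ++ sat s c n ++ v (s ℕ.+ suc i) (suc k ℕ.+ c) ∷ post)
   ≡⟨ cong (D 0 m) (LP.++-assoc pre (sat s c n) _) ⟨
  D 0 m ((pre ++ sat s c n) ++ v (s ℕ.+ suc i) (suc k ℕ.+ c) ∷ post)
   ≡⟨ D-add-row 0 m (λ j _ _ → trans (cong (λ u → v u (suc k ℕ.+ c) j) (+-suc s i)) (trans (v-pascal (s ℕ.+ i) (k ℕ.+ c) j) (cong (λ u → v u (k ℕ.+ c) j + v (s ℕ.+ i) (k ℕ.+ c) j) (sym (+-suc s i))))) (pre ++ sat s c n) post ⟩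
  D 0 m ((pre ++ sat s c n) ++ v (s ℕ.+ suc i) (k ℕ.+ c) ∷ post) + D 0 m ((pre ++ sat s c n) ++ v (s ℕ.+ i) (k ℕ.+ c) ∷ post)
   ≡⟨ cong₂ _+_ (trans (cong (D 0 m) (LP.++-assoc pre (sat s c n) _)) (sat-span m pre s c n (suc i) k post i<n (m≤n⇒m≤1+n k≤i)))
          (trans (cong (D 0 m) (LP.++-assoc pre (sat s c n) _)) (sat-span m pre s c n i k post (<⇒≤ i<n) k≤i)) ⟩
  0ℚ + 0ℚ ≡⟨⟩
  0ℚ ∎
  where open ≡-Reasoning

 -- Lowering `c` by one changes the row that follows the satellite by a row which `sat-span` shows
 -- to be dependent on it.
 sat-slide : ∀ m pre s c n k post → k ℕ.≤ n →
  D 0 m (pre ++ sat s c n ++ v (s ℕ.+ n) (k ℕ.+ c) ∷ post) ≡ D 0 m (pre ++ sat s c n ++ v (s ℕ.+ n) c ∷ post)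
 sat-slide m pre s c n zero post _ = refl
 sat-slide m pre s c (suc n) (suc k) post (s≤s k≤n) = begin
  D 0 m (pre ++ S ++ v (s ℕ.+ suc n) (suc k ℕ.+ c) ∷ post)
   ≡⟨ cong (D 0 m) (LP.++-assoc pre S _) ⟨
  D 0 m ((pre ++ S) ++ v (s ℕ.+ suc n) (suc k ℕ.+ c) ∷ post)
   ≡⟨ D-add-row 0 m (λ j _ _ → trans (cong (λ u → v u (suc k ℕ.+ c) j) (+-suc s n)) (trans (v-pascal (s ℕ.+ n) (k ℕ.+ c) j) (cong (λ u → v u (k ℕ.+ c) j + v (s ℕ.+ n) (k ℕ.+ c) j) (sym (+-suc s n))))) (pre ++ S) post ⟩
  D 0 m ((pre ++ S) ++ v (s ℕ.+ suc n) (k ℕ.+ c) ∷ post) + D 0 m ((pre ++ S) ++ v (s ℕ.+ n) (k ℕ.+ c) ∷ post)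
   ≡⟨ cong₂ _+_ (trans (cong (D 0 m) (LP.++-assoc pre S _)) (sat-slide m pre s c (suc n) k post (m≤n⇒m≤1+n k≤n)))
          (trans (cong (D 0 m) (LP.++-assoc pre S _)) (sat-span m pre s c (suc n) n k post ≤-refl k≤n)) ⟩
  D 0 m (pre ++ S ++ v (s ℕ.+ suc n) c ∷ post) + 0ℚ ≡⟨ QP.+-identityʳ _ ⟩
  D 0 m (pre ++ S ++ v (s ℕ.+ suc n) c ∷ post) ∎
  where
  open ≡-Reasoning
  S = sat s c (suc n)

-- Condensation for `Q`, and its initial cases `a = 0` and `a = 1`.

module Condensation where
 open import Data.Nat using (_+_)
 open import Data.Rational using (-_; _-_) renaming (_*_ to _·_)
 open Determinants
 open PathRows

 -- The rows of a determinant whose satellite has `2a + 4` rows, cut for the Plücker relation: `A`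
 -- is the second satellite row, `B` the last one, `C` the next row on the axis. Without `A` the
 -- satellite starts one step further from the core, without `B` it ends one step earlier. `ζ` is an
 -- axis row that turns into a satellite row when `B` is present.
 module Condense (x y z a : ℕ) where
  n : ℕ
  n = y + z + (a + a) + 4
  c = x + y
  p = Zs x 0 (suc y)
  A = v (suc (y + y)) c
  σ = sat (suc (suc (y + y))) (suc c) (a + a)
  ζ = Z x (suc y + a)
  ζ′ = v (suc (suc (y + y)) + (a + a)) (suc c)
  B = v (suc (suc (suc (y + y)) + (a + a))) (suc c)
  s = Zs x (suc (suc y) + a) (suc z)
  C = Z x (suc (suc y) + a + suc z)
  r = σ ++ [ ζ ]
  open ≡-Reasoning
  p-snoc : ∀ l → p ++ l ≡ Zs x 0 y ++ v (y + y) c ∷ l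
  p-snoc l = trans (cong (_++ l) (trans (cong (Zs x 0) (NP.+-comm 1 y)) (Zs-++ x 0 y 1))) (LP.++-assoc (Zs x 0 y) [ Z x y ] l)
  s-snoc : s ++ [ C ] ≡ Zs x (suc (suc y) + a) (suc (suc z))
  s-snoc = trans (sym (Zs-++ x (suc (suc y) + a) (suc z) 1)) (cong (Zs x (suc (suc y) + a)) (NP.+-comm (suc z) 1))
  r-++ : ∀ l → r ++ l ≡ σ ++ ζ ∷ l
  r-++ l = LP.++-assoc σ [ ζ ] l
  -- When `B` follows, the axis row `ζ` can be slid into the strip of the satellite, which then
  -- closes up to `2a + 2` rows.
  slide : ∀ m pre l → D 0 m (pre ++ r ++ B ∷ l) ≡ D 0 m (pre ++ sat (suc (suc (y + y))) (suc c) (suc (suc (a + a))) ++ l)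
  slide m pre l = begin
   D 0 m (pre ++ r ++ B ∷ l) ≡⟨ cong (λ k → D 0 m (pre ++ k)) (r-++ (B ∷ l)) ⟩
   D 0 m (pre ++ σ ++ ζ ∷ B ∷ l)
    ≡⟨ cong₂ (λ i j → D 0 m (pre ++ σ ++ v i j ∷ B ∷ l)) (i≡ y a) (j≡ x y a) ⟩
   D 0 m (pre ++ σ ++ v (suc (suc (y + y)) + (a + a)) (a + suc c) ∷ B ∷ l)
    ≡⟨ sat-slide m pre (suc (suc (y + y))) (suc c) (a + a) a (B ∷ l) (m≤m+n a a) ⟩
   D 0 m (pre ++ σ ++ ζ′ ∷ B ∷ l)
    ≡⟨ cong (λ k → D 0 m (pre ++ k)) (trans (sym (LP.++-assoc σ (ζ′ ∷ B ∷ []) l)) (cong (_++ l) (trans (sym (sat-++ (suc (suc (y + y))) (suc c) (a + a) 2)) (cong (sat (suc (suc (y + y))) (suc c)) (NP.+-comm (a + a) 2))))) ⟩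
   D 0 m (pre ++ sat (suc (suc (y + y))) (suc c) (suc (suc (a + a))) ++ l) ∎
   where
   i≡ : ∀ y a → suc y + a + (suc y + a) ≡ suc (suc (y + y)) + (a + a)
   i≡ = solve-ℕ
   j≡ : ∀ x y a → x + (suc y + a) ≡ a + suc (x + y)
   j≡ = solve-ℕ
  -- When `A` precedes, the satellite can be moved back by one strip, and the last row of `p`
  -- together with `A` becomes its beginning.
  shift : ∀ m k l → D 0 m (p ++ A ∷ sat (suc (suc (y + y))) (suc c) k ++ l) ≡ D 0 m (Zs x 0 y ++ sat (y + y) c (suc (suc k)) ++ l)
  shift m k l = begin
   D 0 m (p ++ A ∷ sat (suc (suc (y + y))) (suc c) k ++ l) ≡⟨ sat-shift m p (suc (y + y)) c k l ⟩
   D 0 m (p ++ A ∷ sat (suc (suc (y + y))) c k ++ l) ≡⟨ cong (D 0 m) (p-snoc _) ⟩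
   D 0 m (Zs x 0 y ++ sat (y + y) c (suc (suc k)) ++ l) ∎
  as-Q : ∀ {m m′ y k k′ b w w′} → m ≡ m′ → k ≡ k′ → w ≡ w′ →
   D 0 m (Zs x 0 y ++ sat (y + y) (x + y) k ++ Zs x w b) ≡ D 0 m′ (Zs x 0 y ++ sat (y + y) (x + y) k′ ++ Zs x w′ b)
  as-Q refl refl refl = refl
  dim : ∀ {m m′} l → m ≡ m′ → D 0 m l ≡ D 0 m′ l
  dim l e = cong (λ m → D 0 m l) e
  ApBs : D 0 (suc n) (p ++ A ∷ r ++ B ∷ s) ≡ Q x y z (suc (suc a))
  ApBs = begin
   D 0 (suc n) (p ++ A ∷ r ++ B ∷ s)
    ≡⟨ cong (D 0 (suc n)) (LP.++-assoc p [ A ] (r ++ B ∷ s)) ⟨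
   D 0 (suc n) ((p ++ [ A ]) ++ r ++ B ∷ s)
    ≡⟨ slide (suc n) (p ++ [ A ]) s ⟩
   D 0 (suc n) ((p ++ [ A ]) ++ sat (suc (suc (y + y))) (suc c) (suc (suc (a + a))) ++ s)
    ≡⟨ cong (D 0 (suc n)) (LP.++-assoc p [ A ] _) ⟩
   D 0 (suc n) (p ++ A ∷ sat (suc (suc (y + y))) (suc c) (suc (suc (a + a))) ++ s)
    ≡⟨ shift (suc n) (suc (suc (a + a))) s ⟩
   D 0 (suc n) (Zs x 0 y ++ sat (y + y) c (suc (suc (suc (suc (a + a))))) ++ s)
    ≡⟨ as-Q {y = y} {b = suc z} (e₁ y z a) (e₂ a) (e₃ y a) ⟩
   Q x y z (suc (suc a)) ∎
   where
   e₁ : ∀ y z a → suc (y + z + (a + a) + 4) ≡ suc (y + z + (suc (suc a) + suc (suc a)))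
   e₁ = solve-ℕ
   e₂ : ∀ a → suc (suc (suc (suc (a + a)))) ≡ suc (suc a) + suc (suc a)
   e₂ = solve-ℕ
   e₃ : ∀ y a → suc (suc y) + a ≡ y + suc (suc a)
   e₃ = solve-ℕ
  prsC : D 0 n (p ++ r ++ s ++ [ C ]) ≡ Q x (suc y) (suc (suc z)) a
  prsC = begin
   D 0 n (p ++ r ++ s ++ [ C ])
    ≡⟨ cong (λ k → D 0 n (p ++ k)) (trans (r-++ (s ++ [ C ])) (cong (λ k → σ ++ ζ ∷ k) s-snoc)) ⟩
   D 0 n (p ++ σ ++ Zs x (suc y + a) (suc (suc (suc z))))
    ≡⟨ cong₂ (λ i j → D 0 n (p ++ sat i j (a + a) ++ Zs x (suc y + a) (suc (suc (suc z))))) (e₂ y) (e₃ x y) ⟩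
   D 0 n (Zs x 0 (suc y) ++ sat (suc y + suc y) (x + suc y) (a + a) ++ Zs x (suc y + a) (suc (suc (suc z))))
    ≡⟨ dim (Qrows x (suc y) (suc (suc z)) a) (e₁ y z a) ⟩
   Q x (suc y) (suc (suc z)) a ∎
   where
   e₁ : ∀ y z a → y + z + (a + a) + 4 ≡ suc (suc y + suc (suc z) + (a + a))
   e₁ = solve-ℕ
   e₂ : ∀ y → suc (suc (y + y)) ≡ suc y + suc y
   e₂ = solve-ℕ
   e₃ : ∀ x y → suc (x + y) ≡ x + suc y
   e₃ = solve-ℕ
  pArs-general : ∀ m b → D 0 m (p ++ A ∷ r ++ Zs x (suc (suc y) + a) (suc b)) ≡ D 0 m (Zs x 0 y ++ sat (y + y) c (suc a + suc a) ++ Zs x (y + suc a) (suc (suc b)))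
  pArs-general m b = begin
   D 0 m (p ++ A ∷ r ++ Zs x (suc (suc y) + a) (suc b))
    ≡⟨ cong (λ k → D 0 m (p ++ A ∷ k)) (r-++ _) ⟩
   D 0 m (p ++ A ∷ σ ++ Zs x (suc y + a) (suc (suc b)))
    ≡⟨ shift m (a + a) (Zs x (suc y + a) (suc (suc b))) ⟩
   D 0 m (Zs x 0 y ++ sat (y + y) c (suc (suc (a + a))) ++ Zs x (suc y + a) (suc (suc b)))
    ≡⟨ as-Q {m} {y = y} {b = suc (suc b)} refl (e₂ a) (e₃ y a) ⟩
   D 0 m (Zs x 0 y ++ sat (y + y) c (suc a + suc a) ++ Zs x (y + suc a) (suc (suc b))) ∎
   where
   e₂ : ∀ a → suc (suc (a + a)) ≡ suc a + suc a
   e₂ = solve-ℕ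
   e₃ : ∀ y a → suc y + a ≡ y + suc a
   e₃ = solve-ℕ
  pArsC : D 0 (suc n) (p ++ A ∷ r ++ s ++ [ C ]) ≡ Q x y (suc (suc z)) (suc a)
  pArsC = trans (cong (λ k → D 0 (suc n) (p ++ A ∷ r ++ k)) s-snoc)
   (trans (pArs-general (suc n) (suc z)) (dim (Qrows x y (suc (suc z)) (suc a)) (e₁ y z a)))
   where
   e₁ : ∀ y z a → suc (y + z + (a + a) + 4) ≡ suc (y + suc (suc z) + (suc a + suc a))
   e₁ = solve-ℕ
  pArs : D 0 n (p ++ A ∷ r ++ s) ≡ Q x y (suc z) (suc a)
  pArs = trans (pArs-general n z) (dim (Qrows x y (suc z) (suc a)) (e₁ y z a))
   where
   e₁ : ∀ y z a → y + z + (a + a) + 4 ≡ suc (y + suc z + (suc a + suc a))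
   e₁ = solve-ℕ
  prBs-general : ∀ m b → D 0 m (p ++ r ++ B ∷ Zs x (suc (suc y) + a) b) ≡
   D 0 m (Zs x 0 (suc y) ++ sat (suc y + suc y) (x + suc y) (suc a + suc a) ++ Zs x (suc y + suc a) b)
  prBs-general m b = begin
   D 0 m (p ++ r ++ B ∷ Zs x (suc (suc y) + a) b)
    ≡⟨ slide m p _ ⟩
   D 0 m (p ++ sat (suc (suc (y + y))) (suc c) (suc (suc (a + a))) ++ Zs x (suc (suc y) + a) b)
    ≡⟨ cong₂ (λ i j → D 0 m (p ++ sat i j (suc (suc (a + a))) ++ Zs x (suc (suc y) + a) b)) (e₂ y) (e₃ x y) ⟩
   D 0 m (p ++ sat (suc y + suc y) (x + suc y) (suc (suc (a + a))) ++ Zs x (suc (suc y) + a) b)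
    ≡⟨ as-Q {m} {y = suc y} {b = b} refl (e₂ a) (e₄ y a) ⟩
   D 0 m (Zs x 0 (suc y) ++ sat (suc y + suc y) (x + suc y) (suc a + suc a) ++ Zs x (suc y + suc a) b) ∎
   where
   e₂ : ∀ y → suc (suc (y + y)) ≡ suc y + suc y
   e₂ = solve-ℕ
   e₃ : ∀ x y → suc (x + y) ≡ x + suc y
   e₃ = solve-ℕ
   e₄ : ∀ y a → suc (suc y) + a ≡ suc y + suc a
   e₄ = solve-ℕ
  prBs : D 0 n (p ++ r ++ B ∷ s) ≡ Q x (suc y) z (suc a)
  prBs = trans (prBs-general n (suc z)) (dim (Qrows x (suc y) z (suc a)) (e₁ y z a))
   where
   e₁ : ∀ y z a → y + z + (a + a) + 4 ≡ suc (suc y + z + (suc a + suc a))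
   e₁ = solve-ℕ
  prBsC : D 0 (suc n) (p ++ r ++ B ∷ s ++ [ C ]) ≡ Q x (suc y) (suc z) (suc a)
  prBsC = trans (cong (λ k → D 0 (suc n) (p ++ r ++ B ∷ k)) s-snoc)
   (trans (prBs-general (suc n) (suc (suc z))) (dim (Qrows x (suc y) (suc z) (suc a)) (e₁ y z a)))
   where
   e₁ : ∀ y z a → suc (y + z + (a + a) + 4) ≡ suc (suc y + suc z + (suc a + suc a))
   e₁ = solve-ℕ
  -- All six determinants belong to the family, and the size of the satellite runs through `a`,
  -- `a + 1`, `a + 2`; so the sizes 0 and 1 determine the rest.
  Q-condensation : Q x y z (suc (suc a)) · Q x (suc y) (suc (suc z)) a
   ≡ Q x y (suc (suc z)) (suc a) · Q x (suc y) z (suc a) - Q x (suc y) (suc z) (suc a) · Q x y (suc z) (suc a)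
  Q-condensation = begin
   Q x y z (suc (suc a)) · Q x (suc y) (suc (suc z)) a
    ≡⟨ cong₂ _·_ ApBs prsC ⟨
   D 0 (suc n) (p ++ A ∷ r ++ B ∷ s) · D 0 n (p ++ r ++ s ++ [ C ])
    ≡⟨ condensation 0 n p r s A B C ⟩
   D 0 (suc n) (p ++ A ∷ r ++ s ++ [ C ]) · D 0 n (p ++ r ++ B ∷ s) - D 0 (suc n) (p ++ r ++ B ∷ s ++ [ C ]) · D 0 n (p ++ A ∷ r ++ s)
    ≡⟨ cong₂ _-_ (cong₂ _·_ pArsC prBs) (cong₂ _·_ prBsC pArs) ⟩
   Q x y (suc (suc z)) (suc a) · Q x (suc y) z (suc a) - Q x (suc y) (suc z) (suc a) · Q x y (suc z) (suc a) ∎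

 open Condense using (Q-condensation)

 Q-0 : ∀ x y z → Q x y z 0 ≡ M x (suc (y + z))
 Q-0 x y z = begin
  D 0 (suc (y + z + 0)) (Zs x 0 y ++ Zs x (y + 0) (suc z))
   ≡⟨ cong₂ (λ m k → D 0 (suc m) (Zs x 0 y ++ Zs x k (suc z))) (NP.+-identityʳ (y + z)) (NP.+-identityʳ y) ⟩
  D 0 (suc (y + z)) (Zs x 0 y ++ Zs x y (suc z))
   ≡⟨ cong (D 0 (suc (y + z))) (trans (sym (Zs-++ x 0 y (suc z))) (cong (Zs x 0) (+-suc y z))) ⟩
  M x (suc (y + z)) ∎
  where open ≡-Reasoning

 Zs-shift : ∀ x i n → Pointwise (λ r s → ∀ k → k ℕ.< n → r (2 + k) ≡ s k) (Zs x (suc i) n) (Zs (3 + x) i n)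
 Zs-shift x i n = go i n
  where
  one : ∀ i k → Z x (suc i) (2 + k) ≡ Z (3 + x) i k
  one i k = begin
   v (suc i + suc i) (x + suc i) (2 + k) ≡⟨ cong (λ s → v (suc s) (x + suc i) (2 + k)) (+-suc i i) ⟩
   v (suc (suc (i + i))) (x + suc i) (2 + k) ≡⟨ v-shift (suc (i + i)) (x + suc i) (suc k) ⟩
   v (suc (i + i)) (suc (x + suc i)) (suc k) ≡⟨ v-shift (i + i) (suc (x + suc i)) k ⟩
   v (i + i) (suc (suc (x + suc i))) k ≡⟨ cong (λ c → v (i + i) c k) (cong (λ c → suc (suc c)) (+-suc x i)) ⟩
   Z (3 + x) i k ∎
   where open ≡-Reasoning
  go : ∀ i m → Pointwise (λ r s → ∀ k → k ℕ.< n → r (2 + k) ≡ s k) (Zs x (suc i) m) (Zs (3 + x) i m)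
  go i zero = []
  go i (suc m) = (λ k _ → one i k) ∷ go (suc i) m

 -- A satellite touching the core merges with it into a core larger by 3.
 Q-touching : ∀ x z → Q x 0 z 1 ≡ M (3 + x) (suc z)
 Q-touching x z = begin
  D 0 (suc (z + 2)) (v 0 (x + 0) ∷ v 1 (x + 0) ∷ Zs x 1 (suc z))
   ≡⟨ cong (λ m → D 0 (suc m) (v 0 (x + 0) ∷ v 1 (x + 0) ∷ Zs x 1 (suc z))) (NP.+-comm z 2) ⟩
  D 0 (suc (suc (suc z))) (v 0 (x + 0) ∷ v 1 (x + 0) ∷ Zs x 1 (suc z))
   -- The two satellite rows end with a 1 in columns 0 and 1 respectively, so these columns split
   -- off one after the other.
   ≡⟨ D-unit-row 0 (suc (suc z)) (v 0 (x + 0)) (v 1 (x + 0) ∷ Zs x 1 (suc z)) (v-0-0 (x + 0)) (λ { (suc k) _ → v-0-suc (x + 0) k }) ⟩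
  D 1 (suc (suc z)) (v 1 (x + 0) ∷ Zs x 1 (suc z))
   ≡⟨ D-unit-row 1 (suc z) (v 1 (x + 0)) (Zs x 1 (suc z)) (trans (v-shift 0 (x + 0) 0) (v-0-0 (suc (x + 0))))
      (λ { (suc zero) (s≤s ()) ; (suc (suc k)) _ → trans (v-shift 0 (x + 0) (suc k)) (v-0-suc (suc (x + 0)) k) }) ⟩
  D 2 (suc z) (Zs x 1 (suc z))
   ≡⟨ D-pointwise 2 0 (suc z) (Zs-shift x 0 (suc z)) ⟩
  M (3 + x) (suc z) ∎
  where open ≡-Reasoning

 -- For `a = 1` the first satellite row is itself the axis row `Z x y`. The satellite thus adds one
 -- row to the core, and in front it is ready for Cramer's rule.
 Q-1-front : ∀ x y z → Q x y z 1 ≡ sgn (suc y) · D 0 (suc (suc (suc (y + z)))) (v (suc (y + y)) (x + y) ∷ Zs x 0 (suc (suc (y + z))))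
 Q-1-front x y z = begin
  D 0 (suc (y + z + 2)) (Zs x 0 y ++ Z x y ∷ f ∷ Zs x (y + 1) (suc z))
   ≡⟨ cong₂ (λ m k → D 0 (suc m) (Zs x 0 y ++ Z x y ∷ f ∷ Zs x k (suc z))) (NP.+-comm (y + z) 2) (NP.+-comm y 1) ⟩
  D 0 m (Zs x 0 y ++ Z x y ∷ f ∷ Zs x (suc y) (suc z))
   ≡⟨ cong (D 0 m) (trans (sym (LP.++-assoc (Zs x 0 y) [ Z x y ] _)) (cong (_++ f ∷ Zs x (suc y) (suc z)) (trans (sym (Zs-++ x 0 y 1)) (cong (Zs x 0) (NP.+-comm y 1))))) ⟩
  D 0 m (Zs x 0 (suc y) ++ f ∷ Zs x (suc y) (suc z))
   ≡⟨ D-front 0 m (Zs x 0 (suc y)) f _ ⟩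
  sgn (length (Zs x 0 (suc y))) · D 0 m (f ∷ Zs x 0 (suc y) ++ Zs x (suc y) (suc z))
   ≡⟨ cong₂ (λ k l → sgn k · D 0 m (f ∷ l)) (length-Zs x 0 (suc y)) (trans (sym (Zs-++ x 0 (suc y) (suc z))) (cong (λ k → Zs x 0 (suc k)) (+-suc y z))) ⟩
  sgn (suc y) · D 0 m (f ∷ Zs x 0 (suc (suc (y + z)))) ∎
  where
  open ≡-Reasoning
  m = suc (suc (suc (y + z)))
  f = v (suc (y + y)) (x + y)

-- Polynomial identities of creative telescoping.

module Certificates where
 open import Data.Integer.Tactic.RingSolver using () renaming (ring to ℤ-ring)
 import Tactic.RingSolver.NonReflective as NonReflective
 open import Function using (id)

 module ℤ-Solver = NonReflective ℤ-ring

 -- Stated over abstract operations, so that one text yields both the integer polynomials and their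
 -- syntax trees for the ring solver.
 module Polynomials {A : Set} (_:+_ _⊡_ : A → A → A) (⊟ : A → A) (K : ℤ → A) where
  infixl 6 _+:_ _∸_
  infixl 7 _·_
  infixl 8 _*:_
  _+:_ _∸_ _·_ : A → A → A
  _+:_ = _:+_
  x ∸ y = x :+ ⊟ y
  _·_ = _⊡_
  N : ℕ → A
  N n = K (+ n)
  _*:_ : ℕ → A → A
  n *: x = N n ⊡ x
  -- The polynomials quad, p1, p2 and q1 come from Zeilberger's algorithm.
  quad p0 p1 p2 q1 cnum cden : A → A → A → A
  quad x i k = ⊟ (2 *: x · x · x) ∸ 4 *: x · x · i ∸ 7 *: x · x · k ∸ 10 *: x · x +: 6 *: x · i · i
   ∸ 18 *: x · i · k +: 12 *: x · i ∸ 6 *: x · k · k ∸ 36 *: x · k +: 4 *: x ∸ 2 *: i · i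
   +: 9 *: i · i · k ∸ 4 *: i +: 20 *: i · k ∸ 18 *: i · k · k +: 8 *: k ∸ 32 *: k · k
  p0 x τ i = (i +: x +: N 2) · (i · i +: i ∸ x · x ∸ x ∸ τ)
  p1 x τ i = N 24 +: 52 *: i +: 36 *: i · i +: 8 *: i · i · i ∸ 11 *: τ ∸ 5 *: i · τ +: 14 *: x · i
   +: 8 *: x · i · i ∸ 4 *: x · τ ∸ 14 *: x · x ∸ 4 *: x · x · i ∸ 4 *: x · x · x
  p2 x τ i = 2 *: (2 *: i +: N 3) · (4 *: (i +: N 2) · (i +: N 2) +: (i +: N 2) · (4 *: x +: N 2) ∸ τ)
  q1 x τ i = (i +: N 1) · ((4 *: i +: N 6) · (i +: x +: N 2) ∸ τ)
  cden x τ k = k · ((k +: N 1) · (k +: 2 *: x +: N 2) ∸ τ)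
  cnum x τ k = (k +: x +: N 1) · (τ ∸ 2 *: k · (2 *: k +: 2 *: x +: N 1))
  -- The value for which `cnum` vanishes at `k = T`, where the kernel vector has to end. The
  -- identities below hold with `τ` as a free variable.
  tau : A → A → A
  tau x T = (T +: T) · (T +: T +: x +: x +: N 1)
  -- Upper index, lower index and their difference for the entry of `Z x i` in column `k`.
  nn rr ww : A → A → A → A
  nn x i k = x +: i +: k
  rr x i k = i +: i ∸ k
  ww x i k = x +: k +: k ∸ i
  -- The terms of the recurrence for `Z` and of its certificate in column `k`, after division by
  -- what they share: the index of `S₀`, `S₁`, `S₂` is the shift of the row, and `hS⁺`, `hS` belong
  -- to the columns `k + 1` and `k`.
  S₀ S₁ S₂ hS⁺ hS : A → A → A → A
  S₀ x i k = let r = rr x i k ; w = ww x i k in (r +: N 1) · (r +: N 2) · (r +: N 3) · (r +: N 4) · (w +: N 2)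
  S₁ x i k = let n = nn x i k ; r = rr x i k ; w = ww x i k in (n +: N 1) · (r +: N 3) · (r +: N 4) · w · (w +: N 2)
  S₂ x i k = let n = nn x i k ; w = ww x i k in (n +: N 1) · (n +: N 2) · (w +: N 2) · w · (w ∸ N 1)
  hS⁺ x i k = (nn x i k +: N 1) · (rr x i k +: N 4) · quad x i (k +: N 1)
  hS x i k = let w = ww x i k in (w +: N 2) · (w ∸ N 1) · quad x i k
  S-lhs S-rhs F-lhs F-rhs : A → A → A → A → A
  S-lhs x i k τ = p0 x τ i · S₀ x i k +: p1 x τ i · S₁ x i k +: p2 x τ i · S₂ x i k
  S-rhs x i k τ = cnum x τ k · hS⁺ x i k ∸ cden x τ (k ∸ N 1) · hS x i k
  F₀ F₁ hF⁺ hF : A → A → A → A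
  F₀ x i k = let r = rr x i k ; w = ww x i k in (r +: N 2) · (r +: N 3) · (2 *: w +: r +: N 1)
  F₁ x i k = let n = nn x i k ; r = rr x i k ; w = ww x i k in (n +: N 1) · w · (2 *: (w ∸ N 1) +: r +: N 3)
  hF⁺ x i k = (nn x i k +: N 1) · (rr x i k +: N 3) · ⊟ (x +: 3 *: i +: N 4)
  hF x i k = let w = ww x i k in w · (w ∸ N 1) · ⊟ (x +: 3 *: i +: N 4)
  F-lhs x i k τ = p0 x τ i · F₀ x i k +: q1 x τ i · F₁ x i k
  F-rhs x i k τ = cnum x τ k · hF⁺ x i k ∸ cden x τ (k ∸ N 1) · hF x i k

 module Poly = Polynomials ℤ._+_ ℤ._*_ ℤ.-_ id
 open ℤ-Solver using (Expr; _⊕_; _⊗_; ⊝_; Κ; _⊜_)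
 module E {n} = Polynomials {Expr ℤ n} _⊕_ _⊗_ ⊝_ Κ

 -- Left the second-order recurrence in `i` applied to the summand, right a difference in `k`; hence
 -- the pairing of the kernel vector with the rows `Z` obeys this recurrence.
 S-poly : ∀ x i k τ → Poly.S-lhs x i k τ ≡ Poly.S-rhs x i k τ
 S-poly = ℤ-Solver.solve 4 (λ x i k τ → E.S-lhs x i k τ ⊜ E.S-rhs x i k τ) refl

 -- The same for the combination of twice the row `v (2i + 1) (x + i)` with `Z x i`, where order one
 -- is enough.
 F-poly : ∀ x i k τ → Poly.F-lhs x i k τ ≡ Poly.F-rhs x i k τ
 F-poly = ℤ-Solver.solve 4 (λ x i k τ → E.F-lhs x i k τ ⊜ E.F-rhs x i k τ) refl

-- The kernel vector and the summation of its products with binomial rows.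

module KernelVector where
 open import Data.Rational using (_+_; _*_; -_; _-_)
 open Embedding
 open Determinants
 open PathRows
 open Condensation
 open Certificates

 open Poly using (_·_)

 fact : ℕ → ℕ
 fact zero = 1
 fact (suc n) = suc n ℕ.* fact n

 q-≢0 : ∀ {n} → n ≢ 0 → q n ≢ 0ℚ
 q-≢0 {zero} n≢0 = λ _ → n≢0 refl
 q-≢0 {suc n} _ = q-suc≢0 n

 fact≢0 : ∀ n → fact n ≢ 0
 fact≢0 zero ()
 fact≢0 (suc n) e with m*n≡0⇒m≡0∨n≡0 (suc n) e
 ... | inj₂ e′ = fact≢0 n e′

 q-fact≢0 : ∀ n → q (fact n) ≢ 0ℚ
 q-fact≢0 n = q-≢0 (fact≢0 n)

 q-fact-suc : ∀ n → q (fact (suc n)) ≡ (1ℚ + q n) * q (fact n)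
 q-fact-suc n = trans (q-* (suc n) (fact n)) (cong (_* q (fact n)) (q-suc n))

 -- 1 / (r! (n − r)!)
 ebin : ℕ → ℤ → ℚ
 ebin n r = inv (q (fact n)) * bin n r

 bin-ebin : ∀ n r → bin n r ≡ q (fact n) * ebin n r
 bin-ebin n r = begin
  bin n r ≡⟨ QP.*-identityˡ _ ⟨
  1ℚ * bin n r ≡⟨ cong (_* bin n r) (inv-inverseʳ (q-fact≢0 n)) ⟨
  q (fact n) * inv (q (fact n)) * bin n r ≡⟨ QP.*-assoc (q (fact n)) _ _ ⟩
  q (fact n) * ebin n r ∎
  where open ≡-Reasoning

 ebin-step : ∀ n r s u → (1ℚ + q n) * bin n r ≡ u * bin (suc n) s → ebin n r ≡ u * ebin (suc n) s
 ebin-step n r s u e = *-cancelˡ (q-fact≢0 (suc n)) (begin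
  q (fact (suc n)) * ebin n r ≡⟨ cong (_* ebin n r) (q-fact-suc n) ⟩
  (1ℚ + q n) * q (fact n) * ebin n r ≡⟨ QP.*-assoc (1ℚ + q n) _ _ ⟩
  (1ℚ + q n) * (q (fact n) * ebin n r) ≡⟨ cong ((1ℚ + q n) *_) (bin-ebin n r) ⟨
  (1ℚ + q n) * bin n r ≡⟨ e ⟩
  u * bin (suc n) s ≡⟨ cong (u *_) (bin-ebin (suc n) s) ⟩
  u * (q (fact (suc n)) * ebin (suc n) s) ≡⟨ solve 3 (λ a b d → a ⊗ (b ⊗ d) ⊜ b ⊗ (a ⊗ d)) refl u (q (fact (suc n))) (ebin (suc n) s) ⟩
  q (fact (suc n)) * (u * ebin (suc n) s) ∎)
  where open ≡-Reasoning

 -- Equality up to an explicit integer factor. Chaining with `▸` accumulates the product, which is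
 -- compared with the certificate polynomials at the end.
 infix 4 _≡[_]_
 record _≡[_]_ (u : ℚ) (a : ℤ) (w : ℚ) : Set where
  constructor scaled
  field equation : u ≡ ι a * w
 open _≡[_]_

 infixr 5 _▸_
 _▸_ : ∀ {a b : ℤ} {u v w : ℚ} → u ≡[ a ] v → v ≡[ b ] w → u ≡[ a · b ] w
 _▸_ {a} {b} {w = w} (scaled e) (scaled f) = scaled (trans e (trans (cong (ι a *_) f) (trans (sym (QP.*-assoc (ι a) (ι b) w)) (cong (_* w) (sym (ι-* a b))))))

 -- After division by `n!`, passing to a larger upper index costs a factor linear in the indices, on
 -- one side only. Several binomials can thus be expressed through a single one without dividing.
 ebin-right : ∀ n r {s} → s ≡ r ℤ.+ + 1 → ebin n r ≡[ s ] ebin (suc n) s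
 ebin-right n r refl = scaled (ebin-step n r (r ℤ.+ + 1) (ι (r ℤ.+ + 1)) (trans (bin-up-right n r) (cong (_* bin (suc n) (r ℤ.+ + 1)) (sym (ι-+ r (+ 1))))))

 ebin-up : ∀ n r → ebin n r ≡[ + suc n ℤ.- r ] ebin (suc n) r
 ebin-up n r = scaled (ebin-step n r r (ι (+ suc n ℤ.- r)) (trans (bin-up n r) (cong (_* bin (suc n) r)
  (sym (trans (ι-- (+ suc n) r) (cong (_- ι r) (q-suc n)))))))

 Σ₀-cong : ∀ n {f g} → (∀ k → k ℕ.< n → f k ≡ g k) → Σ₀ n f ≡ Σ₀ n g
 Σ₀-cong zero e = refl
 Σ₀-cong (suc n) e = cong₂ _+_ (Σ₀-cong n (λ k k<n → e k (m<n⇒m<1+n k<n))) (e n ≤-refl)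

 Σ₀-lin : ∀ n a b {f g} → a * Σ₀ n f + b * Σ₀ n g ≡ Σ₀ n (λ k → a * f k + b * g k)
 Σ₀-lin zero a b = solve 2 (λ a b → a ⊗ Κ 0ℚ ⊕ b ⊗ Κ 0ℚ ⊜ Κ 0ℚ) refl a b
 Σ₀-lin (suc n) a b {f} {g} = trans
  (solve 6 (λ a b f g u v → a ⊗ (u ⊕ f) ⊕ b ⊗ (v ⊕ g) ⊜ (a ⊗ u ⊕ b ⊗ v) ⊕ (a ⊗ f ⊕ b ⊗ g)) refl a b (f n) (g n) (Σ₀ n f) (Σ₀ n g))
  (cong (_+ (a * f n + b * g n)) (Σ₀-lin n a b))

 module Kernel (x T : ℕ) where
  X τ : ℤ
  X = + x
  τ = Poly.tau X (+ T)
  -- The vector on the columns 0, ..., `T` that the rows `Z x 0`, ..., `Z x (T − 1)` annihilate. The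
  -- row `Z x 0` is a unit vector and forces `c 0 = 0`; the entry 1 at index 1 is a normalisation,
  -- and from there on the ratios are rational functions of `k`.
  c : ℕ → ℚ
  c zero = 0ℚ
  c (suc zero) = 1ℚ
  c (suc (suc k)) = c (suc k) * ι (Poly.cnum X τ (+ suc k)) * inv (ι (Poly.cden X τ (+ suc k)))
  κ : Row → ℚ
  κ = pair 0 (suc T) c
  -- Substituting `T = k + 1 + d` factors the difference with `τ`; up to sign only natural numbers
  -- remain, which shows where they are nonzero.
  cden-value : ∀ k d → k ℕ.+ 1 ℕ.+ d ≡ T → ι (Poly.cden X τ (+ k)) ≡ - (q k * q (k ℕ.+ k ℕ.+ k ℕ.+ d ℕ.+ d ℕ.+ x ℕ.+ x ℕ.+ 4) * q (k ℕ.+ 1 ℕ.+ d ℕ.+ d))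
  cden-value k d refl = begin
   ι (Poly.cden X τ (+ k)) ≡⟨ cong ι (e X (+ k) (+ d)) ⟩
   ι (ℤ.- (+ k · + B · + C)) ≡⟨ ι-neg (+ k · + B · + C) ⟩
   - ι (+ k · + B · + C) ≡⟨ cong -_ (trans (ι-* (+ k · + B) (+ C)) (cong (_* q C) (ι-* (+ k) (+ B)))) ⟩
   - (q k * q B * q C) ∎
   where
   open ≡-Reasoning
   B = k ℕ.+ k ℕ.+ k ℕ.+ d ℕ.+ d ℕ.+ x ℕ.+ x ℕ.+ 4
   C = k ℕ.+ 1 ℕ.+ d ℕ.+ d
   e : ∀ x k d → Poly.cden x (Poly.tau x (k ℤ.+ + 1 ℤ.+ d)) k ≡ ℤ.- (k · (k ℤ.+ k ℤ.+ k ℤ.+ d ℤ.+ d ℤ.+ x ℤ.+ x ℤ.+ + 4) · (k ℤ.+ + 1 ℤ.+ d ℤ.+ d))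
   e = ℤ-Solver.solve 3 (λ x k d → E.cden x (E.tau x (k E.+: E.N 1 E.+: d)) k ℤ-Solver.⊜ ℤ-Solver.⊝_ (k E.· (k E.+: k E.+: k E.+: d E.+: d E.+: x E.+: x E.+: E.N 4) E.· (k E.+: E.N 1 E.+: d E.+: d))) refl
  cnum-value : ∀ k d → k ℕ.+ d ≡ T → ι (Poly.cnum X τ (+ k)) ≡ q (k ℕ.+ x ℕ.+ 1) * q (d ℕ.+ d) * q (k ℕ.+ k ℕ.+ k ℕ.+ k ℕ.+ d ℕ.+ d ℕ.+ x ℕ.+ x ℕ.+ 1)
  cnum-value k d refl = begin
   ι (Poly.cnum X τ (+ k)) ≡⟨ cong ι (e X (+ k) (+ d)) ⟩
   ι (+ A · + B · + C) ≡⟨ trans (ι-* (+ A · + B) (+ C)) (cong (_* q C) (ι-* (+ A) (+ B))) ⟩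
   q A * q B * q C ∎
   where
   open ≡-Reasoning
   A = k ℕ.+ x ℕ.+ 1
   B = d ℕ.+ d
   C = k ℕ.+ k ℕ.+ k ℕ.+ k ℕ.+ d ℕ.+ d ℕ.+ x ℕ.+ x ℕ.+ 1
   e : ∀ x k d → Poly.cnum x (Poly.tau x (k ℤ.+ d)) k ≡ (k ℤ.+ x ℤ.+ + 1) · (d ℤ.+ d) · (k ℤ.+ k ℤ.+ k ℤ.+ k ℤ.+ d ℤ.+ d ℤ.+ x ℤ.+ x ℤ.+ + 1)
   e = ℤ-Solver.solve 3 (λ x k d → E.cnum x (E.tau x (k E.+: d)) k ℤ-Solver.⊜ (k E.+: x E.+: E.N 1) E.· (d E.+: d) E.· (k E.+: k E.+: k E.+: k E.+: d E.+: d E.+: x E.+: x E.+: E.N 1)) refl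
  neg≢0 : ∀ {u} → u ≢ 0ℚ → - u ≢ 0ℚ
  neg≢0 {u} u≢0 e = u≢0 (trans (solve 1 (λ u → u ⊜ ⊝ (⊝ u)) refl u) (cong -_ e))
  cden-≢0 : ∀ k → suc k ℕ.< T → ι (Poly.cden X τ (+ suc k)) ≢ 0ℚ
  cden-≢0 k k<T = subst (_≢ 0ℚ) (sym (cden-value (suc k) d (m+[n∸m]≡n (subst (ℕ._≤ T) (NP.+-comm 1 (suc k)) k<T))))
   (neg≢0 (*-≢0 (*-≢0 (q-suc≢0 k) (q-suc≢0 (k ℕ.+ suc k ℕ.+ suc k ℕ.+ d ℕ.+ d ℕ.+ x ℕ.+ x ℕ.+ 4))) (q-suc≢0 (k ℕ.+ 1 ℕ.+ d ℕ.+ d))))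
   where
   d = T ℕ.∸ (suc k ℕ.+ 1)
  -- The division-free form includes `k = 0`, where `cden` and `c 0` are both zero.
  c-rec : ∀ k → k ℕ.< T → ι (Poly.cden X τ (+ k)) * c (suc k) ≡ ι (Poly.cnum X τ (+ k)) * c k
  c-rec zero _ = trans (cong (λ z → ι z * 1ℚ) (ZP.*-zeroˡ ((+ 0 ℤ.+ + 1) · (+ 0 ℤ.+ + 2 · X ℤ.+ + 2) ℤ.- τ))) (sym (QP.*-zeroʳ (ι (Poly.cnum X τ (+ 0)))))
  c-rec (suc k) k<T = begin
   δ * (c (suc k) * ν * inv δ) ≡⟨ solve 4 (λ d e c n → d ⊗ (c ⊗ n ⊗ e) ⊜ d ⊗ e ⊗ (n ⊗ c)) refl δ (inv δ) (c (suc k)) ν ⟩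
   δ * inv δ * (ν * c (suc k)) ≡⟨ cong (_* (ν * c (suc k))) (inv-inverseʳ (cden-≢0 k k<T)) ⟩
   1ℚ * (ν * c (suc k)) ≡⟨ QP.*-identityˡ _ ⟩
   ν * c (suc k) ∎
   where
   open ≡-Reasoning
   δ = ι (Poly.cden X τ (+ suc k))
   ν = ι (Poly.cnum X τ (+ suc k))
  c-≢0 : ∀ k → k ℕ.< T → c (suc k) ≢ 0ℚ
  c-≢0 zero _ ()
  c-≢0 (suc k) k<T = *-≢0 {c (suc k) * ι (Poly.cnum X τ (+ suc k))} {inv (ι (Poly.cden X τ (+ suc k)))}
   (*-≢0 {c (suc k)} {ι (Poly.cnum X τ (+ suc k))} (c-≢0 k (<⇒≤ k<T)) ν≢0) (inv-≢0 (cden-≢0 k k<T))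
   where
   d = T ℕ.∸ suc (suc k)
   eq : suc k ℕ.+ suc d ≡ T
   eq = trans (+-suc (suc k) d) (m+[n∸m]≡n k<T)
   ν≢0 : ι (Poly.cnum X τ (+ suc k)) ≢ 0ℚ
   ν≢0 = subst (_≢ 0ℚ) (sym (cnum-value (suc k) (suc d) eq))
    (*-≢0 (*-≢0 (q-suc≢0 (k ℕ.+ x ℕ.+ 1)) (q-suc≢0 (d ℕ.+ suc d))) (q-suc≢0 (k ℕ.+ suc k ℕ.+ suc k ℕ.+ suc k ℕ.+ suc d ℕ.+ suc d ℕ.+ x ℕ.+ x ℕ.+ 1)))
  cnum-end : ι (Poly.cnum X τ (+ T)) ≡ 0ℚ
  cnum-end = trans (cnum-value T 0 (NP.+-identityʳ T)) (trans (cong (_* q (T ℕ.+ T ℕ.+ T ℕ.+ T ℕ.+ 0 ℕ.+ 0 ℕ.+ x ℕ.+ x ℕ.+ 1)) (QP.*-zeroʳ (q (T ℕ.+ x ℕ.+ 1)))) (QP.*-zeroˡ (q (T ℕ.+ T ℕ.+ T ℕ.+ T ℕ.+ 0 ℕ.+ 0 ℕ.+ x ℕ.+ x ℕ.+ 1))))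
  -- If c k t(k) = G(k+1) − G(k), where G(k) is c k times a multiple of cden(k − 1), then κ(t) = 0.
  telescope : ∀ (t h : ℕ → ℚ) →
   (∀ k → c k * t k ≡ ι (Poly.cnum X τ (+ k)) * c k * h (suc k) - ι (Poly.cden X τ (+ k ℤ.- + 1)) * c k * h k) →
   Σ₀ (suc T) (λ k → c k * t k) ≡ 0ℚ
  telescope t h e = begin
   Σ₀ T (λ k → c k * t k) + c T * t T ≡⟨ cong₂ _+_ (go T ≤-refl) (e T) ⟩
   A T * h T + (ι (Poly.cnum X τ (+ T)) * c T * h (suc T) - A T * h T)
    ≡⟨ cong (λ z → A T * h T + (z * c T * h (suc T) - A T * h T)) cnum-end ⟩
   A T * h T + (0ℚ * c T * h (suc T) - A T * h T)
    ≡⟨ solve 3 (λ a b d → a ⊕ (Κ 0ℚ ⊗ b ⊗ d ⊖ a) ⊜ Κ 0ℚ) refl (A T * h T) (c T) (h (suc T)) ⟩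
   0ℚ ∎
   where
   open ≡-Reasoning
   A : ℕ → ℚ
   A k = ι (Poly.cden X τ (+ k ℤ.- + 1)) * c k
   go : ∀ n → n ℕ.≤ T → Σ₀ n (λ k → c k * t k) ≡ A n * h n
   go zero _ = sym (trans (cong (_* h 0) (QP.*-zeroʳ (ι (Poly.cden X τ (+ 0 ℤ.- + 1))))) (QP.*-zeroˡ (h 0)))
   go (suc n) n<T = begin
    Σ₀ n (λ k → c k * t k) + c n * t n ≡⟨ cong₂ _+_ (go n (<⇒≤ n<T)) (e n) ⟩
    A n * h n + (ι (Poly.cnum X τ (+ n)) * c n * h (suc n) - A n * h n)
     ≡⟨ solve 2 (λ a b → a ⊕ (b ⊖ a) ⊜ b) refl (A n * h n) (ι (Poly.cnum X τ (+ n)) * c n * h (suc n)) ⟩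
    ι (Poly.cnum X τ (+ n)) * c n * h (suc n)
     ≡⟨ cong (_* h (suc n)) (c-rec n n<T) ⟨
    ι (Poly.cden X τ (+ n)) * c (suc n) * h (suc n) ∎
  module _ (i : ℕ) where
   I : ℤ
   I = + i
   r : ℕ → ℤ
   r k = + (i ℕ.+ i) ℤ.- + k
   n : ℕ → ℕ
   n k = x ℕ.+ i ℕ.+ k
   w : ℕ → ℤ
   w k = Poly.ww X I (+ k)
   φ : ℕ → ℚ
   φ k = q (fact (n k))
   φ-suc : ∀ k → q (fact (suc (n k))) ≡ ι (+ suc (n k)) * φ k
   φ-suc k = q-* (suc (n k)) (fact (n k))
   φ-suc² : ∀ k → q (fact (suc (suc (n k)))) ≡ ι (+ suc (suc (n k))) * (ι (+ suc (n k)) * φ k)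
   φ-suc² k = trans (q-* (suc (suc (n k))) (fact (suc (n k)))) (cong (ι (+ suc (suc (n k))) *_) (φ-suc k))
   n-suc : ∀ k → n (suc k) ≡ suc (n k)
   n-suc k = +-suc (x ℕ.+ i) k
   -- r k + j, in the shape in which ebin meets it
   r⁺ : ℕ → ℕ → ℤ
   r⁺ k j = r k ℤ.+ + j
   r⁺-suc : ∀ k j → r⁺ k (suc j) ≡ r⁺ k j ℤ.+ + 1
   r⁺-suc k j = e (r k) (+ j)
    where
    e : ∀ a b → a ℤ.+ (+ 1 ℤ.+ b) ≡ a ℤ.+ b ℤ.+ + 1
    e = solve-ℤ
   r-suc : ∀ k j → r (suc k) ℤ.+ + suc j ≡ r⁺ k j
   r-suc k j = e (+ (i ℕ.+ i)) (+ k) (+ j)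
    where
    e : ∀ a b d → a ℤ.- (+ 1 ℤ.+ b) ℤ.+ (+ 1 ℤ.+ d) ≡ a ℤ.- b ℤ.+ d
    e = solve-ℤ
   -- This and `hS` are the certificates of the two recurrences, without the factor of `cden` and
   -- `c k` that `telescope` supplies.
   hF : ℕ → ℚ
   hF k = φ k * (ι (w k · (w k ℤ.- + 1) · ℤ.- (X ℤ.+ + 3 · I ℤ.+ + 4)) * ebin (3 ℕ.+ n k) (r⁺ k 3))
   hS : ℕ → ℚ
   hS k = φ k * (ι ((w k ℤ.- + 1) · Poly.quad X I (+ k)) * ebin (4 ℕ.+ n k) (r⁺ k 4))
   tS : ℕ → ℚ
   tS k = ι (Poly.p0 X τ I) * bin (n k) (r⁺ k 0) + ι (Poly.p1 X τ I) * bin (1 ℕ.+ n k) (r⁺ k 2) + ι (Poly.p2 X τ I) * bin (2 ℕ.+ n k) (r⁺ k 4)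
   tF : ℕ → ℚ
   tF k = ι (Poly.p0 X τ I) * (q 2 * bin (n k) (r⁺ k 1) + bin (n k) (r⁺ k 0))
      + ι (Poly.q1 X τ I) * (q 2 * bin (1 ℕ.+ n k) (r⁺ k 3) + bin (1 ℕ.+ n k) (r⁺ k 2))
   module _ (k : ℕ) where
    R W N′ : ℤ
    R = r k
    W = w k
    N′ = + n k
    right : ∀ m j → ebin (m ℕ.+ n k) (r⁺ k j) ≡[ r⁺ k (suc j) ] ebin (suc m ℕ.+ n k) (r⁺ k (suc j))
    right m j = ebin-right (m ℕ.+ n k) (r⁺ k j) (r⁺-suc k j)
    up : ∀ m j → ebin (m ℕ.+ n k) (r⁺ k j) ≡[ + (suc m ℕ.+ n k) ℤ.- r⁺ k j ] ebin (suc m ℕ.+ n k) (r⁺ k j)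
    up m j = ebin-up (m ℕ.+ n k) (r⁺ k j)
    collect₃ : ∀ (c φ β : ℚ) (a b d s₁ s₂ e₀ e₁ e₂ : ℤ) →
     c * (ι a * (φ * (ι e₀ * β)) + ι b * (ι s₁ * φ * (ι e₁ * β)) + ι d * (ι s₂ * (ι s₁ * φ) * (ι e₂ * β)))
     ≡ c * φ * β * ι (a · e₀ ℤ.+ b · (s₁ · e₁) ℤ.+ d · (s₂ · (s₁ · e₂)))
    collect₃ c φ β a b d s₁ s₂ e₀ e₁ e₂ = trans
     (solve 11 (λ c φ β a b d s₁ s₂ e₀ e₁ e₂ →
       c ⊗ (a ⊗ (φ ⊗ (e₀ ⊗ β)) ⊕ b ⊗ (s₁ ⊗ φ ⊗ (e₁ ⊗ β)) ⊕ d ⊗ (s₂ ⊗ (s₁ ⊗ φ) ⊗ (e₂ ⊗ β)))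
       ⊜ c ⊗ φ ⊗ β ⊗ (a ⊗ e₀ ⊕ b ⊗ (s₁ ⊗ e₁) ⊕ d ⊗ (s₂ ⊗ (s₁ ⊗ e₂))))
      refl c φ β (ι a) (ι b) (ι d) (ι s₁) (ι s₂) (ι e₀) (ι e₁) (ι e₂))
     (cong (c * φ * β *_) (sym
      (trans (ι-+ (a · e₀ ℤ.+ b · (s₁ · e₁)) (d · (s₂ · (s₁ · e₂)))) (cong₂ _+_
       (trans (ι-+ (a · e₀) (b · (s₁ · e₁))) (cong₂ _+_ (ι-* a e₀) (trans (ι-* b (s₁ · e₁)) (cong (ι b *_) (ι-* s₁ e₁)))))
       (trans (ι-* d (s₂ · (s₁ · e₂))) (cong (ι d *_) (trans (ι-* s₂ (s₁ · e₂)) (cong (ι s₂ *_) (ι-* s₁ e₂)))))))))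
    collect-diff : ∀ (c φ β : ℚ) (a b s u v : ℤ) →
     c * φ * β * ι (a · (s · u) ℤ.- b · v) ≡ ι a * c * (ι s * φ * (ι u * β)) - ι b * c * (φ * (ι v * β))
    collect-diff c φ β a b s u v = trans
     (cong (c * φ * β *_) (trans (ι-- (a · (s · u)) (b · v)) (cong₂ _-_ (trans (ι-* a (s · u)) (cong (ι a *_) (ι-* s u))) (ι-* b v))))
     (solve 8 (λ c φ β a b s u v → c ⊗ φ ⊗ β ⊗ (a ⊗ (s ⊗ u) ⊖ b ⊗ v) ⊜ a ⊗ c ⊗ (s ⊗ φ ⊗ (u ⊗ β)) ⊖ b ⊗ c ⊗ (φ ⊗ (v ⊗ β)))
      refl c φ β (ι a) (ι b) (ι s) (ι u) (ι v))
    ι-fold : ∀ φ a {b} {u β} → u ≡[ b ] β → φ * (ι a * u) ≡ φ * (ι (a · b) * β)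
    ι-fold φ a {b} {u} {β} (scaled e) = cong (φ *_) (trans (cong (ι a *_) e) (trans (sym (QP.*-assoc (ι a) (ι b) β)) (cong (_* β) (sym (ι-* a b)))))
    module _ where
     open ≡-Reasoning
     -- Every binomial is brought to the single quantity `β`, whose indices are large enough for all
     -- of them. Comparing integer factors then leaves `S-poly` multiplied by `w + 1`.
     S-step : c k * tS k ≡ ι (Poly.cnum X τ (+ k)) * c k * hS (suc k) - ι (Poly.cden X τ (+ k ℤ.- + 1)) * c k * hS k
     S-step = begin
      c k * tS k
       ≡⟨ cong (c k *_) (cong₂ _+_ (cong₂ _+_
          (cong (ι P0 *_) (trans (bin-ebin (n k) (r⁺ k 0)) (cong (φ k *_) (equation (right 0 0 ▸ right 1 1 ▸ right 2 2 ▸ right 3 3 ▸ up 4 4 ▸ up 5 4)))))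
          (cong (ι P1 *_) (trans (bin-ebin (1 ℕ.+ n k) (r⁺ k 2)) (cong₂ _*_ (φ-suc k) (equation (right 1 2 ▸ right 2 3 ▸ up 3 4 ▸ up 4 4 ▸ up 5 4))))))
          (cong (ι P2 *_) (trans (bin-ebin (2 ℕ.+ n k) (r⁺ k 4)) (cong₂ _*_ (φ-suc² k) (equation (up 2 4 ▸ up 3 4 ▸ up 4 4 ▸ up 5 4)))))) ⟩
      c k * (ι P0 * (φ k * (ι e₀ * β)) + ι P1 * (ι s₁ * φ k * (ι e₁ * β)) + ι P2 * (ι s₂ * (ι s₁ * φ k) * (ι e₂ * β)))
       ≡⟨ collect₃ (c k) (φ k) β P0 P1 P2 s₁ s₂ e₀ e₁ e₂ ⟩
      c k * φ k * β * ι (P0 · e₀ ℤ.+ P1 · (s₁ · e₁) ℤ.+ P2 · (s₂ · (s₁ · e₂)))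
       ≡⟨ cong (λ z → c k * φ k * β * ι z) (begin
          P0 · e₀ ℤ.+ P1 · (s₁ · e₁) ℤ.+ P2 · (s₂ · (s₁ · e₂))
           ≡⟨ lhs X I (+ k) P0 P1 P2 ⟩
          (W ℤ.+ + 1) · Poly.S-lhs X I (+ k) τ
           ≡⟨ cong ((W ℤ.+ + 1) ·_) (S-poly X I (+ k) τ) ⟩
          (W ℤ.+ + 1) · Poly.S-rhs X I (+ k) τ
           ≡⟨ rhs X I (+ k) Cn Cd (Poly.quad X I (+ k ℤ.+ + 1)) (Poly.quad X I (+ k)) ⟨
          Cn · (s₁ · ((w (suc k) ℤ.- + 1) · Poly.quad X I (+ k ℤ.+ + 1) · r⁺ k 4)) ℤ.- Cd · v′
           ≡⟨ cong (λ z → Cn · (s₁ · ((w (suc k) ℤ.- + 1) · Poly.quad X I (+ z) · r⁺ k 4)) ℤ.- Cd · v′) (NP.+-comm k 1) ⟩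
          Cn · (s₁ · u) ℤ.- Cd · v′ ∎) ⟩
      c k * φ k * β * ι (Cn · (s₁ · u) ℤ.- Cd · v′)
       ≡⟨ collect-diff (c k) (φ k) β Cn Cd s₁ u v′ ⟩
      ι Cn * c k * (ι s₁ * φ k * (ι u * β)) - ι Cd * c k * (φ k * (ι v′ * β))
       ≡⟨ cong₂ (λ a b → ι Cn * c k * a - ι Cd * c k * b)
          (trans (ι-fold (q (fact (n (suc k)))) ((w (suc k) ℤ.- + 1) · Poly.quad X I (+ suc k))
           (scaled (trans (cong₂ ebin (cong (4 ℕ.+_) (n-suc k)) (r-suc k 3)) (equation (right 5 3)))))
           (cong (_* (ι u * β)) (trans (cong (λ m → q (fact m)) (n-suc k)) (φ-suc k))))
          (ι-fold (φ k) ((W ℤ.- + 1) · Poly.quad X I (+ k)) (up 4 4 ▸ up 5 4)) ⟨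
      ι Cn * c k * hS (suc k) - ι Cd * c k * hS k ∎
      where
      P0 P1 P2 s₁ s₂ Cn Cd e₀ e₁ e₂ u v′ : ℤ
      β : ℚ
      β = ebin (6 ℕ.+ n k) (r⁺ k 4)
      P0 = Poly.p0 X τ I
      P1 = Poly.p1 X τ I
      P2 = Poly.p2 X τ I
      s₁ = + suc (n k)
      s₂ = + suc (suc (n k))
      Cn = Poly.cnum X τ (+ k)
      Cd = Poly.cden X τ (+ k ℤ.- + 1)
      t : ℕ → ℤ
      t j = + (j ℕ.+ n k) ℤ.- r⁺ k 4
      e₀ = r⁺ k 1 · (r⁺ k 2 · (r⁺ k 3 · (r⁺ k 4 · (t 5 · t 6))))
      e₁ = r⁺ k 3 · (r⁺ k 4 · (t 4 · (t 5 · t 6)))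
      e₂ = t 3 · (t 4 · (t 5 · t 6))
      u = (w (suc k) ℤ.- + 1) · Poly.quad X I (+ suc k) · r⁺ k 4
      v′ = (W ℤ.- + 1) · Poly.quad X I (+ k) · (t 5 · t 6)
      lhs : ∀ x i k p0 p1 p2 → let n = x ℤ.+ i ℤ.+ k ; r = i ℤ.+ i ℤ.- k ; w = x ℤ.+ k ℤ.+ k ℤ.- i in
       p0 ℤ.* ((r ℤ.+ + 1) ℤ.* ((r ℤ.+ + 2) ℤ.* ((r ℤ.+ + 3) ℤ.* ((r ℤ.+ + 4) ℤ.* ((+ 5 ℤ.+ n ℤ.- (r ℤ.+ + 4)) ℤ.* (+ 6 ℤ.+ n ℤ.- (r ℤ.+ + 4)))))))
       ℤ.+ p1 ℤ.* ((+ 1 ℤ.+ n) ℤ.* ((r ℤ.+ + 3) ℤ.* ((r ℤ.+ + 4) ℤ.* ((+ 4 ℤ.+ n ℤ.- (r ℤ.+ + 4)) ℤ.* ((+ 5 ℤ.+ n ℤ.- (r ℤ.+ + 4)) ℤ.* (+ 6 ℤ.+ n ℤ.- (r ℤ.+ + 4)))))))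
       ℤ.+ p2 ℤ.* ((+ 2 ℤ.+ n) ℤ.* ((+ 1 ℤ.+ n) ℤ.* ((+ 3 ℤ.+ n ℤ.- (r ℤ.+ + 4)) ℤ.* ((+ 4 ℤ.+ n ℤ.- (r ℤ.+ + 4)) ℤ.* ((+ 5 ℤ.+ n ℤ.- (r ℤ.+ + 4)) ℤ.* (+ 6 ℤ.+ n ℤ.- (r ℤ.+ + 4)))))))
       ≡ (w ℤ.+ + 1) ℤ.* (p0 ℤ.* ((r ℤ.+ + 1) ℤ.* (r ℤ.+ + 2) ℤ.* (r ℤ.+ + 3) ℤ.* (r ℤ.+ + 4) ℤ.* (w ℤ.+ + 2))
        ℤ.+ p1 ℤ.* ((n ℤ.+ + 1) ℤ.* (r ℤ.+ + 3) ℤ.* (r ℤ.+ + 4) ℤ.* w ℤ.* (w ℤ.+ + 2))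
        ℤ.+ p2 ℤ.* ((n ℤ.+ + 1) ℤ.* (n ℤ.+ + 2) ℤ.* (w ℤ.+ + 2) ℤ.* w ℤ.* (w ℤ.- + 1)))
      lhs = solve-ℤ
      rhs : ∀ x i k cn cd a b → let n = x ℤ.+ i ℤ.+ k ; r = i ℤ.+ i ℤ.- k ; w = x ℤ.+ k ℤ.+ k ℤ.- i in
       cn ℤ.* ((+ 1 ℤ.+ n) ℤ.* ((x ℤ.+ (+ 1 ℤ.+ k) ℤ.+ (+ 1 ℤ.+ k) ℤ.- i ℤ.- + 1) ℤ.* a ℤ.* (r ℤ.+ + 4)))
        ℤ.- cd ℤ.* ((w ℤ.- + 1) ℤ.* b ℤ.* ((+ 5 ℤ.+ n ℤ.- (r ℤ.+ + 4)) ℤ.* (+ 6 ℤ.+ n ℤ.- (r ℤ.+ + 4))))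
       ≡ (w ℤ.+ + 1) ℤ.* (cn ℤ.* ((n ℤ.+ + 1) ℤ.* (r ℤ.+ + 4) ℤ.* a) ℤ.- cd ℤ.* ((w ℤ.+ + 2) ℤ.* (w ℤ.- + 1) ℤ.* b))
      rhs = solve-ℤ
     F-step : c k * tF k ≡ ι (Poly.cnum X τ (+ k)) * c k * hF (suc k) - ι (Poly.cden X τ (+ k ℤ.- + 1)) * c k * hF k
     F-step = begin
      c k * tF k
       ≡⟨ cong (c k *_) (cong₂ _+_
          (cong (ι P0 *_) (cong₂ (λ a b → q 2 * a + b)
           (trans (bin-ebin (n k) (r⁺ k 1)) (cong (φ k *_) (equation (right 0 1 ▸ right 1 2 ▸ up 2 3 ▸ up 3 3 ▸ up 4 3))))
           (trans (bin-ebin (n k) (r⁺ k 0)) (cong (φ k *_) (equation (right 0 0 ▸ right 1 1 ▸ right 2 2 ▸ up 3 3 ▸ up 4 3))))))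
          (cong (ι Q1 *_) (cong₂ (λ a b → q 2 * a + b)
           (trans (bin-ebin (1 ℕ.+ n k) (r⁺ k 3)) (cong₂ _*_ (φ-suc k) (equation (up 1 3 ▸ up 2 3 ▸ up 3 3 ▸ up 4 3))))
           (trans (bin-ebin (1 ℕ.+ n k) (r⁺ k 2)) (cong₂ _*_ (φ-suc k) (equation (right 1 2 ▸ up 2 3 ▸ up 3 3 ▸ up 4 3))))))) ⟩
      c k * (ι P0 * (q 2 * (φ k * (ι a₁ * β)) + φ k * (ι a₂ * β)) + ι Q1 * (q 2 * (ι s₁ * φ k * (ι a₃ * β)) + ι s₁ * φ k * (ι a₄ * β)))
       ≡⟨ cong (c k *_) (solve 10 (λ p o two φ s β a₁ a₂ a₃ a₄ →
          p ⊗ (two ⊗ (φ ⊗ (a₁ ⊗ β)) ⊕ φ ⊗ (a₂ ⊗ β)) ⊕ o ⊗ (two ⊗ (s ⊗ φ ⊗ (a₃ ⊗ β)) ⊕ s ⊗ φ ⊗ (a₄ ⊗ β))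
          ⊜ p ⊗ (φ ⊗ ((two ⊗ a₁ ⊕ a₂) ⊗ β)) ⊕ o ⊗ (s ⊗ φ ⊗ ((two ⊗ a₃ ⊕ a₄) ⊗ β)))
         refl (ι P0) (ι Q1) (q 2) (φ k) (ι s₁) β (ι a₁) (ι a₂) (ι a₃) (ι a₄)) ⟩
      c k * (ι P0 * (φ k * ((q 2 * ι a₁ + ι a₂) * β)) + ι Q1 * (ι s₁ * φ k * ((q 2 * ι a₃ + ι a₄) * β)))
       ≡⟨ cong₂ (λ a b → c k * (ι P0 * (φ k * (a * β)) + ι Q1 * (ι s₁ * φ k * (b * β)))) (two a₁ a₂) (two a₃ a₄) ⟨
      c k * (ι P0 * (φ k * (ι (+ 2 · a₁ ℤ.+ a₂) * β)) + ι Q1 * (ι s₁ * φ k * (ι (+ 2 · a₃ ℤ.+ a₄) * β)))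
       -- A zero summand gives the sum the three-term shape that `collect₃` expects.
       ≡⟨ cong (c k *_) (solve 4 (λ a s z b → a ⊜ a ⊕ Κ 0ℚ ⊗ (Κ 0ℚ ⊗ (s ⊗ z) ⊗ (Κ 0ℚ ⊗ b))) refl _ (ι s₁) (φ k) β) ⟩
      c k * (ι P0 * (φ k * (ι (+ 2 · a₁ ℤ.+ a₂) * β)) + ι Q1 * (ι s₁ * φ k * (ι (+ 2 · a₃ ℤ.+ a₄) * β)) + ι (+ 0) * (ι (+ 0) * (ι s₁ * φ k) * (ι (+ 0) * β)))
       ≡⟨ collect₃ (c k) (φ k) β P0 Q1 (+ 0) s₁ (+ 0) (+ 2 · a₁ ℤ.+ a₂) (+ 2 · a₃ ℤ.+ a₄) (+ 0) ⟩
      c k * φ k * β * ι (P0 · (+ 2 · a₁ ℤ.+ a₂) ℤ.+ Q1 · (s₁ · (+ 2 · a₃ ℤ.+ a₄)) ℤ.+ + 0 · (+ 0 · (s₁ · + 0)))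
       ≡⟨ cong (λ z → c k * φ k * β * ι z) (begin
          P0 · (+ 2 · a₁ ℤ.+ a₂) ℤ.+ Q1 · (s₁ · (+ 2 · a₃ ℤ.+ a₄)) ℤ.+ + 0 · (+ 0 · (s₁ · + 0))
           ≡⟨ lhs X I (+ k) P0 Q1 ⟩
          ((W ℤ.+ + 1) · (W ℤ.+ + 2)) · Poly.F-lhs X I (+ k) τ
           ≡⟨ cong (((W ℤ.+ + 1) · (W ℤ.+ + 2)) ·_) (F-poly X I (+ k) τ) ⟩
          ((W ℤ.+ + 1) · (W ℤ.+ + 2)) · Poly.F-rhs X I (+ k) τ
           ≡⟨ rhs X I (+ k) Cn Cd ⟨
          Cn · (s₁ · u) ℤ.- Cd · v′ ∎) ⟩
      c k * φ k * β * ι (Cn · (s₁ · u) ℤ.- Cd · v′)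
       ≡⟨ collect-diff (c k) (φ k) β Cn Cd s₁ u v′ ⟩
      ι Cn * c k * (ι s₁ * φ k * (ι u * β)) - ι Cd * c k * (φ k * (ι v′ * β))
       ≡⟨ cong₂ (λ a b → ι Cn * c k * a - ι Cd * c k * b)
          (trans (ι-fold (q (fact (n (suc k)))) (w (suc k) · (w (suc k) ℤ.- + 1) · ℤ.- (X ℤ.+ + 3 · I ℤ.+ + 4))
           (scaled (trans (cong₂ ebin (cong (3 ℕ.+_) (n-suc k)) (r-suc k 2)) (equation (right 4 2)))))
           (cong (_* (ι u * β)) (trans (cong (λ m → q (fact m)) (n-suc k)) (φ-suc k))))
          (ι-fold (φ k) (W · (W ℤ.- + 1) · ℤ.- (X ℤ.+ + 3 · I ℤ.+ + 4)) (up 3 3 ▸ up 4 3)) ⟨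
      ι Cn * c k * hF (suc k) - ι Cd * c k * hF k ∎
      where
      P0 Q1 s₁ Cn Cd a₁ a₂ a₃ a₄ u v′ : ℤ
      β : ℚ
      β = ebin (5 ℕ.+ n k) (r⁺ k 3)
      P0 = Poly.p0 X τ I
      Q1 = Poly.q1 X τ I
      s₁ = + suc (n k)
      Cn = Poly.cnum X τ (+ k)
      Cd = Poly.cden X τ (+ k ℤ.- + 1)
      t : ℕ → ℤ
      t j = + (j ℕ.+ n k) ℤ.- r⁺ k 3
      a₁ = r⁺ k 2 · (r⁺ k 3 · (t 3 · (t 4 · t 5)))
      a₂ = r⁺ k 1 · (r⁺ k 2 · (r⁺ k 3 · (t 4 · t 5)))
      a₃ = t 2 · (t 3 · (t 4 · t 5))
      a₄ = r⁺ k 3 · (t 3 · (t 4 · t 5))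
      u = w (suc k) · (w (suc k) ℤ.- + 1) · ℤ.- (X ℤ.+ + 3 · I ℤ.+ + 4) · r⁺ k 3
      v′ = W · (W ℤ.- + 1) · ℤ.- (X ℤ.+ + 3 · I ℤ.+ + 4) · (t 4 · t 5)
      two : ∀ a b → ι (+ 2 · a ℤ.+ b) ≡ q 2 * ι a + ι b
      two a b = trans (ι-+ (+ 2 · a) b) (cong (_+ ι b) (ι-* (+ 2) a))
      lhs : ∀ x i k p0 q1 → let n = x ℤ.+ i ℤ.+ k ; r = i ℤ.+ i ℤ.- k ; w = x ℤ.+ k ℤ.+ k ℤ.- i in
       p0 ℤ.* (+ 2 ℤ.* ((r ℤ.+ + 2) ℤ.* ((r ℤ.+ + 3) ℤ.* ((+ 3 ℤ.+ n ℤ.- (r ℤ.+ + 3)) ℤ.* ((+ 4 ℤ.+ n ℤ.- (r ℤ.+ + 3)) ℤ.* (+ 5 ℤ.+ n ℤ.- (r ℤ.+ + 3))))))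
           ℤ.+ (r ℤ.+ + 1) ℤ.* ((r ℤ.+ + 2) ℤ.* ((r ℤ.+ + 3) ℤ.* ((+ 4 ℤ.+ n ℤ.- (r ℤ.+ + 3)) ℤ.* (+ 5 ℤ.+ n ℤ.- (r ℤ.+ + 3))))))
       ℤ.+ q1 ℤ.* ((+ 1 ℤ.+ n) ℤ.* (+ 2 ℤ.* ((+ 2 ℤ.+ n ℤ.- (r ℤ.+ + 3)) ℤ.* ((+ 3 ℤ.+ n ℤ.- (r ℤ.+ + 3)) ℤ.* ((+ 4 ℤ.+ n ℤ.- (r ℤ.+ + 3)) ℤ.* (+ 5 ℤ.+ n ℤ.- (r ℤ.+ + 3)))))
           ℤ.+ (r ℤ.+ + 3) ℤ.* ((+ 3 ℤ.+ n ℤ.- (r ℤ.+ + 3)) ℤ.* ((+ 4 ℤ.+ n ℤ.- (r ℤ.+ + 3)) ℤ.* (+ 5 ℤ.+ n ℤ.- (r ℤ.+ + 3))))))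
       ℤ.+ + 0 ℤ.* (+ 0 ℤ.* ((+ 1 ℤ.+ n) ℤ.* + 0))
       ≡ ((w ℤ.+ + 1) ℤ.* (w ℤ.+ + 2)) ℤ.* (p0 ℤ.* ((r ℤ.+ + 2) ℤ.* (r ℤ.+ + 3) ℤ.* (+ 2 ℤ.* w ℤ.+ r ℤ.+ + 1))
        ℤ.+ q1 ℤ.* ((n ℤ.+ + 1) ℤ.* w ℤ.* (+ 2 ℤ.* (w ℤ.- + 1) ℤ.+ r ℤ.+ + 3)))
      lhs = solve-ℤ
      rhs : ∀ x i k cn cd → let n = x ℤ.+ i ℤ.+ k ; r = i ℤ.+ i ℤ.- k ; w = x ℤ.+ k ℤ.+ k ℤ.- i ; w⁺ = x ℤ.+ (+ 1 ℤ.+ k) ℤ.+ (+ 1 ℤ.+ k) ℤ.- i in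
       cn ℤ.* ((+ 1 ℤ.+ n) ℤ.* (w⁺ ℤ.* (w⁺ ℤ.- + 1) ℤ.* ℤ.- (x ℤ.+ + 3 ℤ.* i ℤ.+ + 4) ℤ.* (r ℤ.+ + 3)))
        ℤ.- cd ℤ.* (w ℤ.* (w ℤ.- + 1) ℤ.* ℤ.- (x ℤ.+ + 3 ℤ.* i ℤ.+ + 4) ℤ.* ((+ 4 ℤ.+ n ℤ.- (r ℤ.+ + 3)) ℤ.* (+ 5 ℤ.+ n ℤ.- (r ℤ.+ + 3))))
       ≡ ((w ℤ.+ + 1) ℤ.* (w ℤ.+ + 2)) ℤ.* (cn ℤ.* ((n ℤ.+ + 1) ℤ.* (r ℤ.+ + 3) ℤ.* ℤ.- (x ℤ.+ + 3 ℤ.* i ℤ.+ + 4))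
        ℤ.- cd ℤ.* (w ℤ.* (w ℤ.- + 1) ℤ.* ℤ.- (x ℤ.+ + 3 ℤ.* i ℤ.+ + 4)))
      rhs = solve-ℤ

-- Values of the kernel functional on the rows `Z` and `v`.

module KernelAtRows where
 open import Data.Rational using (_+_; _*_; -_; _-_)
 open Embedding
 open Determinants
 open PathRows
 open Condensation
 open Certificates
 open KernelVector

 open Poly using (_·_)

 Σ₀-head : ∀ n f → Σ₀ (suc n) f ≡ f 0 + Σ₀ n (λ k → f (suc k))
 Σ₀-head zero f = QP.+-comm 0ℚ (f 0)
 Σ₀-head (suc n) f = trans (cong (_+ f (suc n)) (Σ₀-head n f)) (QP.+-assoc (f 0) (Σ₀ n (λ k → f (suc k))) (f (suc n)))

 Σ₀-zero : ∀ n {f} → (∀ k → f k ≡ 0ℚ) → Σ₀ n f ≡ 0ℚ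
 Σ₀-zero zero e = refl
 Σ₀-zero (suc n) e = cong₂ _+_ (Σ₀-zero n e) (e n)

 bin-one : ∀ n → bin n (+ 1) ≡ q n
 bin-one n = begin
  bin n (+ 1) ≡⟨ QP.*-identityˡ _ ⟨
  1ℚ * bin n (+ 1) ≡⟨ bin-next n (+ 0) ⟨
  (q n - 0ℚ) * bin n (+ 0) ≡⟨ cong ((q n - 0ℚ) *_) (bin-zero n) ⟩
  (q n - 0ℚ) * 1ℚ ≡⟨ solve 1 (λ a → (a ⊖ Κ 0ℚ) ⊗ Κ 1ℚ ⊜ a) refl (q n) ⟩
  q n ∎
  where open ≡-Reasoning

 module KernelValues (x T : ℕ) where
  open Kernel x T
  κ-Z κ-v : ℕ → ℚ
  κ-Z i = κ (Z x i)
  κ-v i = κ (v (suc (i ℕ.+ i)) (x ℕ.+ i))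
  module _ (i : ℕ) where
   open ≡-Reasoning
   Z₀ : ∀ k → Z x i k ≡ bin (n i k) (r⁺ i k 0)
   Z₀ k = cong (bin (n i k)) (sym (ZP.+-identityʳ _))
   Z₁ : ∀ k → Z x (suc i) k ≡ bin (1 ℕ.+ n i k) (r⁺ i k 2)
   Z₁ k = cong₂ bin (cong (ℕ._+ k) (+-suc x i)) (trans (cong (λ z → + z ℤ.- + k) (+-suc (suc i) i)) (e (+ (i ℕ.+ i)) (+ k)))
    where
    e : ∀ a b → + 2 ℤ.+ a ℤ.- b ≡ a ℤ.- b ℤ.+ + 2
    e = solve-ℤ
   Z₂ : ∀ k → Z x (suc (suc i)) k ≡ bin (2 ℕ.+ n i k) (r⁺ i k 4)
   Z₂ k = cong₂ bin (cong (ℕ._+ k) (trans (+-suc x (suc i)) (cong suc (+-suc x i))))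
    (trans (cong (λ z → + z ℤ.- + k) (trans (+-suc (suc (suc i)) (suc i)) (cong (λ z → suc (suc (suc z))) (+-suc i i)))) (e (+ (i ℕ.+ i)) (+ k)))
    where
    e : ∀ a b → + 4 ℤ.+ a ℤ.- b ≡ a ℤ.- b ℤ.+ + 4
    e = solve-ℤ
   v₀ : ∀ k → v (suc (i ℕ.+ i)) (x ℕ.+ i) k ≡ bin (n i k) (r⁺ i k 1)
   v₀ k = cong (bin (n i k)) (e (+ (i ℕ.+ i)) (+ k))
    where
    e : ∀ a b → + 1 ℤ.+ a ℤ.- b ≡ a ℤ.- b ℤ.+ + 1
    e = solve-ℤ
   v₁ : ∀ k → v (suc (suc i ℕ.+ suc i)) (x ℕ.+ suc i) k ≡ bin (1 ℕ.+ n i k) (r⁺ i k 3)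
   v₁ k = cong₂ bin (cong (ℕ._+ k) (+-suc x i)) (trans (cong (λ z → + z ℤ.- + k) (+-suc (suc (suc i)) i)) (e (+ (i ℕ.+ i)) (+ k)))
    where
    e : ∀ a b → + 3 ℤ.+ a ℤ.- b ≡ a ℤ.- b ℤ.+ + 3
    e = solve-ℤ
   S-recurrence : ι (Poly.p0 X τ (+ i)) * κ-Z i + ι (Poly.p1 X τ (+ i)) * κ-Z (suc i) + ι (Poly.p2 X τ (+ i)) * κ-Z (suc (suc i)) ≡ 0ℚ
   S-recurrence = begin
    P * κ-Z i + P′ * κ-Z (suc i) + P″ * κ-Z (suc (suc i))
     ≡⟨ cong (_+ P″ * κ-Z (suc (suc i))) (Σ₀-lin (suc T) P P′) ⟩
    Σ₀ (suc T) (λ k → P * (c k * Z x i k) + P′ * (c k * Z x (suc i) k)) + P″ * κ-Z (suc (suc i))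
     ≡⟨ cong (_+ P″ * κ-Z (suc (suc i))) (QP.*-identityˡ (Σ₀ (suc T) (λ k → P * (c k * Z x i k) + P′ * (c k * Z x (suc i) k)))) ⟨
    1ℚ * Σ₀ (suc T) (λ k → P * (c k * Z x i k) + P′ * (c k * Z x (suc i) k)) + P″ * κ-Z (suc (suc i))
     ≡⟨ Σ₀-lin (suc T) 1ℚ P″ ⟩
    Σ₀ (suc T) (λ k → 1ℚ * (P * (c k * Z x i k) + P′ * (c k * Z x (suc i) k)) + P″ * (c k * Z x (suc (suc i)) k))
     ≡⟨ Σ₀-cong (suc T) (λ k _ → trans
        (solve 7 (λ c p p′ p″ a b d → Κ 1ℚ ⊗ (p ⊗ (c ⊗ a) ⊕ p′ ⊗ (c ⊗ b)) ⊕ p″ ⊗ (c ⊗ d) ⊜ c ⊗ (p ⊗ a ⊕ p′ ⊗ b ⊕ p″ ⊗ d))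
         refl (c k) P P′ P″ (Z x i k) (Z x (suc i) k) (Z x (suc (suc i)) k))
        (cong (c k *_) (cong₂ _+_ (cong₂ _+_ (cong (P *_) (Z₀ k)) (cong (P′ *_) (Z₁ k))) (cong (P″ *_) (Z₂ k))))) ⟩
    Σ₀ (suc T) (λ k → c k * tS i k)
     ≡⟨ telescope (tS i) (hS i) (S-step i) ⟩
    0ℚ ∎
    where
    P = ι (Poly.p0 X τ (+ i))
    P′ = ι (Poly.p1 X τ (+ i))
    P″ = ι (Poly.p2 X τ (+ i))
   F-recurrence : ι (Poly.p0 X τ (+ i)) * (q 2 * κ-v i + 1ℚ * κ-Z i) + ι (Poly.q1 X τ (+ i)) * (q 2 * κ-v (suc i) + 1ℚ * κ-Z (suc i)) ≡ 0ℚ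
   F-recurrence = begin
    P * (q 2 * κ-v i + 1ℚ * κ-Z i) + P′ * (q 2 * κ-v (suc i) + 1ℚ * κ-Z (suc i))
     ≡⟨ cong₂ (λ a b → P * a + P′ * b) (Σ₀-lin (suc T) (q 2) 1ℚ) (Σ₀-lin (suc T) (q 2) 1ℚ) ⟩
    P * Σ₀ (suc T) (λ k → q 2 * (c k * V k) + 1ℚ * (c k * Z x i k)) + P′ * Σ₀ (suc T) (λ k → q 2 * (c k * V′ k) + 1ℚ * (c k * Z x (suc i) k))
     ≡⟨ Σ₀-lin (suc T) P P′ ⟩
    Σ₀ (suc T) (λ k → P * (q 2 * (c k * V k) + 1ℚ * (c k * Z x i k)) + P′ * (q 2 * (c k * V′ k) + 1ℚ * (c k * Z x (suc i) k)))
     ≡⟨ Σ₀-cong (suc T) (λ k _ → trans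
        (solve 8 (λ c p p′ two a b d e → p ⊗ (two ⊗ (c ⊗ a) ⊕ Κ 1ℚ ⊗ (c ⊗ b)) ⊕ p′ ⊗ (two ⊗ (c ⊗ d) ⊕ Κ 1ℚ ⊗ (c ⊗ e))
          ⊜ c ⊗ (p ⊗ (two ⊗ a ⊕ b) ⊕ p′ ⊗ (two ⊗ d ⊕ e)))
         refl (c k) P P′ (q 2) (V k) (Z x i k) (V′ k) (Z x (suc i) k))
        (cong (c k *_) (cong₂ _+_ (cong (P *_) (cong₂ (λ a b → q 2 * a + b) (v₀ k) (Z₀ k))) (cong (P′ *_) (cong₂ (λ a b → q 2 * a + b) (v₁ k) (Z₁ k)))))) ⟩
    Σ₀ (suc T) (λ k → c k * tF i k)
     ≡⟨ telescope (tF i) (hF i) (F-step i) ⟩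
    0ℚ ∎
    where
    P = ι (Poly.p0 X τ (+ i))
    P′ = ι (Poly.q1 X τ (+ i))
    V = v (suc (i ℕ.+ i)) (x ℕ.+ i)
    V′ = v (suc (suc i ℕ.+ suc i)) (x ℕ.+ suc i)
  -- The factor is zero at `i + 2 = T`: the recurrence carries the vanishing up to the row with
  -- index `T − 1` and stops there.
  p2-≢0 : ∀ i → suc (suc i) ℕ.< T → ι (Poly.p2 X τ (+ i)) ≢ 0ℚ
  p2-≢0 i i< = subst (_≢ 0ℚ) (sym value) (neg≢0 (*-≢0 (*-≢0 (*-≢0 (q-suc≢0 3) (q-suc≢0 (i ℕ.+ i ℕ.+ 2))) (q-suc≢0 d)) (q-suc≢0 B)))
   where
   d = T ℕ.∸ suc (suc (suc i))
   B = i ℕ.+ i ℕ.+ i ℕ.+ i ℕ.+ x ℕ.+ x ℕ.+ d ℕ.+ d ℕ.+ 10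
   e : ∀ x i d → Poly.p2 x (Poly.tau x (+ 3 ℤ.+ i ℤ.+ d)) i ≡ ℤ.- (+ 4 · (+ 1 ℤ.+ (i ℤ.+ i ℤ.+ + 2)) · (+ 1 ℤ.+ d) · (+ 1 ℤ.+ (i ℤ.+ i ℤ.+ i ℤ.+ i ℤ.+ x ℤ.+ x ℤ.+ d ℤ.+ d ℤ.+ + 10)))
   e = ℤ-Solver.solve 3 (λ x i d → E.p2 x (E.tau x (E.N 3 E.+: i E.+: d)) i ℤ-Solver.⊜ ℤ-Solver.⊝_ (E.N 4 E.· (E.N 1 E.+: (i E.+: i E.+: E.N 2)) E.· (E.N 1 E.+: d) E.· (E.N 1 E.+: (i E.+: i E.+: i E.+: i E.+: x E.+: x E.+: d E.+: d E.+: E.N 10)))) refl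
   value : ι (Poly.p2 X τ (+ i)) ≡ - (q 4 * q (suc (i ℕ.+ i ℕ.+ 2)) * q (suc d) * q (suc B))
   value = trans (cong (λ z → ι (Poly.p2 X (Poly.tau X (+ z)) (+ i))) (sym (m+[n∸m]≡n i<)))
    (trans (cong ι (e X (+ i) (+ d)))
    (trans (ι-neg (+ 4 · + suc (i ℕ.+ i ℕ.+ 2) · + suc d · + suc B)) (cong -_
     (trans (ι-* (+ 4 · + suc (i ℕ.+ i ℕ.+ 2) · + suc d) (+ suc B)) (cong (_* q (suc B))
     (trans (ι-* (+ 4 · + suc (i ℕ.+ i ℕ.+ 2)) (+ suc d)) (cong (_* q (suc d)) (ι-* (+ 4) (+ suc (i ℕ.+ i ℕ.+ 2))))))))))
  κ-Z-0 : κ-Z 0 ≡ 0ℚ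
  κ-Z-0 = Σ₀-zero (suc T) λ
   { zero → QP.*-zeroˡ (v 0 (x ℕ.+ 0) 0)
   ; (suc k) → trans (cong (c (suc k) *_) (v-0-suc (x ℕ.+ 0) k)) (QP.*-zeroʳ (c (suc k))) }
  v-1-0 : ∀ s → v 1 s 1 ≡ 1ℚ
  v-1-0 s = trans (v-shift 0 s 0) (v-0-0 (suc s))
  v-1-suc : ∀ s k → v 1 s (suc (suc k)) ≡ 0ℚ
  v-1-suc s k = trans (v-shift 0 s (suc k)) (v-0-suc (suc s) k)
  κ-v-0 : 0 ℕ.< T → κ-v 0 ≡ 1ℚ
  κ-v-0 (s≤s {n = T′} _) = begin
   Σ₀ (suc (suc T′)) f ≡⟨ trans (Σ₀-head (suc T′) f) (cong (λ z → f 0 + z) (Σ₀-head T′ (λ k → f (suc k)))) ⟩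
   f 0 + (f 1 + Σ₀ T′ (λ k → f (suc (suc k)))) ≡⟨ cong₂ _+_ (QP.*-zeroˡ (v 1 (x ℕ.+ 0) 0)) (cong₂ _+_ (cong (1ℚ *_) (v-1-0 (x ℕ.+ 0)))
                              (Σ₀-zero T′ λ k → trans (cong (c (suc (suc k)) *_) (v-1-suc (x ℕ.+ 0) k)) (QP.*-zeroʳ (c (suc (suc k)))))) ⟩
   0ℚ + (1ℚ * 1ℚ + 0ℚ) ≡⟨⟩
   1ℚ ∎
   where
   open ≡-Reasoning
   f : ℕ → ℚ
   f k = c k * v 1 (x ℕ.+ 0) k
  -- Only the columns 1 and 2 contribute, with entries `x + 2` and 1, and `c 2` is `−(x + 2)`
  -- whatever `T` is.
  κ-Z-1 : 1 ℕ.< T → κ-Z 1 ≡ 0ℚ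
  κ-Z-1 1<T@(s≤s (s≤s {n = T′} _)) = begin
   Σ₀ (suc (suc (suc T′))) f
    ≡⟨ trans (Σ₀-head (suc (suc T′)) f) (cong (λ z → f 0 + z) (trans (Σ₀-head (suc T′) (λ k → f (suc k))) (cong (λ z → f 1 + z) (Σ₀-head T′ (λ k → f (suc (suc k))))))) ⟩
   f 0 + (f 1 + (f 2 + Σ₀ T′ (λ k → f (suc (suc (suc k))))))
    ≡⟨ cong₂ _+_ (QP.*-zeroˡ (v 2 (x ℕ.+ 1) 0)) (cong₂ _+_ (cong (1ℚ *_) (bin-one (x ℕ.+ 1 ℕ.+ 1))) (cong₂ _+_
       (trans (cong (c 2 *_) (trans (v-shift 1 (x ℕ.+ 1) 1) (v-1-0 (suc (x ℕ.+ 1))))) (QP.*-identityʳ (c 2)))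
       (Σ₀-zero T′ λ k → trans (cong (c (3 ℕ.+ k) *_) (trans (v-shift 1 (x ℕ.+ 1) (suc (suc k))) (v-1-suc (suc (x ℕ.+ 1)) k))) (QP.*-zeroʳ (c (3 ℕ.+ k)))))) ⟩
   0ℚ + (1ℚ * q (x ℕ.+ 1 ℕ.+ 1) + (c 2 + 0ℚ))
    ≡⟨ *-cancelˡ (cden-≢0 0 1<T) (begin
       δ * (0ℚ + (1ℚ * u + (c 2 + 0ℚ))) ≡⟨ solve 3 (λ d u c → d ⊗ (Κ 0ℚ ⊕ (Κ 1ℚ ⊗ u ⊕ (c ⊕ Κ 0ℚ))) ⊜ d ⊗ u ⊕ d ⊗ c) refl δ u (c 2) ⟩
       δ * u + δ * c 2 ≡⟨ cong₂ _+_ (sym (ι-* (Poly.cden X τ (+ 1)) (+ (x ℕ.+ 1 ℕ.+ 1)))) (trans (c-rec 1 1<T) (QP.*-identityʳ _)) ⟩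
       ι (Poly.cden X τ (+ 1) · + (x ℕ.+ 1 ℕ.+ 1)) + ι (Poly.cnum X τ (+ 1)) ≡⟨ ι-+ (Poly.cden X τ (+ 1) · + (x ℕ.+ 1 ℕ.+ 1)) (Poly.cnum X τ (+ 1)) ⟨
       ι (Poly.cden X τ (+ 1) · + (x ℕ.+ 1 ℕ.+ 1) ℤ.+ Poly.cnum X τ (+ 1)) ≡⟨ cong ι (e X τ) ⟩
       0ℚ ≡⟨ QP.*-zeroʳ δ ⟨
       δ * 0ℚ ∎) ⟩
   0ℚ ∎
   where
   open ≡-Reasoning
   f : ℕ → ℚ
   f k = c k * v 2 (x ℕ.+ 1) k
   δ = ι (Poly.cden X τ (+ 1))
   u = q (x ℕ.+ 1 ℕ.+ 1)
   e : ∀ x τ → Poly.cden x τ (+ 1) · (x ℤ.+ + 1 ℤ.+ + 1) ℤ.+ Poly.cnum x τ (+ 1) ≡ + 0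
   e = ℤ-Solver.solve 2 (λ x τ → E.cden x τ (E.N 1) E.· (x E.+: E.N 1 E.+: E.N 1) E.+: E.cnum x τ (E.N 1) ℤ-Solver.⊜ E.N 0) refl
  -- A recurrence of order two with two zero initial values.
  κ-Z-vanishes : ∀ i → i ℕ.< T → κ-Z i ≡ 0ℚ
  κ-Z-vanishes zero _ = κ-Z-0
  κ-Z-vanishes (suc zero) 1<T = κ-Z-1 1<T
  κ-Z-vanishes (suc (suc i)) i<T = *-cancelˡ (p2-≢0 i i<T) (begin
   P″ * S″ ≡⟨ solve 5 (λ p p′ p″ u w → p″ ⊗ w ⊜ p ⊗ Κ 0ℚ ⊕ p′ ⊗ Κ 0ℚ ⊕ p″ ⊗ w) refl P P′ P″ 0ℚ S″ ⟩
   P * 0ℚ + P′ * 0ℚ + P″ * S″ ≡⟨ cong₂ (λ a b → P * a + P′ * b + P″ * S″) (κ-Z-vanishes i (<⇒≤ (<⇒≤ i<T))) (κ-Z-vanishes (suc i) (<⇒≤ i<T)) ⟨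
   P * κ-Z i + P′ * κ-Z (suc i) + P″ * S″ ≡⟨ S-recurrence i ⟩
   0ℚ ≡⟨ QP.*-zeroʳ P″ ⟨
   P″ * 0ℚ ∎)
   where
   open ≡-Reasoning
   P = ι (Poly.p0 X τ (+ i))
   P′ = ι (Poly.p1 X τ (+ i))
   P″ = ι (Poly.p2 X τ (+ i))
   S″ = κ-Z (suc (suc i))
  ι-neg-product₃ : ∀ a b d → ι (ℤ.- (+ a · + b · + d)) ≡ - (q a * q b * q d)
  ι-neg-product₃ a b d = trans (ι-neg (+ a · + b · + d)) (cong -_ (trans (ι-* (+ a · + b) (+ d)) (cong (_* q d) (ι-* (+ a) (+ b)))))
  -- Since the axis rows are annihilated, `F-recurrence` links two consecutive values on the rows
  -- `v`; its coefficients factor once `T = i + 2 + d` is substituted.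
  κ-v-step : ∀ i d → i ℕ.+ 2 ℕ.+ d ≡ T →
   q (i ℕ.+ x ℕ.+ 2) * q (3 ℕ.* i ℕ.+ 2 ℕ.* d ℕ.+ x ℕ.+ 5) * q (i ℕ.+ 2 ℕ.* d ℕ.+ x ℕ.+ 4) * κ-v i
   ≡ - (q (suc i) * q (2 ℕ.* d ℕ.+ 1) * q (2 ℕ.* (2 ℕ.* i ℕ.+ d ℕ.+ x ℕ.+ 4)) * κ-v (suc i))
  κ-v-step i d refl = *-cancelˡ (q-suc≢0 1) (begin
   q 2 * (a * κ-v i) ≡⟨ solve 3 (λ t a e → t ⊗ (a ⊗ e) ⊜ ⊝ (⊝ a ⊗ (t ⊗ e ⊕ Κ 1ℚ ⊗ Κ 0ℚ))) refl (q 2) a (κ-v i) ⟩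
   - (- a * (q 2 * κ-v i + 1ℚ * 0ℚ)) ≡⟨ cong₂ (λ u z → - (u * (q 2 * κ-v i + 1ℚ * z))) p0≡ (κ-Z-vanishes i (≤-trans (s≤s (m≤m+n i (suc d))) (≤-reflexive (e₁ i d)))) ⟨
   - (ι (Poly.p0 X τ (+ i)) * (q 2 * κ-v i + 1ℚ * κ-Z i))
    ≡⟨ solve 2 (λ u w → ⊝ u ⊜ w ⊖ (u ⊕ w)) refl _ (ι (Poly.q1 X τ (+ i)) * (q 2 * κ-v (suc i) + 1ℚ * κ-Z (suc i))) ⟩
   ι (Poly.q1 X τ (+ i)) * (q 2 * κ-v (suc i) + 1ℚ * κ-Z (suc i)) - (ι (Poly.p0 X τ (+ i)) * (q 2 * κ-v i + 1ℚ * κ-Z i) + ι (Poly.q1 X τ (+ i)) * (q 2 * κ-v (suc i) + 1ℚ * κ-Z (suc i)))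
    ≡⟨ cong (λ z → ι (Poly.q1 X τ (+ i)) * (q 2 * κ-v (suc i) + 1ℚ * κ-Z (suc i)) - z) (F-recurrence i) ⟩
   ι (Poly.q1 X τ (+ i)) * (q 2 * κ-v (suc i) + 1ℚ * κ-Z (suc i)) - 0ℚ
    ≡⟨ cong₂ (λ u z → u * (q 2 * κ-v (suc i) + 1ℚ * z) - 0ℚ) q1≡ (κ-Z-vanishes (suc i) (≤-trans (s≤s (s≤s (m≤m+n i d))) (≤-reflexive (e₂ i d)))) ⟩
   - b * (q 2 * κ-v (suc i) + 1ℚ * 0ℚ) - 0ℚ
    ≡⟨ solve 3 (λ t b e → ⊝ b ⊗ (t ⊗ e ⊕ Κ 1ℚ ⊗ Κ 0ℚ) ⊖ Κ 0ℚ ⊜ t ⊗ (⊝ (b ⊗ e))) refl (q 2) b (κ-v (suc i)) ⟩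
   q 2 * - (b * κ-v (suc i)) ∎)
   where
   open ≡-Reasoning
   a = q (i ℕ.+ x ℕ.+ 2) * q (3 ℕ.* i ℕ.+ 2 ℕ.* d ℕ.+ x ℕ.+ 5) * q (i ℕ.+ 2 ℕ.* d ℕ.+ x ℕ.+ 4)
   b = q (suc i) * q (2 ℕ.* d ℕ.+ 1) * q (2 ℕ.* (2 ℕ.* i ℕ.+ d ℕ.+ x ℕ.+ 4))
   e₁ : ∀ i d → suc (i ℕ.+ suc d) ≡ i ℕ.+ 2 ℕ.+ d
   e₁ = solve-ℕ
   e₂ : ∀ i d → suc (suc (i ℕ.+ d)) ≡ i ℕ.+ 2 ℕ.+ d
   e₂ = solve-ℕ
   p0≡ : ι (Poly.p0 X τ (+ i)) ≡ - a
   p0≡ = trans (cong ι (trans (e X (+ i) (+ d)) (cong₂ (λ u w → ℤ.- (+ (i ℕ.+ x ℕ.+ 2) · u · w)) (cong +_ (n₁ i d x)) (cong +_ (n₂ i d x)))))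
    (ι-neg-product₃ (i ℕ.+ x ℕ.+ 2) (3 ℕ.* i ℕ.+ 2 ℕ.* d ℕ.+ x ℕ.+ 5) (i ℕ.+ 2 ℕ.* d ℕ.+ x ℕ.+ 4))
    where
    n₁ : ∀ i d x → i ℕ.+ i ℕ.+ i ℕ.+ d ℕ.+ d ℕ.+ x ℕ.+ 5 ≡ 3 ℕ.* i ℕ.+ 2 ℕ.* d ℕ.+ x ℕ.+ 5
    n₁ = solve-ℕ
    n₂ : ∀ i d x → i ℕ.+ d ℕ.+ d ℕ.+ x ℕ.+ 4 ≡ i ℕ.+ 2 ℕ.* d ℕ.+ x ℕ.+ 4
    n₂ = solve-ℕ
    e : ∀ x i d → Poly.p0 x (Poly.tau x (i ℤ.+ + 2 ℤ.+ d)) i ≡ ℤ.- ((i ℤ.+ x ℤ.+ + 2) · (i ℤ.+ i ℤ.+ i ℤ.+ d ℤ.+ d ℤ.+ x ℤ.+ + 5) · (i ℤ.+ d ℤ.+ d ℤ.+ x ℤ.+ + 4))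
    e = ℤ-Solver.solve 3 (λ x i d → E.p0 x (E.tau x (i E.+: E.N 2 E.+: d)) i ℤ-Solver.⊜ ℤ-Solver.⊝_ ((i E.+: x E.+: E.N 2) E.· (i E.+: i E.+: i E.+: d E.+: d E.+: x E.+: E.N 5) E.· (i E.+: d E.+: d E.+: x E.+: E.N 4))) refl
   q1≡ : ι (Poly.q1 X τ (+ i)) ≡ - b
   q1≡ = trans (cong ι (trans (e X (+ i) (+ d)) (cong₂ (λ u w → ℤ.- (+ suc i · u · w)) (cong +_ (n₁ d)) (cong +_ (n₂ i d x)))))
    (ι-neg-product₃ (suc i) (2 ℕ.* d ℕ.+ 1) (2 ℕ.* (2 ℕ.* i ℕ.+ d ℕ.+ x ℕ.+ 4)))
    where
    n₁ : ∀ d → d ℕ.+ d ℕ.+ 1 ≡ 2 ℕ.* d ℕ.+ 1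
    n₁ = solve-ℕ
    n₂ : ∀ i d x → i ℕ.+ i ℕ.+ i ℕ.+ i ℕ.+ d ℕ.+ d ℕ.+ x ℕ.+ x ℕ.+ 8 ≡ 2 ℕ.* (2 ℕ.* i ℕ.+ d ℕ.+ x ℕ.+ 4)
    n₂ = solve-ℕ
    e : ∀ x i d → Poly.q1 x (Poly.tau x (i ℤ.+ + 2 ℤ.+ d)) i ≡ ℤ.- ((+ 1 ℤ.+ i) · (d ℤ.+ d ℤ.+ + 1) · (i ℤ.+ i ℤ.+ i ℤ.+ i ℤ.+ d ℤ.+ d ℤ.+ x ℤ.+ x ℤ.+ + 8))
    e = ℤ-Solver.solve 3 (λ x i d → E.q1 x (E.tau x (i E.+: E.N 2 E.+: d)) i ℤ-Solver.⊜ ℤ-Solver.⊝_ ((E.N 1 E.+: i) E.· (d E.+: d E.+: E.N 1) E.· (i E.+: i E.+: i E.+: i E.+: d E.+: d E.+: x E.+: x E.+: E.N 8))) refl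

-- Recurrence of the core determinant, and the satellite of size one.

module CoreDeterminant where
 open import Data.Nat using (_+_; _*_)
 open import Data.Rational using (-_; _-_) renaming (_*_ to _·_)
 open Embedding
 open Determinants
 open PathRows
 open Condensation
 open Certificates
 open KernelVector
 open KernelAtRows

 F : ℕ → ℚ
 F n = q (fact n)

 F-suc : ∀ {m n} → m ≡ suc n → F m ≡ q m · F n
 F-suc {n = n} refl = q-* (suc n) (fact n)

 F≢0 : ∀ n → F n ≢ 0ℚ
 F≢0 = q-fact≢0

 module _ (x : ℕ) where
  Zs-killed : ∀ T i n → i + n ℕ.≤ T → All (λ r → Kernel.κ x T r ≡ 0ℚ) (Zs x i n)
  Zs-killed T i zero _ = []
  Zs-killed T i (suc n) le = KernelValues.κ-Z-vanishes x T i (≤-trans (s≤s (m≤m+n i n)) le′) ∷ Zs-killed T (suc i) n le′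
   where
   le′ : suc i + n ℕ.≤ T
   le′ = subst (ℕ._≤ T) (+-suc i n) le
  module _ (T : ℕ) where
   open Kernel x T using (c)
   open KernelValues x T using (κ-v)
   -- Cramer's rule: of the `T + 1` rows only the one in front has a nonzero pairing with the kernel
   -- vector.
   D-by-kernel : ∀ y → c T · D 0 (suc T) (v (suc (y + y)) (x + y) ∷ Zs x 0 T) ≡ sgn T · κ-v y · M x T
   D-by-kernel y = D-kernel 0 T c (v (suc (y + y)) (x + y)) (Zs x 0 T) (Zs-killed T 0 T ≤-refl)
   -- ĉ and ε are the absolute values of c and of κ on the rows v.
   ĉ ε : ℕ → ℚ
   ĉ k = - sgn k · c k
   ε y = sgn y · κ-v y
  sgn-sandwich : ∀ n a → sgn n · (sgn n · a) ≡ a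
  sgn-sandwich n a = trans (sym (QP.*-assoc (sgn n) (sgn n) a)) (trans (cong (_· a) (sgn-sq n)) (QP.*-identityˡ a))
  -- The core matrix with the extra row `v 1 x` is read in two ways: as a touching satellite it is a
  -- core determinant at `x + 3`, by Cramer's rule it is one at `x` divided by the last kernel
  -- entry, because the kernel functional is 1 on that row.
  M-recurrence : ∀ z → M x (suc (suc z)) ≡ ĉ (suc (suc z)) (suc (suc z)) · M (3 + x) (suc z)
  M-recurrence z = begin
   M x T ≡⟨ sgn-sandwich T (M x T) ⟨
   sgn T · (sgn T · M x T) ≡⟨ solve 2 (λ s m → s ⊗ (s ⊗ m) ⊜ (⊝ s) ⊗ ((⊝ Κ 1ℚ) ⊗ (s ⊗ Κ 1ℚ ⊗ m))) refl (sgn T) (M x T) ⟩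
   - sgn T · (sgn 1 · (sgn T · 1ℚ · M x T))
    ≡⟨ cong (λ e → - sgn T · (sgn 1 · (sgn T · e · M x T))) (KernelValues.κ-v-0 x T (s≤s z≤n)) ⟨
   - sgn T · (sgn 1 · (sgn T · κ-v 0 · M x T)) ≡⟨ cong (λ e → - sgn T · (sgn 1 · e)) (D-by-kernel T 0) ⟨
   - sgn T · (sgn 1 · (c T · d)) ≡⟨ solve 4 (λ s t c d → (⊝ s) ⊗ (t ⊗ (c ⊗ d)) ⊜ (⊝ s) ⊗ c ⊗ (t ⊗ d)) refl (sgn T) (sgn 1) (c T) d ⟩
   - sgn T · c T · (sgn 1 · d) ≡⟨ cong (- sgn T · c T ·_) (trans (sym (Q-touching x z)) (Q-1-front x 0 z)) ⟨
   - sgn T · c T · M (3 + x) (suc z) ∎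
   where
   open ≡-Reasoning
   T = suc (suc z)
   open Kernel x T using (c)
   open KernelValues x T using (κ-v)
   d = D 0 (suc T) (v 1 (x + 0) ∷ Zs x 0 T)
  -- The last kernel entry from Cramer's rule cancels against the one in `M-recurrence`; only the
  -- value on the satellite row survives.
  Q-1 : ∀ y z → Q x y z 1 ≡ ε (suc (suc (y + z))) y · M (3 + x) (suc (y + z))
  Q-1 y z = *-cancelˡ (Kernel.c-≢0 x T (suc (y + z)) ≤-refl) (begin
   c T · Q x y z 1 ≡⟨ cong (c T ·_) (Q-1-front x y z) ⟩
   c T · (sgn (suc y) · d) ≡⟨ solve 3 (λ c s d → c ⊗ (s ⊗ d) ⊜ s ⊗ (c ⊗ d)) refl (c T) (sgn (suc y)) d ⟩
   sgn (suc y) · (c T · d) ≡⟨ cong (sgn (suc y) ·_) (D-by-kernel T y) ⟩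
   - sgn y · (sgn T · κ-v y · M x T) ≡⟨ cong (λ m → - sgn y · (sgn T · κ-v y · m)) (M-recurrence (y + z)) ⟩
   - sgn y · (sgn T · κ-v y · (- sgn T · c T · M (3 + x) (suc (y + z))))
    ≡⟨ solve 5 (λ s t k c m → (⊝ s) ⊗ (t ⊗ k ⊗ ((⊝ t) ⊗ c ⊗ m)) ⊜ t ⊗ (t ⊗ (c ⊗ (s ⊗ k ⊗ m)))) refl (sgn y) (sgn T) (κ-v y) (c T) _ ⟩
   sgn T · (sgn T · (c T · (sgn y · κ-v y · M (3 + x) (suc (y + z)))))
    ≡⟨ sgn-sandwich T _ ⟩
   c T · (sgn y · κ-v y · M (3 + x) (suc (y + z))) ∎)
   where
   open ≡-Reasoning
   T = suc (suc (y + z))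
   open Kernel x T using (c)
   open KernelValues x T using (κ-v)
   d = D 0 (suc T) (v (suc (y + y)) (x + y) ∷ Zs x 0 T)
  ĉ-step : ∀ T k d → k + 1 + d ≡ T →
   q k · q (k + k + k + d + d + x + x + 4) · q (k + 1 + d + d) · ĉ T (suc k)
   ≡ q (k + x + 1) · q (suc d + suc d) · q (k + k + k + k + suc d + suc d + x + x + 1) · ĉ T k
  ĉ-step T k d e = begin
   δ · (- - sgn k · c (suc k)) ≡⟨ solve 3 (λ δ s c → δ ⊗ ((⊝ (⊝ s)) ⊗ c) ⊜ (⊝ s) ⊗ ((⊝ δ) ⊗ c)) refl δ (sgn k) (c (suc k)) ⟩
   - sgn k · (- δ · c (suc k)) ≡⟨ cong (λ z → - sgn k · (z · c (suc k))) (Kernel.cden-value x T k d e) ⟨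
   - sgn k · (ι (Poly.cden (+ x) τ (+ k)) · c (suc k)) ≡⟨ cong (- sgn k ·_) (Kernel.c-rec x T k k<T) ⟩
   - sgn k · (ι (Poly.cnum (+ x) τ (+ k)) · c k) ≡⟨ cong (λ z → - sgn k · (z · c k)) (Kernel.cnum-value x T k (suc d) (trans (trans (+-suc k d) (cong (ℕ._+ d) (NP.+-comm 1 k))) e)) ⟩
   - sgn k · (ν · c k) ≡⟨ solve 3 (λ s v c → (⊝ s) ⊗ (v ⊗ c) ⊜ v ⊗ ((⊝ s) ⊗ c)) refl (sgn k) ν (c k) ⟩
   ν · (- sgn k · c k) ∎
   where
   open ≡-Reasoning
   open Kernel x T using (c; τ)
   k<T : k ℕ.< T
   k<T = ≤-trans (≤-reflexive (NP.+-comm 1 k)) (≤-trans (m≤m+n (k + 1) d) (≤-reflexive e))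
   δ = q k · q (k + k + k + d + d + x + x + 4) · q (k + 1 + d + d)
   ν = q (k + x + 1) · q (suc d + suc d) · q (k + k + k + k + suc d + suc d + x + x + 1)
  -- k is one less than in ĉ, and d = T − k.
  ĉ-den ĉ-num : ℕ → ℕ → ℚ
  ĉ-den k d = F d · F (suc (k + k) + suc d + x) · F k · F (3 * suc k + 2 * d + 2 * x + 1)
  ĉ-num k d = F (x + suc k) · F (4 * suc k + 2 * d + 2 * x) · F (k + 2 * d)
  -- Induction on `k` with `T` kept, one application of `ĉ-step` at a time. The last group of
  -- factors on each side depends on `x` and `T` only and normalises the first entry to 1.
  ĉ-closed : ∀ T k d → suc k + d ≡ T →
   ĉ T (suc k) · ĉ-den k d · (F (x + 1) · F (2 * (k + d))) ≡ ĉ-num k d · (F (k + d) · F (suc k + d + x + 1))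
  ĉ-closed T zero d e = begin
   ĉ T 1 · (F d · F (suc (suc d + x)) · F 0 · F (3 + 2 * d + 2 * x + 1)) · (F (x + 1) · F (2 * d))
    ≡⟨ cong₂ (λ u w → 1ℚ · (F d · u · 1ℚ · w) · (F (x + 1) · F (2 * d))) (cong F (e₁ d x)) (cong F (e₂ d x)) ⟩
   1ℚ · (F d · F (suc d + x + 1) · 1ℚ · F (4 + 2 * d + 2 * x)) · (F (x + 1) · F (2 * d))
    ≡⟨ solve 5 (λ a b c d e → Κ 1ℚ ⊗ (a ⊗ b ⊗ Κ 1ℚ ⊗ c) ⊗ (d ⊗ e) ⊜ d ⊗ c ⊗ e ⊗ (a ⊗ b)) refl (F d) (F (suc d + x + 1)) (F (4 + 2 * d + 2 * x)) (F (x + 1)) (F (2 * d)) ⟩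
   ĉ-num 0 d · (F d · F (suc d + x + 1)) ∎
   where
   open ≡-Reasoning
   e₁ : ∀ d x → suc (suc d + x) ≡ suc d + x + 1
   e₁ = solve-ℕ
   e₂ : ∀ d x → 3 + 2 * d + 2 * x + 1 ≡ 4 + 2 * d + 2 * x
   e₂ = solve-ℕ
  ĉ-closed T (suc k) d e = *-cancelˡ δ≢0 (begin
   δ · (ĉ T (2 + k) · ĉ-den (suc k) d · E)
    ≡⟨ cong₂ (λ u w → δ · (ĉ T (2 + k) · (F d · u · w · F (3 * suc (suc k) + 2 * d + 2 * x + 1)) · E)) (F-suc (n₁ k d x)) (F-suc {n = k} refl) ⟩
   δ · (ĉ T (2 + k) · (F d · (G · g) · (K · F k) · F (3 * suc (suc k) + 2 * d + 2 * x + 1)) · E)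
    ≡⟨ cong (λ u → δ · (ĉ T (2 + k) · (F d · (G · g) · (K · F k) · u) · E)) (trans (cong F (n₂ k d x)) (F-suc (n₃ k d x))) ⟩
   δ · (ĉ T (2 + k) · (F d · (G · g) · (K · F k) · (B · h)) · E)
    ≡⟨ solve 9 (λ δ c fd G K fk B r E → δ ⊗ (c ⊗ (fd ⊗ G ⊗ (K ⊗ fk) ⊗ (B ⊗ r)) ⊗ E) ⊜ (δ ⊗ c) ⊗ (fd ⊗ G ⊗ (K ⊗ fk) ⊗ (B ⊗ r) ⊗ E)) refl δ (ĉ T (2 + k)) (F d) (G · g) K (F k) B h E ⟩
   δ · ĉ T (2 + k) · (F d · (G · g) · (K · F k) · (B · h) · E)
    ≡⟨ cong (_· (F d · (G · g) · (K · F k) · (B · h) · E)) (ĉ-step T (suc k) d (trans (cong (ℕ._+ d) (NP.+-comm (suc k) 1)) e)) ⟩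
   A · D2 · E3 · ĉ T (suc k) · (F d · (G · g) · (K · F k) · (B · h) · E)
    ≡⟨ cong (λ u → A · u · E3 · ĉ T (suc k) · (F d · (G · g) · (K · F k) · (B · h) · E)) (trans (cong q (n₄ d)) (q-* 2 (suc d))) ⟩
   A · (q 2 · q (suc d)) · E3 · ĉ T (suc k) · (F d · (G · g) · (K · F k) · (B · h) · E)
    ≡⟨ solve 13 (λ A t d E3 c fd G g K fk B r E → A ⊗ (t ⊗ d) ⊗ E3 ⊗ c ⊗ (fd ⊗ (G ⊗ g) ⊗ (K ⊗ fk) ⊗ (B ⊗ r) ⊗ E)
       ⊜ A ⊗ E3 ⊗ (t ⊗ G) ⊗ K ⊗ B ⊗ (c ⊗ ((d ⊗ fd) ⊗ g ⊗ fk ⊗ r) ⊗ E))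
      refl A (q 2) (q (suc d)) E3 (ĉ T (suc k)) (F d) G g K (F k) B h E ⟩
   A · E3 · (q 2 · G) · K · B · (ĉ T (suc k) · ((q (suc d) · F d) · g · F k · h) · E)
    ≡⟨ cong₂ (λ u w → A · E3 · u · K · B · w) (trans (sym (q-* 2 (suc (suc k + suc k) + suc d + x))) (cong q (n₅ k d x)))
       (begin
        ĉ T (suc k) · ((q (suc d) · F d) · g · F k · h) · E
         ≡⟨ cong₂ (λ u w → ĉ T (suc k) · (u · g · F k · w) · E) (F-suc {n = d} refl) (cong F (n₆ k d x)) ⟨
        ĉ T (suc k) · (F (suc d) · g · F k · F (3 * suc k + 2 * suc d + 2 * x + 1)) · E
         ≡⟨ cong₂ (λ u w → ĉ T (suc k) · (F (suc d) · u · F k · F (3 * suc k + 2 * suc d + 2 * x + 1)) · (F (x + 1) · w)) (cong F (n₇ k d x)) (cong (λ z → F (2 * z)) (sym (+-suc k d))) ⟩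
        ĉ T (suc k) · ĉ-den k (suc d) · (F (x + 1) · F (2 * (k + suc d)))
         ≡⟨ ĉ-closed T k (suc d) (trans (+-suc (suc k) d) e) ⟩
        ĉ-num k (suc d) · (F (k + suc d) · F (suc k + suc d + x + 1))
         ≡⟨ cong (ĉ-num k (suc d) ·_) (cong₂ (λ u w → F u · F (w + x + 1)) (+-suc k d) (+-suc (suc k) d)) ⟩
        ĉ-num k (suc d) · E′
         ≡⟨ cong₂ (λ u w → F (x + suc k) · u · w · E′) (cong F (n₈ k d x)) (trans (cong F (n₉ k d)) (F-suc (n₁₀ k d))) ⟩
        F (x + suc k) · m · (C · l) · E′ ∎) ⟩
   A · E3 · E4 · K · B · (F (x + suc k) · m · (C · l) · E′)
    ≡⟨ solve 10 (λ A E3 E4 K B fa m C l E → A ⊗ E3 ⊗ E4 ⊗ K ⊗ B ⊗ (fa ⊗ m ⊗ (C ⊗ l) ⊗ E) ⊜ (K ⊗ B ⊗ C) ⊗ ((A ⊗ fa) ⊗ (E4 ⊗ (E3 ⊗ m)) ⊗ l ⊗ E))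
       refl A E3 E4 K B (F (x + suc k)) m C l E′ ⟩
   δ · ((A · F (x + suc k)) · (E4 · (E3 · m)) · l · E′)
    ≡⟨ cong (δ ·_) (cong₂ (λ u w → u · w · l · E′)
       (trans (F-suc (+-suc x (suc k))) (cong (λ z → q z · F (x + suc k)) (n₁₁ k x)))
       (trans (F-suc (n₁₂ k d x)) (cong₂ _·_ (cong q (n₁₃ k d x)) (F-suc (n₁₄ k d x))))) ⟨
   δ · (ĉ-num (suc k) d · E′) ∎)
   where
   open ≡-Reasoning
   δ = q (suc k) · q (suc k + suc k + suc k + d + d + x + x + 4) · q (suc k + 1 + d + d)
   δ≢0 : δ ≢ 0ℚ
   δ≢0 = *-≢0 (*-≢0 (q-suc≢0 k) (q-suc≢0 (k + suc k + suc k + d + d + x + x + 4))) (q-suc≢0 (k + 1 + d + d))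
   E = F (x + 1) · F (2 * (suc k + d))
   E′ = F (suc k + d) · F (suc (suc k) + d + x + 1)
   G = q (suc (suc k + suc k) + suc d + x)
   g = F (suc k + suc k + suc d + x)
   K = q (suc k)
   B = q (suc k + suc k + suc k + d + d + x + x + 4)
   h = F (suc k + suc k + suc k + d + d + x + x + 3)
   A = q (suc k + x + 1)
   D2 = q (suc d + suc d)
   E3 = q (suc k + suc k + suc k + suc k + suc d + suc d + x + x + 1)
   E4 = q (4 * suc k + 2 * d + 2 * x + 4)
   m = F (4 * suc k + 2 * d + 2 * x + 2)
   C = q (suc k + 1 + d + d)
   l = F (suc k + 2 * d)
   n₁ : ∀ k d x → suc (suc k + suc k) + suc d + x ≡ suc (suc k + suc k + suc d + x)
   n₁ = solve-ℕ
   n₂ : ∀ k d x → 3 * suc (suc k) + 2 * d + 2 * x + 1 ≡ suc k + suc k + suc k + d + d + x + x + 4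
   n₂ = solve-ℕ
   n₃ : ∀ k d x → suc k + suc k + suc k + d + d + x + x + 4 ≡ suc (suc k + suc k + suc k + d + d + x + x + 3)
   n₃ = solve-ℕ
   n₄ : ∀ d → suc d + suc d ≡ 2 * suc d
   n₄ = solve-ℕ
   n₅ : ∀ k d x → 2 * (suc (suc k + suc k) + suc d + x) ≡ 4 * suc k + 2 * d + 2 * x + 4
   n₅ = solve-ℕ
   n₆ : ∀ k d x → 3 * suc k + 2 * suc d + 2 * x + 1 ≡ suc k + suc k + suc k + d + d + x + x + 3
   n₆ = solve-ℕ
   n₇ : ∀ k d x → suc k + suc k + suc d + x ≡ suc (k + k) + suc (suc d) + x
   n₇ = solve-ℕ
   n₈ : ∀ k d x → 4 * suc k + 2 * suc d + 2 * x ≡ 4 * suc k + 2 * d + 2 * x + 2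
   n₈ = solve-ℕ
   n₉ : ∀ k d → k + 2 * suc d ≡ suc k + 1 + d + d
   n₉ = solve-ℕ
   n₁₀ : ∀ k d → suc k + 1 + d + d ≡ suc (suc k + 2 * d)
   n₁₀ = solve-ℕ
   n₁₁ : ∀ k x → x + suc (suc k) ≡ suc k + x + 1
   n₁₁ = solve-ℕ
   n₁₂ : ∀ k d x → 4 * suc (suc k) + 2 * d + 2 * x ≡ suc (suc k + suc k + suc k + suc k + suc d + suc d + x + x + 1)
   n₁₂ = solve-ℕ
   n₁₃ : ∀ k d x → 4 * suc (suc k) + 2 * d + 2 * x ≡ 4 * suc k + 2 * d + 2 * x + 4
   n₁₃ = solve-ℕ
   n₁₄ : ∀ k d x → suc k + suc k + suc k + suc k + suc d + suc d + x + x + 1 ≡ suc (4 * suc k + 2 * d + 2 * x + 2)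
   n₁₄ = solve-ℕ

-- Products of factorials along progressions and their cross ratios.

module FactorialRatios where
 open KernelVector

 module Factorials where
  open import Data.Nat using (_+_; _*_)
  open ≡-Reasoning
  Π : ℕ → (ℕ → ℕ) → ℕ
  Π zero h = 1
  Π (suc a) h = Π a h * h a
  Π-cong : ∀ a {g h} → (∀ i → g i ≡ h i) → Π a g ≡ Π a h
  Π-cong zero e = refl
  Π-cong (suc a) e = cong₂ _*_ (Π-cong a e) (e a)
  Π-head : ∀ a h → Π (suc a) h ≡ h 0 * Π a (λ i → h (suc i))
  Π-head zero h = NP.*-comm 1 (h 0)
  Π-head (suc a) h = trans (cong (_* h (suc a)) (Π-head a h)) (NP.*-assoc (h 0) (Π a (λ i → h (suc i))) (h (suc a)))
  Π≢0 : ∀ a {h} → (∀ i → h i ≢ 0) → Π a h ≢ 0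
  Π≢0 zero _ ()
  Π≢0 (suc a) {h} p e with m*n≡0⇒m≡0∨n≡0 (Π a h) e
  ... | inj₁ e′ = Π≢0 a p e′
  ... | inj₂ e′ = p a e′
  *≢0 : ∀ {m n} → m ≢ 0 → n ≢ 0 → m * n ≢ 0
  *≢0 {m} p r e with m*n≡0⇒m≡0∨n≡0 m e
  ... | inj₁ e′ = p e′
  ... | inj₂ e′ = r e′
  cancel : ∀ {c m n} → c ≢ 0 → m * c ≡ n * c → m ≡ n
  cancel {zero} c≢0 _ with () ← c≢0 refl
  cancel {suc c} {m} {n} _ e = NP.*-cancelʳ-≡ m n (suc c) e
  -- ff n = (2n + 1)! / n!
  ff : ℕ → ℕ
  ff zero = 1
  ff (suc n) = 2 * (2 * n + 3) * ff n
  ff≢0 : ∀ n → ff n ≢ 0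
  ff≢0 zero ()
  ff≢0 (suc n) = *≢0 {2 * (2 * n + 3)} (λ e → nz (NP.m+n≡0⇒m≡0 (2 * n + 3) e)) (ff≢0 n)
   where
   nz : 2 * n + 3 ≢ 0
   nz e with () ← m+n≡0⇒n≡0 (2 * n) e
  fact-suc : ∀ {m n} → m ≡ suc n → fact m ≡ m * fact n
  fact-suc refl = refl
  fact-ff : ∀ n → fact (suc (n + n)) ≡ ff n * fact n
  fact-ff zero = refl
  fact-ff (suc n) = begin
   fact (suc (suc n + suc n)) ≡⟨ cong fact (e₁ n) ⟩
   suc (suc (suc (n + n))) * (suc (suc (n + n)) * fact (suc (n + n))) ≡⟨ cong (λ z → suc (suc (suc (n + n))) * (suc (suc (n + n)) * z)) (fact-ff n) ⟩
   suc (suc (suc (n + n))) * (suc (suc (n + n)) * (ff n * fact n)) ≡⟨ e₂ n (ff n) (fact n) ⟩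
   ff (suc n) * fact (suc n) ∎
   where
   e₁ : ∀ n → suc (suc n + suc n) ≡ suc (suc (suc (n + n)))
   e₁ = solve-ℕ
   e₂ : ∀ n f g → suc (suc (suc (n + n))) * (suc (suc (n + n)) * (f * g)) ≡ (2 * (2 * n + 3) * f) * (suc n * g)
   e₂ = solve-ℕ
  -- The building blocks of the closed form. Shifting `c` trades a first factor for a new last one,
  -- which is what makes cross ratios of neighbours short.
  Jf J₁ J₂ : ℕ → ℕ → ℕ
  Jf c a = Π a (λ i → ff (c + i))
  J₁ c a = Π a (λ i → fact (suc (c + i)))
  J₂ c a = Π a (λ i → fact (suc (suc (c + (i + i)))))
  Jf≢0 : ∀ c a → Jf c a ≢ 0
  Jf≢0 c a = Π≢0 a (λ i → ff≢0 (c + i))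
  J₁≢0 : ∀ c a → J₁ c a ≢ 0
  J₁≢0 c a = Π≢0 a (λ i → fact≢0 (suc (c + i)))
  J₂≢0 : ∀ c a → J₂ c a ≢ 0
  J₂≢0 c a = Π≢0 a (λ i → fact≢0 (suc (suc (c + (i + i)))))
  Jf-head : ∀ c a → Jf c (suc a) ≡ ff c * Jf (suc c) a
  Jf-head c a = trans (Π-head a _) (cong₂ _*_ (cong ff (NP.+-identityʳ c)) (Π-cong a (λ i → cong ff (+-suc c i))))
  J₁-head : ∀ c a → J₁ c (suc a) ≡ fact (suc c) * J₁ (suc c) a
  J₁-head c a = trans (Π-head a _) (cong₂ _*_ (cong (λ z → fact (suc z)) (NP.+-identityʳ c)) (Π-cong a (λ i → cong (λ z → fact (suc z)) (+-suc c i))))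
  J₂-head : ∀ c a → J₂ c (suc a) ≡ fact (2 + c) * J₂ (2 + c) a
  J₂-head c a = trans (Π-head a _) (cong₂ _*_ (cong (λ z → fact (suc (suc z))) (NP.+-identityʳ c))
   (Π-cong a (λ i → cong (λ z → fact (suc (suc z))) (e c i))))
   where
   e : ∀ c i → c + (suc i + suc i) ≡ 2 + c + (i + i)
   e = solve-ℕ
  -- Neighbouring products share all but their end factors, so in the cross ratio only quotients of
  -- the ends remain. The versions for `J₂` and `J₁` hold for the same reason.
  Jf-cross : ∀ z a → Jf (2 + z) a * Jf z a * (2 * z + 3) ≡ Jf (1 + z) a * Jf (1 + z) a * (2 * z + 2 * a + 3)
  Jf-cross z a = cancel (*≢0 {2} (λ ()) (*≢0 (ff≢0 z) (ff≢0 (z + a)))) (begin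
   A * B * (2 * z + 3) * (2 * (f * g)) ≡⟨ e₁ z A B f g ⟩
   (ff (suc z) * A) * (B * g) ≡⟨ cong₂ _*_ (sym (Jf-head (suc z) a)) (Jf-head z a) ⟩
   (C * ff (suc z + a)) * (f * C) ≡⟨ cong (λ w → (C * w) * (f * C)) refl ⟩
   (C * (2 * (2 * (z + a) + 3) * g)) * (f * C) ≡⟨ e₂ z a C f g ⟩
   C * C * (2 * z + 2 * a + 3) * (2 * (f * g)) ∎)
   where
   A = Jf (2 + z) a
   B = Jf z a
   C = Jf (1 + z) a
   f = ff z
   g = ff (z + a)
   e₁ : ∀ z A B f g → A * B * (2 * z + 3) * (2 * (f * g)) ≡ (2 * (2 * z + 3) * f * A) * (B * g)
   e₁ = solve-ℕ
   e₂ : ∀ z a C f g → (C * (2 * (2 * (z + a) + 3) * g)) * (f * C) ≡ C * C * (2 * z + 2 * a + 3) * (2 * (f * g))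
   e₂ = solve-ℕ
  J₂-cross : ∀ c a → J₂ (2 + c) a * J₂ (1 + c) a * (c + 2 * a + 3) ≡ J₂ c a * J₂ (3 + c) a * (c + 3)
  J₂-cross c a = cancel (*≢0 (fact≢0 (2 + c)) (fact≢0 (2 + c + (a + a)))) (begin
   J₂ (2 + c) a * J₂ (1 + c) a * (c + 2 * a + 3) * (fact (2 + c) * g) ≡⟨ e₁ c a (J₂ (2 + c) a) (J₂ (1 + c) a) (fact (2 + c)) g ⟩
   (fact (2 + c) * J₂ (2 + c) a) * (J₂ (1 + c) a * (suc (2 + c + (a + a)) * g)) ≡⟨ cong₂ _*_ (J₂-head c a) refl ⟨
   (J₂ c a * g) * J₂ (1 + c) (suc a) ≡⟨ cong ((J₂ c a * g) *_) (J₂-head (1 + c) a) ⟩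
   (J₂ c a * g) * (suc (2 + c) * fact (2 + c) * J₂ (3 + c) a) ≡⟨ e₂ c (J₂ c a) (J₂ (3 + c) a) (fact (2 + c)) g ⟩
   J₂ c a * J₂ (3 + c) a * (c + 3) * (fact (2 + c) * g) ∎)
   where
   g = fact (2 + c + (a + a))
   e₁ : ∀ c a A B f g → A * B * (c + 2 * a + 3) * (f * g) ≡ (f * A) * (B * (suc (2 + c + (a + a)) * g))
   e₁ = solve-ℕ
   e₂ : ∀ c A B f g → (A * g) * (suc (2 + c) * f * B) ≡ A * B * (c + 3) * (f * g)
   e₂ = solve-ℕ
  J₁-cross : ∀ c a → J₁ (2 + c) a * J₁ (2 + c) a * (c + a + 3) ≡ J₁ (1 + c) a * J₁ (3 + c) a * (c + 3)
  J₁-cross c a = cancel (*≢0 (fact≢0 (2 + c)) (fact≢0 (2 + c + a))) (begin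
   A * A * (c + a + 3) * (f * g) ≡⟨ e₁ c a A f g ⟩
   (f * A) * (A * (suc (2 + c + a) * g)) ≡⟨ cong (_* (A * (suc (2 + c + a) * g))) (J₁-head (1 + c) a) ⟨
   (J₁ (1 + c) a * g) * J₁ (2 + c) (suc a) ≡⟨ cong ((J₁ (1 + c) a * g) *_) (J₁-head (2 + c) a) ⟩
   (J₁ (1 + c) a * g) * (suc (2 + c) * f * J₁ (3 + c) a) ≡⟨ e₂ c (J₁ (1 + c) a) (J₁ (3 + c) a) f g ⟩
   J₁ (1 + c) a * J₁ (3 + c) a * (c + 3) * (f * g) ∎)
   where
   A = J₁ (2 + c) a
   f = fact (2 + c)
   g = fact (2 + c + a)
   e₁ : ∀ c a A f g → A * A * (c + a + 3) * (f * g) ≡ (f * A) * (A * (suc (2 + c + a) * g))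
   e₁ = solve-ℕ
   e₂ : ∀ c A B f g → (A * g) * (suc (2 + c) * f * B) ≡ A * B * (c + 3) * (f * g)
   e₂ = solve-ℕ
  -- The versions marked ⁺ and ⁻ compare lengths `a + 2` and `a` with two products of length
  -- `a + 1`, as the condensation relation demands: ⁺ serves the numerator, ⁻ the denominator.
  Jf-cross⁺ : ∀ z a → Jf z (2 + a) * Jf (2 + z) a * (2 * (2 * z + 3)) ≡ Jf (1 + z) (1 + a) * Jf (1 + z) (1 + a)
  Jf-cross⁺ z a = begin
   Jf z (2 + a) * A * (2 * (2 * z + 3)) ≡⟨ cong (λ w → w * A * (2 * (2 * z + 3))) (Jf-head z (1 + a)) ⟩
   ff z * B * A * (2 * (2 * z + 3)) ≡⟨ e z A B (ff z) ⟩
   B * (2 * (2 * z + 3) * ff z * A) ≡⟨ cong (B *_) (Jf-head (suc z) a) ⟨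
   B * B ∎
   where
   A = Jf (2 + z) a
   B = Jf (1 + z) (1 + a)
   e : ∀ z A B f → f * B * A * (2 * (2 * z + 3)) ≡ B * (2 * (2 * z + 3) * f * A)
   e = solve-ℕ
  Jf-cross⁻ : ∀ w a → Jf w (2 + a) * Jf (3 + w) a * (4 * (2 * w + 5) * (2 * w + 3)) ≡ Jf (2 + w) (1 + a) * Jf (1 + w) (1 + a)
  Jf-cross⁻ w a = begin
   Jf w (2 + a) * A * (4 * (2 * w + 5) * (2 * w + 3)) ≡⟨ cong (λ u → u * A * (4 * (2 * w + 5) * (2 * w + 3))) (Jf-head w (1 + a)) ⟩
   ff w * B * A * (4 * (2 * w + 5) * (2 * w + 3)) ≡⟨ e w A B (ff w) ⟩
   (2 * (2 * suc w + 3) * (2 * (2 * w + 3) * ff w)) * A * B ≡⟨ cong (_* B) (Jf-head (2 + w) a) ⟨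
   Jf (2 + w) (1 + a) * B ∎
   where
   A = Jf (3 + w) a
   B = Jf (1 + w) (1 + a)
   e : ∀ w A B f → f * B * A * (4 * (2 * w + 5) * (2 * w + 3)) ≡ (2 * (2 * suc w + 3) * (2 * (2 * w + 3) * f)) * A * B
   e = solve-ℕ
  J₂-cross⁺ : ∀ c a → J₂ c (2 + a) * J₂ (3 + c) a * (c + 2 * a + 5) ≡ J₂ (3 + c) (1 + a) * J₂ c (1 + a)
  J₂-cross⁺ c a = begin
   J₂ c (1 + a) * fact (suc (suc (c + (suc a + suc a)))) * J₂ (3 + c) a * (c + 2 * a + 5)
    ≡⟨ e (c + 2 * a + 5) (J₂ c (1 + a)) (fact (suc (suc (c + (suc a + suc a))))) (J₂ (3 + c) a) ⟩
   J₂ (3 + c) a * ((c + 2 * a + 5) * fact (suc (suc (c + (suc a + suc a))))) * J₂ c (1 + a)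
    ≡⟨ cong (λ w → J₂ (3 + c) a * w * J₂ c (1 + a)) (trans (cong fact (e₂ c a)) (fact-suc (e₃ c a))) ⟨
   J₂ (3 + c) a * fact (suc (suc (3 + c + (a + a)))) * J₂ c (1 + a) ∎
   where
   e : ∀ l A f B → A * f * B * l ≡ B * (l * f) * A
   e = solve-ℕ
   e₂ : ∀ c a → suc (suc (3 + c + (a + a))) ≡ c + 2 * a + 5
   e₂ = solve-ℕ
   e₃ : ∀ c a → c + 2 * a + 5 ≡ suc (suc (suc (c + (suc a + suc a))))
   e₃ = solve-ℕ
  J₂-cross⁻ : ∀ c a → J₂ c (2 + a) * J₂ (1 + c) a ≡ J₂ (1 + c) (1 + a) * J₂ c (1 + a) * (c + 2 * a + 4)
  J₂-cross⁻ c a = begin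
   J₂ c (1 + a) * fact (suc (suc (c + (suc a + suc a)))) * J₂ (1 + c) a
    ≡⟨ cong (λ w → J₂ c (1 + a) * w * J₂ (1 + c) a) (trans (cong fact (e₂ c a)) (fact-suc (e₃ c a))) ⟩
   J₂ c (1 + a) * ((c + 2 * a + 4) * fact (suc (suc (1 + c + (a + a))))) * J₂ (1 + c) a
    ≡⟨ e (c + 2 * a + 4) (J₂ c (1 + a)) (fact (suc (suc (1 + c + (a + a))))) (J₂ (1 + c) a) ⟩
   J₂ (1 + c) a * fact (suc (suc (1 + c + (a + a)))) * J₂ c (1 + a) * (c + 2 * a + 4) ∎
   where
   e : ∀ l A f B → A * (l * f) * B ≡ B * f * A * l
   e = solve-ℕ
   e₂ : ∀ c a → suc (suc (c + (suc a + suc a))) ≡ c + 2 * a + 4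
   e₂ = solve-ℕ
   e₃ : ∀ c a → c + 2 * a + 4 ≡ suc (suc (suc (1 + c + (a + a))))
   e₃ = solve-ℕ
  J₁-cross⁺ : ∀ c a → J₁ (4 + c) (2 + a) * J₁ (3 + c) a ≡ J₁ (4 + c) (1 + a) * J₁ (3 + c) (1 + a) * ((c + a + 5) * (c + a + 6))
  J₁-cross⁺ c a = begin
   J₁ (4 + c) (1 + a) * fact (suc (4 + c + suc a)) * J₁ (3 + c) a
    ≡⟨ cong (λ w → J₁ (4 + c) (1 + a) * w * J₁ (3 + c) a) (trans (cong fact (e₂ c a)) (trans (fact-suc (e₃ c a)) (cong ((c + a + 6) *_) (fact-suc (e₄ c a))))) ⟩
   J₁ (4 + c) (1 + a) * ((c + a + 6) * ((c + a + 5) * fact (suc (3 + c + a)))) * J₁ (3 + c) a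
    ≡⟨ e (c + a + 6) (c + a + 5) (J₁ (4 + c) (1 + a)) (fact (suc (3 + c + a))) (J₁ (3 + c) a) ⟩
   J₁ (4 + c) (1 + a) * (J₁ (3 + c) a * fact (suc (3 + c + a))) * ((c + a + 5) * (c + a + 6)) ∎
   where
   e : ∀ l k A f B → A * (l * (k * f)) * B ≡ A * (B * f) * (k * l)
   e = solve-ℕ
   e₂ : ∀ c a → suc (4 + c + suc a) ≡ c + a + 6
   e₂ = solve-ℕ
   e₃ : ∀ c a → c + a + 6 ≡ suc (c + a + 5)
   e₃ = solve-ℕ
   e₄ : ∀ c a → c + a + 5 ≡ suc (suc (3 + c + a))
   e₄ = solve-ℕ
  J₁-cross⁻ : ∀ c a → J₁ (4 + c) (2 + a) * J₁ (4 + c) a ≡ J₁ (5 + c) (1 + a) * J₁ (3 + c) (1 + a) * (c + 5)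
  J₁-cross⁻ c a = begin
   J₁ (4 + c) (2 + a) * J₁ (4 + c) a ≡⟨ cong (_* J₁ (4 + c) a) (J₁-head (4 + c) (1 + a)) ⟩
   suc (4 + c) * fact (4 + c) * J₁ (5 + c) (1 + a) * J₁ (4 + c) a ≡⟨ e c (fact (4 + c)) (J₁ (5 + c) (1 + a)) (J₁ (4 + c) a) ⟩
   J₁ (5 + c) (1 + a) * (fact (4 + c) * J₁ (4 + c) a) * (c + 5) ≡⟨ cong (λ w → J₁ (5 + c) (1 + a) * w * (c + 5)) (J₁-head (3 + c) a) ⟨
   J₁ (5 + c) (1 + a) * J₁ (3 + c) (1 + a) * (c + 5) ∎
   where
   e : ∀ c f A B → suc (4 + c) * f * A * B ≡ A * (f * B) * (c + 5)
   e = solve-ℕ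

-- Numerator and denominator of the satellite factor, and their cross ratios.

module SatelliteRecurrence where
 open import Data.Nat using (_+_; _*_)
 open Embedding
 open PathRows
 open Condensation
 open KernelVector
 open KernelAtRows
 open CoreDeterminant
 open FactorialRatios

 module Satellite (x : ℕ) where
  open Factorials
  -- The part of the closed form that is free of `z`, and of `a` except through the number of
  -- factors.
  kn kd : ℕ → ℕ → ℕ
  kn y i = fact (suc (x + y + (i + i))) * fact (suc (x + 3 * y + 3 * i)) * fact i
  kd y i = fact (suc (x + 3 * i)) * fact (suc (x + 3 * y + (i + i))) * fact (i + y)
  KN KD : ℕ → ℕ → ℕ
  KN y a = Π a (kn y)
  KD y a = Π a (kd y)
  -- Their quotient is the factor by which a satellite at distance `y` changes the determinant of
  -- the core enlarged by `3a`. At `y = 0` the two coincide, in accordance with the merging of a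
  -- touching satellite.
  Num Den : ℕ → ℕ → ℕ → ℕ
  Num y z a = Jf z a * J₂ (x + 3 * y + 2 * z + 2 * a) a * J₁ (x + y + z + 2 * a) a * KN y a
  Den y z a = Jf (z + y) a * J₂ (x + y + 2 * z + 2 * a) a * J₁ (x + 2 * y + z + 2 * a) a * KD y a
  Num-cong : ∀ {y z a i j k} → z ≡ i → x + 3 * y + 2 * z + 2 * a ≡ j → x + y + z + 2 * a ≡ k →
   Num y z a ≡ Jf i a * J₂ j a * J₁ k a * KN y a
  Num-cong refl refl refl = refl
  Den-cong : ∀ {y z a i j k} → z + y ≡ i → x + y + 2 * z + 2 * a ≡ j → x + 2 * y + z + 2 * a ≡ k →
   Den y z a ≡ Jf i a * J₂ j a * J₁ k a * KD y a
  Den-cong refl refl refl = refl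
  KN-cross : ∀ y a → KN y (2 + a) * KN (1 + y) a ≡ KN (1 + y) (1 + a) * KN y (1 + a) * ((x + y + 2 * a + 3) * (a + 1))
  KN-cross y a = begin
   KN y (1 + a) * kn y (1 + a) * KN (1 + y) a
    ≡⟨ cong (λ w → KN y (1 + a) * w * KN (1 + y) a) step ⟩
   KN y (1 + a) * (kn (1 + y) a * ((x + y + 2 * a + 3) * (a + 1))) * KN (1 + y) a
    ≡⟨ e (KN y (1 + a)) (kn (1 + y) a) ((x + y + 2 * a + 3) * (a + 1)) (KN (1 + y) a) ⟩
   KN (1 + y) a * kn (1 + y) a * KN y (1 + a) * ((x + y + 2 * a + 3) * (a + 1)) ∎
   where
   open ≡-Reasoning
   e : ∀ A k l B → A * (k * l) * B ≡ B * k * A * l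
   e = solve-ℕ
   e₁ : ∀ x y a → suc (x + y + (suc a + suc a)) ≡ x + y + 2 * a + 3
   e₁ = solve-ℕ
   e₂ : ∀ x y a → x + y + 2 * a + 3 ≡ suc (suc (x + suc y + (a + a)))
   e₂ = solve-ℕ
   e₃ : ∀ x y a → suc (x + 3 * y + 3 * suc a) ≡ suc (x + 3 * suc y + 3 * a)
   e₃ = solve-ℕ
   e₄ : ∀ l A B a f → l * A * B * (suc a * f) ≡ A * B * f * (l * (a + 1))
   e₄ = solve-ℕ
   step : kn y (1 + a) ≡ kn (1 + y) a * ((x + y + 2 * a + 3) * (a + 1))
   step = trans (cong₂ (λ u w → u * w * fact (suc a)) (trans (cong fact (e₁ x y a)) (fact-suc (e₂ x y a))) (cong fact (e₃ x y a)))
    (e₄ (x + y + 2 * a + 3) (fact (suc (x + suc y + (a + a)))) (fact (suc (x + 3 * suc y + 3 * a))) a (fact a))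
  X₃ : ℕ → ℕ
  X₃ a = (x + 3 * a + 2) * (x + 3 * a + 3) * (x + 3 * a + 4)
  KD-cross : ∀ y a → KD y (2 + a) * KD (1 + y) a * (x + 3 * y + 2 * a + 4) ≡ KD (1 + y) (1 + a) * KD y (1 + a) * X₃ a
  KD-cross y a = begin
   KD y (1 + a) * kd y (1 + a) * KD (1 + y) a * (x + 3 * y + 2 * a + 4)
    ≡⟨ e (KD y (1 + a)) (kd y (1 + a)) (KD (1 + y) a) (x + 3 * y + 2 * a + 4) ⟩
   KD y (1 + a) * (kd y (1 + a) * (x + 3 * y + 2 * a + 4)) * KD (1 + y) a
    ≡⟨ cong (λ w → KD y (1 + a) * w * KD (1 + y) a) step ⟩
   KD y (1 + a) * (kd (1 + y) a * X₃ a) * KD (1 + y) a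
    ≡⟨ e′ (KD y (1 + a)) (kd (1 + y) a) (X₃ a) (KD (1 + y) a) ⟩
   KD (1 + y) a * kd (1 + y) a * KD y (1 + a) * X₃ a ∎
   where
   open ≡-Reasoning
   e : ∀ A k B l → A * k * B * l ≡ A * (k * l) * B
   e = solve-ℕ
   e′ : ∀ A k l B → A * (k * l) * B ≡ B * k * A * l
   e′ = solve-ℕ
   e₁ : ∀ x a → suc (x + 3 * suc a) ≡ x + 3 * a + 4
   e₁ = solve-ℕ
   e₂ : ∀ x a → x + 3 * a + 4 ≡ suc (x + 3 * a + 3)
   e₂ = solve-ℕ
   e₃ : ∀ x a → x + 3 * a + 3 ≡ suc (x + 3 * a + 2)
   e₃ = solve-ℕ
   e₄ : ∀ x a → x + 3 * a + 2 ≡ suc (suc (x + 3 * a))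
   e₄ = solve-ℕ
   e₅ : ∀ x y a → suc (x + 3 * suc y + (a + a)) ≡ x + 3 * y + 2 * a + 4
   e₅ = solve-ℕ
   e₆ : ∀ x y a → x + 3 * y + 2 * a + 4 ≡ suc (suc (x + 3 * y + (suc a + suc a)))
   e₆ = solve-ℕ
   e₇ : ∀ l₂ l₃ l₄ A B f l → l₄ * (l₃ * (l₂ * A)) * B * f * l ≡ A * (l * B) * f * (l₂ * l₃ * l₄)
   e₇ = solve-ℕ
   step : kd y (1 + a) * (x + 3 * y + 2 * a + 4) ≡ kd (1 + y) a * X₃ a
   step = begin
    kd y (1 + a) * (x + 3 * y + 2 * a + 4)
     ≡⟨ cong (λ w → w * B * f * l) (trans (cong fact (e₁ x a)) (trans (fact-suc (e₂ x a)) (cong ((x + 3 * a + 4) *_) (trans (fact-suc (e₃ x a)) (cong ((x + 3 * a + 3) *_) (fact-suc (e₄ x a))))))) ⟩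
    (x + 3 * a + 4) * ((x + 3 * a + 3) * ((x + 3 * a + 2) * A)) * B * f * l
     ≡⟨ e₇ (x + 3 * a + 2) (x + 3 * a + 3) (x + 3 * a + 4) A B f l ⟩
    A * (l * B) * f * X₃ a
     ≡⟨ cong₂ (λ u w → A * u * w * X₃ a) (trans (cong fact (e₅ x y a)) (fact-suc (e₆ x y a))) (cong fact (+-suc a y)) ⟨
    kd (1 + y) a * X₃ a ∎
    where
    A = fact (suc (x + 3 * a))
    B = fact (suc (x + 3 * y + (suc a + suc a)))
    f = fact (suc a + y)
    l = x + 3 * y + 2 * a + 4
  -- The condensation relation has three products. The ratios named α compare the left side, and
  -- those named β the first product on the right, with the last product on the right.
  module Step (y z a : ℕ) where
   open ≡-Reasoning
   c c′ e e′ s : ℕ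
   c = x + 3 * y + 2 * z + 2 * a + 4
   c′ = x + y + 2 * z + 2 * a + 3
   e = x + y + z + 2 * a
   e′ = x + 2 * y + z + 2 * a
   s = z + y
   b = 1 + a
   mul₃ : ∀ {k k′ l l′ m m′ n n′ : ℕ} → k ≡ k′ → l ≡ l′ → m ≡ m′ → n ≡ n′ → k * l * m * n ≡ k′ * l′ * m′ * n′
   mul₃ refl refl refl refl = refl
   num-β : Num y (2 + z) b * Num (1 + y) z b * ((2 * z + 3) * (c + 2 * b + 3)) ≡ Num (1 + y) (1 + z) b * Num y (1 + z) b * ((2 * z + 2 * b + 3) * (c + 3))
   num-β = begin
    Num y (2 + z) b * Num (1 + y) z b * ((2 * z + 3) * (c + 2 * b + 3))
     ≡⟨ cong₂ (λ u w → u * w * ((2 * z + 3) * (c + 2 * b + 3))) (Num-cong {y} {2 + z} {b} refl (j₁ x y z a) (k₁ x y z a)) (Num-cong {1 + y} {z} {b} refl (j₂ x y z a) (k₂ x y z a)) ⟩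
    (Jf (2 + z) b * J₂ (2 + c) b * J₁ (4 + e) b * KN y b) * (Jf z b * J₂ (1 + c) b * J₁ (3 + e) b * KN (1 + y) b) * ((2 * z + 3) * (c + 2 * b + 3))
     ≡⟨ t₁ (Jf (2 + z) b) (Jf z b) (J₂ (2 + c) b) (J₂ (1 + c) b) (J₁ (4 + e) b) (J₁ (3 + e) b) (KN y b) (KN (1 + y) b) (2 * z + 3) (c + 2 * b + 3) ⟩
    (Jf (2 + z) b * Jf z b * (2 * z + 3)) * (J₂ (2 + c) b * J₂ (1 + c) b * (c + 2 * b + 3)) * (J₁ (4 + e) b * J₁ (3 + e) b) * (KN y b * KN (1 + y) b)
     ≡⟨ cong₂ (λ u w → u * w * (J₁ (4 + e) b * J₁ (3 + e) b) * (KN y b * KN (1 + y) b)) (Jf-cross z b) (J₂-cross c b) ⟩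
    (Jf (1 + z) b * Jf (1 + z) b * (2 * z + 2 * b + 3)) * (J₂ c b * J₂ (3 + c) b * (c + 3)) * (J₁ (4 + e) b * J₁ (3 + e) b) * (KN y b * KN (1 + y) b)
     ≡⟨ t₂ (Jf (1 + z) b) (2 * z + 2 * b + 3) (J₂ c b) (J₂ (3 + c) b) (c + 3) (J₁ (4 + e) b) (J₁ (3 + e) b) (KN y b) (KN (1 + y) b) ⟩
    (Jf (1 + z) b * J₂ (3 + c) b * J₁ (4 + e) b * KN (1 + y) b) * (Jf (1 + z) b * J₂ c b * J₁ (3 + e) b * KN y b) * ((2 * z + 2 * b + 3) * (c + 3))
     ≡⟨ cong₂ (λ u w → u * w * ((2 * z + 2 * b + 3) * (c + 3))) (Num-cong {1 + y} {1 + z} {b} refl (j₃ x y z a) (k₃ x y z a)) (Num-cong {y} {1 + z} {b} refl (j₄ x y z a) (k₄ x y z a)) ⟨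
    Num (1 + y) (1 + z) b * Num y (1 + z) b * ((2 * z + 2 * b + 3) * (c + 3)) ∎
    where
    t₁ : ∀ A A′ B B′ C C′ K K′ l m → (A * B * C * K) * (A′ * B′ * C′ * K′) * (l * m) ≡ (A * A′ * l) * (B * B′ * m) * (C * C′) * (K * K′)
    t₁ = solve-ℕ
    t₂ : ∀ A l B B′ m C C′ K K′ → (A * A * l) * (B * B′ * m) * (C * C′) * (K * K′) ≡ (A * B′ * C * K′) * (A * B * C′ * K) * (l * m)
    t₂ = solve-ℕ
    j₁ : ∀ x y z a → x + 3 * y + 2 * (2 + z) + 2 * (1 + a) ≡ 2 + (x + 3 * y + 2 * z + 2 * a + 4)
    j₁ = solve-ℕ
    j₂ : ∀ x y z a → x + 3 * (1 + y) + 2 * z + 2 * (1 + a) ≡ 1 + (x + 3 * y + 2 * z + 2 * a + 4)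
    j₂ = solve-ℕ
    j₃ : ∀ x y z a → x + 3 * (1 + y) + 2 * (1 + z) + 2 * (1 + a) ≡ 3 + (x + 3 * y + 2 * z + 2 * a + 4)
    j₃ = solve-ℕ
    j₄ : ∀ x y z a → x + 3 * y + 2 * (1 + z) + 2 * (1 + a) ≡ x + 3 * y + 2 * z + 2 * a + 4
    j₄ = solve-ℕ
    k₁ : ∀ x y z a → x + y + (2 + z) + 2 * (1 + a) ≡ 4 + (x + y + z + 2 * a)
    k₁ = solve-ℕ
    k₂ : ∀ x y z a → x + (1 + y) + z + 2 * (1 + a) ≡ 3 + (x + y + z + 2 * a)
    k₂ = solve-ℕ
    k₃ : ∀ x y z a → x + (1 + y) + (1 + z) + 2 * (1 + a) ≡ 4 + (x + y + z + 2 * a)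
    k₃ = solve-ℕ
    k₄ : ∀ x y z a → x + y + (1 + z) + 2 * (1 + a) ≡ 3 + (x + y + z + 2 * a)
    k₄ = solve-ℕ
   den-β : Den y (2 + z) b * Den (1 + y) z b * ((c′ + 3) * (2 + e′ + b + 3)) ≡ Den (1 + y) (1 + z) b * Den y (1 + z) b * ((c′ + 2 * b + 3) * (2 + e′ + 3))
   den-β = begin
    Den y (2 + z) b * Den (1 + y) z b * (l * m)
     ≡⟨ cong₂ (λ u w → u * w * (l * m)) (Den-cong {y} {2 + z} {b} refl (j₁ x y z a) (k₁ x y z a)) (Den-cong {1 + y} {z} {b} (+-suc z y) (j₂ x y z a) (k₂ x y z a)) ⟩
    (Jf (2 + s) b * J₂ (3 + c′) b * J₁ (4 + e′) b * KD y b) * (Jf (1 + s) b * J₂ c′ b * J₁ (4 + e′) b * KD (1 + y) b) * (l * m)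
     ≡⟨ t₁ (Jf (2 + s) b) (Jf (1 + s) b) (J₂ (3 + c′) b) (J₂ c′ b) (J₁ (4 + e′) b) (KD y b) (KD (1 + y) b) l m ⟩
    (Jf (2 + s) b * Jf (1 + s) b) * (J₂ c′ b * J₂ (3 + c′) b * l) * (J₁ (4 + e′) b * J₁ (4 + e′) b * m) * (KD y b * KD (1 + y) b)
     ≡⟨ cong₂ (λ u w → (Jf (2 + s) b * Jf (1 + s) b) * u * w * (KD y b * KD (1 + y) b)) (sym (J₂-cross c′ b)) (J₁-cross (2 + e′) b) ⟩
    (Jf (2 + s) b * Jf (1 + s) b) * (J₂ (2 + c′) b * J₂ (1 + c′) b * (c′ + 2 * b + 3)) * (J₁ (3 + e′) b * J₁ (5 + e′) b * (2 + e′ + 3)) * (KD y b * KD (1 + y) b)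
     ≡⟨ t₂ (Jf (2 + s) b) (Jf (1 + s) b) (J₂ (2 + c′) b) (J₂ (1 + c′) b) (c′ + 2 * b + 3) (J₁ (3 + e′) b) (J₁ (5 + e′) b) (2 + e′ + 3) (KD y b) (KD (1 + y) b) ⟩
    (Jf (2 + s) b * J₂ (2 + c′) b * J₁ (5 + e′) b * KD (1 + y) b) * (Jf (1 + s) b * J₂ (1 + c′) b * J₁ (3 + e′) b * KD y b) * ((c′ + 2 * b + 3) * (2 + e′ + 3))
     ≡⟨ cong₂ (λ u w → u * w * ((c′ + 2 * b + 3) * (2 + e′ + 3))) (Den-cong {1 + y} {1 + z} {b} (cong suc (+-suc z y)) (j₃ x y z a) (k₃ x y z a)) (Den-cong {y} {1 + z} {b} refl (j₄ x y z a) (k₄ x y z a)) ⟨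
    Den (1 + y) (1 + z) b * Den y (1 + z) b * ((c′ + 2 * b + 3) * (2 + e′ + 3)) ∎
    where
    l = c′ + 3
    m = 2 + e′ + b + 3
    t₁ : ∀ A A′ B B′ C K K′ l m → (A * B * C * K) * (A′ * B′ * C * K′) * (l * m) ≡ (A * A′) * (B′ * B * l) * (C * C * m) * (K * K′)
    t₁ = solve-ℕ
    t₂ : ∀ A A′ B B′ m C C′ n K K′ → (A * A′) * (B * B′ * m) * (C * C′ * n) * (K * K′) ≡ (A * B * C′ * K′) * (A′ * B′ * C * K) * (m * n)
    t₂ = solve-ℕ
    j₁ : ∀ x y z a → x + y + 2 * (2 + z) + 2 * (1 + a) ≡ 3 + (x + y + 2 * z + 2 * a + 3)
    j₁ = solve-ℕ
    j₂ : ∀ x y z a → x + (1 + y) + 2 * z + 2 * (1 + a) ≡ x + y + 2 * z + 2 * a + 3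
    j₂ = solve-ℕ
    j₃ : ∀ x y z a → x + (1 + y) + 2 * (1 + z) + 2 * (1 + a) ≡ 2 + (x + y + 2 * z + 2 * a + 3)
    j₃ = solve-ℕ
    j₄ : ∀ x y z a → x + y + 2 * (1 + z) + 2 * (1 + a) ≡ 1 + (x + y + 2 * z + 2 * a + 3)
    j₄ = solve-ℕ
    k₁ : ∀ x y z a → x + 2 * y + (2 + z) + 2 * (1 + a) ≡ 4 + (x + 2 * y + z + 2 * a)
    k₁ = solve-ℕ
    k₂ : ∀ x y z a → x + 2 * (1 + y) + z + 2 * (1 + a) ≡ 4 + (x + 2 * y + z + 2 * a)
    k₂ = solve-ℕ
    k₃ : ∀ x y z a → x + 2 * (1 + y) + (1 + z) + 2 * (1 + a) ≡ 5 + (x + 2 * y + z + 2 * a)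
    k₃ = solve-ℕ
    k₄ : ∀ x y z a → x + 2 * y + (1 + z) + 2 * (1 + a) ≡ 3 + (x + 2 * y + z + 2 * a)
    k₄ = solve-ℕ
   num-α : Num y z (2 + a) * Num (1 + y) (2 + z) a * (2 * (2 * z + 3) * (c + 2 * a + 5))
    ≡ Num (1 + y) (1 + z) b * Num y (1 + z) b * ((e + a + 5) * (e + a + 6) * ((x + y + 2 * a + 3) * (a + 1)))
   num-α = begin
    Num y z (2 + a) * Num (1 + y) (2 + z) a * (l * m)
     ≡⟨ cong₂ (λ u w → u * w * (l * m)) (Num-cong {y} {z} {2 + a} refl (j₁ x y z a) (k₁ x y z a)) (Num-cong {1 + y} {2 + z} {a} refl (j₂ x y z a) (k₂ x y z a)) ⟩
    (Jf z (2 + a) * J₂ c (2 + a) * J₁ (4 + e) (2 + a) * KN y (2 + a)) * (Jf (2 + z) a * J₂ (3 + c) a * J₁ (3 + e) a * KN (1 + y) a) * (l * m)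
     ≡⟨ t₁ (Jf z (2 + a)) (Jf (2 + z) a) (J₂ c (2 + a)) (J₂ (3 + c) a) (J₁ (4 + e) (2 + a)) (J₁ (3 + e) a) (KN y (2 + a)) (KN (1 + y) a) l m ⟩
    (Jf z (2 + a) * Jf (2 + z) a * l) * (J₂ c (2 + a) * J₂ (3 + c) a * m) * (J₁ (4 + e) (2 + a) * J₁ (3 + e) a) * (KN y (2 + a) * KN (1 + y) a)
     ≡⟨ mul₃ (Jf-cross⁺ z a) (J₂-cross⁺ c a) (J₁-cross⁺ e a) (KN-cross y a) ⟩
    (Jf (1 + z) b * Jf (1 + z) b) * (J₂ (3 + c) b * J₂ c b) * (J₁ (4 + e) b * J₁ (3 + e) b * n) * (KN (1 + y) b * KN y b * o)
     ≡⟨ t₂ (Jf (1 + z) b) (J₂ (3 + c) b) (J₂ c b) (J₁ (4 + e) b) (J₁ (3 + e) b) n (KN (1 + y) b) (KN y b) o ⟩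
    (Jf (1 + z) b * J₂ (3 + c) b * J₁ (4 + e) b * KN (1 + y) b) * (Jf (1 + z) b * J₂ c b * J₁ (3 + e) b * KN y b) * (n * o)
     ≡⟨ cong₂ (λ u w → u * w * (n * o)) (Num-cong {1 + y} {1 + z} {b} refl (j₃ x y z a) (k₃ x y z a)) (Num-cong {y} {1 + z} {b} refl (j₄ x y z a) (k₄ x y z a)) ⟨
    Num (1 + y) (1 + z) b * Num y (1 + z) b * (n * o) ∎
    where
    l = 2 * (2 * z + 3)
    m = c + 2 * a + 5
    n = (e + a + 5) * (e + a + 6)
    o = (x + y + 2 * a + 3) * (a + 1)
    t₁ : ∀ A A′ B B′ C C′ K K′ l m → (A * B * C * K) * (A′ * B′ * C′ * K′) * (l * m) ≡ (A * A′ * l) * (B * B′ * m) * (C * C′) * (K * K′)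
    t₁ = solve-ℕ
    t₂ : ∀ A B B′ C C′ n K K′ o → (A * A) * (B * B′) * (C * C′ * n) * (K * K′ * o) ≡ (A * B * C * K) * (A * B′ * C′ * K′) * (n * o)
    t₂ = solve-ℕ
    j₁ : ∀ x y z a → x + 3 * y + 2 * z + 2 * (2 + a) ≡ x + 3 * y + 2 * z + 2 * a + 4
    j₁ = solve-ℕ
    j₂ : ∀ x y z a → x + 3 * (1 + y) + 2 * (2 + z) + 2 * a ≡ 3 + (x + 3 * y + 2 * z + 2 * a + 4)
    j₂ = solve-ℕ
    j₃ : ∀ x y z a → x + 3 * (1 + y) + 2 * (1 + z) + 2 * (1 + a) ≡ 3 + (x + 3 * y + 2 * z + 2 * a + 4)
    j₃ = solve-ℕ
    j₄ : ∀ x y z a → x + 3 * y + 2 * (1 + z) + 2 * (1 + a) ≡ x + 3 * y + 2 * z + 2 * a + 4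
    j₄ = solve-ℕ
    k₁ : ∀ x y z a → x + y + z + 2 * (2 + a) ≡ 4 + (x + y + z + 2 * a)
    k₁ = solve-ℕ
    k₂ : ∀ x y z a → x + (1 + y) + (2 + z) + 2 * a ≡ 3 + (x + y + z + 2 * a)
    k₂ = solve-ℕ
    k₃ : ∀ x y z a → x + (1 + y) + (1 + z) + 2 * (1 + a) ≡ 4 + (x + y + z + 2 * a)
    k₃ = solve-ℕ
    k₄ : ∀ x y z a → x + y + (1 + z) + 2 * (1 + a) ≡ 3 + (x + y + z + 2 * a)
    k₄ = solve-ℕ
   den-α : Den y z (2 + a) * Den (1 + y) (2 + z) a * (4 * (2 * s + 5) * (2 * s + 3) * (x + 3 * y + 2 * a + 4))
    ≡ Den (1 + y) (1 + z) b * Den y (1 + z) b * ((1 + c′ + 2 * a + 4) * (e′ + 5) * X₃ a)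
   den-α = begin
    Den y z (2 + a) * Den (1 + y) (2 + z) a * (l * m)
     ≡⟨ cong₂ (λ u w → u * w * (l * m)) (Den-cong {y} {z} {2 + a} refl (j₁ x y z a) (k₁ x y z a)) (Den-cong {1 + y} {2 + z} {a} (cong (λ ω → 2 + ω) (+-suc z y)) (j₂ x y z a) (k₂ x y z a)) ⟩
    (Jf s (2 + a) * J₂ (1 + c′) (2 + a) * J₁ (4 + e′) (2 + a) * KD y (2 + a)) * (Jf (3 + s) a * J₂ (2 + c′) a * J₁ (4 + e′) a * KD (1 + y) a) * (l * m)
     ≡⟨ t₁ (Jf s (2 + a)) (Jf (3 + s) a) (J₂ (1 + c′) (2 + a)) (J₂ (2 + c′) a) (J₁ (4 + e′) (2 + a)) (J₁ (4 + e′) a) (KD y (2 + a)) (KD (1 + y) a) l m ⟩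
    (Jf s (2 + a) * Jf (3 + s) a * l) * (J₂ (1 + c′) (2 + a) * J₂ (2 + c′) a) * (J₁ (4 + e′) (2 + a) * J₁ (4 + e′) a) * (KD y (2 + a) * KD (1 + y) a * m)
     ≡⟨ mul₃ (Jf-cross⁻ s a) (J₂-cross⁻ (1 + c′) a) (J₁-cross⁻ e′ a) (KD-cross y a) ⟩
    (Jf (2 + s) b * Jf (1 + s) b) * (J₂ (2 + c′) b * J₂ (1 + c′) b * n) * (J₁ (5 + e′) b * J₁ (3 + e′) b * o) * (KD (1 + y) b * KD y b * X₃ a)
     ≡⟨ t₂ (Jf (2 + s) b) (Jf (1 + s) b) (J₂ (2 + c′) b) (J₂ (1 + c′) b) n (J₁ (5 + e′) b) (J₁ (3 + e′) b) o (KD (1 + y) b) (KD y b) (X₃ a) ⟩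
    (Jf (2 + s) b * J₂ (2 + c′) b * J₁ (5 + e′) b * KD (1 + y) b) * (Jf (1 + s) b * J₂ (1 + c′) b * J₁ (3 + e′) b * KD y b) * (n * o * X₃ a)
     ≡⟨ cong₂ (λ u w → u * w * (n * o * X₃ a)) (Den-cong {1 + y} {1 + z} {b} (cong suc (+-suc z y)) (j₃ x y z a) (k₃ x y z a)) (Den-cong {y} {1 + z} {b} refl (j₄ x y z a) (k₄ x y z a)) ⟨
    Den (1 + y) (1 + z) b * Den y (1 + z) b * (n * o * X₃ a) ∎
    where
    l = 4 * (2 * s + 5) * (2 * s + 3)
    m = x + 3 * y + 2 * a + 4
    n = 1 + c′ + 2 * a + 4
    o = e′ + 5
    t₁ : ∀ A A′ B B′ C C′ K K′ l m → (A * B * C * K) * (A′ * B′ * C′ * K′) * (l * m) ≡ (A * A′ * l) * (B * B′) * (C * C′) * (K * K′ * m)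
    t₁ = solve-ℕ
    t₂ : ∀ A A′ B B′ n C C′ o K K′ m → (A * A′) * (B * B′ * n) * (C * C′ * o) * (K * K′ * m) ≡ (A * B * C * K) * (A′ * B′ * C′ * K′) * (n * o * m)
    t₂ = solve-ℕ
    j₁ : ∀ x y z a → x + y + 2 * z + 2 * (2 + a) ≡ 1 + (x + y + 2 * z + 2 * a + 3)
    j₁ = solve-ℕ
    j₂ : ∀ x y z a → x + (1 + y) + 2 * (2 + z) + 2 * a ≡ 2 + (x + y + 2 * z + 2 * a + 3)
    j₂ = solve-ℕ
    j₃ : ∀ x y z a → x + (1 + y) + 2 * (1 + z) + 2 * (1 + a) ≡ 2 + (x + y + 2 * z + 2 * a + 3)
    j₃ = solve-ℕ
    j₄ : ∀ x y z a → x + y + 2 * (1 + z) + 2 * (1 + a) ≡ 1 + (x + y + 2 * z + 2 * a + 3)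
    j₄ = solve-ℕ
    k₁ : ∀ x y z a → x + 2 * y + z + 2 * (2 + a) ≡ 4 + (x + 2 * y + z + 2 * a)
    k₁ = solve-ℕ
    k₂ : ∀ x y z a → x + 2 * (1 + y) + (2 + z) + 2 * a ≡ 4 + (x + 2 * y + z + 2 * a)
    k₂ = solve-ℕ
    k₃ : ∀ x y z a → x + 2 * (1 + y) + (1 + z) + 2 * (1 + a) ≡ 5 + (x + 2 * y + z + 2 * a)
    k₃ = solve-ℕ
    k₄ : ∀ x y z a → x + 2 * y + (1 + z) + 2 * (1 + a) ≡ 3 + (x + 2 * y + z + 2 * a)
    k₄ = solve-ℕ

-- Closed form and cross ratio of the factors in the core recurrence.

module CoreRatios where
 open import Data.Nat using (_+_; _*_)
 open import Data.Rational using (-_; _-_) renaming (_*_ to _·_)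
 open Embedding
 open Determinants
 open PathRows
 open Condensation
 open KernelVector
 open KernelAtRows
 open CoreDeterminant
 open FactorialRatios
 open SatelliteRecurrence

 q-*₃ : ∀ a b c → q (a * b * c) ≡ q a · q b · q c
 q-*₃ a b c = trans (q-* (a * b) c) (cong (_· q c) (q-* a b))

 q-*₄ : ∀ a b c d → q (a * b * c * d) ≡ q a · q b · q c · q d
 q-*₄ a b c d = trans (q-* (a * b * c) d) (cong (_· q d) (q-*₃ a b c))

 gnum gden : ℕ → ℕ → ℕ
 gnum x k = fact (x + suc k) * fact (4 * suc k + 2 * x) * fact k * fact (suc k + x + 1)
 gden x k = fact (suc (k + k) + 1 + x) * fact (3 * suc k + 2 * x + 1) * fact (x + 1) * fact (2 * k)

 -- The last kernel entry up to sign; for positive `k` it is the quotient of `M x (k + 1)` by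
 -- `M (3 + x) k`, by `M-recurrence`.
 g : ℕ → ℕ → ℚ
 g x k = ĉ x (suc k) (suc k)

 g-closed : ∀ x k → g x k · q (gden x k) ≡ q (gnum x k)
 g-closed x k = *-cancelˡ (F≢0 k) (begin
  F k · (g x k · q (gden x k))
   ≡⟨ cong (λ w → F k · (g x k · w)) (q-*₄ (fact (suc (k + k) + 1 + x)) (fact (3 * suc k + 2 * x + 1)) (fact (x + 1)) (fact (2 * k))) ⟩
  F k · (g x k · (A · B · C · E))
   ≡⟨ solve 6 (λ k g a b c e → k ⊗ (g ⊗ (a ⊗ b ⊗ c ⊗ e)) ⊜ g ⊗ (Κ 1ℚ ⊗ a ⊗ k ⊗ b) ⊗ (c ⊗ e)) refl (F k) (g x k) A B C E ⟩
  g x k · (1ℚ · A · F k · B) · (C · E)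
   ≡⟨ cong₂ (λ u w → g x k · (1ℚ · A · F k · F u) · (C · F w)) (e₁ k x) (e₂ k) ⟨
  g x k · ĉ-den x k 0 · (F (x + 1) · F (2 * (k + 0)))
   ≡⟨ ĉ-closed x (suc k) k 0 (cong suc (NP.+-identityʳ k)) ⟩
  ĉ-num x k 0 · (F (k + 0) · F (suc k + 0 + x + 1))
   ≡⟨ cong₂ (λ u w → F (x + suc k) · F u · F w · (F (k + 0) · F (suc k + 0 + x + 1))) (e₃ k x) (NP.+-identityʳ k) ⟩
  F (x + suc k) · F (4 * suc k + 2 * x) · F k · (F (k + 0) · F (suc k + 0 + x + 1))
   ≡⟨ cong₂ (λ u w → F (x + suc k) · F (4 * suc k + 2 * x) · F k · (F u · F (suc w + x + 1))) (NP.+-identityʳ k) (NP.+-identityʳ k) ⟩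
  F (x + suc k) · F (4 * suc k + 2 * x) · F k · (F k · F (suc k + x + 1))
   ≡⟨ solve 4 (λ a b k c → a ⊗ b ⊗ k ⊗ (k ⊗ c) ⊜ k ⊗ (a ⊗ b ⊗ k ⊗ c)) refl (F (x + suc k)) (F (4 * suc k + 2 * x)) (F k) (F (suc k + x + 1)) ⟩
  F k · (F (x + suc k) · F (4 * suc k + 2 * x) · F k · F (suc k + x + 1))
   ≡⟨ cong (F k ·_) (q-*₄ (fact (x + suc k)) (fact (4 * suc k + 2 * x)) (fact k) (fact (suc k + x + 1))) ⟨
  F k · q (gnum x k) ∎)
  where
  open ≡-Reasoning
  A = F (suc (k + k) + 1 + x)
  B = F (3 * suc k + 2 * x + 1)
  C = F (x + 1)
  E = F (2 * k)
  e₁ : ∀ k x → 3 * suc k + 0 + 2 * x + 1 ≡ 3 * suc k + 2 * x + 1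
  e₁ = solve-ℕ
  e₂ : ∀ k → 2 * (k + 0) ≡ 2 * k
  e₂ = solve-ℕ
  e₃ : ∀ k x → 4 * suc k + 0 + 2 * x ≡ 4 * suc k + 2 * x
  e₃ = solve-ℕ

 gden≢0 : ∀ x k → gden x k ≢ 0
 gden≢0 x k = *≢0 (*≢0 (*≢0 (fact≢0 (suc (k + k) + 1 + x)) (fact≢0 (3 * suc k + 2 * x + 1))) (fact≢0 (x + 1))) (fact≢0 (2 * k))
  where open Factorials

 gnum≢0 : ∀ x k → gnum x k ≢ 0
 gnum≢0 x k = *≢0 (*≢0 (*≢0 (fact≢0 (x + suc k)) (fact≢0 (4 * suc k + 2 * x))) (fact≢0 k)) (fact≢0 (suc k + x + 1))
  where open Factorials

 gr gr′ : ℕ → ℕ → ℕ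
 gr u s = 2 * (u + s + 5) * (u + s + 6) * (2 * s + 5) * (2 * s + 3)
 gr′ u s = (4 * s + 2 * u + 15) * ((u + 2) * (u + 3) * (u + 4))

 module _ where
  open Factorials using (fact-suc)
  g-cross-ℕ : ∀ u s → gnum u (3 + s) * gden (3 + u) (1 + s) * gr u s ≡ gnum (3 + u) (1 + s) * gden u (3 + s) * gr′ u s
  g-cross-ℕ u s = begin
   gnum u (3 + s) * gden (3 + u) (1 + s) * gr u s
    ≡⟨ cong₂ (λ N D → N * D * gr u s)
      (cong₂ (λ P R → f₁ * P * R * fact (suc (3 + s) + u + 1))
       (cong fact (n₁ s u)) refl)
      (cong₂ (λ P R → f₅ * fact (3 * suc (1 + s) + 2 * (3 + u) + 1) * P * R)
       refl refl) ⟩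
   f₁ * ((2 + (4 * s + 14 + 2 * u)) * ((1 + (4 * s + 14 + 2 * u)) * f₂)) * ((3 + s) * ((2 + s) * f₃)) * f₄
    * (f₅ * fact (3 * suc (1 + s) + 2 * (3 + u) + 1) * ((3 + (u + 1)) * ((2 + (u + 1)) * ((1 + (u + 1)) * f₇))) * f₈) * gr u s
    ≡⟨ cong (λ w → f₁ * ((2 + (4 * s + 14 + 2 * u)) * ((1 + (4 * s + 14 + 2 * u)) * f₂)) * ((3 + s) * ((2 + s) * f₃)) * f₄
      * (f₅ * w * ((3 + (u + 1)) * ((2 + (u + 1)) * ((1 + (u + 1)) * f₇))) * f₈) * gr u s) (cong fact (n₂ s u)) ⟩
   f₁ * ((2 + (4 * s + 14 + 2 * u)) * ((1 + (4 * s + 14 + 2 * u)) * f₂)) * ((3 + s) * ((2 + s) * f₃)) * f₄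
    * (f₅ * f₆ * ((3 + (u + 1)) * ((2 + (u + 1)) * ((1 + (u + 1)) * f₇))) * f₈) * gr u s
    ≡⟨ poly s u f₁ f₂ f₃ f₄ f₅ f₆ f₇ f₈ ⟩
   (((1 + (u + suc (3 + s))) * f₁) * f₂ * f₃ * ((1 + (suc (3 + s) + u + 1)) * f₄))
    * (((1 + (suc (1 + s + (1 + s)) + 1 + (3 + u))) * f₅) * f₆ * f₇ * ((4 + 2 * (1 + s)) * ((3 + 2 * (1 + s)) * ((2 + 2 * (1 + s)) * ((1 + 2 * (1 + s)) * f₈))))) * gr′ u s
    ≡⟨ cong₂ (λ N D → N * D * gr′ u s)
      (cong₂ (λ P R → P * f₂′ * f₃ * R) (cong fact (n₃ s u)) (cong fact (n₄ s u)))
      (cong₂ (λ P R → P * f₆ * f₇ * R) (cong fact (n₅ s u)) (cong fact (n₆ s))) ⟨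
   (fact (3 + u + suc (1 + s)) * f₂′ * f₃ * fact (suc (1 + s) + (3 + u) + 1)) * gden u (3 + s) * gr′ u s
    ≡⟨ cong (λ w → (fact (3 + u + suc (1 + s)) * w * f₃ * fact (suc (1 + s) + (3 + u) + 1)) * gden u (3 + s) * gr′ u s) (cong fact (n₇ s u)) ⟩
   gnum (3 + u) (1 + s) * gden u (3 + s) * gr′ u s ∎
   where
   open ≡-Reasoning
   f₁ f₂ f₂′ f₃ f₄ f₅ f₆ f₇ f₈ : ℕ
   f₁ = fact (u + suc (3 + s))
   f₂ = fact (4 * s + 14 + 2 * u)
   f₂′ = fact (4 * s + 14 + 2 * u)
   f₃ = fact (1 + s)
   f₄ = fact (suc (3 + s) + u + 1)
   f₅ = fact (suc (1 + s + (1 + s)) + 1 + (3 + u))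
   f₆ = fact (3 * suc (3 + s) + 2 * u + 1)
   f₇ = fact (u + 1)
   f₈ = fact (2 * (1 + s))
   n₁ : ∀ s u → 4 * suc (3 + s) + 2 * u ≡ 2 + (4 * s + 14 + 2 * u)
   n₁ = solve-ℕ
   n₂ : ∀ s u → 3 * suc (1 + s) + 2 * (3 + u) + 1 ≡ 3 * suc (3 + s) + 2 * u + 1
   n₂ = solve-ℕ
   n₃ : ∀ s u → 3 + u + suc (1 + s) ≡ 1 + (u + suc (3 + s))
   n₃ = solve-ℕ
   n₄ : ∀ s u → suc (1 + s) + (3 + u) + 1 ≡ 1 + (suc (3 + s) + u + 1)
   n₄ = solve-ℕ
   n₅ : ∀ s u → suc (3 + s + (3 + s)) + 1 + u ≡ 1 + (suc (1 + s + (1 + s)) + 1 + (3 + u))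
   n₅ = solve-ℕ
   n₆ : ∀ s → 2 * (3 + s) ≡ 4 + 2 * (1 + s)
   n₆ = solve-ℕ
   n₇ : ∀ s u → 4 * s + 14 + 2 * u ≡ 4 * suc (1 + s) + 2 * (3 + u)
   n₇ = solve-ℕ
   poly : ∀ s u a b c d e f h k →
    a * ((2 + (4 * s + 14 + 2 * u)) * ((1 + (4 * s + 14 + 2 * u)) * b)) * ((3 + s) * ((2 + s) * c)) * d
     * (e * f * ((3 + (u + 1)) * ((2 + (u + 1)) * ((1 + (u + 1)) * h))) * k)
     * (2 * (u + s + 5) * (u + s + 6) * (2 * s + 5) * (2 * s + 3))
    ≡ (((1 + (u + suc (3 + s))) * a) * b * c * ((1 + (suc (3 + s) + u + 1)) * d))
     * (((1 + (suc (1 + s + (1 + s)) + 1 + (3 + u))) * e) * f * h * ((4 + 2 * (1 + s)) * ((3 + 2 * (1 + s)) * ((2 + 2 * (1 + s)) * ((1 + 2 * (1 + s)) * k)))))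
     * ((4 * s + 2 * u + 15) * ((u + 2) * (u + 3) * (u + 4)))
   poly = solve-ℕ

 -- These are the two factors through which `M-recurrence` reduces a core determinant on the left
 -- and one on the right of the condensation relation; nearly all their factorials agree.
 g-cross : ∀ u s → g u (3 + s) · q (gr u s) ≡ g (3 + u) (1 + s) · q (gr′ u s)
 g-cross u s = *-cancelˡ {D₁ · D₂} (*-≢0 (q-≢0 (gden≢0 u (3 + s))) (q-≢0 (gden≢0 (3 + u) (1 + s)))) (begin
  D₁ · D₂ · (g₁ · q (gr u s)) ≡⟨ solve 4 (λ a b c d → a ⊗ b ⊗ (c ⊗ d) ⊜ (c ⊗ a) ⊗ b ⊗ d) refl D₁ D₂ g₁ (q (gr u s)) ⟩
  g₁ · D₁ · D₂ · q (gr u s) ≡⟨ cong (λ w → w · D₂ · q (gr u s)) (g-closed u (3 + s)) ⟩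
  q (gnum u (3 + s)) · D₂ · q (gr u s) ≡⟨ q-*₃ (gnum u (3 + s)) (gden (3 + u) (1 + s)) (gr u s) ⟨
  q (gnum u (3 + s) * gden (3 + u) (1 + s) * gr u s) ≡⟨ cong q (g-cross-ℕ u s) ⟩
  q (gnum (3 + u) (1 + s) * gden u (3 + s) * gr′ u s) ≡⟨ q-*₃ (gnum (3 + u) (1 + s)) (gden u (3 + s)) (gr′ u s) ⟩
  q (gnum (3 + u) (1 + s)) · D₁ · q (gr′ u s) ≡⟨ cong (λ w → w · D₁ · q (gr′ u s)) (g-closed (3 + u) (1 + s)) ⟨
  g₂ · D₂ · D₁ · q (gr′ u s) ≡⟨ solve 4 (λ a b c d → c ⊗ b ⊗ a ⊗ d ⊜ a ⊗ b ⊗ (c ⊗ d)) refl D₁ D₂ g₂ (q (gr′ u s)) ⟩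
  D₁ · D₂ · (g₂ · q (gr′ u s)) ∎)
  where
  open ≡-Reasoning
  D₁ = q (gden u (3 + s))
  D₂ = q (gden (3 + u) (1 + s))
  g₁ = g u (3 + s)
  g₂ = g (3 + u) (1 + s)

 g≢0 : ∀ x k → g x k ≢ 0ℚ
 g≢0 x k e = q-≢0 (gnum≢0 x k) (trans (sym (g-closed x k)) (trans (cong (_· q (gden x k)) e) (QP.*-zeroˡ (q (gden x k)))))

 M-1 : ∀ x → M x 1 ≡ 1ℚ
 M-1 x = cong (λ w → w · 1ℚ - 0ℚ) (v-0-0 (x + 0))

 M≢0 : ∀ x T → M x (suc T) ≢ 0ℚ
 M≢0 x zero e with () ← trans (sym (M-1 x)) e
 M≢0 x (suc T) = subst (_≢ 0ℚ) (sym (M-recurrence x T)) (*-≢0 {g x (suc T)} (g≢0 x (suc T)) (M≢0 (3 + x) T))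

-- Product formula for `Q` by induction on the size of the satellite.

module DeterminantProduct where
 open import Data.Nat using (_+_; _*_)
 open import Data.Rational using (-_; _-_) renaming (_*_ to _·_)
 open Embedding
 open Determinants
 open PathRows
 open Condensation
 open KernelVector
 open KernelAtRows
 open CoreDeterminant
 open FactorialRatios
 open SatelliteRecurrence
 open CoreRatios

 open import Algebra.Solver.CommutativeMonoid NP.*-1-commutativeMonoid using () renaming (solve to solve-×; _⊕_ to infixl 7 _⊡_; _⊜_ to infix 4 _≑_)

 module ClosedForm (x : ℕ) where
  open Factorials
  open Satellite x
  open ≡-Reasoning
  Num≢0 : ∀ y z a → Num y z a ≢ 0
  Num≢0 y z a = *≢0 (*≢0 (*≢0 (Jf≢0 z a) (J₂≢0 (x + 3 * y + 2 * z + 2 * a) a)) (J₁≢0 (x + y + z + 2 * a) a))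
   (Π≢0 a (λ i → *≢0 (*≢0 (fact≢0 (suc (x + y + (i + i)))) (fact≢0 (suc (x + 3 * y + 3 * i)))) (fact≢0 i)))
  Den≢0 : ∀ y z a → Den y z a ≢ 0
  Den≢0 y z a = *≢0 (*≢0 (*≢0 (Jf≢0 (z + y) a) (J₂≢0 (x + y + 2 * z + 2 * a) a)) (J₁≢0 (x + 2 * y + z + 2 * a) a))
   (Π≢0 a (λ i → *≢0 (*≢0 (fact≢0 (suc (x + 3 * i))) (fact≢0 (suc (x + 3 * y + (i + i))))) (fact≢0 (i + y))))
  Num-1 : ∀ y z → Num y z 1 ≡ ff z * fact (x + 3 * y + 2 * z + 4) * fact (x + y + z + 3) * (fact (x + y + 1) * fact (x + 3 * y + 1))
  Num-1 y z = trans
   (cong₂ (λ u w → u * w) (cong₂ _*_ (cong₂ _*_ (trans (NP.*-identityˡ (ff (z + 0))) (cong ff (NP.+-identityʳ z)))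
     (trans (NP.*-identityˡ (fact (suc (suc (x + 3 * y + 2 * z + 2 + 0))))) (cong fact (e₁ x y z))))
     (trans (NP.*-identityˡ (fact (suc (x + y + z + 2 + 0)))) (cong fact (e₂ x y z))))
    (trans (e₅ (fact (suc (x + y + 0))) (fact (suc (x + 3 * y + 0)))) (cong₂ (λ u w → fact u * fact w) (e₃ x y) (e₄ x y))))
   refl
   where
   e₁ : ∀ x y z → suc (suc (x + 3 * y + 2 * z + 2 + 0)) ≡ x + 3 * y + 2 * z + 4
   e₁ = solve-ℕ
   e₂ : ∀ x y z → suc (x + y + z + 2 + 0) ≡ x + y + z + 3
   e₂ = solve-ℕ
   e₃ : ∀ x y → suc (x + y + 0) ≡ x + y + 1
   e₃ = solve-ℕ
   e₄ : ∀ x y → suc (x + 3 * y + 0) ≡ x + 3 * y + 1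
   e₄ = solve-ℕ
   e₅ : ∀ a b → 1 * (a * b * 1) ≡ a * b
   e₅ = solve-ℕ
  Den-1 : ∀ y z → Den y z 1 ≡ ff (z + y) * fact (x + y + 2 * z + 4) * fact (x + 2 * y + z + 3) * (fact (x + 1) * fact (x + 3 * y + 1) * fact y)
  Den-1 y z =
   cong₂ (λ u w → u * w) (cong₂ _*_ (cong₂ _*_ (trans (NP.*-identityˡ (ff (z + y + 0))) (cong ff (NP.+-identityʳ (z + y))))
     (trans (NP.*-identityˡ (fact (suc (suc (x + y + 2 * z + 2 + 0))))) (cong fact (e₁ x y z))))
     (trans (NP.*-identityˡ (fact (suc (x + 2 * y + z + 2 + 0)))) (cong fact (e₂ x y z))))
    (trans (NP.*-identityˡ (fact (suc (x + 0)) * fact (suc (x + 3 * y + 0)) * fact y)) (cong₂ (λ u w → fact u * fact w * fact y) (e₃ x) (e₄ x y)))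
   where
   e₁ : ∀ x y z → suc (suc (x + y + 2 * z + 2 + 0)) ≡ x + y + 2 * z + 4
   e₁ = solve-ℕ
   e₂ : ∀ x y z → suc (x + 2 * y + z + 2 + 0) ≡ x + 2 * y + z + 3
   e₂ = solve-ℕ
   e₃ : ∀ x → suc (x + 0) ≡ x + 1
   e₃ = solve-ℕ
   e₄ : ∀ x y → suc (x + 3 * y + 0) ≡ x + 3 * y + 1
   e₄ = solve-ℕ
  -- The coefficients of `κ-v-step` at `i = y`.
  ka kb : ℕ → ℕ → ℕ
  ka y d = (y + x + 2) * (3 * y + 2 * d + x + 5) * (y + 2 * d + x + 4)
  kb y d = suc y * (2 * d + 1) * (2 * (2 * y + d + x + 4))
  one-step : ∀ y z → ka y (suc z) * Num y (suc z) 1 * Den (suc y) z 1 ≡ kb y (suc z) * Den y (suc z) 1 * Num (suc y) z 1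
  one-step y z = begin
   ka y (suc z) * Num y (suc z) 1 * Den (suc y) z 1
    ≡⟨ cong₂ (λ u w → ka y (suc z) * u * w) (Num-1 y (suc z)) (Den-1 (suc y) z) ⟩
   ka y (suc z) * (ff (suc z) * fact (x + 3 * y + 2 * suc z + 4) * fact (x + y + suc z + 3) * (f₁ * f₂))
    * (ff (z + suc y) * fact (x + suc y + 2 * z + 4) * fact (x + 2 * suc y + z + 3) * (f₃ * fact (x + 3 * suc y + 1) * fact (suc y)))
    ≡⟨ cong₂ (λ u w → ka y (suc z) * u * w)
       (cong₂ (λ u w → ff (suc z) * u * w * (f₁ * f₂)) (cong fact (n₁ x y z)) (cong fact (n₂ x y z)))
       (cong₂ (λ u w → u * f₆ * w * (f₃ * f₇ * fact (suc y))) (cong ff (+-suc z y)) (cong fact (n₃ x y z))) ⟩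
   ka y (suc z) * (ff (suc z) * f₄ * f₅ * (f₁ * f₂)) * (h * f₆ * (suc (x + 2 * y + suc z + 3) * f₈) * (f₃ * f₇ * (suc y * fact y)))
    ≡⟨ cong (λ u → u * (ff (suc z) * f₄ * f₅ * (f₁ * f₂)) * (h * f₆ * (suc (x + 2 * y + suc z + 3) * f₈) * (f₃ * f₇ * (suc y * fact y))))
       (cong₂ _*_ (cong₂ _*_ (l₁ x y) (l₂ x y z)) (l₃ x y z)) ⟩
   suc (x + y + 1) * suc (x + 3 * y + 2 * z + 6) * suc (x + suc y + 2 * z + 4) * (ff (suc z) * f₄ * f₅ * (f₁ * f₂)) * (h * f₆ * (suc (x + 2 * y + suc z + 3) * f₈) * (f₃ * f₇ * (suc y * fact y)))
    ≡⟨ monomial 2 (suc (x + y + 1)) (suc (x + 3 * y + 2 * z + 6)) (suc (x + suc y + 2 * z + 4)) (2 * z + 3) (suc (x + 2 * y + suc z + 3)) (suc y) (ff z) h f₁ f₂ f₃ f₄ f₅ f₆ f₇ f₈ (fact y) ⟩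
   suc y * (2 * z + 3) * (2 * suc (x + 2 * y + suc z + 3)) * (h * (suc (x + suc y + 2 * z + 4) * f₆) * f₈ * (f₃ * f₂ * fact y)) * (ff z * (suc (x + 3 * y + 2 * z + 6) * f₄) * f₅ * (suc (x + y + 1) * f₁ * f₇))
    ≡⟨ cong₂ (λ u w → suc y * u * (2 * w) * (h * (suc (x + suc y + 2 * z + 4) * f₆) * f₈ * (f₃ * f₂ * fact y)) * (ff z * (suc (x + 3 * y + 2 * z + 6) * f₄) * f₅ * (suc (x + y + 1) * f₁ * f₇)))
       (l₄ z) (l₅ x y z) ⟨
   kb y (suc z) * (h * (suc (x + suc y + 2 * z + 4) * f₆) * f₈ * (f₃ * f₂ * fact y)) * (ff z * (suc (x + 3 * y + 2 * z + 6) * f₄) * f₅ * (suc (x + y + 1) * f₁ * f₇))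
    ≡⟨ cong₂ (λ u w → kb y (suc z) * u * w)
       (cong (λ u → h * u * f₈ * (f₃ * f₂ * fact y)) (cong fact (n₄ x y z)))
       (cong₂ (λ u w → ff z * u * f₅ * (w * f₇)) (cong fact (n₅ x y z)) (cong fact (n₆ x y))) ⟨
   kb y (suc z) * (h * fact (x + y + 2 * suc z + 4) * f₈ * (f₃ * f₂ * fact y)) * (ff z * fact (x + 3 * suc y + 2 * z + 4) * f₅ * (fact (x + suc y + 1) * f₇))
    ≡⟨ cong₂ (λ u w → kb y (suc z) * u * w) (Den-1 y (suc z)) (Num-1 (suc y) z) ⟨
   kb y (suc z) * Den y (suc z) 1 * Num (suc y) z 1 ∎
   where
   h f₁ f₂ f₃ f₄ f₅ f₆ f₇ f₈ : ℕ
   h = ff (suc z + y)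
   f₁ = fact (x + y + 1)
   f₂ = fact (x + 3 * y + 1)
   f₃ = fact (x + 1)
   f₄ = fact (x + 3 * y + 2 * z + 6)
   f₅ = fact (x + suc y + z + 3)
   f₆ = fact (x + suc y + 2 * z + 4)
   f₇ = fact (x + 3 * suc y + 1)
   f₈ = fact (x + 2 * y + suc z + 3)
   n₁ : ∀ x y z → x + 3 * y + 2 * suc z + 4 ≡ x + 3 * y + 2 * z + 6
   n₁ = solve-ℕ
   n₂ : ∀ x y z → x + y + suc z + 3 ≡ x + suc y + z + 3
   n₂ = solve-ℕ
   n₃ : ∀ x y z → x + 2 * suc y + z + 3 ≡ suc (x + 2 * y + suc z + 3)
   n₃ = solve-ℕ
   n₄ : ∀ x y z → x + y + 2 * suc z + 4 ≡ suc (x + suc y + 2 * z + 4)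
   n₄ = solve-ℕ
   n₅ : ∀ x y z → x + 3 * suc y + 2 * z + 4 ≡ suc (x + 3 * y + 2 * z + 6)
   n₅ = solve-ℕ
   n₆ : ∀ x y → x + suc y + 1 ≡ suc (x + y + 1)
   n₆ = solve-ℕ
   l₁ : ∀ x y → y + x + 2 ≡ suc (x + y + 1)
   l₁ = solve-ℕ
   l₂ : ∀ x y z → 3 * y + 2 * suc z + x + 5 ≡ suc (x + 3 * y + 2 * z + 6)
   l₂ = solve-ℕ
   l₃ : ∀ x y z → y + 2 * suc z + x + 4 ≡ suc (x + suc y + 2 * z + 4)
   l₃ = solve-ℕ
   l₄ : ∀ z → 2 * suc z + 1 ≡ 2 * z + 3
   l₄ = solve-ℕ
   l₅ : ∀ x y z → 2 * y + suc z + x + 4 ≡ suc (x + 2 * y + suc z + 3)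
   l₅ = solve-ℕ
   -- With the linear factors treated as atoms both sides are one monomial, and only a reordering is
   -- left.
   monomial : ∀ t a b c d e y f h f₁ f₂ f₃ f₄ f₅ f₆ f₇ f₈ k →
    a * b * c * (t * d * f * f₄ * f₅ * (f₁ * f₂)) * (h * f₆ * (e * f₈) * (f₃ * f₇ * (y * k)))
    ≡ y * d * (t * e) * (h * (c * f₆) * f₈ * (f₃ * f₂ * k)) * (f * (b * f₄) * f₅ * (a * f₁ * f₇))
   monomial = solve-× 18 (λ t a b c d e y f h f₁ f₂ f₃ f₄ f₅ f₆ f₇ f₈ k →
    a ⊡ b ⊡ c ⊡ (t ⊡ d ⊡ f ⊡ f₄ ⊡ f₅ ⊡ (f₁ ⊡ f₂)) ⊡ (h ⊡ f₆ ⊡ (e ⊡ f₈) ⊡ (f₃ ⊡ f₇ ⊡ (y ⊡ k)))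
    ≑ y ⊡ d ⊡ (t ⊡ e) ⊡ (h ⊡ (c ⊡ f₆) ⊡ f₈ ⊡ (f₃ ⊡ f₂ ⊡ k)) ⊡ (f ⊡ (b ⊡ f₄) ⊡ f₅ ⊡ (a ⊡ f₁ ⊡ f₇))) refl
  -- Induction on `y` with `y + z`, and hence `T`, kept constant: the first-order recurrence of the
  -- kernel values trades `y + 1`, `z` for `y`, `z + 1`.
  ε-closed : ∀ y z → ε x (2 + (y + z)) y · q (Den y z 1) ≡ q (Num y z 1)
  ε-closed zero z = trans (cong₂ (λ u w → 1ℚ · u · q w) (KernelValues.κ-v-0 x (2 + z) (s≤s z≤n)) base) (QP.*-identityˡ (q (Num 0 z 1)))
   where
   base : Den 0 z 1 ≡ Num 0 z 1
   base = trans (Den-1 0 z) (trans (trans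
    (cong₂ (λ u w → ff u * fact (x + 0 + 2 * z + 4) * fact (x + 0 + z + 3) * (fact (w + 1) * fact (x + 0 + 1) * 1)) (NP.+-identityʳ z) (sym (NP.+-identityʳ x)))
    (cong (λ w → ff z * fact (x + 0 + 2 * z + 4) * fact (x + 0 + z + 3) * w) (NP.*-identityʳ _))) (sym (Num-1 0 z)))
  ε-closed (suc y) z = *-cancelˡ {B · D₀} (*-≢0 (*-≢0 (*-≢0 (q-suc≢0 y) (q-≢0 b₁≢0)) (q-≢0 b₂≢0)) (q-≢0 (Den≢0 y (suc z) 1))) (begin
   B · D₀ · (ε x T (suc y) · D′) ≡⟨ solve 5 (λ b d s k e → b ⊗ d ⊗ ((⊝ s) ⊗ k ⊗ e) ⊜ s ⊗ (⊝ (b ⊗ k)) ⊗ d ⊗ e) refl B D₀ (sgn y) (κ-v (suc y)) D′ ⟩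
   sgn y · - (B · κ-v (suc y)) · D₀ · D′ ≡⟨ cong (λ w → sgn y · w · D₀ · D′) (κ-v-step y (suc z) eq) ⟨
   sgn y · (A · κ-v y) · D₀ · D′ ≡⟨ solve 5 (λ s a k d e → s ⊗ (a ⊗ k) ⊗ d ⊗ e ⊜ a ⊗ (s ⊗ k ⊗ d) ⊗ e) refl (sgn y) A (κ-v y) D₀ D′ ⟩
   A · (ε x T y · D₀) · D′ ≡⟨ cong (λ w → A · w · D′) (trans (cong (λ t → ε x t y · D₀) (cong (λ w → suc (suc w)) (sym (+-suc y z)))) (ε-closed y (suc z))) ⟩
   A · q (Num y (suc z) 1) · D′ ≡⟨ cong (λ w → w · q (Num y (suc z) 1) · D′) (q-*₃ (y + x + 2) (3 * y + 2 * suc z + x + 5) (y + 2 * suc z + x + 4)) ⟨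
   q (ka y (suc z)) · q (Num y (suc z) 1) · D′ ≡⟨ q-*₃ (ka y (suc z)) (Num y (suc z) 1) (Den (suc y) z 1) ⟨
   q (ka y (suc z) * Num y (suc z) 1 * Den (suc y) z 1) ≡⟨ cong q (one-step y z) ⟩
   q (kb y (suc z) * Den y (suc z) 1 * Num (suc y) z 1) ≡⟨ q-*₃ (kb y (suc z)) (Den y (suc z) 1) (Num (suc y) z 1) ⟩
   q (kb y (suc z)) · D₀ · q (Num (suc y) z 1) ≡⟨ cong (λ w → w · D₀ · q (Num (suc y) z 1)) (q-*₃ (suc y) (2 * suc z + 1) (2 * (2 * y + suc z + x + 4))) ⟩
   B · D₀ · q (Num (suc y) z 1) ∎)
   where
   T = 2 + (suc y + z)
   open KernelValues x T using (κ-v; κ-v-step)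
   A = q (y + x + 2) · q (3 * y + 2 * suc z + x + 5) · q (y + 2 * suc z + x + 4)
   B = q (suc y) · q (2 * suc z + 1) · q (2 * (2 * y + suc z + x + 4))
   D₀ = q (Den y (suc z) 1)
   D′ = q (Den (suc y) z 1)
   eq : y + 2 + suc z ≡ T
   eq = e y z
    where
    e : ∀ y z → y + 2 + suc z ≡ 2 + (suc y + z)
    e = solve-ℕ
   b₁≢0 : 2 * suc z + 1 ≢ 0
   b₁≢0 e with () ← m+n≡0⇒n≡0 (2 * suc z) e
   b₂≢0 : 2 * (2 * y + suc z + x + 4) ≢ 0
   b₂≢0 e with () ← m+n≡0⇒n≡0 (2 * y + suc z + x) (NP.m+n≡0⇒m≡0 (2 * y + suc z + x + 4) e)
  B : ℕ → ℕ → ℕ → ℚ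
  B y z a = q (Num y z a) · inv (q (Den y z a))
  B-Den : ∀ y z a → B y z a · q (Den y z a) ≡ q (Num y z a)
  B-Den y z a = trans (solve 3 (λ n i d → n ⊗ i ⊗ d ⊜ n ⊗ (d ⊗ i)) refl (q (Num y z a)) (inv (q (Den y z a))) (q (Den y z a)))
   (trans (cong (q (Num y z a) ·_) (inv-inverseʳ (q-≢0 (Den≢0 y z a)))) (QP.*-identityʳ (q (Num y z a))))
  B≢0 : ∀ y z a → B y z a ≢ 0ℚ
  B≢0 y z a = *-≢0 (q-≢0 (Num≢0 y z a)) (inv-≢0 (q-≢0 (Den≢0 y z a)))
  -- Cross ratios of B from those of its numerators and denominators.
  B-cross : ∀ y₁ z₁ a₁ y₂ z₂ a₂ y₃ z₃ a₃ y₄ z₄ a₄ {l m l′ m′} →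
   Num y₁ z₁ a₁ * Num y₂ z₂ a₂ * l ≡ Num y₃ z₃ a₃ * Num y₄ z₄ a₄ * m →
   Den y₁ z₁ a₁ * Den y₂ z₂ a₂ * l′ ≡ Den y₃ z₃ a₃ * Den y₄ z₄ a₄ * m′ →
   B y₁ z₁ a₁ · B y₂ z₂ a₂ · (q l · q m′) ≡ B y₃ z₃ a₃ · B y₄ z₄ a₄ · (q m · q l′)
  B-cross y₁ z₁ a₁ y₂ z₂ a₂ y₃ z₃ a₃ y₄ z₄ a₄ {l} {m} {l′} {m′} en ed =
   *-cancelˡ {D₁ · D₂ · (D₃ · D₄)} (*-≢0 (*-≢0 (nz y₁ z₁ a₁) (nz y₂ z₂ a₂)) (*-≢0 (nz y₃ z₃ a₃) (nz y₄ z₄ a₄))) (begin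
   D₁ · D₂ · (D₃ · D₄) · (B₁ · B₂ · (q l · q m′))
    ≡⟨ solve 8 (λ a b c d e f l m → a ⊗ b ⊗ (c ⊗ d) ⊗ (e ⊗ f ⊗ (l ⊗ m)) ⊜ ((e ⊗ a) ⊗ (f ⊗ b) ⊗ l) ⊗ (c ⊗ d ⊗ m)) refl D₁ D₂ D₃ D₄ B₁ B₂ (q l) (q m′) ⟩
   (B₁ · D₁) · (B₂ · D₂) · q l · (D₃ · D₄ · q m′)
    ≡⟨ cong₂ (λ u w → u · q l · w) (cong₂ _·_ (B-Den y₁ z₁ a₁) (B-Den y₂ z₂ a₂)) (trans (sym (q-*₃ (Den y₃ z₃ a₃) (Den y₄ z₄ a₄) m′)) (trans (cong q (sym ed)) (q-*₃ (Den y₁ z₁ a₁) (Den y₂ z₂ a₂) l′))) ⟩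
   q (Num y₁ z₁ a₁) · q (Num y₂ z₂ a₂) · q l · (D₁ · D₂ · q l′)
    ≡⟨ cong (_· (D₁ · D₂ · q l′)) (trans (sym (q-*₃ (Num y₁ z₁ a₁) (Num y₂ z₂ a₂) l)) (trans (cong q en) (q-*₃ (Num y₃ z₃ a₃) (Num y₄ z₄ a₄) m))) ⟩
   q (Num y₃ z₃ a₃) · q (Num y₄ z₄ a₄) · q m · (D₁ · D₂ · q l′)
    ≡⟨ cong (λ u → u · q m · (D₁ · D₂ · q l′)) (cong₂ _·_ (B-Den y₃ z₃ a₃) (B-Den y₄ z₄ a₄)) ⟨
   (B₃ · D₃) · (B₄ · D₄) · q m · (D₁ · D₂ · q l′)
    ≡⟨ solve 8 (λ a b c d e f l m → (e ⊗ c) ⊗ (f ⊗ d) ⊗ l ⊗ (a ⊗ b ⊗ m) ⊜ a ⊗ b ⊗ (c ⊗ d) ⊗ (e ⊗ f ⊗ (l ⊗ m))) refl D₁ D₂ D₃ D₄ B₃ B₄ (q m) (q l′) ⟩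
   D₁ · D₂ · (D₃ · D₄) · (B₃ · B₄ · (q m · q l′)) ∎)
   where
   nz : ∀ y z a → q (Den y z a) ≢ 0ℚ
   nz y z a = q-≢0 (Den≢0 y z a)
   D₁ = q (Den y₁ z₁ a₁)
   D₂ = q (Den y₂ z₂ a₂)
   D₃ = q (Den y₃ z₃ a₃)
   D₄ = q (Den y₄ z₄ a₄)
   B₁ = B y₁ z₁ a₁
   B₂ = B y₂ z₂ a₂
   B₃ = B y₃ z₃ a₃
   B₄ = B y₄ z₄ a₄
  -- The closed form: a core enlarged by 3 for each unit of `a`, times the satellite factor. Writing
  -- `a * 3 + x` makes a step in `a` add 3 by computation.
  Φ : ℕ → ℕ → ℕ → ℚ
  Φ y z a = M (a * 3 + x) (suc (y + z)) · B y z a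
  Φ≢0 : ∀ y z a → Φ y z a ≢ 0ℚ
  Φ≢0 y z a = *-≢0 (M≢0 (a * 3 + x) (y + z)) (B≢0 y z a)
  module _ (y z a : ℕ) where
   open Step y z a using (num-α; den-α; num-β; den-β; c; c′; e; e′; s; b)
   private
    u = a * 3 + x
    B₁ = B y z (2 + a)
    B₂ = B (1 + y) (2 + z) a
    B₃ = B (1 + y) (1 + z) (1 + a)
    B₄ = B y (1 + z) (1 + a)
    B₅ = B y (2 + z) (1 + a)
    B₆ = B (1 + y) z (1 + a)
    -- Relative to the last product of the condensation relation, the left side and the first
    -- product are in the proportions `αα` to `dd` and `ββ` to `dd`.
    dd αα ββ : ℕ
    dd = (2 * z + 3) * (c + 2 * b + 3) * ((c′ + 2 * b + 3) * (2 + e′ + 3))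
    ββ = (2 * z + 2 * b + 3) * (c + 3) * ((c′ + 3) * (2 + e′ + b + 3))
    αα = (4 * s + 2 * u + 15) * ((x + y + 2 * a + 3) * (a + 1)) * (x + 3 * y + 2 * a + 4)
    G₄ = g u (3 + s)
    G₂ = g (3 + u) (1 + s)
   -- All that remains of condensation when the common factors have been removed.
   αα+dd≡ββ : αα + dd ≡ ββ
   αα+dd≡ββ = poly x y z a
    where
    poly : ∀ x y z a → (4 * (z + y) + 2 * (a * 3 + x) + 15) * ((x + y + 2 * a + 3) * (a + 1)) * (x + 3 * y + 2 * a + 4)
     + (2 * z + 3) * (x + 3 * y + 2 * z + 2 * a + 4 + 2 * (1 + a) + 3) * ((x + y + 2 * z + 2 * a + 3 + 2 * (1 + a) + 3) * (2 + (x + 2 * y + z + 2 * a) + 3))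
     ≡ (2 * z + 2 * (1 + a) + 3) * (x + 3 * y + 2 * z + 2 * a + 4 + 3) * ((x + y + 2 * z + 2 * a + 3 + 3) * (2 + (x + 2 * y + z + 2 * a) + (1 + a) + 3))
    poly = solve-ℕ
   β-ratio : B₅ · B₆ · q dd ≡ B₃ · B₄ · q ββ
   β-ratio = trans (cong (B₅ · B₆ ·_) (q-* ((2 * z + 3) * (c + 2 * b + 3)) ((c′ + 2 * b + 3) * (2 + e′ + 3))))
    (trans (B-cross y (2 + z) b (1 + y) z b (1 + y) (1 + z) b y (1 + z) b num-β den-β)
     (cong (B₃ · B₄ ·_) (sym (q-* ((2 * z + 2 * b + 3) * (c + 3)) ((c′ + 3) * (2 + e′ + b + 3))))))
   α-ratio : G₄ · (B₁ · B₂) · q dd ≡ G₂ · (B₃ · B₄) · q αα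
   α-ratio = *-cancelˡ {q (2 * X₃ a * gr u s)} (q-≢0 (*≢0 (*≢0 {2} (λ ()) X₃≢0) gr≢0)) (begin
    q (2 * X₃ a * gr u s) · (G₄ · (B₁ · B₂) · q dd)
     ≡⟨ cong (_· (G₄ · (B₁ · B₂) · q dd)) (q-*₃ 2 (X₃ a) (gr u s)) ⟩
    q 2 · q (X₃ a) · q (gr u s) · (G₄ · (B₁ · B₂) · q dd)
     ≡⟨ solve 6 (λ t X r G P d → t ⊗ X ⊗ r ⊗ (G ⊗ P ⊗ d) ⊜ (G ⊗ r) ⊗ (P ⊗ (t ⊗ X ⊗ d))) refl (q 2) (q (X₃ a)) (q (gr u s)) G₄ (B₁ · B₂) (q dd) ⟩
    (G₄ · q (gr u s)) · (B₁ · B₂ · (q 2 · q (X₃ a) · q dd))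
     ≡⟨ cong₂ (λ v w → v · (B₁ · B₂ · w)) (g-cross u s) (trans (sym (q-*₃ 2 (X₃ a) dd)) (trans (cong q dd-form) (q-* l m′))) ⟩
    (G₂ · q (gr′ u s)) · (B₁ · B₂ · (q l · q m′))
     ≡⟨ cong ((G₂ · q (gr′ u s)) ·_) (B-cross y z (2 + a) (1 + y) (2 + z) a (1 + y) (1 + z) b y (1 + z) b num-α den-α) ⟩
    (G₂ · q (gr′ u s)) · (B₃ · B₄ · (q m · q l′))
     ≡⟨ solve 5 (λ G r P m l → G ⊗ r ⊗ (P ⊗ (m ⊗ l)) ⊜ G ⊗ P ⊗ (r ⊗ m ⊗ l)) refl G₂ (q (gr′ u s)) (B₃ · B₄) (q m) (q l′) ⟩
    G₂ · (B₃ · B₄) · (q (gr′ u s) · q m · q l′)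
     ≡⟨ cong (G₂ · (B₃ · B₄) ·_) (trans (sym (q-*₃ (gr′ u s) m l′)) (trans (cong q αα-form) (q-*₄ 2 (X₃ a) (gr u s) αα))) ⟩
    G₂ · (B₃ · B₄) · (q 2 · q (X₃ a) · q (gr u s) · q αα)
     ≡⟨ solve 6 (λ t X r G P d → G ⊗ P ⊗ (t ⊗ X ⊗ r ⊗ d) ⊜ t ⊗ X ⊗ r ⊗ (G ⊗ P ⊗ d)) refl (q 2) (q (X₃ a)) (q (gr u s)) G₂ (B₃ · B₄) (q αα) ⟩
    q 2 · q (X₃ a) · q (gr u s) · (G₂ · (B₃ · B₄) · q αα)
     ≡⟨ cong (_· (G₂ · (B₃ · B₄) · q αα)) (q-*₃ 2 (X₃ a) (gr u s)) ⟨
    q (2 * X₃ a * gr u s) · (G₂ · (B₃ · B₄) · q αα) ∎)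
    where
    l m l′ m′ : ℕ
    l = 2 * (2 * z + 3) * (c + 2 * a + 5)
    m = (e + a + 5) * (e + a + 6) * ((x + y + 2 * a + 3) * (a + 1))
    l′ = 4 * (2 * s + 5) * (2 * s + 3) * (x + 3 * y + 2 * a + 4)
    m′ = (1 + c′ + 2 * a + 4) * (e′ + 5) * X₃ a
    n≢0 : ∀ m n → m + suc n ≢ 0
    n≢0 m n e with () ← m+n≡0⇒n≡0 m e
    X₃≢0 : X₃ a ≢ 0
    X₃≢0 = *≢0 (*≢0 (n≢0 (x + 3 * a) 1) (n≢0 (x + 3 * a) 2)) (n≢0 (x + 3 * a) 3)
    gr≢0 : gr u s ≢ 0
    gr≢0 = *≢0 (*≢0 (*≢0 (*≢0 {2} (λ ()) (n≢0 (u + s) 4)) (n≢0 (u + s) 5)) (n≢0 (2 * s) 4)) (n≢0 (2 * s) 2)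
    dd-form : 2 * X₃ a * dd ≡ l * m′
    dd-form = trans (cong₂ (λ v w → 2 * X₃ a * ((2 * z + 3) * v * w)) (e₁ c a) (cong₂ _*_ (e₂ c′ a) (e₃ e′)))
      (e₄ (X₃ a) (2 * z + 3) (c + 2 * a + 5) (1 + c′ + 2 * a + 4) (e′ + 5))
     where
     e₁ : ∀ c a → c + 2 * (1 + a) + 3 ≡ c + 2 * a + 5
     e₁ = solve-ℕ
     e₂ : ∀ c a → c + 2 * (1 + a) + 3 ≡ 1 + c + 2 * a + 4
     e₂ = solve-ℕ
     e₃ : ∀ e → 2 + e + 3 ≡ e + 5
     e₃ = solve-ℕ
     e₄ : ∀ X p r t v → 2 * X * (p * r * (t * v)) ≡ (2 * p * r) * (t * v * X)
     e₄ = solve-ℕ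
    αα-form : gr′ u s * m * l′ ≡ 2 * X₃ a * gr u s * αα
    αα-form = trans
     (cong₂ (λ v w → (4 * s + 2 * u + 15) * v * (w * ((x + y + 2 * a + 3) * (a + 1))) * l′)
      (cong₂ _*_ (cong₂ _*_ (e₁ a x 2) (e₁ a x 3)) (e₁ a x 4)) (cong₂ _*_ (e₂ x y z a 5) (e₂ x y z a 6)))
     (e₃ (4 * s + 2 * u + 15) (X₃ a) (u + s + 5) (u + s + 6) ((x + y + 2 * a + 3) * (a + 1)) (2 * s + 5) (2 * s + 3) (x + 3 * y + 2 * a + 4))
     where
     e₁ : ∀ a x k → a * 3 + x + k ≡ x + 3 * a + k
     e₁ = solve-ℕ
     e₂ : ∀ x y z a k → x + y + z + 2 * a + a + k ≡ a * 3 + x + (z + y) + k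
     e₂ = solve-ℕ
     e₃ : ∀ A X p r o t v w → A * X * (p * r * o) * (4 * t * v * w) ≡ 2 * X * (2 * p * r * t * v) * (A * o * w)
     e₃ = solve-ℕ
   B-identity : G₄ · (B₁ · B₂) ≡ G₂ · (B₅ · B₆ - B₃ · B₄)
   B-identity = *-cancelˡ {q dd} (q-≢0 {dd} dd≢0) (begin
    q dd · (G₄ · (B₁ · B₂)) ≡⟨ trans (QP.*-comm (q dd) (G₄ · (B₁ · B₂))) α-ratio ⟩
    G₂ · (B₃ · B₄) · q αα ≡⟨ solve 4 (λ G P a d → G ⊗ P ⊗ a ⊜ G ⊗ (P ⊗ (a ⊕ d) ⊖ d ⊗ P)) refl G₂ (B₃ · B₄) (q αα) (q dd) ⟩
    G₂ · (B₃ · B₄ · (q αα ℚ.+ q dd) - q dd · (B₃ · B₄)) ≡⟨ cong (λ w → G₂ · (B₃ · B₄ · w - q dd · (B₃ · B₄))) (trans (sym (q-+ αα dd)) (cong q αα+dd≡ββ)) ⟩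
    G₂ · (B₃ · B₄ · q ββ - q dd · (B₃ · B₄)) ≡⟨ cong (λ w → G₂ · (w - q dd · (B₃ · B₄))) β-ratio ⟨
    G₂ · (B₅ · B₆ · q dd - q dd · (B₃ · B₄)) ≡⟨ solve 4 (λ G P R d → G ⊗ (P ⊗ d ⊖ d ⊗ R) ⊜ d ⊗ (G ⊗ (P ⊖ R))) refl G₂ (B₅ · B₆) (B₃ · B₄) (q dd) ⟩
    q dd · (G₂ · (B₅ · B₆ - B₃ · B₄)) ∎)
    where
    n≢0 : ∀ m n → m + suc n ≢ 0
    n≢0 m n e with () ← m+n≡0⇒n≡0 m e
    dd≢0 : dd ≢ 0
    dd≢0 = *≢0 {(2 * z + 3) * (c + 2 * b + 3)} {(c′ + 2 * b + 3) * (2 + e′ + 3)}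
     (*≢0 {2 * z + 3} {c + 2 * b + 3} (n≢0 (2 * z) 2) (n≢0 (c + 2 * b) 2))
     (*≢0 {c′ + 2 * b + 3} {2 + e′ + 3} (n≢0 (c′ + 2 * b) 2) (λ ()))
   -- Applied once on each side, `M-recurrence` reduces the core determinants of all three products
   -- to the same pair `M₆`, `M₃`; what is left is `B-identity`.
   Φ-condensation : Φ y z (2 + a) · Φ (1 + y) (2 + z) a ≡ Φ y (2 + z) (1 + a) · Φ (1 + y) z (1 + a) - Φ (1 + y) (1 + z) (1 + a) · Φ y (1 + z) (1 + a)
   Φ-condensation = begin
    M (6 + u) (suc (y + z)) · B₁ · (M u (suc (suc (y + suc (suc z)))) · B₂)
     ≡⟨ cong₂ (λ v w → M (6 + u) v · B₁ · (M u w · B₂)) (cong suc (NP.+-comm y z)) (t₁ y z) ⟩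
    M₆ · B₁ · (M u (4 + s) · B₂)
     ≡⟨ cong (λ w → M₆ · B₁ · (w · B₂)) (M-recurrence u (2 + s)) ⟩
    M₆ · B₁ · (G₄ · M₃ · B₂)
     ≡⟨ solve 5 (λ m b g n d → m ⊗ b ⊗ (g ⊗ n ⊗ d) ⊜ m ⊗ n ⊗ (g ⊗ (b ⊗ d))) refl M₆ B₁ G₄ M₃ B₂ ⟩
    M₆ · M₃ · (G₄ · (B₁ · B₂))
     ≡⟨ cong (M₆ · M₃ ·_) B-identity ⟩
    M₆ · M₃ · (G₂ · (B₅ · B₆ - B₃ · B₄))
     ≡⟨ solve 7 (λ m n g b₅ b₆ b₃ b₄ → m ⊗ n ⊗ (g ⊗ (b₅ ⊗ b₆ ⊖ b₃ ⊗ b₄)) ⊜ n ⊗ b₅ ⊗ (g ⊗ m ⊗ b₆) ⊖ n ⊗ b₃ ⊗ (g ⊗ m ⊗ b₄)) refl M₆ M₃ G₂ B₅ B₆ B₃ B₄ ⟩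
    M₃ · B₅ · (G₂ · M₆ · B₆) - M₃ · B₃ · (G₂ · M₆ · B₄)
     ≡⟨ cong (λ w → M₃ · B₅ · (w · B₆) - M₃ · B₃ · (w · B₄)) (M-recurrence (3 + u) s) ⟨
    M₃ · B₅ · (M (3 + u) (2 + s) · B₆) - M₃ · B₃ · (M (3 + u) (2 + s) · B₄)
     ≡⟨ cong₂ _-_ (cong₂ (λ v w → M (3 + u) v · B₅ · (M (3 + u) w · B₆)) (t₂ y z) (cong (λ w → suc (suc w)) (NP.+-comm y z)))
            (cong₂ (λ v w → M (3 + u) v · B₃ · (M (3 + u) w · B₄)) (t₃ y z) (t₄ y z)) ⟨
    Φ y (2 + z) (1 + a) · Φ (1 + y) z (1 + a) - Φ (1 + y) (1 + z) (1 + a) · Φ y (1 + z) (1 + a) ∎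
    where
    M₆ = M (6 + u) (1 + s)
    M₃ = M (3 + u) (3 + s)
    t₁ : ∀ y z → suc (suc (y + suc (suc z))) ≡ 4 + (z + y)
    t₁ = solve-ℕ
    t₂ : ∀ y z → suc (y + (2 + z)) ≡ 3 + (z + y)
    t₂ = solve-ℕ
    t₃ : ∀ y z → suc (suc y + suc z) ≡ 3 + (z + y)
    t₃ = solve-ℕ
    t₄ : ∀ y z → suc (y + suc z) ≡ 2 + (z + y)
    t₄ = solve-ℕ
  -- `Q` and `Φ` satisfy the same condensation relation and agree for `a = 0` and `a = 1`. Since `Φ`
  -- never vanishes, the relation can be solved for the value at `a + 2`.
  Q-closed : ∀ a y z → Q x y z a ≡ Φ y z a
  Q-closed zero y z = trans (Q-0 x y z) (sym (QP.*-identityʳ (M x (suc (y + z)))))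
  Q-closed (suc zero) y z = trans (Q-1 x y z) (trans (QP.*-comm (ε x (2 + (y + z)) y) (M (3 + x) (suc (y + z))))
   (cong (M (3 + x) (suc (y + z)) ·_) (*-cancelˡ (q-≢0 (Den≢0 y z 1))
    (trans (QP.*-comm (q (Den y z 1)) (ε x (2 + (y + z)) y)) (trans (ε-closed y z) (trans (sym (B-Den y z 1)) (QP.*-comm (B y z 1) (q (Den y z 1)))))))))
  Q-closed (suc (suc a)) y z = *-cancelˡ (Φ≢0 (1 + y) (2 + z) a) (begin
   Φ (1 + y) (2 + z) a · Q x y z (2 + a) ≡⟨ QP.*-comm (Φ (1 + y) (2 + z) a) (Q x y z (2 + a)) ⟩
   Q x y z (2 + a) · Φ (1 + y) (2 + z) a ≡⟨ cong (Q x y z (2 + a) ·_) (Q-closed a (1 + y) (2 + z)) ⟨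
   Q x y z (2 + a) · Q x (1 + y) (2 + z) a ≡⟨ Condense.Q-condensation x y z a ⟩
   Q x y (2 + z) (1 + a) · Q x (1 + y) z (1 + a) - Q x (1 + y) (1 + z) (1 + a) · Q x y (1 + z) (1 + a)
    ≡⟨ cong₂ _-_ (cong₂ _·_ (Q-closed (suc a) y (2 + z)) (Q-closed (suc a) (1 + y) z)) (cong₂ _·_ (Q-closed (suc a) (1 + y) (1 + z)) (Q-closed (suc a) y (1 + z))) ⟩
   Φ y (2 + z) (1 + a) · Φ (1 + y) z (1 + a) - Φ (1 + y) (1 + z) (1 + a) · Φ y (1 + z) (1 + a)
    ≡⟨ Φ-condensation y z a ⟨
   Φ y z (2 + a) · Φ (1 + y) (2 + z) a ≡⟨ QP.*-comm (Φ y z (2 + a)) (Φ (1 + y) (2 + z) a) ⟩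
   Φ (1 + y) (2 + z) a · Φ y z (2 + a) ∎)

-- Pochhammer symbols in terms of factorials.

module Pochhammer where
 open import Data.Nat using (_+_; _*_)
 open import Data.Rational using (-_; _-_) renaming (_*_ to _·_)
 open Embedding
 open Determinants
 open PathRows
 open Condensation
 open KernelVector
 open KernelAtRows
 open CoreDeterminant
 open FactorialRatios
 open SatelliteRecurrence
 open CoreRatios
 open DeterminantProduct

 open import Algebra.Solver.CommutativeMonoid NP.*-1-commutativeMonoid using () renaming (solve to solve-×; _⊕_ to infixl 7 _⊡_; _⊜_ to infix 4 _≑_)

 inv-unique : ∀ {a b c} → b ≢ 0ℚ → a · b ≡ c → a ≡ c · inv b
 inv-unique {a} {b} {c} b≢0 e = begin
  a ≡⟨ QP.*-identityʳ a ⟨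
  a · 1ℚ ≡⟨ cong (a ·_) (inv-inverseʳ b≢0) ⟨
  a · (b · inv b) ≡⟨ QP.*-assoc a b (inv b) ⟨
  a · b · inv b ≡⟨ cong (_· inv b) e ⟩
  c · inv b ∎
  where open ≡-Reasoning

 inv-cancel : ∀ {a b} → b ≢ 0ℚ → a · inv b · b ≡ a
 inv-cancel {a} {b} b≢0 = trans (solve 3 (λ a b i → a ⊗ i ⊗ b ⊜ a ⊗ (b ⊗ i)) refl a b (inv b)) (trans (cong (a ·_) (inv-inverseʳ b≢0)) (QP.*-identityʳ a))

 asc-fact : ∀ m d → ι (ascℤ (+ suc m) 1 d) · F m ≡ F (m + d)
 asc-fact m zero = trans (QP.*-identityˡ (F m)) (cong F (sym (NP.+-identityʳ m)))
 asc-fact m (suc d) = begin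
  ι (ascℤ (+ suc m) 1 d ℤ.* (+ suc m ℤ.+ + (1 * d))) · F m ≡⟨ cong (_· F m) (ι-* (ascℤ (+ suc m) 1 d) (+ suc m ℤ.+ + (1 * d))) ⟩
  ι (ascℤ (+ suc m) 1 d) · q (suc m + 1 * d) · F m ≡⟨ solve 3 (λ a b c → a ⊗ b ⊗ c ⊜ b ⊗ (a ⊗ c)) refl (ι (ascℤ (+ suc m) 1 d)) (q (suc m + 1 * d)) (F m) ⟩
  q (suc m + 1 * d) · (ι (ascℤ (+ suc m) 1 d) · F m) ≡⟨ cong₂ (λ u w → q (suc m + u) · w) (NP.*-identityˡ d) (asc-fact m d) ⟩
  q (suc (m + d)) · F (m + d) ≡⟨ F-suc {n = m + d} refl ⟨
  F (suc (m + d)) ≡⟨ cong F (+-suc m d) ⟨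
  F (m + suc d) ∎
  where
  open ≡-Reasoning

 desc-fact : ∀ m k n → k + n ≡ m → ι (descℤ (+ suc m) 1 n) · F k ≡ F m
 desc-fact m k zero e = trans (QP.*-identityˡ (F k)) (cong F (trans (sym (NP.+-identityʳ k)) e))
 desc-fact m k (suc n) e = begin
  ι (descℤ (+ suc m) 1 n ℤ.* (+ suc m ℤ.- + (1 * suc n))) · F k
   ≡⟨ cong (λ z → ι (descℤ (+ suc m) 1 n ℤ.* z) · F k) top ⟩
  ι (descℤ (+ suc m) 1 n ℤ.* + suc k) · F k
   ≡⟨ cong (_· F k) (ι-* (descℤ (+ suc m) 1 n) (+ suc k)) ⟩
  ι (descℤ (+ suc m) 1 n) · q (suc k) · F k
   ≡⟨ trans (QP.*-assoc (ι (descℤ (+ suc m) 1 n)) (q (suc k)) (F k)) (cong (ι (descℤ (+ suc m) 1 n) ·_) (sym (F-suc {n = k} refl))) ⟩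
  ι (descℤ (+ suc m) 1 n) · F (suc k)
   ≡⟨ desc-fact m (suc k) n (trans (sym (+-suc k n)) e) ⟩
  F m ∎
  where
  open ≡-Reasoning
  lin : ∀ k n → + 1 ℤ.+ (k ℤ.+ (+ 1 ℤ.+ n)) ℤ.- (+ 1 ℤ.+ n ℤ.+ + 0) ≡ + 1 ℤ.+ k
  lin = solve-ℤ
  top : + suc m ℤ.- + (1 * suc n) ≡ + suc k
  top = trans (cong (λ w → + suc w ℤ.- + (1 * suc n)) (sym e)) (lin (+ k) (+ n))

 -- One formula for both signs of the index: the convention for negative index is precisely the one
 -- that makes the symbol the quotient of `k!` by `m!` also for `k < m`. From here on the sign of an
 -- index need not be known.
 poch-fact : ∀ {A n} m k → A ≡ + suc m → n ≡ + k ℤ.- + m → poch A n · F m ≡ F k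
 poch-fact m k refl refl with ≤-total m k
 ... | inj₁ m≤k = trans (cong (λ z → poch (+ suc m) z · F m) (trans (ZP.m-n≡m⊖n k m) (ZP.⊖-≥ m≤k)))
     (trans (asc-fact m (k ℕ.∸ m)) (cong F (m+[n∸m]≡n m≤k)))
 ... | inj₂ k≤m with m ℕ.∸ k in eq
 ... | zero = trans (cong₂ (λ z w → poch (+ suc m) z · F w) (trans (cong (λ w → + k ℤ.- + w) m≡k) (ZP.+-inverseʳ (+ k))) m≡k) (QP.*-identityˡ (F k))
  where
  m≡k : m ≡ k
  m≡k = NP.≤-antisym (NP.m∸n≡0⇒m≤n eq) k≤m
 ... | suc d = begin
  poch (+ suc m) (+ k ℤ.- + m) · F m ≡⟨ cong (λ z → poch (+ suc m) z · F m) (trans (ZP.m-n≡m⊖n k m) (trans (ZP.⊖-≤ k≤m) (cong (λ w → ℤ.- (+ w)) eq))) ⟩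
  inv (ι (descℤ (+ suc m) 1 (suc d))) · F m ≡⟨ cong (inv (ι (descℤ (+ suc m) 1 (suc d))) ·_) (desc-fact m k (suc d) k+d) ⟨
  inv δ · (δ · F k) ≡⟨ solve 3 (λ i d f → i ⊗ (d ⊗ f) ⊜ d ⊗ i ⊗ f) refl (inv δ) δ (F k) ⟩
  δ · inv δ · F k ≡⟨ cong (_· F k) (inv-inverseʳ δ≢0) ⟩
  1ℚ · F k ≡⟨ QP.*-identityˡ (F k) ⟩
  F k ∎
  where
  open ≡-Reasoning
  δ = ι (descℤ (+ suc m) 1 (suc d))
  k+d : k + suc d ≡ m
  k+d = trans (cong (λ ω → k + ω) (sym eq)) (m+[n∸m]≡n k≤m)
  δ≢0 : δ ≢ 0ℚ
  δ≢0 e = F≢0 m (trans (sym (desc-fact m k (suc d) k+d)) (trans (cong (_· F k) e) (QP.*-zeroˡ (F k))))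

 open Factorials using (ff; ff≢0; fact-ff; Π; *≢0; fact-suc)

 -- The symbol with step 2 multiplies the odd numbers that `ff` collects, and `ff` takes a factor 2
 -- with each of them.
 poch₂-ff : ∀ N k → ι (ascℤ (+ (2 * N + 3)) 2 k) · (q (2 ℕ.^ k) · q (ff N)) ≡ q (ff (N + k))
 poch₂-ff N zero = trans (solve 1 (λ f → Κ 1ℚ ⊗ (Κ 1ℚ ⊗ f) ⊜ f) refl (q (ff N))) (cong (λ w → q (ff w)) (sym (NP.+-identityʳ N)))
 poch₂-ff N (suc k) = begin
  ι (a ℤ.* + (2 * N + 3 + 2 * k)) · (q (2 * 2 ℕ.^ k) · q (ff N))
   ≡⟨ cong₂ (λ u w → u · (w · q (ff N))) (ι-* a (+ (2 * N + 3 + 2 * k))) (q-* 2 (2 ℕ.^ k)) ⟩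
  ι a · q (2 * N + 3 + 2 * k) · (q 2 · q (2 ℕ.^ k) · q (ff N))
   ≡⟨ solve 5 (λ a l t p f → a ⊗ l ⊗ (t ⊗ p ⊗ f) ⊜ t ⊗ l ⊗ (a ⊗ (p ⊗ f))) refl (ι a) (q (2 * N + 3 + 2 * k)) (q 2) (q (2 ℕ.^ k)) (q (ff N)) ⟩
  q 2 · q (2 * N + 3 + 2 * k) · (ι a · (q (2 ℕ.^ k) · q (ff N)))
   ≡⟨ cong₂ (λ u w → q 2 · q u · w) (e N k) (poch₂-ff N k) ⟩
  q 2 · q (2 * (N + k) + 3) · q (ff (N + k))
   ≡⟨ q-*₃ 2 (2 * (N + k) + 3) (ff (N + k)) ⟨
  q (ff (suc (N + k)))
   ≡⟨ cong (λ w → q (ff w)) (+-suc N k) ⟨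
  q (ff (N + suc k)) ∎
  where
  open ≡-Reasoning
  a = ascℤ (+ (2 * N + 3)) 2 k
  e : ∀ N k → 2 * N + 3 + 2 * k ≡ 2 * (N + k) + 3
  e = solve-ℕ

 ^≢0 : ∀ k → 2 ℕ.^ k ≢ 0
 ^≢0 zero ()
 ^≢0 (suc k) = *≢0 {2} {2 ℕ.^ k} (λ ()) (^≢0 k)

 module Core where
  open ≡-Reasoning
  -- Numerator and denominator of the factor with index `j + 1` in the first product of `P₁`, where
  -- `2u + 2` stands for the combination of `x` and `a` in its symbols.
  mN mD : ℕ → ℕ → ℕ
  mN u j = fact (2 * u + 3 * j + 4) * fact j * ff (u + 3 * j + 2) * ff (u + j + 1)
  mD u j = fact (2 * u + 2 * j + 3) * fact (2 * j + 1) * ff (u + 2 * j + 2) * ff (u + 2 * j + 1)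
  mD≢0 : ∀ u j → mD u j ≢ 0
  mD≢0 u j = *≢0 {fact (2 * u + 2 * j + 3) * fact (2 * j + 1) * ff (u + 2 * j + 2)} {ff (u + 2 * j + 1)}
   (*≢0 {fact (2 * u + 2 * j + 3) * fact (2 * j + 1)} {ff (u + 2 * j + 2)}
    (*≢0 {fact (2 * u + 2 * j + 3)} {fact (2 * j + 1)} (fact≢0 (2 * u + 2 * j + 3)) (fact≢0 (2 * j + 1))) (ff≢0 (u + 2 * j + 2))) (ff≢0 (u + 2 * j + 1))
  -- The denominator-free form of `g-μ`: successive factors `g` have the same quotient as a factor
  -- of the product at `u` and one at `u + 3`.
  m-cross-ℕ : ∀ u j → let n = suc j in
   gnum u n * mN u n * gden u (suc n) * mD (3 + u) j ≡ gnum u (suc n) * mN (3 + u) j * gden u n * mD u n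
  m-cross-ℕ u j = begin
   gnum u n * mN u n * gden u (suc n) * mD (3 + u) j
    ≡⟨ cong₂ (λ N D → gnum u n * N * D * mD (3 + u) j)
       (cong (λ w → w * F₃ * K * k₁) (cong fact (e₁ u n)))
       (cong₂ _*_ (cong₂ _*_ (cong₂ _*_ two-p three-P) refl) two-s) ⟩
   gnum u n * (F₆ * F₃ * K * k₁) * ((p * (r * F₅)) * (P₇ * (P₆ * (P₅ * F₆))) * F₇ * ((2 * N₁) * (s₁ * F₈))) * mD (3 + u) j
    ≡⟨ cong (λ w → gnum u n * (F₆ * F₃ * K * k₁) * ((p * (r * F₅)) * (P₇ * (P₆ * (P₅ * F₆))) * F₇ * ((2 * N₁) * (s₁ * F₈))) * w)
       (cong₂ _*_ (cong₂ _*_ (cong (_* Gⱼ) four-v) (trans (cong ff (e₂ u j)) (cong₂ (λ a b → 2 * a * (2 * b * H₁)) (e₃ u n) (e₄ u n)))) (cong ff (e₅ u j))) ⟩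
   F₁ * F₂ * F₃ * F₄ * (F₆ * F₃ * K * k₁) * ((p * (r * F₅)) * (P₇ * (P₆ * (P₅ * F₆))) * F₇ * ((2 * N₁) * (s₁ * F₈)))
    * (v₇ * (2 * C * (v₅ * (2 * A * G₁))) * Gⱼ * (2 * E₃ * (2 * E₁ * H₁)) * H₂)
    ≡⟨ monomial 2 F₁ F₂ Fⱼ F₄ F₅ F₆ F₇ F₈ K k₁ p r P₇ P₆ P₅ N₁ s₁ v₇ v₅ C A G₁ Gⱼ E₃ E₁ H₁ H₂ n ⟩
   ((A * F₁) * (2 * p * (E₃ * (2 * r * (E₁ * F₂)))) * (N₁ * F₃) * (C * F₄)) * ((P₇ * (P₆ * (P₅ * F₆))) * Fⱼ * K * (2 * v₇ * (2 * v₅ * k₁)))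
    * (F₅ * F₆ * F₇ * F₈) * (G₁ * (s₁ * (2 * n * Gⱼ)) * H₂ * H₁)
    ≡⟨ cong₂ (λ N D → N * ((P₇ * (P₆ * (P₅ * F₆))) * Fⱼ * K * (2 * v₇ * (2 * v₅ * k₁))) * (F₅ * F₆ * F₇ * F₈) * (G₁ * D * H₂ * H₁))
       (cong₂ (λ a b → a * b * (N₁ * F₃) * (C * F₄)) (cong fact (+-suc u (suc n))) four-E) two-n ⟨
   gnum u (suc n) * ((P₇ * (P₆ * (P₅ * F₆))) * Fⱼ * K * (2 * v₇ * (2 * v₅ * k₁))) * gden u n * mD u n
    ≡⟨ cong (λ w → gnum u (suc n) * w * gden u n * mD u n) (cong₂ _*_ (cong₂ _*_ (cong (_* Fⱼ) three-P′) (cong ff (e₆ u j))) (cong ff (e₇ u j))) ⟨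
   gnum u (suc n) * mN (3 + u) j * gden u n * mD u n ∎
   where
   n F₁ F₂ F₃ Fⱼ F₄ F₅ F₆ F₇ F₈ K k₁ p r P₇ P₆ P₅ N₁ s₁ v₇ v₅ C A G₁ Gⱼ E₃ E₁ H₁ H₂ : ℕ
   n = suc j
   F₁ = fact (u + suc n)
   F₂ = fact (4 * suc n + 2 * u)
   F₃ = fact n
   Fⱼ = fact j
   F₄ = fact (suc n + u + 1)
   F₅ = fact (suc (n + n) + 1 + u)
   F₆ = fact (3 * suc n + 2 * u + 1)
   F₇ = fact (u + 1)
   F₈ = fact (2 * n)
   K = ff (u + 3 * n + 2)
   k₁ = ff (u + n + 1)
   p = 2 * n + u + 4
   r = 2 * n + u + 3
   P₇ = 3 * n + 2 * u + 7
   P₆ = 3 * n + 2 * u + 6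
   P₅ = 3 * n + 2 * u + 5
   N₁ = suc n
   s₁ = 2 * n + 1
   v₇ = 2 * suc (u + n + 1) + 3
   v₅ = 2 * (u + n + 1) + 3
   C = suc (suc n + u + 1)
   A = suc (u + suc n)
   G₁ = fact (2 * u + 2 * n + 3)
   Gⱼ = fact (2 * j + 1)
   E₃ = 4 * n + 2 * u + 7
   E₁ = 4 * n + 2 * u + 5
   H₁ = ff (u + 2 * n + 1)
   H₂ = ff (u + 2 * n + 2)
   e₁ : ∀ u n → 2 * u + 3 * n + 4 ≡ 3 * suc n + 2 * u + 1
   e₁ = solve-ℕ
   e₂ : ∀ u j → 3 + u + 2 * j + 2 ≡ suc (suc (u + 2 * suc j + 1))
   e₂ = solve-ℕ
   e₃ : ∀ u n → 2 * suc (u + 2 * n + 1) + 3 ≡ 4 * n + 2 * u + 7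
   e₃ = solve-ℕ
   e₄ : ∀ u n → 2 * (u + 2 * n + 1) + 3 ≡ 4 * n + 2 * u + 5
   e₄ = solve-ℕ
   e₅ : ∀ u j → 3 + u + 2 * j + 1 ≡ u + 2 * suc j + 2
   e₅ = solve-ℕ
   e₆ : ∀ u j → 3 + u + 3 * j + 2 ≡ u + 3 * suc j + 2
   e₆ = solve-ℕ
   e₇ : ∀ u j → 3 + u + j + 1 ≡ suc (suc (u + suc j + 1))
   e₇ = solve-ℕ
   two-p : fact (suc (suc n + suc n) + 1 + u) ≡ p * (r * F₅)
   two-p = trans (cong fact (a₁ n u)) (trans (fact-suc (a₂ n u)) (cong (λ ω → p * ω) (fact-suc (a₃ n u))))
    where
    a₁ : ∀ n u → suc (suc n + suc n) + 1 + u ≡ 2 * n + u + 4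
    a₁ = solve-ℕ
    a₂ : ∀ n u → 2 * n + u + 4 ≡ suc (2 * n + u + 3)
    a₂ = solve-ℕ
    a₃ : ∀ n u → 2 * n + u + 3 ≡ suc (suc (n + n) + 1 + u)
    a₃ = solve-ℕ
   P-chain : fact P₇ ≡ P₇ * (P₆ * (P₅ * F₆))
   P-chain = trans (fact-suc (a₁ n u)) (cong (λ ω → P₇ * ω) (trans (fact-suc (a₂ n u)) (cong (λ ω → P₆ * ω) (fact-suc (a₃ n u)))))
    where
    a₁ : ∀ n u → 3 * n + 2 * u + 7 ≡ suc (3 * n + 2 * u + 6)
    a₁ = solve-ℕ
    a₂ : ∀ n u → 3 * n + 2 * u + 6 ≡ suc (3 * n + 2 * u + 5)
    a₂ = solve-ℕ
    a₃ : ∀ n u → 3 * n + 2 * u + 5 ≡ suc (3 * suc n + 2 * u + 1)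
    a₃ = solve-ℕ
   three-P : fact (3 * suc (suc n) + 2 * u + 1) ≡ P₇ * (P₆ * (P₅ * F₆))
   three-P = trans (cong fact (a n u)) P-chain
    where
    a : ∀ n u → 3 * suc (suc n) + 2 * u + 1 ≡ 3 * n + 2 * u + 7
    a = solve-ℕ
   three-P′ : fact (2 * (3 + u) + 3 * j + 4) ≡ P₇ * (P₆ * (P₅ * F₆))
   three-P′ = trans (cong fact (a j u)) P-chain
    where
    a : ∀ j u → 2 * (3 + u) + 3 * j + 4 ≡ 3 * suc j + 2 * u + 7
    a = solve-ℕ
   two-s : fact (2 * suc n) ≡ (2 * N₁) * (s₁ * F₈)
   two-s = trans (fact-suc (a₁ n)) (cong ((2 * N₁) *_) (fact-suc (a₂ n)))
    where
    a₁ : ∀ n → 2 * suc n ≡ suc (2 * n + 1)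
    a₁ = solve-ℕ
    a₂ : ∀ n → 2 * n + 1 ≡ suc (2 * n)
    a₂ = solve-ℕ
   four-v : fact (2 * (3 + u) + 2 * j + 3) ≡ v₇ * (2 * C * (v₅ * (2 * A * G₁)))
   four-v = trans (cong fact (a₁ u j)) (trans (fact-suc (a₂ u n)) (cong (λ ω → v₇ * ω) (trans (fact-suc (a₃ u n)) (cong (λ ω → 2 * C * ω) (trans (fact-suc (a₄ u n)) (cong (λ ω → v₅ * ω) (fact-suc (a₅ u n))))))))
    where
    a₁ : ∀ u j → 2 * (3 + u) + 2 * j + 3 ≡ 2 * suc (u + suc j + 1) + 3
    a₁ = solve-ℕ
    a₂ : ∀ u n → 2 * suc (u + n + 1) + 3 ≡ suc (2 * suc (suc n + u + 1))
    a₂ = solve-ℕ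
    a₃ : ∀ u n → 2 * suc (suc n + u + 1) ≡ suc (2 * (u + n + 1) + 3)
    a₃ = solve-ℕ
    a₄ : ∀ u n → 2 * (u + n + 1) + 3 ≡ suc (2 * suc (u + suc n))
    a₄ = solve-ℕ
    a₅ : ∀ u n → 2 * suc (u + suc n) ≡ suc (2 * u + 2 * n + 3)
    a₅ = solve-ℕ
   four-E : fact (4 * suc (suc n) + 2 * u) ≡ 2 * p * (E₃ * (2 * r * (E₁ * F₂)))
   four-E = trans (cong fact (a₁ u n)) (trans (fact-suc (a₂ u n)) (cong (λ ω → 2 * p * ω) (trans (fact-suc (a₃ u n)) (cong (λ ω → E₃ * ω) (trans (fact-suc (a₄ u n)) (cong (λ ω → 2 * r * ω) (fact-suc (a₅ u n))))))))
    where
    a₁ : ∀ u n → 4 * suc (suc n) + 2 * u ≡ 2 * (2 * n + u + 4)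
    a₁ = solve-ℕ
    a₂ : ∀ u n → 2 * (2 * n + u + 4) ≡ suc (4 * n + 2 * u + 7)
    a₂ = solve-ℕ
    a₃ : ∀ u n → 4 * n + 2 * u + 7 ≡ suc (2 * (2 * n + u + 3))
    a₃ = solve-ℕ
    a₄ : ∀ u n → 2 * (2 * n + u + 3) ≡ suc (4 * n + 2 * u + 5)
    a₄ = solve-ℕ
    a₅ : ∀ u n → 4 * n + 2 * u + 5 ≡ suc (4 * suc n + 2 * u)
    a₅ = solve-ℕ
   two-n : fact (2 * n + 1) ≡ s₁ * (2 * n * Gⱼ)
   two-n = trans (fact-suc (a₁ n)) (cong (λ ω → s₁ * ω) (fact-suc (a₂ j)))
    where
    a₁ : ∀ n → 2 * n + 1 ≡ suc (2 * n)
    a₁ = solve-ℕ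
    a₂ : ∀ j → 2 * suc j ≡ suc (2 * j + 1)
    a₂ = solve-ℕ
   monomial : ∀ t F₁ F₂ Fⱼ F₄ F₅ F₆ F₇ F₈ K k₁ p r P₇ P₆ P₅ N₁ s₁ v₇ v₅ C A G₁ Gⱼ E₃ E₁ H₁ H₂ n →
    F₁ * F₂ * (n * Fⱼ) * F₄ * (F₆ * (n * Fⱼ) * K * k₁) * ((p * (r * F₅)) * (P₇ * (P₆ * (P₅ * F₆))) * F₇ * ((t * N₁) * (s₁ * F₈)))
     * (v₇ * (t * C * (v₅ * (t * A * G₁))) * Gⱼ * (t * E₃ * (t * E₁ * H₁)) * H₂)
    ≡ ((A * F₁) * (t * p * (E₃ * (t * r * (E₁ * F₂)))) * (N₁ * (n * Fⱼ)) * (C * F₄)) * ((P₇ * (P₆ * (P₅ * F₆))) * Fⱼ * K * (t * v₇ * (t * v₅ * k₁)))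
     * (F₅ * F₆ * F₇ * F₈) * (G₁ * (s₁ * (t * n * Gⱼ)) * H₂ * H₁)
   monomial = solve-× 29 (λ t F₁ F₂ Fⱼ F₄ F₅ F₆ F₇ F₈ K k₁ p r P₇ P₆ P₅ N₁ s₁ v₇ v₅ C A G₁ Gⱼ E₃ E₁ H₁ H₂ n →
    F₁ ⊡ F₂ ⊡ (n ⊡ Fⱼ) ⊡ F₄ ⊡ (F₆ ⊡ (n ⊡ Fⱼ) ⊡ K ⊡ k₁) ⊡ ((p ⊡ (r ⊡ F₅)) ⊡ (P₇ ⊡ (P₆ ⊡ (P₅ ⊡ F₆))) ⊡ F₇ ⊡ ((t ⊡ N₁) ⊡ (s₁ ⊡ F₈)))
     ⊡ (v₇ ⊡ (t ⊡ C ⊡ (v₅ ⊡ (t ⊡ A ⊡ G₁))) ⊡ Gⱼ ⊡ (t ⊡ E₃ ⊡ (t ⊡ E₁ ⊡ H₁)) ⊡ H₂)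
    ≑ ((A ⊡ F₁) ⊡ (t ⊡ p ⊡ (E₃ ⊡ (t ⊡ r ⊡ (E₁ ⊡ F₂)))) ⊡ (N₁ ⊡ (n ⊡ Fⱼ)) ⊡ (C ⊡ F₄)) ⊡ ((P₇ ⊡ (P₆ ⊡ (P₅ ⊡ F₆))) ⊡ Fⱼ ⊡ K ⊡ (t ⊡ v₇ ⊡ (t ⊡ v₅ ⊡ k₁)))
     ⊡ (F₅ ⊡ F₆ ⊡ F₇ ⊡ F₈) ⊡ (G₁ ⊡ (s₁ ⊡ (t ⊡ n ⊡ Gⱼ)) ⊡ H₂ ⊡ H₁)) refl

-- The first product of `P₁` is a core determinant.

module FirstProduct where
 open import Data.Rational using (_+_; _*_; -_; _-_)
 open Embedding
 open Determinants
 open PathRows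
 open Condensation
 open KernelVector
 open KernelAtRows
 open CoreDeterminant
 open FactorialRatios
 open SatelliteRecurrence
 open CoreRatios
 open DeterminantProduct
 open Pochhammer

 open import Algebra.Solver.CommutativeMonoid QP.*-1-commutativeMonoid using () renaming (solve to solve-ℚ×; _⊕_ to infixl 7 _⊡_; _⊜_ to infix 4 _≑_)
 open Factorials using (ff; ff≢0; Π; *≢0; fact-suc; Jf; J₁; J₂)

 ∏ : ℕ → (ℕ → ℚ) → ℚ
 ∏ zero h = 1ℚ
 ∏ (suc n) h = ∏ n h * h n

 ∏-cong : ∀ n {g h} → (∀ j → j ℕ.< n → g j ≡ h j) → ∏ n g ≡ ∏ n h
 ∏-cong zero e = refl
 ∏-cong (suc n) e = cong₂ _*_ (∏-cong n (λ j j<n → e j (m<n⇒m<1+n j<n))) (e n ≤-refl)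

 ∏₁≡∏ : ∀ n f → ∏₁ n f ≡ ∏ n (λ j → f (suc j))
 ∏₁≡∏ zero f = refl
 ∏₁≡∏ (suc n) f = cong (_* f (suc n)) (∏₁≡∏ n f)

 ∏-* : ∀ n g h → ∏ n (λ j → g j * h j) ≡ ∏ n g * ∏ n h
 ∏-* zero g h = refl
 ∏-* (suc n) g h = trans (cong (_* (g n * h n)) (∏-* n g h))
  (solve 4 (λ a b c d → a ⊗ b ⊗ (c ⊗ d) ⊜ a ⊗ c ⊗ (b ⊗ d)) refl (∏ n g) (∏ n h) (g n) (h n))

 ∏-head : ∀ n h → ∏ (suc n) h ≡ h 0 * ∏ n (λ j → h (suc j))
 ∏-head zero h = QP.*-comm 1ℚ (h 0)
 ∏-head (suc n) h = trans (cong (_* h (suc n)) (∏-head n h)) (QP.*-assoc (h 0) (∏ n (λ j → h (suc j))) (h (suc n)))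

 ∏-reverse : ∀ n h → ∏ n (λ j → h (n ℕ.∸ suc j)) ≡ ∏ n h
 ∏-reverse zero h = refl
 ∏-reverse (suc n) h = trans (∏-head n (λ j → h (n ℕ.∸ j))) (trans (cong (h n *_) (∏-reverse n h)) (QP.*-comm (h n) (∏ n h)))

 ∏-Π : ∀ n h → ∏ n (λ j → q (h j)) ≡ q (Π n h)
 ∏-Π zero h = refl
 ∏-Π (suc n) h = trans (cong (_* q (h n)) (∏-Π n h)) (sym (q-* (Π n h) (h n)))

 module CoreProduct where
  open import Data.Nat using () renaming (_+_ to _+:_; _*_ to _*:_)
  open Core
  open ≡-Reasoning
  μ : ℕ → ℕ → ℚ
  μ u j = q (mN u j) * inv (q (mD u j))
  μ-mD : ∀ u j → μ u j * q (mD u j) ≡ q (mN u j)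
  μ-mD u j = inv-cancel {q (mN u j)} {q (mD u j)} (q-≢0 {mD u j} (mD≢0 u j))
  -- The inductive step of `g-∏`.
  g-μ : ∀ u j → g u (2 +: j) * μ (3 +: u) j ≡ g u (1 +: j) * μ u (1 +: j)
  g-μ u j = *-cancelˡ {d₁ * d₂ * d₃ * d₄} nz (begin
   d₁ * d₂ * d₃ * d₄ * (g₂ * μ₃) ≡⟨ solve-ℚ× 6 (λ a b c d e f → a ⊡ b ⊡ c ⊡ d ⊡ (e ⊡ f) ≑ (e ⊡ b) ⊡ (f ⊡ c) ⊡ a ⊡ d) refl d₁ d₂ d₃ d₄ g₂ μ₃ ⟩
   (g₂ * d₂) * (μ₃ * d₃) * d₁ * d₄ ≡⟨ cong₂ (λ v w → v * w * d₁ * d₄) (g-closed u (2 +: j)) (μ-mD (3 +: u) j) ⟩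
   q (gnum u (2 +: j)) * q (mN (3 +: u) j) * d₁ * d₄ ≡⟨ q-*₄ (gnum u (2 +: j)) (mN (3 +: u) j) (gden u (1 +: j)) (mD u (1 +: j)) ⟨
   q (gnum u (2 +: j) *: mN (3 +: u) j *: gden u (1 +: j) *: mD u (1 +: j)) ≡⟨ cong q (m-cross-ℕ u j) ⟨
   q (gnum u (1 +: j) *: mN u (1 +: j) *: gden u (2 +: j) *: mD (3 +: u) j) ≡⟨ q-*₄ (gnum u (1 +: j)) (mN u (1 +: j)) (gden u (2 +: j)) (mD (3 +: u) j) ⟩
   q (gnum u (1 +: j)) * q (mN u (1 +: j)) * d₂ * d₃ ≡⟨ cong₂ (λ v w → v * w * d₂ * d₃) (g-closed u (1 +: j)) (μ-mD u (1 +: j)) ⟨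
   (g₁ * d₁) * (μ₁ * d₄) * d₂ * d₃ ≡⟨ solve-ℚ× 6 (λ a b c d e f → (e ⊡ a) ⊡ (f ⊡ d) ⊡ b ⊡ c ≑ a ⊡ b ⊡ c ⊡ d ⊡ (e ⊡ f)) refl d₁ d₂ d₃ d₄ g₁ μ₁ ⟩
   d₁ * d₂ * d₃ * d₄ * (g₁ * μ₁) ∎)
   where
   g₁ = g u (1 +: j)
   g₂ = g u (2 +: j)
   μ₁ = μ u (1 +: j)
   μ₃ = μ (3 +: u) j
   d₁ = q (gden u (1 +: j))
   d₂ = q (gden u (2 +: j))
   d₃ = q (mD (3 +: u) j)
   d₄ = q (mD u (1 +: j))
   nz : d₁ * d₂ * d₃ * d₄ ≢ 0ℚ
   nz = *-≢0 {d₁ * d₂ * d₃} {d₄} (*-≢0 {d₁ * d₂} {d₃} (*-≢0 {d₁} {d₂} (q-≢0 {gden u (1 +: j)} (gden≢0 u (1 +: j))) (q-≢0 {gden u (2 +: j)} (gden≢0 u (2 +: j))))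
    (q-≢0 {mD (3 +: u) j} (mD≢0 (3 +: u) j))) (q-≢0 {mD u (1 +: j)} (mD≢0 u (1 +: j)))
  half : ℚ
  half = inv (q 2)
  g-1-ℕ : ∀ u → gnum u 1 *: 2 *: mD u 0 ≡ mN u 0 *: gden u 1
  g-1-ℕ u = begin
   gnum u 1 *: 2 *: mD u 0
    ≡⟨ cong₂ (λ v w → v *: 2 *: w) (cong₂ (λ a b → a *: b *: 1 *: fact (2 +: u +: 1)) (trans (cong fact (e₁ u)) (fact-suc (e₂ u))) (trans (cong fact (e₃ u)) (fact-suc (e₄ u))))
       (cong (λ a → a *: 1 *: ff (u +: 0 +: 2) *: ff (u +: 0 +: 1)) (cong fact (e₅ u))) ⟩
   ((u +: 2) *: f₁) *: ((2 *: u +: 8) *: f₂) *: 1 *: f₃ *: 2 *: (f₄ *: 1 *: h₂ *: h₁)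
    ≡⟨ poly u f₁ f₂ f₃ f₄ h₁ h₂ ⟩
   ((2 *: u +: 4) *: f₄) *: 1 *: h₂ *: h₁ *: (((u +: 4) *: f₃) *: f₂ *: f₁ *: 2)
    ≡⟨ cong₂ (λ v w → v *: 1 *: h₂ *: h₁ *: (w *: f₂ *: f₁ *: 2)) (trans (cong fact (e₆ u)) (fact-suc (e₇ u))) (trans (cong fact (e₈ u)) (fact-suc (e₉ u))) ⟨
   mN u 0 *: gden u 1 ∎
   where
   f₁ f₂ f₃ f₄ h₁ h₂ : ℕ
   f₁ = fact (u +: 1)
   f₂ = fact (3 *: 2 +: 2 *: u +: 1)
   f₃ = fact (2 +: u +: 1)
   f₄ = fact (2 *: u +: 3)
   h₁ = ff (u +: 0 +: 1)
   h₂ = ff (u +: 0 +: 2)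
   e₁ : ∀ u → u +: 2 ≡ u +: 2
   e₁ u = refl
   e₂ : ∀ u → u +: 2 ≡ suc (u +: 1)
   e₂ = solve-ℕ
   e₃ : ∀ u → 4 *: 2 +: 2 *: u ≡ 2 *: u +: 8
   e₃ = solve-ℕ
   e₄ : ∀ u → 2 *: u +: 8 ≡ suc (3 *: 2 +: 2 *: u +: 1)
   e₄ = solve-ℕ
   e₅ : ∀ u → 2 *: u +: 0 +: 3 ≡ 2 *: u +: 3
   e₅ = solve-ℕ
   e₆ : ∀ u → 2 *: u +: 0 +: 4 ≡ 2 *: u +: 4
   e₆ = solve-ℕ
   e₇ : ∀ u → 2 *: u +: 4 ≡ suc (2 *: u +: 3)
   e₇ = solve-ℕ
   e₈ : ∀ u → suc (1 +: 1) +: 1 +: u ≡ u +: 4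
   e₈ = solve-ℕ
   e₉ : ∀ u → u +: 4 ≡ suc (2 +: u +: 1)
   e₉ = solve-ℕ
   poly : ∀ u f₁ f₂ f₃ f₄ h₁ h₂ → ((u +: 2) *: f₁) *: ((2 *: u +: 8) *: f₂) *: 1 *: f₃ *: 2 *: (f₄ *: 1 *: h₂ *: h₁) ≡ ((2 *: u +: 4) *: f₄) *: 1 *: h₂ *: h₁ *: (((u +: 4) *: f₃) *: f₂ *: f₁ *: 2)
   poly = solve-ℕ
  g-1 : ∀ u → g u 1 ≡ half * μ u 0
  g-1 u = *-cancelˡ {d * q 2 * m} nz (begin
   d * q 2 * m * g u 1 ≡⟨ solve-ℚ× 4 (λ a b c e → a ⊡ b ⊡ c ⊡ e ≑ (e ⊡ a) ⊡ b ⊡ c) refl d (q 2) m (g u 1) ⟩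
   g u 1 * d * q 2 * m ≡⟨ cong (λ w → w * q 2 * m) (g-closed u 1) ⟩
   q (gnum u 1) * q 2 * m ≡⟨ q-*₃ (gnum u 1) 2 (mD u 0) ⟨
   q (gnum u 1 *: 2 *: mD u 0) ≡⟨ cong q (g-1-ℕ u) ⟩
   q (mN u 0 *: gden u 1) ≡⟨ q-* (mN u 0) (gden u 1) ⟩
   q (mN u 0) * d ≡⟨ cong (_* d) (μ-mD u 0) ⟨
   μ u 0 * m * d ≡⟨ QP.*-identityˡ _ ⟨
   1ℚ * (μ u 0 * m * d) ≡⟨ cong (_* (μ u 0 * m * d)) (inv-inverseʳ {q 2} (λ ())) ⟨
   q 2 * half * (μ u 0 * m * d) ≡⟨ solve-ℚ× 5 (λ t h n m d → t ⊡ h ⊡ (n ⊡ m ⊡ d) ≑ d ⊡ t ⊡ m ⊡ (h ⊡ n)) refl (q 2) half (μ u 0) m d ⟩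
   d * q 2 * m * (half * μ u 0) ∎)
   where
   d = q (gden u 1)
   m = q (mD u 0)
   nz : d * q 2 * m ≢ 0ℚ
   nz = *-≢0 {d * q 2} {m} (*-≢0 {d} {q 2} (q-≢0 {gden u 1} (gden≢0 u 1)) (λ ())) (q-≢0 {mD u 0} (mD≢0 u 0))
  -- Each factor absorbs one of the halves contained in the power of 2 in front of the product.
  hμ : ℕ → ℕ → ℚ
  hμ u j = half * μ u j
  -- The product thus obeys the recurrence of `M` from `u` to `u + 3`, which identifies the two.
  g-∏ : ∀ n u → g u (1 +: n) * ∏ n (hμ (3 +: u)) ≡ ∏ (suc n) (hμ u)
  g-∏ zero u = trans (QP.*-identityʳ (g u 1)) (trans (g-1 u) (sym (QP.*-identityˡ (hμ u 0))))
  g-∏ (suc n) u = begin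
   g u (2 +: n) * (∏ n (hμ (3 +: u)) * (half * μ (3 +: u) n))
    ≡⟨ solve-ℚ× 4 (λ g p h m → g ⊡ (p ⊡ (h ⊡ m)) ≑ (g ⊡ m) ⊡ (p ⊡ h)) refl (g u (2 +: n)) (∏ n (hμ (3 +: u))) half (μ (3 +: u) n) ⟩
   g u (2 +: n) * μ (3 +: u) n * (∏ n (hμ (3 +: u)) * half)
    ≡⟨ cong (_* (∏ n (hμ (3 +: u)) * half)) (g-μ u n) ⟩
   g u (1 +: n) * μ u (1 +: n) * (∏ n (hμ (3 +: u)) * half)
    ≡⟨ solve-ℚ× 4 (λ g p h m → (g ⊡ m) ⊡ (p ⊡ h) ≑ g ⊡ p ⊡ (h ⊡ m)) refl (g u (1 +: n)) (∏ n (hμ (3 +: u))) half (μ u (1 +: n)) ⟩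
   g u (1 +: n) * ∏ n (hμ (3 +: u)) * (half * μ u (1 +: n))
    ≡⟨ cong (_* (half * μ u (1 +: n))) (g-∏ n u) ⟩
   ∏ (suc n) (hμ u) * (half * μ u (1 +: n)) ∎
  M-closed : ∀ n u → M u (suc n) ≡ ∏ n (hμ u)
  M-closed zero u = M-1 u
  M-closed (suc n) u = trans (M-recurrence u n) (trans (cong (g u (suc n) *_) (M-closed n (3 +: u))) (g-∏ n u))
  half-power : ∀ n h → inv (q (2 ℕ.^ n)) * ∏ n h ≡ ∏ n (λ j → half * h j)
  half-power n h = *-cancelˡ {q (2 ℕ.^ n)} (q-≢0 {2 ℕ.^ n} (^≢0 n)) (trans
   (trans (sym (QP.*-assoc (q (2 ℕ.^ n)) (inv (q (2 ℕ.^ n))) (∏ n h))) (trans (cong (_* ∏ n h) (inv-inverseʳ (q-≢0 {2 ℕ.^ n} (^≢0 n)))) (QP.*-identityˡ (∏ n h))))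
   (sym (go n)))
   where
   go : ∀ n → q (2 ℕ.^ n) * ∏ n (λ j → half * h j) ≡ ∏ n h
   go zero = refl
   go (suc n) = begin
    q (2 *: 2 ℕ.^ n) * (∏ n (λ j → half * h j) * (half * h n))
     ≡⟨ cong (_* (∏ n (λ j → half * h j) * (half * h n))) (q-* 2 (2 ℕ.^ n)) ⟩
    q 2 * q (2 ℕ.^ n) * (∏ n (λ j → half * h j) * (half * h n))
     ≡⟨ solve-ℚ× 5 (λ t p a h b → t ⊡ p ⊡ (a ⊡ (h ⊡ b)) ≑ (t ⊡ h) ⊡ (p ⊡ a ⊡ b)) refl (q 2) (q (2 ℕ.^ n)) (∏ n (λ j → half * h j)) half (h n) ⟩
    q 2 * half * (q (2 ℕ.^ n) * ∏ n (λ j → half * h j) * h n)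
     ≡⟨ cong₂ (λ v w → v * (w * h n)) (inv-inverseʳ {q 2} (λ ())) (go n) ⟩
    1ℚ * (∏ n h * h n) ≡⟨ QP.*-identityˡ _ ⟩
    ∏ n h * h n ∎
  -- The i-th factor of the first product of P₁, where X = 2u + 2.
  coreTerm : ℤ → ℕ → ℚ
  coreTerm X i =
     (poch (X ℤ.+ ℓ (2 ℕ.* i)) (ℓ i)
      ℚ.* poch₂ (X ℤ.+ ℓ (4 ℕ.* i ℕ.+ 1)) (ℓ i ℤ.- ℓ 1))
     ℚ.* inv (poch (ℓ i) (ℓ i)
      ℚ.* poch₂ (X ℤ.+ ℓ (2 ℕ.* i ℕ.+ 1)) (ℓ i ℤ.- ℓ 1))
  poch₂-ff′ : ∀ {A n} N k → A ≡ + (2 *: N +: 3) → n ≡ + k → poch₂ A n * (q (2 ℕ.^ k) * q (ff N)) ≡ q (ff (N +: k))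
  poch₂-ff′ N k refl refl = poch₂-ff N k
  factor≢0 : ∀ {p a b} → b ≢ 0ℚ → p * a ≡ b → p ≢ 0ℚ
  factor≢0 {a = a} b≢0 e p≡0 = b≢0 (trans (sym e) (trans (cong (_* a) p≡0) (QP.*-zeroˡ a)))
  coreTerm-μ : ∀ u j → coreTerm (+ (2 *: u +: 2)) (suc j) ≡ μ u j
  coreTerm-μ u j = inv-unique {p₁ * p₂ * inv (p₃ * p₄)} {q (mD u j)} (q-≢0 {mD u j} (mD≢0 u j)) (*-cancelˡ {w * W} (*-≢0 {w} {W} (q-≢0 {2 ℕ.^ j} (^≢0 j)) (*-≢0 {w} {F j * q (ff (u +: j +: 1))} (q-≢0 {2 ℕ.^ j} (^≢0 j)) (*-≢0 {F j} (F≢0 j) (q-≢0 {ff (u +: j +: 1)} (ff≢0 (u +: j +: 1))))))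
   (begin
   w * W * (t * q (mD u j))
    ≡⟨ cong (λ v → w * W * (t * v)) (q-*₄ (fact (2 *: u +: 2 *: j +: 3)) (fact (2 *: j +: 1)) (ff (u +: 2 *: j +: 2)) (ff (u +: 2 *: j +: 1))) ⟩
   w * (w * (F j * q (ff (u +: j +: 1)))) * (t * (A₁ * F (2 *: j +: 1) * A₂ * q (ff (u +: 2 *: j +: 1))))
    ≡⟨ cong₂ (λ a b → w * (w * (F j * q (ff (u +: j +: 1)))) * (t * (A₁ * a * A₂ * b))) h₃ h₄ ⟨
   w * (w * (F j * A₄)) * (t * (A₁ * (p₃ * F j) * A₂ * (p₄ * (w * A₄))))
    ≡⟨ solve-ℚ× 9 (λ w f A₄ p i A₁ p₃ A₂ p₄ → w ⊡ (w ⊡ (f ⊡ A₄)) ⊡ ((p ⊡ i) ⊡ (A₁ ⊡ (p₃ ⊡ f) ⊡ A₂ ⊡ (p₄ ⊡ (w ⊡ A₄))))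
       ≑ p ⊡ (i ⊡ (p₃ ⊡ p₄)) ⊡ (w ⊡ (w ⊡ (f ⊡ A₄)) ⊡ (A₁ ⊡ f ⊡ A₂ ⊡ (w ⊡ A₄)))) refl w (F j) A₄ (p₁ * p₂) (inv (p₃ * p₄)) A₁ p₃ A₂ p₄ ⟩
   p₁ * p₂ * (inv (p₃ * p₄) * (p₃ * p₄)) * (w * (w * (F j * A₄)) * (A₁ * F j * A₂ * (w * A₄)))
    ≡⟨ cong (λ v → p₁ * p₂ * v * (w * (w * (F j * A₄)) * (A₁ * F j * A₂ * (w * A₄)))) (trans (QP.*-comm (inv (p₃ * p₄)) (p₃ * p₄)) (inv-inverseʳ p₃₄≢0)) ⟩
   p₁ * p₂ * 1ℚ * (w * (w * (F j * A₄)) * (A₁ * F j * A₂ * (w * A₄)))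
    ≡⟨ solve 7 (λ w f A₄ p₁ p₂ A₁ A₂ → p₁ ⊗ p₂ ⊗ Κ 1ℚ ⊗ (w ⊗ (w ⊗ (f ⊗ A₄)) ⊗ (A₁ ⊗ f ⊗ A₂ ⊗ (w ⊗ A₄)))
       ⊜ w ⊗ (w ⊗ (f ⊗ A₄)) ⊗ ((p₁ ⊗ A₁) ⊗ f ⊗ (p₂ ⊗ (w ⊗ A₂)) ⊗ A₄)) refl w (F j) A₄ p₁ p₂ A₁ A₂ ⟩
   w * W * ((p₁ * A₁) * F j * (p₂ * (w * A₂)) * A₄)
    ≡⟨ cong₂ (λ a b → w * W * (a * F j * b * A₄)) h₁ h₂ ⟩
   w * W * (F (2 *: u +: 3 *: j +: 4) * F j * q (ff (u +: 3 *: j +: 2)) * A₄)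
    ≡⟨ cong (w * W *_) (q-*₄ (fact (2 *: u +: 3 *: j +: 4)) (fact j) (ff (u +: 3 *: j +: 2)) (ff (u +: j +: 1))) ⟨
   w * W * q (mN u j) ∎))
   where
   X = + (2 *: u +: 2)
   p₁ p₂ p₃ p₄ t w W A₁ A₂ A₄ : ℚ
   p₁ = poch (X ℤ.+ ℓ (2 ℕ.* suc j)) (ℓ (suc j))
   p₂ = poch₂ (X ℤ.+ ℓ (4 ℕ.* suc j ℕ.+ 1)) (ℓ (suc j) ℤ.- ℓ 1)
   p₃ = poch (ℓ (suc j)) (ℓ (suc j))
   p₄ = poch₂ (X ℤ.+ ℓ (2 ℕ.* suc j ℕ.+ 1)) (ℓ (suc j) ℤ.- ℓ 1)
   t = p₁ * p₂ * inv (p₃ * p₄)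
   w = q (2 ℕ.^ j)
   W = w * (F j * q (ff (u +: j +: 1)))
   A₁ = F (2 *: u +: 2 *: j +: 3)
   A₂ = q (ff (u +: 2 *: j +: 2))
   A₄ = q (ff (u +: j +: 1))
   h₁ : p₁ * A₁ ≡ F (2 *: u +: 3 *: j +: 4)
   h₁ = poch-fact (2 *: u +: 2 *: j +: 3) (2 *: u +: 3 *: j +: 4) (cong +_ (a u j)) (b (+ u) (+ j))
    where
    a : ∀ u j → 2 *: u +: 2 +: 2 *: suc j ≡ suc (2 *: u +: 2 *: j +: 3)
    a = solve-ℕ
    b : ∀ u j → + 1 ℤ.+ j ≡ (u ℤ.+ (u ℤ.+ + 0) ℤ.+ (j ℤ.+ (j ℤ.+ (j ℤ.+ + 0))) ℤ.+ + 4) ℤ.- (u ℤ.+ (u ℤ.+ + 0) ℤ.+ (j ℤ.+ (j ℤ.+ + 0)) ℤ.+ + 3)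
    b = solve-ℤ
   h₂ : p₂ * (w * A₂) ≡ q (ff (u +: 3 *: j +: 2))
   h₂ = trans (poch₂-ff′ (u +: 2 *: j +: 2) j (cong +_ (a u j)) (b (+ j))) (cong (λ v → q (ff v)) (d u j))
    where
    a : ∀ u j → 2 *: u +: 2 +: (4 *: suc j +: 1) ≡ 2 *: (u +: 2 *: j +: 2) +: 3
    a = solve-ℕ
    b : ∀ j → + 1 ℤ.+ j ℤ.- + 1 ≡ j
    b = solve-ℤ
    d : ∀ u j → u +: 2 *: j +: 2 +: j ≡ u +: 3 *: j +: 2
    d = solve-ℕ
   h₃ : p₃ * F j ≡ F (2 *: j +: 1)
   h₃ = poch-fact j (2 *: j +: 1) refl (b (+ j))
    where
    b : ∀ j → + 1 ℤ.+ j ≡ (j ℤ.+ (j ℤ.+ + 0) ℤ.+ + 1) ℤ.- j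
    b = solve-ℤ
   h₄ : p₄ * (w * A₄) ≡ q (ff (u +: 2 *: j +: 1))
   h₄ = trans (poch₂-ff′ (u +: j +: 1) j (cong +_ (a u j)) (b (+ j))) (cong (λ v → q (ff v)) (d u j))
    where
    a : ∀ u j → 2 *: u +: 2 +: (2 *: suc j +: 1) ≡ 2 *: (u +: j +: 1) +: 3
    a = solve-ℕ
    b : ∀ j → + 1 ℤ.+ j ℤ.- + 1 ≡ j
    b = solve-ℤ
    d : ∀ u j → u +: j +: 1 +: j ≡ u +: 2 *: j +: 1
    d = solve-ℕ
   p₃₄≢0 : p₃ * p₄ ≢ 0ℚ
   p₃₄≢0 = *-≢0 {p₃} {p₄} (factor≢0 {p₃} {F j} (F≢0 (2 *: j +: 1)) h₃) (factor≢0 {p₄} {w * A₄} (q-≢0 {ff (u +: 2 *: j +: 1)} (ff≢0 (u +: 2 *: j +: 1))) h₄)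
  core-product : ∀ u n → inv (ι (+ (2 ℕ.^ n))) * ∏₁ n (coreTerm (+ (2 *: u +: 2))) ≡ M u (suc n)
  core-product u n = trans (cong (inv (q (2 ℕ.^ n)) *_) (trans (∏₁≡∏ n (coreTerm (+ (2 *: u +: 2)))) (∏-cong n (λ j _ → coreTerm-μ u j))))
   (trans (half-power n (μ u)) (sym (M-closed n u)))

-- The second product of `P₁` is the satellite factor.

module SecondProduct where
 open import Data.Rational using (_+_; _*_; -_; _-_)
 open Embedding
 open PathRows
 open Condensation
 open KernelVector
 open KernelAtRows
 open CoreDeterminant
 open FactorialRatios
 open SatelliteRecurrence
 open CoreRatios
 open DeterminantProduct
 open Pochhammer
 open FirstProduct

 open import Algebra.Solver.CommutativeMonoid QP.*-1-commutativeMonoid using () renaming (solve to solve-ℚ×; _⊕_ to infixl 7 _⊡_; _⊜_ to infix 4 _≑_)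
 open Factorials using (ff; Π; Jf; J₁; J₂)

 module SatelliteProduct (x y z : ℕ) where
  open import Data.Nat using () renaming (_+_ to _+:_; _*_ to _*:_)
  open Satellite x
  open ClosedForm x
  open ≡-Reasoning
  -- The i-th factor of the second product of P₁ at suc x.
  satTerm : ℕ → ℕ → ℚ
  satTerm a i =
     (poch (ℓ z ℤ.+ ℓ i) (ℓ y ℤ.+ ℓ a ℤ.- ℓ (2 ℕ.* i) ℤ.+ ℓ 1)
      ℚ.* poch (ℓ (suc x) ℤ.+ ℓ y ℤ.+ ℓ (2 ℕ.* z) ℤ.+ ℓ (2 ℕ.* a) ℤ.+ ℓ (2 ℕ.* i))
           (ℓ (2 ℕ.* y) ℤ.+ ℓ (2 ℕ.* a) ℤ.- ℓ (4 ℕ.* i) ℤ.+ ℓ 2)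
      ℚ.* poch (ℓ (suc x) ℤ.+ ℓ (3 ℕ.* i) ℤ.- ℓ 2) (ℓ y ℤ.- ℓ i ℤ.+ ℓ 1)
      ℚ.* poch (ℓ (suc x) ℤ.+ ℓ (3 ℕ.* y) ℤ.+ ℓ (2 ℕ.* i) ℤ.- ℓ 1) (ℓ i ℤ.- ℓ 1))
     ℚ.* inv (poch (ℓ i) (ℓ y)
      ℚ.* poch (ℓ y ℤ.+ ℓ (2 ℕ.* z) ℤ.+ ℓ (2 ℕ.* i) ℤ.- ℓ 1)
           (ℓ y ℤ.+ ℓ (2 ℕ.* a) ℤ.- ℓ (4 ℕ.* i) ℤ.+ ℓ 3)
      ℚ.* poch (ℓ (2 ℕ.* z) ℤ.+ ℓ (2 ℕ.* i))
           (ℓ y ℤ.+ ℓ (2 ℕ.* a) ℤ.- ℓ (4 ℕ.* i) ℤ.+ ℓ 1)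
      ℚ.* poch (ℓ (suc x) ℤ.+ ℓ y ℤ.+ ℓ z ℤ.+ ℓ (2 ℕ.* a) ℤ.+ ℓ i)
           (ℓ y ℤ.+ ℓ a ℤ.- ℓ (2 ℕ.* i) ℤ.+ ℓ 1))
  module Factor (a j : ℕ) where
   -- The factorials that depend on the distance `j` from the first factor; `Vn` and `Vd` collect
   -- those that depend on the distance from the last one.
   Un Ud : ℚ
   Un = F (2 *: z +: 2 *: j +: 1) * F (y +: 2 *: z +: 2 *: j) * F (suc (x +: y +: (j +: j))) * F (suc (x +: 3 *: y +: 3 *: j)) * F j * F (suc (x +: y +: z +: 2 *: a +: j))
   Ud = F (z +: j) * F (suc (suc (x +: y +: 2 *: z +: 2 *: a +: (j +: j)))) * F (suc (x +: 3 *: j)) * F (suc (x +: 3 *: y +: (j +: j))) * F (j +: y)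
   Vn Vd : ℚ
   Vn = F (z +: y +: j) * F (suc (suc (x +: 3 *: y +: 2 *: z +: 2 *: a +: (j +: j))))
   Vd = F (2 *: (z +: y) +: 2 *: j +: 1) * F (y +: 2 *: z +: 2 *: j) * F (suc (x +: 2 *: y +: z +: 2 *: a +: j))
   Ud≢0 : Ud ≢ 0ℚ
   Ud≢0 = *-≢0 {F (z +: j) * F (suc (suc (x +: y +: 2 *: z +: 2 *: a +: (j +: j)))) * F (suc (x +: 3 *: j)) * F (suc (x +: 3 *: y +: (j +: j)))} {F (j +: y)}
    (*-≢0 {F (z +: j) * F (suc (suc (x +: y +: 2 *: z +: 2 *: a +: (j +: j)))) * F (suc (x +: 3 *: j))} {F (suc (x +: 3 *: y +: (j +: j)))}
     (*-≢0 {F (z +: j) * F (suc (suc (x +: y +: 2 *: z +: 2 *: a +: (j +: j))))} {F (suc (x +: 3 *: j))}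
      (*-≢0 {F (z +: j)} {F (suc (suc (x +: y +: 2 *: z +: 2 *: a +: (j +: j))))} (F≢0 (z +: j)) (F≢0 (suc (suc (x +: y +: 2 *: z +: 2 *: a +: (j +: j))))))
      (F≢0 (suc (x +: 3 *: j)))) (F≢0 (suc (x +: 3 *: y +: (j +: j))))) (F≢0 (j +: y))
   Vd≢0 : Vd ≢ 0ℚ
   Vd≢0 = *-≢0 {F (2 *: (z +: y) +: 2 *: j +: 1) * F (y +: 2 *: z +: 2 *: j)} {F (suc (x +: 2 *: y +: z +: 2 *: a +: j))}
    (*-≢0 {F (2 *: (z +: y) +: 2 *: j +: 1)} {F (y +: 2 *: z +: 2 *: j)} (F≢0 (2 *: (z +: y) +: 2 *: j +: 1)) (F≢0 (y +: 2 *: z +: 2 *: j)))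
    (F≢0 (suc (x +: 2 *: y +: z +: 2 *: a +: j)))
   U V : ℚ
   U = Un * inv Ud
   V = Vn * inv Vd
  open Factor using (U; V)
  -- With i = j + 1 and a = j + 1 + k the factor splits into a function of j and a function of k.
  satTerm-split : ∀ j k → satTerm (suc j +: k) (suc j) ≡ U (suc j +: k) j * V (suc j +: k) k
  satTerm-split j k = *-cancelˡ {Ud * Vd} (*-≢0 {Ud} {Vd} (Factor.Ud≢0 a j) (Factor.Vd≢0 a k)) (begin
   Ud * Vd * (p₁ * p₂ * p₃ * p₄ * inv d)
    ≡⟨ cong (λ w → w * (p₁ * p₂ * p₃ * p₄ * inv d)) (cong₂ (λ b c → b₁ * b₂ * b₃ * b₄ * b * c) (sym k₁) (cong₂ _*_ (cong₂ _*_ (sym k₂) (sym k₃)) (sym k₄))) ⟩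
   b₁ * b₂ * b₃ * b₄ * (d₁ * c₁) * (d₂ * c₂ * (d₃ * c₃) * (d₄ * c₄)) * (p₁ * p₂ * p₃ * p₄ * inv d)
    ≡⟨ solve-ℚ× 17 (λ b₁ b₂ b₃ b₄ d₁ c₁ d₂ c₂ d₃ c₃ d₄ c₄ p₁ p₂ p₃ p₄ i →
       b₁ ⊡ b₂ ⊡ b₃ ⊡ b₄ ⊡ (d₁ ⊡ c₁) ⊡ (d₂ ⊡ c₂ ⊡ (d₃ ⊡ c₃) ⊡ (d₄ ⊡ c₄)) ⊡ (p₁ ⊡ p₂ ⊡ p₃ ⊡ p₄ ⊡ i)
       ≑ (p₁ ⊡ b₁) ⊡ (p₂ ⊡ b₂) ⊡ (p₃ ⊡ b₃) ⊡ (p₄ ⊡ b₄) ⊡ (c₁ ⊡ c₂ ⊡ c₃ ⊡ c₄) ⊡ (d₁ ⊡ d₂ ⊡ d₃ ⊡ d₄ ⊡ i))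
      refl b₁ b₂ b₃ b₄ d₁ c₁ d₂ c₂ d₃ c₃ d₄ c₄ p₁ p₂ p₃ p₄ (inv d) ⟩
   (p₁ * b₁) * (p₂ * b₂) * (p₃ * b₃) * (p₄ * b₄) * (c₁ * c₂ * c₃ * c₄) * (d * inv d)
    ≡⟨ cong₂ (λ v w → v * (c₁ * c₂ * c₃ * c₄) * w) (cong₂ _*_ (cong₂ _*_ (cong₂ _*_ h₁ h₂) h₃) h₄) (inv-inverseʳ d≢0) ⟩
   e₁ * e₂ * e₃ * e₄ * (c₁ * c₂ * c₃ * c₄) * 1ℚ
    ≡⟨ QP.*-identityʳ (e₁ * e₂ * e₃ * e₄ * (c₁ * c₂ * c₃ * c₄)) ⟩
   e₁ * e₂ * e₃ * e₄ * (c₁ * c₂ * c₃ * c₄)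
    ≡⟨ solve-ℚ× 8 (λ e₁ e₂ e₃ e₄ c₁ c₂ c₃ c₄ → e₁ ⊡ e₂ ⊡ e₃ ⊡ e₄ ⊡ (c₁ ⊡ c₂ ⊡ c₃ ⊡ c₄) ≑ (c₃ ⊡ c₂ ⊡ e₃ ⊡ e₄ ⊡ c₁ ⊡ c₄) ⊡ (e₁ ⊡ e₂)) refl e₁ e₂ e₃ e₄ c₁ c₂ c₃ c₄ ⟩
   Factor.Un a j * Factor.Vn a k
    ≡⟨ cong₂ _*_ (inv-cancel {Factor.Un a j} {Ud} (Factor.Ud≢0 a j)) (inv-cancel {Factor.Vn a k} {Vd} (Factor.Vd≢0 a k)) ⟨
   U a j * Ud * (V a k * Vd)
    ≡⟨ solve-ℚ× 4 (λ u v p r → u ⊡ p ⊡ (v ⊡ r) ≑ p ⊡ r ⊡ (u ⊡ v)) refl (U a j) (V a k) Ud Vd ⟩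
   Ud * Vd * (U a j * V a k) ∎)
   where
   a i : ℕ
   a = suc j +: k
   i = suc j
   Ud Vd p₁ p₂ p₃ p₄ d₁ d₂ d₃ d₄ d b₁ b₂ b₃ b₄ e₁ e₂ e₃ e₄ c₁ c₂ c₃ c₄ : ℚ
   Ud = Factor.Ud a j
   Vd = Factor.Vd a k
   p₁ = poch (ℓ z ℤ.+ ℓ i) (ℓ y ℤ.+ ℓ a ℤ.- ℓ (2 ℕ.* i) ℤ.+ ℓ 1)
   p₂ = poch (ℓ (suc x) ℤ.+ ℓ y ℤ.+ ℓ (2 ℕ.* z) ℤ.+ ℓ (2 ℕ.* a) ℤ.+ ℓ (2 ℕ.* i)) (ℓ (2 ℕ.* y) ℤ.+ ℓ (2 ℕ.* a) ℤ.- ℓ (4 ℕ.* i) ℤ.+ ℓ 2)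
   p₃ = poch (ℓ (suc x) ℤ.+ ℓ (3 ℕ.* i) ℤ.- ℓ 2) (ℓ y ℤ.- ℓ i ℤ.+ ℓ 1)
   p₄ = poch (ℓ (suc x) ℤ.+ ℓ (3 ℕ.* y) ℤ.+ ℓ (2 ℕ.* i) ℤ.- ℓ 1) (ℓ i ℤ.- ℓ 1)
   d₁ = poch (ℓ i) (ℓ y)
   d₂ = poch (ℓ y ℤ.+ ℓ (2 ℕ.* z) ℤ.+ ℓ (2 ℕ.* i) ℤ.- ℓ 1) (ℓ y ℤ.+ ℓ (2 ℕ.* a) ℤ.- ℓ (4 ℕ.* i) ℤ.+ ℓ 3)
   d₃ = poch (ℓ (2 ℕ.* z) ℤ.+ ℓ (2 ℕ.* i)) (ℓ y ℤ.+ ℓ (2 ℕ.* a) ℤ.- ℓ (4 ℕ.* i) ℤ.+ ℓ 1)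
   d₄ = poch (ℓ (suc x) ℤ.+ ℓ y ℤ.+ ℓ z ℤ.+ ℓ (2 ℕ.* a) ℤ.+ ℓ i) (ℓ y ℤ.+ ℓ a ℤ.- ℓ (2 ℕ.* i) ℤ.+ ℓ 1)
   d = d₁ * d₂ * d₃ * d₄
   b₁ = F (z +: j)
   b₂ = F (suc (suc (x +: y +: 2 *: z +: 2 *: a +: (j +: j))))
   b₃ = F (suc (x +: 3 *: j))
   b₄ = F (suc (x +: 3 *: y +: (j +: j)))
   e₁ = F (z +: y +: k)
   e₂ = F (suc (suc (x +: 3 *: y +: 2 *: z +: 2 *: a +: (k +: k))))
   e₃ = F (suc (x +: y +: (j +: j)))
   e₄ = F (suc (x +: 3 *: y +: 3 *: j))
   c₁ = F j
   c₂ = F (y +: 2 *: z +: 2 *: j)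
   c₃ = F (2 *: z +: 2 *: j +: 1)
   c₄ = F (suc (x +: y +: z +: 2 *: a +: j))
   h₁ : p₁ * b₁ ≡ e₁
   h₁ = poch-fact (z +: j) (z +: y +: k) (cong +_ (+-suc z j)) (b (+ y) (+ z) (+ j) (+ k))
    where
    b : ∀ y z j k → y ℤ.+ (+ 1 ℤ.+ j ℤ.+ k) ℤ.- ((+ 1 ℤ.+ j) ℤ.+ ((+ 1 ℤ.+ j) ℤ.+ + 0)) ℤ.+ + 1 ≡ (z ℤ.+ y ℤ.+ k) ℤ.- (z ℤ.+ j)
    b = solve-ℤ
   h₂ : p₂ * b₂ ≡ e₂
   h₂ = poch-fact (suc (suc (x +: y +: 2 *: z +: 2 *: a +: (j +: j))) ) (suc (suc (x +: 3 *: y +: 2 *: z +: 2 *: a +: (k +: k)))) (cong +_ (s x y z a j)) (b (+ x) (+ y) (+ z) (+ j) (+ k))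
    where
    s : ∀ x y z a j → suc x +: y +: 2 *: z +: 2 *: a +: 2 *: suc j ≡ suc (suc (suc (x +: y +: 2 *: z +: 2 *: a +: (j +: j))))
    s = solve-ℕ
    b : ∀ x y z j k → let a = + 1 ℤ.+ j ℤ.+ k ; 2a = a ℤ.+ (a ℤ.+ + 0) ; i = + 1 ℤ.+ j ; 2z = z ℤ.+ (z ℤ.+ + 0) in
     (y ℤ.+ (y ℤ.+ + 0)) ℤ.+ 2a ℤ.- (i ℤ.+ (i ℤ.+ (i ℤ.+ (i ℤ.+ + 0)))) ℤ.+ + 2
     ≡ (+ 2 ℤ.+ (x ℤ.+ (y ℤ.+ (y ℤ.+ (y ℤ.+ + 0))) ℤ.+ 2z ℤ.+ 2a ℤ.+ (k ℤ.+ k))) ℤ.- (+ 2 ℤ.+ (x ℤ.+ y ℤ.+ 2z ℤ.+ 2a ℤ.+ (j ℤ.+ j)))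
    b = solve-ℤ
   h₃ : p₃ * b₃ ≡ e₃
   h₃ = poch-fact (suc (x +: 3 *: j)) (suc (x +: y +: (j +: j))) (s (+ x) (+ j)) (b (+ x) (+ y) (+ j))
    where
    s : ∀ x j → let i = + 1 ℤ.+ j in (+ 1 ℤ.+ x) ℤ.+ (i ℤ.+ (i ℤ.+ (i ℤ.+ + 0))) ℤ.- + 2 ≡ + 2 ℤ.+ (x ℤ.+ (j ℤ.+ (j ℤ.+ (j ℤ.+ + 0))))
    s = solve-ℤ
    b : ∀ x y j → y ℤ.- (+ 1 ℤ.+ j) ℤ.+ + 1 ≡ (+ 1 ℤ.+ (x ℤ.+ y ℤ.+ (j ℤ.+ j))) ℤ.- (+ 1 ℤ.+ (x ℤ.+ (j ℤ.+ (j ℤ.+ (j ℤ.+ + 0)))))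
    b = solve-ℤ
   h₄ : p₄ * b₄ ≡ e₄
   h₄ = poch-fact (suc (x +: 3 *: y +: (j +: j))) (suc (x +: 3 *: y +: 3 *: j)) (s (+ x) (+ y) (+ j)) (b (+ x) (+ y) (+ j))
    where
    s : ∀ x y j → let i = + 1 ℤ.+ j ; 3y = y ℤ.+ (y ℤ.+ (y ℤ.+ + 0)) in (+ 1 ℤ.+ x) ℤ.+ 3y ℤ.+ (i ℤ.+ (i ℤ.+ + 0)) ℤ.- + 1 ≡ + 2 ℤ.+ (x ℤ.+ 3y ℤ.+ (j ℤ.+ j))
    s = solve-ℤ
    b : ∀ x y j → let 3y = y ℤ.+ (y ℤ.+ (y ℤ.+ + 0)) in (+ 1 ℤ.+ j) ℤ.- + 1 ≡ (+ 1 ℤ.+ (x ℤ.+ 3y ℤ.+ (j ℤ.+ (j ℤ.+ (j ℤ.+ + 0))))) ℤ.- (+ 1 ℤ.+ (x ℤ.+ 3y ℤ.+ (j ℤ.+ j)))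
    b = solve-ℤ
   k₁ : d₁ * c₁ ≡ F (j +: y)
   k₁ = poch-fact j (j +: y) refl (b (+ y) (+ j))
    where
    b : ∀ y j → y ≡ (j ℤ.+ y) ℤ.- j
    b = solve-ℤ
   k₂ : d₂ * c₂ ≡ F (2 *: (z +: y) +: 2 *: k +: 1)
   k₂ = poch-fact (y +: 2 *: z +: 2 *: j) (2 *: (z +: y) +: 2 *: k +: 1) (s (+ y) (+ z) (+ j)) (b (+ y) (+ z) (+ j) (+ k))
    where
    s : ∀ y z j → let i = + 1 ℤ.+ j ; 2z = z ℤ.+ (z ℤ.+ + 0) in y ℤ.+ 2z ℤ.+ (i ℤ.+ (i ℤ.+ + 0)) ℤ.- + 1 ≡ + 1 ℤ.+ (y ℤ.+ 2z ℤ.+ (j ℤ.+ (j ℤ.+ + 0)))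
    s = solve-ℤ
    b : ∀ y z j k → let a = + 1 ℤ.+ j ℤ.+ k ; 2a = a ℤ.+ (a ℤ.+ + 0) ; i = + 1 ℤ.+ j ; 2z = z ℤ.+ (z ℤ.+ + 0) in
     y ℤ.+ 2a ℤ.- (i ℤ.+ (i ℤ.+ (i ℤ.+ (i ℤ.+ + 0)))) ℤ.+ + 3
     ≡ ((z ℤ.+ y) ℤ.+ (z ℤ.+ y ℤ.+ + 0) ℤ.+ (k ℤ.+ (k ℤ.+ + 0)) ℤ.+ + 1) ℤ.- (y ℤ.+ 2z ℤ.+ (j ℤ.+ (j ℤ.+ + 0)))
    b = solve-ℤ
   k₃ : d₃ * c₃ ≡ F (y +: 2 *: z +: 2 *: k)
   k₃ = poch-fact (2 *: z +: 2 *: j +: 1) (y +: 2 *: z +: 2 *: k) (cong +_ (s z j)) (b (+ y) (+ z) (+ j) (+ k))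
    where
    s : ∀ z j → 2 *: z +: 2 *: suc j ≡ suc (2 *: z +: 2 *: j +: 1)
    s = solve-ℕ
    b : ∀ y z j k → let a = + 1 ℤ.+ j ℤ.+ k ; 2a = a ℤ.+ (a ℤ.+ + 0) ; i = + 1 ℤ.+ j ; 2z = z ℤ.+ (z ℤ.+ + 0) in
     y ℤ.+ 2a ℤ.- (i ℤ.+ (i ℤ.+ (i ℤ.+ (i ℤ.+ + 0)))) ℤ.+ + 1
     ≡ (y ℤ.+ 2z ℤ.+ (k ℤ.+ (k ℤ.+ + 0))) ℤ.- (2z ℤ.+ (j ℤ.+ (j ℤ.+ + 0)) ℤ.+ + 1)
    b = solve-ℤ
   k₄ : d₄ * c₄ ≡ F (suc (x +: 2 *: y +: z +: 2 *: a +: k))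
   k₄ = poch-fact (suc (x +: y +: z +: 2 *: a +: j)) (suc (x +: 2 *: y +: z +: 2 *: a +: k)) (cong +_ (s x y z a j)) (b (+ x) (+ y) (+ z) (+ j) (+ k))
    where
    s : ∀ x y z a j → suc x +: y +: z +: 2 *: a +: suc j ≡ suc (suc (x +: y +: z +: 2 *: a +: j))
    s = solve-ℕ
    b : ∀ x y z j k → let a = + 1 ℤ.+ j ℤ.+ k ; 2a = a ℤ.+ (a ℤ.+ + 0) ; i = + 1 ℤ.+ j in
     y ℤ.+ a ℤ.- (i ℤ.+ (i ℤ.+ + 0)) ℤ.+ + 1
     ≡ (+ 1 ℤ.+ (x ℤ.+ (y ℤ.+ (y ℤ.+ + 0)) ℤ.+ z ℤ.+ 2a ℤ.+ k)) ℤ.- (+ 1 ℤ.+ (x ℤ.+ y ℤ.+ z ℤ.+ 2a ℤ.+ j))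
    b = solve-ℤ
   nz : ∀ p f {m} → p * f ≡ F m → p ≢ 0ℚ
   nz p f {m} e p≡0 = F≢0 m (trans (sym e) (trans (cong (_* f) p≡0) (QP.*-zeroˡ f)))
   d≢0 : d ≢ 0ℚ
   d≢0 = *-≢0 {d₁ * d₂ * d₃} {d₄} (*-≢0 {d₁ * d₂} {d₃} (*-≢0 {d₁} {d₂} (nz d₁ c₁ {j +: y} k₁) (nz d₂ c₂ {2 *: (z +: y) +: 2 *: k +: 1} k₂)) (nz d₃ c₃ {y +: 2 *: z +: 2 *: k} k₃)) (nz d₄ c₄ {suc (x +: 2 *: y +: z +: 2 *: a +: k)} k₄)
  module _ (a : ℕ) where
   n₁ n₂ n₃ m₁ m₂ m₃ : ℕ → ℕ
   n₁ j = ff (z +: j)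
   n₂ j = fact (suc (suc (x +: 3 *: y +: 2 *: z +: 2 *: a +: (j +: j))))
   n₃ j = fact (suc (x +: y +: z +: 2 *: a +: j))
   m₁ j = ff (z +: y +: j)
   m₂ j = fact (suc (suc (x +: y +: 2 *: z +: 2 *: a +: (j +: j))))
   m₃ j = fact (suc (x +: 2 *: y +: z +: 2 *: a +: j))
   -- With both parts taken at the same index, the factorial of `y + 2z + 2j` cancels, and the
   -- factorials of odd numbers split by `fact-ff` into the factors of `Num` and `Den`.
   UV-ratio : ∀ j → U a j * V a j * (q (m₁ j) * q (m₂ j) * q (m₃ j) * q (kd y j)) ≡ q (n₁ j) * q (n₂ j) * q (n₃ j) * q (kn y j)
   UV-ratio j = *-cancelˡ {Ud * Vd} (*-≢0 {Ud} {Vd} (Factor.Ud≢0 a j) (Factor.Vd≢0 a j)) (begin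
    Ud * Vd * (U a j * V a j * (q (m₁ j) * q (m₂ j) * q (m₃ j) * q (kd y j)))
     ≡⟨ solve-ℚ× 5 (λ u v p r w → p ⊡ r ⊡ (u ⊡ v ⊡ w) ≑ u ⊡ p ⊡ (v ⊡ r) ⊡ w) refl (U a j) (V a j) Ud Vd _ ⟩
    U a j * Ud * (V a j * Vd) * (q (m₁ j) * q (m₂ j) * q (m₃ j) * q (kd y j))
     ≡⟨ cong₂ (λ v w → v * (q (m₁ j) * q (m₂ j) * q (m₃ j) * w)) (cong₂ _*_ (inv-cancel {Factor.Un a j} {Ud} (Factor.Ud≢0 a j)) (inv-cancel {Factor.Vn a j} {Vd} (Factor.Vd≢0 a j)))
        (q-*₃ (fact (suc (x +: 3 *: j))) (fact (suc (x +: 3 *: y +: (j +: j)))) (fact (j +: y))) ⟩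
    F (2 *: z +: 2 *: j +: 1) * C * G₁ * G₂ * G₃ * q (n₃ j) * (F (z +: y +: j) * q (n₂ j)) * (q (m₁ j) * q (m₂ j) * q (m₃ j) * (H₁ * H₂ * H₃))
     ≡⟨ cong (λ v → v * C * G₁ * G₂ * G₃ * q (n₃ j) * (F (z +: y +: j) * q (n₂ j)) * (q (m₁ j) * q (m₂ j) * q (m₃ j) * (H₁ * H₂ * H₃))) odd₁ ⟩
    (q (n₁ j) * F (z +: j)) * C * G₁ * G₂ * G₃ * q (n₃ j) * (F (z +: y +: j) * q (n₂ j)) * (q (m₁ j) * q (m₂ j) * q (m₃ j) * (H₁ * H₂ * H₃))
     ≡⟨ solve-ℚ× 15 (λ n₁ f C G₁ G₂ G₃ n₃ g n₂ m₁ m₂ m₃ H₁ H₂ H₃ →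
        (n₁ ⊡ f) ⊡ C ⊡ G₁ ⊡ G₂ ⊡ G₃ ⊡ n₃ ⊡ (g ⊡ n₂) ⊡ (m₁ ⊡ m₂ ⊡ m₃ ⊡ (H₁ ⊡ H₂ ⊡ H₃))
        ≑ (f ⊡ m₂ ⊡ H₁ ⊡ H₂ ⊡ H₃) ⊡ ((m₁ ⊡ g) ⊡ C ⊡ m₃) ⊡ (n₁ ⊡ n₂ ⊡ n₃ ⊡ (G₁ ⊡ G₂ ⊡ G₃)))
       refl (q (n₁ j)) (F (z +: j)) C G₁ G₂ G₃ (q (n₃ j)) (F (z +: y +: j)) (q (n₂ j)) (q (m₁ j)) (q (m₂ j)) (q (m₃ j)) H₁ H₂ H₃ ⟩
    Ud * ((q (m₁ j) * F (z +: y +: j)) * C * q (m₃ j)) * (q (n₁ j) * q (n₂ j) * q (n₃ j) * (G₁ * G₂ * G₃))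
     ≡⟨ cong₂ (λ v w → Ud * (v * C * q (m₃ j)) * (q (n₁ j) * q (n₂ j) * q (n₃ j) * w)) odd₂ (q-*₃ (fact (suc (x +: y +: (j +: j)))) (fact (suc (x +: 3 *: y +: 3 *: j))) (fact j)) ⟨
    Ud * Vd * (q (n₁ j) * q (n₂ j) * q (n₃ j) * q (kn y j)) ∎)
    where
    Ud Vd C G₁ G₂ G₃ H₁ H₂ H₃ : ℚ
    Ud = Factor.Ud a j
    Vd = Factor.Vd a j
    C = F (y +: 2 *: z +: 2 *: j)
    G₁ = F (suc (x +: y +: (j +: j)))
    G₂ = F (suc (x +: 3 *: y +: 3 *: j))
    G₃ = F j
    H₁ = F (suc (x +: 3 *: j))
    H₂ = F (suc (x +: 3 *: y +: (j +: j)))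
    H₃ = F (j +: y)
    odd : ∀ w → F (2 *: w +: 2 *: j +: 1) ≡ q (ff (w +: j)) * F (w +: j)
    odd w = trans (cong F (e w j)) (trans (cong q (Factorials.fact-ff (w +: j))) (q-* (ff (w +: j)) (fact (w +: j))))
     where
     e : ∀ w j → 2 *: w +: 2 *: j +: 1 ≡ suc (w +: j +: (w +: j))
     e = solve-ℕ
    odd₁ = odd z
    odd₂ = odd (z +: y)
   ∏UV : ∏ a (λ j → U a j * V a j) * q (Den y z a) ≡ q (Num y z a)
   ∏UV = begin
    ∏ a (λ j → U a j * V a j) * q (Den y z a)
     ≡⟨ cong (∏ a (λ j → U a j * V a j) *_) (trans (q-*₄ (Jf (z +: y) a) (J₂ (x +: y +: 2 *: z +: 2 *: a) a) (J₁ (x +: 2 *: y +: z +: 2 *: a) a) (KD y a)) (sym (four m₁ m₂ m₃ (kd y)))) ⟩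
    ∏ a (λ j → U a j * V a j) * ∏ a (λ j → q (m₁ j) * q (m₂ j) * q (m₃ j) * q (kd y j))
     ≡⟨ ∏-* a (λ j → U a j * V a j) (λ j → q (m₁ j) * q (m₂ j) * q (m₃ j) * q (kd y j)) ⟨
    ∏ a (λ j → U a j * V a j * (q (m₁ j) * q (m₂ j) * q (m₃ j) * q (kd y j)))
     ≡⟨ ∏-cong a (λ j _ → UV-ratio j) ⟩
    ∏ a (λ j → q (n₁ j) * q (n₂ j) * q (n₃ j) * q (kn y j))
     ≡⟨ trans (four n₁ n₂ n₃ (kn y)) (sym (q-*₄ (Jf z a) (J₂ (x +: 3 *: y +: 2 *: z +: 2 *: a) a) (J₁ (x +: y +: z +: 2 *: a) a) (KN y a))) ⟩
    q (Num y z a) ∎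
    where
    four : ∀ h₁ h₂ h₃ h₄ → ∏ a (λ j → q (h₁ j) * q (h₂ j) * q (h₃ j) * q (h₄ j)) ≡ q (Π a h₁) * q (Π a h₂) * q (Π a h₃) * q (Π a h₄)
    four h₁ h₂ h₃ h₄ = trans (∏-* a (λ j → q (h₁ j) * q (h₂ j) * q (h₃ j)) (λ j → q (h₄ j))) (cong₂ _*_
     (trans (∏-* a (λ j → q (h₁ j) * q (h₂ j)) (λ j → q (h₃ j))) (cong₂ _*_
      (trans (∏-* a (λ j → q (h₁ j)) (λ j → q (h₂ j))) (cong₂ _*_ (∏-Π a h₁) (∏-Π a h₂))) (∏-Π a h₃))) (∏-Π a h₄))
   -- Single factors of `P₁` do not match those of `B`. After the split, the part counted from the
   -- end is multiplied in reverse order, and then the match is factor by factor.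
   satellite-product : ∏₁ a (satTerm a) ≡ B y z a
   satellite-product = begin
    ∏₁ a (satTerm a) ≡⟨ ∏₁≡∏ a (satTerm a) ⟩
    ∏ a (λ j → satTerm a (suc j)) ≡⟨ ∏-cong a (λ j j<a → subst (λ b → satTerm b (suc j) ≡ U b j * V b (a ℕ.∸ suc j)) (m+[n∸m]≡n j<a) (satTerm-split j (a ℕ.∸ suc j))) ⟩
    ∏ a (λ j → U a j * V a (a ℕ.∸ suc j)) ≡⟨ ∏-* a (U a) (λ j → V a (a ℕ.∸ suc j)) ⟩
    ∏ a (U a) * ∏ a (λ j → V a (a ℕ.∸ suc j)) ≡⟨ cong (∏ a (U a) *_) (∏-reverse a (V a)) ⟩
    ∏ a (U a) * ∏ a (V a) ≡⟨ ∏-* a (U a) (V a) ⟨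
    ∏ a (λ j → U a j * V a j) ≡⟨ inv-unique {∏ a (λ j → U a j * V a j)} {q (Den y z a)} (q-≢0 {Den y z a} (Den≢0 y z a)) ∏UV ⟩
    B y z a ∎

 -- At `x + 1` the symbols of the first product contain `2 (3a + x) + 2`, so this product belongs to
 -- the core enlarged by `3a`.
 P₁-closed : ∀ x y z a → P₁ (suc x) y z a ≡ Q x y z a
 P₁-closed x y z a = begin
  P₁ (suc x) y z a
   ≡⟨⟩
  inv (ι (+ (2 ℕ.^ (y ℕ.+ z)))) * ∏₁ (y ℕ.+ z) (CoreProduct.coreTerm (ℓ (2 ℕ.* suc x ℕ.+ 6 ℕ.* a))) * ∏₁ a (SatelliteProduct.satTerm x y z a)
   ≡⟨ cong₂ (λ X S → inv (ι (+ (2 ℕ.^ (y ℕ.+ z)))) * ∏₁ (y ℕ.+ z) (CoreProduct.coreTerm (+ X)) * S) (e x a) (SatelliteProduct.satellite-product x y z a) ⟩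
  inv (ι (+ (2 ℕ.^ (y ℕ.+ z)))) * ∏₁ (y ℕ.+ z) (CoreProduct.coreTerm (+ (2 ℕ.* (a ℕ.* 3 ℕ.+ x) ℕ.+ 2))) * ClosedForm.B x y z a
   ≡⟨ cong (_* ClosedForm.B x y z a) (CoreProduct.core-product (a ℕ.* 3 ℕ.+ x) (y ℕ.+ z)) ⟩
  ClosedForm.Φ x y z a
   ≡⟨ ClosedForm.Q-closed x a y z ⟨
  Q x y z a ∎
  where
  open ≡-Reasoning
  e : ∀ x a → 2 ℕ.* suc x ℕ.+ 6 ℕ.* a ≡ 2 ℕ.* (a ℕ.* 3 ℕ.+ x) ℕ.+ 2
  e = solve-ℕ

-- Linear arithmetic over the natural numbers by explicit certificates.

module Farkas where
 open import Data.Nat using (_+_; _*_; _≤_; _≤?_; _≤ᵇ_)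
 open import Data.Bool using (T; _∧_)
 open import Data.Bool.Properties using (T-∧)
 open import Data.Unit using (⊤)
 open import Function using (Equivalence)

 infix 9 #_
 infixl 8 _:*_
 infixl 7 _:+_

 data Expr : Set where
  var : ℕ → Expr
  #_ : ℕ → Expr
  _:+_ : Expr → Expr → Expr
  _:*_ : ℕ → Expr → Expr

 at : List ℕ → ℕ → ℕ
 at [] _ = 0
 at (x ∷ _) zero = x
 at (_ ∷ ρ) (suc i) = at ρ i

 ⟦_⟧ : Expr → List ℕ → ℕ
 ⟦ var i ⟧ ρ = at ρ i
 ⟦ # n ⟧ ρ = n
 ⟦ a :+ b ⟧ ρ = ⟦ a ⟧ ρ + ⟦ b ⟧ ρ
 ⟦ k :* a ⟧ ρ = k * ⟦ a ⟧ ρ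

 -- Constant and coefficients are natural numbers; an inequality keeps its two sides apart, so
 -- nothing has to be subtracted.
 Linear : Set
 Linear = ℕ × List ℕ

 dot : List ℕ → List ℕ → ℕ
 dot [] ρ = 0
 dot (c ∷ cs) [] = 0
 dot (c ∷ cs) (x ∷ ρ) = c * x + dot cs ρ

 value : Linear → List ℕ → ℕ
 value (c , cs) ρ = c + dot cs ρ

 plus : List ℕ → List ℕ → List ℕ
 plus [] ds = ds
 plus (c ∷ cs) [] = c ∷ cs
 plus (c ∷ cs) (d ∷ ds) = c + d ∷ plus cs ds

 dot-plus : ∀ cs ds ρ → dot (plus cs ds) ρ ≡ dot cs ρ + dot ds ρ
 dot-plus [] ds ρ = refl
 dot-plus (c ∷ cs) [] ρ = sym (NP.+-identityʳ _)
 dot-plus (c ∷ cs) (d ∷ ds) [] = refl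
 dot-plus (c ∷ cs) (d ∷ ds) (x ∷ ρ) = trans (cong (λ w → (c + d) * x + w) (dot-plus cs ds ρ)) (lemma c d x (dot cs ρ) (dot ds ρ))
  where
  lemma : ∀ c d x u w → (c + d) * x + (u + w) ≡ c * x + u + (d * x + w)
  lemma = solve-ℕ

 dot-scale : ∀ k cs ρ → dot (map (k *_) cs) ρ ≡ k * dot cs ρ
 dot-scale k [] ρ = sym (NP.*-zeroʳ k)
 dot-scale k (c ∷ cs) [] = sym (NP.*-zeroʳ k)
 dot-scale k (c ∷ cs) (x ∷ ρ) = trans (cong (λ w → k * c * x + w) (dot-scale k cs ρ)) (lemma k c x (dot cs ρ))
  where
  lemma : ∀ k c x u → k * c * x + k * u ≡ k * (c * x + u)
  lemma = solve-ℕ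

 basis : ℕ → List ℕ
 basis zero = 1 ∷ []
 basis (suc i) = 0 ∷ basis i

 dot-basis : ∀ i ρ → dot (basis i) ρ ≡ at ρ i
 dot-basis zero [] = refl
 dot-basis zero (x ∷ ρ) = trans (NP.+-identityʳ _) (NP.+-identityʳ x)
 dot-basis (suc i) [] = refl
 dot-basis (suc i) (x ∷ ρ) = dot-basis i ρ

 _+:_ : Linear → Linear → Linear
 (c , cs) +: (d , ds) = c + d , plus cs ds

 value-+: : ∀ f g ρ → value (f +: g) ρ ≡ value f ρ + value g ρ
 value-+: (c , cs) (d , ds) ρ = trans (cong (λ w → c + d + w) (dot-plus cs ds ρ)) (lemma c d (dot cs ρ) (dot ds ρ))
  where
  lemma : ∀ c d u w → c + d + (u + w) ≡ c + u + (d + w)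
  lemma = solve-ℕ

 scale : ℕ → Linear → Linear
 scale k (c , cs) = k * c , map (k *_) cs

 value-scale : ∀ k f ρ → value (scale k f) ρ ≡ k * value f ρ
 value-scale k (c , cs) ρ = trans (cong (λ w → k * c + w) (dot-scale k cs ρ)) (sym (NP.*-distribˡ-+ k c _))

 linearize : Expr → Linear
 linearize (var i) = 0 , basis i
 linearize (# n) = n , []
 linearize (a :+ b) = linearize a +: linearize b
 linearize (k :* a) = scale k (linearize a)

 value-linear : ∀ e ρ → value (linearize e) ρ ≡ ⟦ e ⟧ ρ
 value-linear (var i) ρ = dot-basis i ρ
 value-linear (# n) ρ = NP.+-identityʳ n
 value-linear (a :+ b) ρ = trans (value-+: (linearize a) (linearize b) ρ) (cong₂ _+_ (value-linear a ρ) (value-linear b ρ))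
 value-linear (k :* a) ρ = trans (value-scale k (linearize a) ρ) (cong (λ w → k * w) (value-linear a ρ))

 Inequality : Set
 Inequality = Linear × Linear

 Valid : List ℕ → Inequality → Set
 Valid ρ (l , r) = value l ρ ≤ value r ρ

 infix 6 _≼_ _≺_ _:=_ _⋠_ _⊀_
 data Relation : Set where
  _≼_ _:=_ _⋠_ : Expr → Expr → Relation

 _≺_ _⊀_ : Expr → Expr → Relation
 l ≺ r = # 1 :+ l ≼ r
 l ⊀ r = # 1 :+ l ⋠ r

 Holds : List ℕ → Relation → Set
 Holds ρ (l ≼ r) = ⟦ l ⟧ ρ ≤ ⟦ r ⟧ ρ
 Holds ρ (l := r) = ⟦ l ⟧ ρ ≡ ⟦ r ⟧ ρ
 Holds ρ (l ⋠ r) = ¬ (⟦ l ⟧ ρ ≤ ⟦ r ⟧ ρ)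

 infixr 4 _&_ _And_
 record _And_ (A B : Set) : Set where
  constructor _&_
  field
   fst : A
   snd : B

 HoldAll : List ℕ → List Relation → Set
 HoldAll ρ [] = ⊤
 HoldAll ρ (h ∷ []) = Holds ρ h
 HoldAll ρ (h ∷ hs@(_ ∷ _)) = Holds ρ h And HoldAll ρ hs

 data ValidAll (ρ : List ℕ) : List Inequality → Set where
  [] : ValidAll ρ []
  _∷_ : ∀ {i is} → Valid ρ i → ValidAll ρ is → ValidAll ρ (i ∷ is)

 inequality : Expr → Expr → Inequality
 inequality l r = linearize l , linearize r

 valid : ∀ ρ l r → ⟦ l ⟧ ρ ≤ ⟦ r ⟧ ρ → Valid ρ (inequality l r)
 valid ρ l r = subst₂ _≤_ (sym (value-linear l ρ)) (sym (value-linear r ρ))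

 expand : Relation → List Inequality
 expand (l ≼ r) = inequality l r ∷ []
 expand (l := r) = inequality l r ∷ inequality r l ∷ []
 expand (l ⋠ r) = inequality (# 1 :+ r) l ∷ []

 expand-valid : ∀ ρ h {is} → Holds ρ h → ValidAll ρ is → ValidAll ρ (expand h ++ is)
 expand-valid ρ (l ≼ r) p vs = valid ρ l r p ∷ vs
 expand-valid ρ (l := r) p vs = valid ρ l r (≤-reflexive p) ∷ valid ρ r l (≤-reflexive (sym p)) ∷ vs
 expand-valid ρ (l ⋠ r) p vs = valid ρ (# 1 :+ r) l (NP.≰⇒> p) ∷ vs

 expandAll : List Relation → List Inequality
 expandAll = List.foldr (λ h is → expand h ++ is) []

 expandAll-valid : ∀ ρ hs → HoldAll ρ hs → ValidAll ρ (expandAll hs)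
 expandAll-valid ρ [] _ = []
 expandAll-valid ρ (h ∷ []) p = expand-valid ρ h p []
 expandAll-valid ρ (h ∷ hs@(_ ∷ _)) (p & ps) = expand-valid ρ h p (expandAll-valid ρ hs ps)

 combine : List ℕ → List Inequality → Inequality
 combine (k ∷ ks) ((l , r) ∷ is) = let (l′ , r′) = combine ks is in scale k l +: l′ , scale k r +: r′
 combine _ _ = (0 , []) , (0 , [])

 combine-valid : ∀ ρ ks is → ValidAll ρ is → Valid ρ (combine ks is)
 combine-valid ρ [] is vs = z≤n
 combine-valid ρ (k ∷ ks) [] vs = z≤n
 combine-valid ρ (k ∷ ks) ((l , r) ∷ is) (v ∷ vs) =
  subst₂ _≤_ (sym (trans (value-+: (scale k l) (proj₁ (combine ks is)) ρ) (cong (λ w → w + value (proj₁ (combine ks is)) ρ) (value-scale k l ρ))))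
        (sym (trans (value-+: (scale k r) (proj₂ (combine ks is)) ρ) (cong (λ w → w + value (proj₂ (combine ks is)) ρ) (value-scale k r ρ))))
   (+-mono-≤ (NP.*-monoʳ-≤ k v) (combine-valid ρ ks is vs))

 dominates : List ℕ → List ℕ → Bool
 dominates cs [] = true
 dominates [] (d ∷ ds) = (d ≤ᵇ 0) ∧ dominates [] ds
 dominates (c ∷ cs) (d ∷ ds) = (d ≤ᵇ c) ∧ dominates cs ds

 ∧⁻ : ∀ {a b} → T (a ∧ b) → T a × T b
 ∧⁻ = Equivalence.to T-∧

 dot-mono : ∀ cs ds ρ → T (dominates cs ds) → dot ds ρ ≤ dot cs ρ
 dot-mono cs [] ρ _ = z≤n
 dot-mono [] (d ∷ ds) [] _ = z≤n
 dot-mono (c ∷ cs) (d ∷ ds) [] _ = z≤n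
 dot-mono [] (d ∷ ds) (x ∷ ρ) t = +-mono-≤ (NP.*-monoˡ-≤ x (≤ᵇ⇒≤ d 0 (proj₁ (∧⁻ {d ≤ᵇ 0} t)))) (dot-mono [] ds ρ (proj₂ (∧⁻ {d ≤ᵇ 0} t)))
 dot-mono (c ∷ cs) (d ∷ ds) (x ∷ ρ) t = +-mono-≤ (NP.*-monoˡ-≤ x (≤ᵇ⇒≤ d c (proj₁ (∧⁻ {d ≤ᵇ c} t)))) (dot-mono cs ds ρ (proj₂ (∧⁻ {d ≤ᵇ c} t)))

 -- A left side with the larger constant and coefficientwise larger or equal cannot be at most the
 -- right side, as the variables are natural numbers; their non-negativity is thus built into the
 -- test.
 absurd : Inequality → Bool
 absurd ((c , cs) , (d , ds)) = (suc d ≤ᵇ c) ∧ dominates cs ds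

 absurd-invalid : ∀ ρ i → T (absurd i) → ¬ Valid ρ i
 absurd-invalid ρ ((c , cs) , (d , ds)) t v = <⇒≱
  (NP.+-mono-<-≤ (≤ᵇ⇒≤ (suc d) c (proj₁ (∧⁻ {suc d ≤ᵇ c} t))) (dot-mono cs ds ρ (proj₂ (∧⁻ {suc d ≤ᵇ c} t)))) v

 -- Farkas' lemma: the multipliers ks turn the relations (preceded by the negated goal) into an absurd inequality.
 contradiction-by : ∀ {X : Set} ρ hs ks → {T (absurd (combine ks (expandAll hs)))} → HoldAll ρ hs → X
 contradiction-by ρ hs ks {t} p = ⊥-elim (absurd-invalid ρ (combine ks (expandAll hs)) t (combine-valid ρ ks (expandAll hs) (expandAll-valid ρ hs p)))

 ≤-by : ∀ ρ hs l r ks → {T (absurd (combine ks (inequality (# 1 :+ r) l ∷ expandAll hs)))} → HoldAll ρ hs → ⟦ l ⟧ ρ ≤ ⟦ r ⟧ ρ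
 ≤-by ρ hs l r ks {t} p with ⟦ l ⟧ ρ ≤? ⟦ r ⟧ ρ
 ... | yes l≤r = l≤r
 ... | no l≰r = ⊥-elim (absurd-invalid ρ (combine ks (inequality (# 1 :+ r) l ∷ expandAll hs)) t
  (combine-valid ρ ks (inequality (# 1 :+ r) l ∷ expandAll hs) (valid ρ (# 1 :+ r) l (NP.≰⇒> l≰r) ∷ expandAll-valid ρ hs p)))

 infix 4 _⊢_
 record Sequent : Set where
  constructor _⊢_
  field
   hypotheses : List Relation
   conclusion : Relation

 -- Every expression may refer to the parameters of the region and, by position, to the variables listed in the first argument of linear.
 ŷ ẑ â x̂ t̂ d̂ m̂ L̂ ĉ Ŵ T̂ μ̂ ŝ : Expr
 ŷ = var 0
 ẑ = var 1
 â = var 2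
 x̂ = var 3
 t̂ = # 1 :+ (ŷ :+ ẑ)
 d̂ = 2 :* ẑ :+ # 2
 m̂ = d̂ :+ 2 :* ŷ :+ 2 :* â
 L̂ = 3 :* m̂ :+ 2 :* x̂
 ĉ = m̂ :+ x̂ :+ ŷ
 Ŵ = # 1 :+ (ŷ :+ ẑ :+ (â :+ â))
 T̂ = m̂ :+ (x̂ :+ (ŷ :+ (â :+ ẑ)))
 μ̂ = # 1 :+ (ẑ :+ ŷ :+ â)
 ŝ = 6 :* t̂ :+ 2 :* x̂ :+ 6 :* â

 infix 9 !_
 !_ : ℕ → Expr
 ! i = var (4 + i)

 module Linear (y z a x : ℕ) where
  env : List ℕ → List ℕ
  env ρ = y ∷ z ∷ a ∷ x ∷ ρ
  Certified : Sequent → List ℕ → Set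
  Certified (hs ⊢ l ≼ r) ks = T (absurd (combine ks (inequality (# 1 :+ r) l ∷ expandAll hs)))
  Certified (hs ⊢ _) ks = ⊥
  -- The hidden certificate evaluates to the unit type if the multipliers are right. The first
  -- multiplier belongs to the negated conclusion, and an equation takes two, one for each
  -- direction.
  linear : ∀ ρ s ks → {Certified s ks} → HoldAll (env ρ) (Sequent.hypotheses s) → Holds (env ρ) (Sequent.conclusion s)
  linear ρ (hs ⊢ l ≼ r) ks {t} p = ≤-by (env ρ) hs l r ks {t} p
  equal : ∀ ρ hs l r ks ks′ → {Certified (hs ⊢ l ≼ r) ks} → {Certified (hs ⊢ r ≼ l) ks′} → HoldAll (env ρ) hs → ⟦ l ⟧ (env ρ) ≡ ⟦ r ⟧ (env ρ)
  equal ρ hs l r ks ks′ {t} {t′} p = NP.≤-antisym (≤-by (env ρ) hs l r ks {t} p) (≤-by (env ρ) hs r l ks′ {t′} p)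
  refute : ∀ {X : Set} ρ hs ks → {T (absurd (combine ks (expandAll hs)))} → HoldAll (env ρ) hs → X
  refute ρ hs ks {t} p = contradiction-by (env ρ) hs ks {t} p

-- Words that encode families of non-intersecting paths.

module PathWords where
 open import Data.Nat using (_≤_; _<_; _<?_)
 import Data.List.Membership.DecPropositional as DecMem

 -- Strictly decreasing lists, a canonical form for finite sets of positions: `Below-unique` turns
 -- equality of members into equality of lists.
 data Below (hi : ℕ) : List ℕ → Set where
  [] : Below hi []
  _∷_ : ∀ {A P} → A < hi → Below A P → Below hi (A ∷ P)

 Below-weaken : ∀ {m n P} → m ≤ n → Below m P → Below n P
 Below-weaken m≤n [] = []
 Below-weaken m≤n (p ∷ q) = ≤-trans p m≤n ∷ q

 Below-∈ : ∀ {hi P A} → Below hi P → A ∈ P → A < hi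
 Below-∈ (p ∷ ps) (here refl) = p
 Below-∈ (p ∷ ps) (there A∈) = <-trans (Below-∈ ps A∈) p

 Below-unique : ∀ {hi P Q} → Below hi P → Below hi Q → (∀ A → A ∈ P → A ∈ Q) → (∀ A → A ∈ Q → A ∈ P) → P ≡ Q
 Below-unique [] [] _ _ = refl
 Below-unique [] (_∷_ {A} q qs) f g with () ← g A (here refl)
 Below-unique (_∷_ {A} p ps) [] f g with () ← f A (here refl)
 Below-unique (_∷_ {A} p ps) (_∷_ {B} q qs) f g with f A (here refl) | g B (here refl)
 ... | there A∈ | there B∈ = ⊥-elim (<-asym (Below-∈ qs A∈) (Below-∈ ps B∈))
 ... | here refl | _ = cong (A ∷_) (Below-unique ps qs (λ C C∈ → tail (f C (there C∈)) (Below-∈ ps C∈)) (λ C C∈ → tail (g C (there C∈)) (Below-∈ qs C∈)))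
  where
  tail : ∀ {C R} → C ∈ A ∷ R → C < A → C ∈ R
  tail (here refl) C<A = ⊥-elim (<-irrefl refl C<A)
  tail (there C∈) _ = C∈
 ... | there _ | here refl = cong (A ∷_) (Below-unique ps qs (λ C C∈ → tail (f C (there C∈)) (Below-∈ ps C∈)) (λ C C∈ → tail (g C (there C∈)) (Below-∈ qs C∈)))
  where
  tail : ∀ {C R} → C ∈ A ∷ R → C < A → C ∈ R
  tail (here refl) C<A = ⊥-elim (<-irrefl refl C<A)
  tail (there C∈) _ = C∈

 module _ {P : ℕ → Set} (P? : ∀ n → Dec (P n)) where
  select : ℕ → List ℕ
  select zero = []
  select (suc n) with P? n
  ... | yes _ = n ∷ select n
  ... | no _ = select n
  select-Below : ∀ n → Below n (select n)
  select-Below zero = []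
  select-Below (suc n) with P? n
  ... | yes _ = ≤-refl ∷ select-Below n
  ... | no _ = Below-weaken (n≤1+n n) (select-Below n)
  ∈-select⁻ : ∀ n {A} → A ∈ select n → A < n × P A
  ∈-select⁻ (suc n) A∈ with P? n
  ∈-select⁻ (suc n) (here refl) | yes p = ≤-refl , p
  ∈-select⁻ (suc n) (there A∈) | yes p = m<n⇒m<1+n (proj₁ (∈-select⁻ n A∈)) , proj₂ (∈-select⁻ n A∈)
  ∈-select⁻ (suc n) A∈ | no _ = m<n⇒m<1+n (proj₁ (∈-select⁻ n A∈)) , proj₂ (∈-select⁻ n A∈)
  ∈-select⁺ : ∀ n {A} → A < n → P A → A ∈ select n
  ∈-select⁺ (suc n) {A} (s≤s A≤n) p with P? n | m≤n⇒m<n∨m≡n A≤n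
  ... | yes _ | inj₁ A<n = there (∈-select⁺ n A<n p)
  ... | no _ | inj₁ A<n = ∈-select⁺ n A<n p
  ... | yes _ | inj₂ refl = here refl
  ... | no ¬p | inj₂ refl = ⊥-elim (¬p p)

 -- One strip of a word: where each path enters, and whether it leaves at the same position or at
 -- the next.
 Entry : Set
 Entry = List (ℕ × Bool)

 dst : ℕ × Bool → ℕ
 dst (A , false) = A
 dst (A , true) = suc A

 open DecMem ℕ._≟_ using (_∈?_)

 -- Words describing families of non-intersecting paths that cross the strips
 -- b, b − 1, …, 1.  A path enters strip b through its down triangle at A and leaves it
 -- through the up triangle at A or at A + 1; U b and D b are the up and down triangles
 -- present in strip b.
 module Paths (U D : ℕ → ℕ → Set) (U? : ∀ b A → Dec (U b A)) (D? : ∀ b A → Dec (D b A)) (ub : ℕ → ℕ) where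
  -- The bound `hi` is the exit of the path treated before. It makes the exits strictly decreasing,
  -- so that the paths do not touch.
  steps : ℕ → ℕ → List ℕ → List Entry
  choose : ℕ → ℕ → ℕ × Bool → List ℕ → List Entry
  steps b hi [] = [] ∷ []
  steps b hi (A ∷ P) = choose b hi (A , false) P ++ choose b hi (A , true) P
  choose b hi p P with (dst p <? hi) ×-dec U? b (dst p)
  ... | yes _ = map (p ∷_) (steps b (dst p) P)
  ... | no _ = []
  -- Either a path comes down from the strip above, or the triangle above is missing and a path
  -- starts at the boundary.
  Enters : ℕ → List ℕ → ℕ → Set
  Enters k P′ A = D k A × (¬ U (suc k) A ⊎ A ∈ P′)
  enters? : ∀ k P′ A → Dec (Enters k P′ A)
  enters? k P′ A = D? k A ×-dec (¬? (U? (suc k) A) ⊎-dec (A ∈? P′))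
  next : ℕ → List ℕ → List ℕ
  next k P′ = select (enters? k P′) (ub k)
  -- An up triangle of strip k + 1 that no path uses is matched with the down triangle below it.
  Unmatched : ℕ → List ℕ → ℕ → Set
  Unmatched k P′ A = U (suc k) A × ¬ D k A × ¬ A ∈ P′
  unmatched? : ∀ k P′ A → Dec (Unmatched k P′ A)
  unmatched? k P′ A = U? (suc k) A ×-dec ¬? (D? k A) ×-dec ¬? (A ∈? P′)
  -- A word is discarded as soon as an up triangle off the paths has no down triangle below it to be
  -- matched with.
  Closed : ℕ → List ℕ → Set
  Closed k P′ = select (unmatched? k P′) (ub (suc k)) ≡ []
  closed? : ∀ k P′ → Dec (Closed k P′)
  closed? k P′ with select (unmatched? k P′) (ub (suc k))
  ... | [] = yes refl
  ... | _ ∷ _ = no λ ()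
  paths : ℕ → List ℕ → List (List Entry)
  continue : ℕ → Entry → List (List Entry)
  paths zero P = [] ∷ []
  paths (suc k) P = concatMap (continue k) (steps (suc k) (ub (suc k)) P)
  continue k e with closed? k (map dst e)
  ... | yes _ = map (e ∷_) (paths k (next k (map dst e)))
  ... | no _ = []

-- Summation of determinants over one strip of paths.

module PathSums where
 open import Data.Nat using (_≤_; _<_; _∸_)
 open import Data.Rational using (_+_; -_; _-_)
 open Embedding
 open Determinants
 open PathRows
 open PathWords

 sumOver : ∀ {X : Set} → (X → ℚ) → List X → ℚ
 sumOver f [] = 0ℚ
 sumOver f (x ∷ xs) = f x + sumOver f xs

 sumOver-++ : ∀ {X : Set} (f : X → ℚ) xs ys → sumOver f (xs ++ ys) ≡ sumOver f xs + sumOver f ys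
 sumOver-++ f [] ys = sym (QP.+-identityˡ _)
 sumOver-++ f (x ∷ xs) ys = trans (cong (λ s → f x + s) (sumOver-++ f xs ys)) (sym (QP.+-assoc (f x) _ _))

 sumOver-map : ∀ {X Y : Set} (f : Y → ℚ) (g : X → Y) xs → sumOver f (map g xs) ≡ sumOver (λ x → f (g x)) xs
 sumOver-map f g [] = refl
 sumOver-map f g (x ∷ xs) = cong (λ s → f (g x) + s) (sumOver-map f g xs)

 sumOver-cong : ∀ {X : Set} {f g : X → ℚ} xs → (∀ {x} → x ∈ xs → f x ≡ g x) → sumOver f xs ≡ sumOver g xs
 sumOver-cong [] e = refl
 sumOver-cong (x ∷ xs) e = cong₂ _+_ (e (here refl)) (sumOver-cong xs (λ x∈ → e (there x∈)))

 length-concatMap : ∀ {X Y : Set} (f : X → List Y) xs → q (length (concatMap f xs)) ≡ sumOver (λ x → q (length (f x))) xs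
 length-concatMap f [] = refl
 length-concatMap f (x ∷ xs) = trans (cong q (LP.length-++ (f x)))
  (trans (q-+ (length (f x)) _) (cong (λ s → q (length (f x)) + s) (length-concatMap f xs)))

 module Steps (U D′ : ℕ → ℕ → Set) (U? : ∀ b A → Dec (U b A)) (D? : ∀ b A → Dec (D′ b A)) (ub : ℕ → ℕ) where
  open Paths U D′ U? D? ub public
  choose-∷ : ∀ b hi p P {e} → e ∈ choose b hi p P → ∃ λ e′ → e ≡ p ∷ e′ × e′ ∈ steps b (dst p) P × dst p < hi × U b (dst p)
  choose-∷ b hi p P e∈ with (dst p NP.<? hi) ×-dec U? b (dst p)
  ... | yes (lt , u) with ∈-map⁻ (p ∷_) e∈
  ... | e′ , e′∈ , refl = e′ , refl , e′∈ , lt , u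
  steps-∷ : ∀ b hi A P {e} → e ∈ steps b hi (A ∷ P) →
   ∃ λ s → ∃ λ e′ → e ≡ (A , s) ∷ e′ × e′ ∈ steps b (dst (A , s)) P × dst (A , s) < hi × U b (dst (A , s))
  steps-∷ b hi A P e∈ with ∈-++⁻ (choose b hi (A , false) P) e∈
  ... | inj₁ e∈ˡ = false , choose-∷ b hi _ P e∈ˡ
  ... | inj₂ e∈ʳ = true , choose-∷ b hi _ P e∈ʳ
  steps-Below : ∀ b hi P {e} → e ∈ steps b hi P → Below hi (map dst e)
  steps-Below b hi [] (here refl) = []
  steps-Below b hi (A ∷ P) e∈ with steps-∷ b hi A P e∈
  ... | s , e′ , refl , e′∈ , lt , _ = lt ∷ steps-Below b _ P e′∈
  steps-U : ∀ b hi P {e} → e ∈ steps b hi P → All (U b) (map dst e)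
  steps-U b hi [] (here refl) = []
  steps-U b hi (A ∷ P) e∈ with steps-∷ b hi A P e∈
  ... | s , e′ , refl , e′∈ , _ , u = u ∷ steps-U b _ P e′∈
  steps-source : ∀ b hi P {e} → e ∈ steps b hi P → map proj₁ e ≡ P
  steps-source b hi [] (here refl) = refl
  steps-source b hi (A ∷ P) e∈ with steps-∷ b hi A P e∈
  ... | s , e′ , refl , e′∈ , _ = cong (A ∷_) (steps-source b _ P e′∈)
  -- One step of the Lindström–Gessel–Viennot argument: choices that are not allowed contribute
  -- determinants with a zero row or two equal rows.
  sum-steps : ∀ j n b (f g : ℕ → Row) →
   (∀ A k → j ≤ k → k < j ℕ.+ n → f A k ≡ g A k + g (suc A) k) →
   ∀ hi P pre → Below hi P →
   (∀ {A} → A ∈ P → ¬ U b A → ∀ pre post → D j n (pre ++ g A ∷ post) ≡ 0ℚ) →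
   (∀ {A} → A ∈ P → suc A < hi → U b (suc A)) →
   (∀ {A} → A ∈ P → suc A ≡ hi → ∀ post → D j n (pre ++ g (suc A) ∷ post) ≡ 0ℚ) →
   sumOver (λ e → D j n (pre ++ map g (map dst e))) (steps b hi P) ≡ D j n (pre ++ map f P)
  sum-steps j n b f g pascal hi [] pre _ _ _ _ = QP.+-identityʳ _
  sum-steps j n b f g pascal hi (A ∷ P) pre (A<hi ∷ below) zeros ups top = begin
   sumOver φ (choose b hi (A , false) P ++ choose b hi (A , true) P)
    ≡⟨ sumOver-++ φ (choose b hi (A , false) P) _ ⟩
   sumOver φ (choose b hi (A , false) P) + sumOver φ (choose b hi (A , true) P)
    ≡⟨ cong₂ _+_ (chosen (A , false) (≤-refl) stay) (chosen (A , true) (n≤1+n A) move) ⟩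
   D j n (pre ++ g A ∷ map f P) + D j n (pre ++ g (suc A) ∷ map f P)
    ≡⟨ D-add-row {f A} {g A} {g (suc A)} j n (pascal A) pre (map f P) ⟨
   D j n (pre ++ f A ∷ map f P) ∎
   where
   open ≡-Reasoning
   φ : Entry → ℚ
   φ e = D j n (pre ++ map g (map dst e))
   stay : ¬ (A < hi × U b A) → ∀ post → D j n (pre ++ g A ∷ post) ≡ 0ℚ
   stay ¬s = zeros (here refl) (λ u → ¬s (A<hi , u)) pre
   move : ¬ (suc A < hi × U b (suc A)) → ∀ post → D j n (pre ++ g (suc A) ∷ post) ≡ 0ℚ
   move ¬s with m≤n⇒m<n∨m≡n A<hi
   ... | inj₁ lt = ⊥-elim (¬s (lt , ups (here refl) lt))
   ... | inj₂ e = top (here refl) e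
   chosen : ∀ p → A ≤ dst p → (¬ (dst p < hi × U b (dst p)) → ∀ post → D j n (pre ++ g (dst p) ∷ post) ≡ 0ℚ) →
    sumOver φ (choose b hi p P) ≡ D j n (pre ++ g (dst p) ∷ map f P)
   chosen p A≤ vanish with (dst p NP.<? hi) ×-dec U? b (dst p)
   ... | no ¬s = sym (vanish ¬s (map f P))
   ... | yes (lt , u) = begin
    sumOver φ (map (p ∷_) (steps b (dst p) P)) ≡⟨ sumOver-map φ (p ∷_) (steps b (dst p) P) ⟩
    sumOver (λ e → φ (p ∷ e)) (steps b (dst p) P) ≡⟨ sumOver-cong (steps b (dst p) P) (λ {e} _ → cong (D j n) (sym (LP.++-assoc pre [ g (dst p) ] (map g (map dst e))))) ⟩
    sumOver (λ e → D j n ((pre ++ [ g (dst p) ]) ++ map g (map dst e))) (steps b (dst p) P)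
     ≡⟨ sum-steps j n b f g pascal (dst p) P (pre ++ [ g (dst p) ]) (Below-weaken A≤ below)
        (λ A∈ → zeros (there A∈)) (λ A∈ l → ups (there A∈) (<-trans l lt)) again ⟩
    D j n ((pre ++ [ g (dst p) ]) ++ map f P) ≡⟨ cong (D j n) (LP.++-assoc pre [ g (dst p) ] (map f P)) ⟩
    D j n (pre ++ g (dst p) ∷ map f P) ∎
    where
    -- The next path would leave where the present one does, and its row would repeat.
    again : ∀ {A′} → A′ ∈ P → suc A′ ≡ dst p → ∀ post → D j n ((pre ++ [ g (dst p) ]) ++ g (suc A′) ∷ post) ≡ 0ℚ
    again _ e post = trans (cong (D j n) (trans (LP.++-assoc pre [ g (dst p) ] _) (cong (λ B → pre ++ g (dst p) ∷ g B ∷ post) e)))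
     (D-alternating j n pre (g (dst p)) post)
  length-continue : ∀ k e → Closed k (map dst e) → length (continue k e) ≡ length (paths k (next k (map dst e)))
  length-continue k e cl with closed? k (map dst e)
  ... | yes _ = LP.length-map (e ∷_) (paths k (next k (map dst e)))
  ... | no ¬cl = ⊥-elim (¬cl cl)
  length-open : ∀ k e → ¬ Closed k (map dst e) → length (continue k e) ≡ 0
  length-open k e ¬cl with closed? k (map dst e)
  ... | yes cl = ⊥-elim (¬cl cl)
  ... | no _ = refl
  Closed⁺ : ∀ k P → (∀ A → A < ub (suc k) → U (suc k) A → ¬ D′ k A → A ∈ P) → Closed k P
  Closed⁺ k P f = Below-unique (select-Below (unmatched? k P) (ub (suc k))) [] none (λ _ ())
   where
   none : ∀ A → A ∈ select (unmatched? k P) (ub (suc k)) → A ∈ []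
   none A A∈ with ∈-select⁻ (unmatched? k P) (ub (suc k)) A∈
   ... | lt , u , ¬d , ∉ = ⊥-elim (∉ (f A lt u ¬d))
  Closed⁻ : ∀ k P → Closed k P → ∀ A → A < ub (suc k) → U (suc k) A → ¬ D′ k A → ¬ ¬ A ∈ P
  Closed⁻ k P cl A lt u ¬d ∉ with () ← subst (A ∈_) cl (∈-select⁺ (unmatched? k P) (ub (suc k)) lt (u , ¬d , ∉))
  next⁺ : ∀ k P′ {A} → A < ub k → D′ k A → ¬ U (suc k) A ⊎ A ∈ P′ → A ∈ next k P′
  next⁺ k P′ lt d u = ∈-select⁺ (enters? k P′) (ub k) lt (d , u)
  next⁻ : ∀ k P′ {A} → A ∈ next k P′ → A < ub k × D′ k A × (¬ U (suc k) A ⊎ A ∈ P′)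
  next⁻ k P′ A∈ = ∈-select⁻ (enters? k P′) (ub k) A∈
  next-Below : ∀ k P′ → Below (ub k) (next k P′)
  next-Below k P′ = select-Below (enters? k P′) (ub k)

 module Rows (m : ℕ) where
  -- Column `j` stands for the exit at position `m − 1 − j` of the strip `m − j`; from position `A`
  -- it takes `m − 1 − A − j` moves in `β + j − m` strips. A down triangle of strip `b` carries
  -- `row (suc b)`, the up triangle through which the path leaves that strip carries `row b`.
  row : ℕ → ℕ → Row
  row β A j = bin ((β ℕ.+ j) ∸ m) (+ m ℤ.- + suc (A ℕ.+ j))
  -- The two terms are the choices to stay and to move; the hypothesis makes the truncated
  -- difference in the upper index exact.
  row-pascal : ∀ β A j → m ≤ β ℕ.+ j → row (suc β) A j ≡ row β A j + row β (suc A) j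
  row-pascal β A j m≤ = trans (cong (λ n → bin n (+ m ℤ.- + suc (A ℕ.+ j))) (NP.+-∸-assoc 1 m≤))
   (cong (λ r → row β A j + bin ((β ℕ.+ j) ∸ m) r) (lemma (+ m) (+ (A ℕ.+ j))))
   where
   lemma : ∀ m k → m ℤ.- (+ 1 ℤ.+ k) ℤ.- + 1 ≡ m ℤ.- (+ 1 ℤ.+ (+ 1 ℤ.+ k))
   lemma = solve-ℤ
  row-v : ∀ A s c j → s ℕ.+ suc A ≡ m → row (m ℕ.+ c) A j ≡ v s c j
  row-v A s c j e = cong₂ bin (trans (cong (_∸ m) (NP.+-assoc m c j)) (NP.m+n∸m≡n m (c ℕ.+ j)))
   (trans (cong (λ m → + m ℤ.- + suc (A ℕ.+ j)) (sym e)) (lemma (+ s) (+ A) (+ j)))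
   where
   lemma : ∀ s A j → s ℤ.+ (+ 1 ℤ.+ A) ℤ.- (+ 1 ℤ.+ (A ℤ.+ j)) ≡ s ℤ.- j
   lemma = solve-ℤ

-- The chamber of the region, strip by strip, and the determinant that counts its paths.

module Strips (y z a x : ℕ) where
 open import Data.Nat using (_≤_; _<_; _≤?_; _<?_; _∸_; _⊓_; _+_; _*_)
 open Farkas using (#_; _:+_; _:*_; _≼_; _≺_; _:=_; _⋠_; _⊀_; _&_; _⊢_; !_; ŷ; ẑ; â; x̂; t̂; d̂; m̂; L̂; ĉ; Ŵ; T̂; μ̂; ŝ; module Linear)
 open PathWords
 open Embedding
 open Determinants
 open PathRows
 open PathSums
 open Linear y z a x using (linear; equal; refute)

 -- The thresholds of the region for `t = y + z + 1`: `L` is the side of the reference triangle, `m`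
 -- bounds the core, `d` and `c₀` bound the satellites. `W` is the size of the determinant, and
 -- `m = t + W`.
 t d m L c₀ W : ℕ
 t = suc (y + z)
 d = 2 * z + 2
 m = d + 2 * y + 2 * a
 L = 3 * m + 2 * x
 c₀ = m + x + y
 W = suc (y + z + (a + a))

 Clear : ℕ → ℕ → Set
 Clear b A = b < c₀ ⊎ A < d

 -- Unit triangles with strip coordinates `A < b < c`, where `c` is eliminated through the sum of
 -- the three. The third condition is `b < c`, the fourth keeps out of the cut corner, `A < m` out
 -- of the core and `Clear` out of the satellite.
 Up Down : ℕ → ℕ → Set
 Up b A = A < b × A < m × A + 2 * b + 2 ≤ L × 2 * t ≤ A + b × Clear b A
 Down b A = A < b × A < m × A + 2 * b + 3 ≤ L × 2 * t ≤ suc (A + b) × Clear b A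

 clear? : ∀ b A → Dec (Clear b A)
 clear? b A = (b <? c₀) ⊎-dec (A <? d)

 Up? : ∀ b A → Dec (Up b A)
 Up? b A = (A <? b) ×-dec (A <? m) ×-dec (A + 2 * b + 2 ≤? L) ×-dec (2 * t ≤? A + b) ×-dec clear? b A

 Down? : ∀ b A → Dec (Down b A)
 Down? b A = (A <? b) ×-dec (A <? m) ×-dec (A + 2 * b + 3 ≤? L) ×-dec (2 * t ≤? suc (A + b)) ×-dec clear? b A

 -- The wall at large positions: the axis `A = b`, the core, or from strip `c₀` on the satellite.
 ub : ℕ → ℕ
 ub b with b <? c₀
 ... | yes _ = b ⊓ m
 ... | no _ = d

 below-ub : ∀ {b A} → A < b → A < m → Clear b A → A < ub b
 below-ub {b} A<b A<m cl with b <? c₀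
 below-ub {b} A<b A<m cl | yes _ = NP.⊓-pres-m< A<b A<m
 below-ub {b} A<b A<m (inj₁ p) | no ¬p = ⊥-elim (¬p p)
 below-ub {b} A<b A<m (inj₂ p) | no _ = p

 Up-ub : ∀ {b A} → Up b A → A < ub b
 Up-ub (p , q , _ , _ , c) = below-ub p q c

 Down-ub : ∀ {b A} → Down b A → A < ub b
 Down-ub (p , q , _ , _ , c) = below-ub p q c

 -- Of the conditions on the up triangle at the same place, only the one on the cut corner is not
 -- implied by those on the down triangle.
 ¬Up : ∀ {b A} → Down b A → ¬ Up b A → suc (A + b) ≤ 2 * t
 ¬Up {b} {A} (p , q , r , s , c) ¬u with 2 * t ≤? A + b
 ... | yes l = ⊥-elim (¬u (p , q , linear (A ∷ b ∷ []) (! 0 :+ 2 :* ! 1 :+ # 3 ≼ L̂ ∷ [] ⊢ ! 0 :+ 2 :* ! 1 :+ # 2 ≼ L̂) (1 ∷ 1 ∷ []) r , l , c))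
 ... | no ¬l = linear (A ∷ b ∷ []) (ŷ :+ ẑ :+ (# 1 :+ (ŷ :+ ẑ :+ # 0)) ⊀ ! 0 :+ ! 1 ∷ [] ⊢ ! 0 :+ ! 1 ≺ # 1 :+ (ŷ :+ ẑ :+ (# 1 :+ (ŷ :+ ẑ :+ # 0)))) (1 ∷ 1 ∷ []) ¬l

 Up-suc : ∀ {b A} → Down b A → suc A < ub b → Up b (suc A)
 Up-suc {b} {A} (p , q , r , s , c) lt with b <? c₀
 ... | yes b<c = NP.m<n⊓o⇒m<n b m lt , NP.m<n⊓o⇒m<o b m lt , linear (A ∷ b ∷ []) (! 0 :+ 2 :* ! 1 :+ # 3 ≼ L̂ ∷ [] ⊢ ! 0 :+ 2 :* ! 1 :+ # 2 ≺ L̂) (1 ∷ 1 ∷ []) r , linear (A ∷ b ∷ []) (ŷ :+ ẑ :+ (# 1 :+ (ŷ :+ ẑ :+ # 0)) ≺ # 1 :+ (! 0 :+ ! 1) ∷ [] ⊢ ŷ :+ ẑ :+ (# 1 :+ (ŷ :+ ẑ :+ # 0)) ≺ # 1 :+ (! 0 :+ ! 1)) (1 ∷ 1 ∷ []) s , inj₁ b<c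
 ... | no ¬b<c = linear (b ∷ A ∷ []) (! 0 ⊀ ĉ ∷ # 1 :+ ! 1 ≺ d̂ ∷ [] ⊢ # 1 :+ ! 1 ≺ ! 0) (1 ∷ 1 ∷ 1 ∷ []) (¬b<c & lt) , linear (A ∷ []) (# 1 :+ ! 0 ≺ d̂ ∷ [] ⊢ # 1 :+ ! 0 ≺ m̂) (1 ∷ 1 ∷ []) lt , linear (A ∷ b ∷ []) (! 0 :+ 2 :* ! 1 :+ # 3 ≼ L̂ ∷ [] ⊢ ! 0 :+ 2 :* ! 1 :+ # 2 ≺ L̂) (1 ∷ 1 ∷ []) r , linear (A ∷ b ∷ []) (ŷ :+ ẑ :+ (# 1 :+ (ŷ :+ ẑ :+ # 0)) ≺ # 1 :+ (! 0 :+ ! 1) ∷ [] ⊢ ŷ :+ ẑ :+ (# 1 :+ (ŷ :+ ẑ :+ # 0)) ≺ # 1 :+ (! 0 :+ ! 1)) (1 ∷ 1 ∷ []) s , inj₂ lt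

 at-ub : ∀ {b A} → Down b A → suc A ≡ ub b → suc A ≡ b ⊎ suc A ≡ m ⊎ (c₀ ≤ b × suc A ≡ d)
 at-ub {b} {A} dn e with b <? c₀
 ... | no ¬b<c = inj₂ (inj₂ (≮⇒≥ ¬b<c , e))
 ... | yes _ with NP.⊓-sel b m
 ... | inj₁ l = inj₁ (trans e l)
 ... | inj₂ l = inj₂ (inj₁ (trans e l))

 Clear-down : ∀ {k A} → Clear (suc k) A → Clear k A
 Clear-down {k} (inj₁ p) = inj₁ (<-trans (NP.n<1+n k) p)
 Clear-down (inj₂ p) = inj₂ p

 Up⇒Down : ∀ {k A} → A < k → Up (suc k) A → Down k A
 Up⇒Down {k} {A} A<k (p , q , r , s , c) = A<k , q , linear (A ∷ k ∷ []) (! 0 :+ 2 :* (# 1 :+ ! 1) :+ # 2 ≼ L̂ ∷ [] ⊢ ! 0 :+ 2 :* ! 1 :+ # 3 ≼ L̂) (1 ∷ 1 ∷ []) r , linear (A ∷ k ∷ []) (2 :* t̂ ≼ ! 0 :+ (# 1 :+ ! 1) ∷ [] ⊢ 2 :* t̂ ≼ # 1 :+ (! 0 :+ ! 1)) (1 ∷ 1 ∷ []) s , Clear-down c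

 -- At these heights the core keeps the positions away from the axis `A = b`; every up triangle has
 -- a down triangle beneath it, and no path can end.
 Up⇒Down-high : ∀ {k A} → m ≤ k ⊎ (suc k ≡ m × x ≡ 0) → Up (suc k) A → Down k A
 Up⇒Down-high {k} {A} (inj₁ l) u@(_ , q , r , _) = Up⇒Down {k} {A} (linear (A ∷ k ∷ []) (! 0 ≺ m̂ ∷ ! 0 :+ 2 :* (# 1 :+ ! 1) :+ # 2 ≼ L̂ ∷ m̂ ≼ ! 1 ∷ [] ⊢ ! 0 ≺ ! 1) (1 ∷ 1 ∷ 0 ∷ 1 ∷ []) (q & r & l)) u
 Up⇒Down-high {k} {A} (inj₂ (l , e)) u@(_ , q , r , _) = Up⇒Down {k} {A} (linear (A ∷ k ∷ []) (! 0 ≺ m̂ ∷ ! 0 :+ 2 :* (# 1 :+ ! 1) :+ # 2 ≼ L̂ ∷ # 1 :+ ! 1 := m̂ ∷ x̂ := # 0 ∷ [] ⊢ ! 0 ≺ ! 1) (1 ∷ 0 ∷ 1 ∷ 0 ∷ 3 ∷ 2 ∷ []) (q & r & l & e)) u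

 -- The paths that enter strip m + i − 1 from a strip k ↦ m + i where the triangle above is missing.
 Emitted : ℕ → ℕ → Set
 Emitted i A = A < m × 2 * t ≤ A + (m + i) × (m + i ≤ c₀ ⊎ A < d) × (suc (A + 2 * (m + i)) ≡ L ⊎ (suc (A + 2 * (m + i)) ≤ L × c₀ ≤ m + i × d ≤ A))

 emitted? : ∀ i A → Dec (Emitted i A)
 emitted? i A = (A <? m) ×-dec (2 * t ≤? A + (m + i)) ×-dec ((m + i ≤? c₀) ⊎-dec (A <? d))
  ×-dec ((suc (A + 2 * (m + i)) NP.≟ L) ⊎-dec ((suc (A + 2 * (m + i)) ≤? L) ×-dec (c₀ ≤? m + i) ×-dec (d ≤? A)))

 emitted : ℕ → List ℕ
 emitted i = select (emitted? i) m

 Emitted⇒Down : ∀ {i k A} → suc k ≡ m + i → A < k → Emitted i A → Down k A × ¬ Up (suc k) A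
 Emitted⇒Down {i} {k} {A} e A<k (p , q , c , f) = (A<k , p , fits f , linear (A ∷ i ∷ k ∷ []) (2 :* t̂ ≼ ! 0 :+ (m̂ :+ ! 1) ∷ # 1 :+ ! 2 := m̂ :+ ! 1 ∷ [] ⊢ 2 :* t̂ ≼ # 1 :+ (! 0 :+ ! 2)) (1 ∷ 0 ∷ 0 ∷ 1 ∷ []) (q & e) , clear c) , not f
  where
  fits : _ → A + 2 * k + 3 ≤ L
  fits (inj₁ f) = linear (A ∷ i ∷ k ∷ []) (# 1 :+ (! 0 :+ 2 :* (m̂ :+ ! 1)) := L̂ ∷ # 1 :+ ! 2 := m̂ :+ ! 1 ∷ [] ⊢ ! 0 :+ 2 :* ! 2 :+ # 3 ≼ L̂) (1 ∷ 1 ∷ 0 ∷ 2 ∷ []) (f & e)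
  fits (inj₂ (f , _)) = linear (A ∷ i ∷ k ∷ []) (! 0 :+ 2 :* (m̂ :+ ! 1) ≺ L̂ ∷ # 1 :+ ! 2 := m̂ :+ ! 1 ∷ [] ⊢ ! 0 :+ 2 :* ! 2 :+ # 3 ≼ L̂) (1 ∷ 1 ∷ 2 ∷ []) (f & e)
  clear : _ → Clear k A
  clear (inj₁ c) = inj₁ (linear (i ∷ k ∷ []) (m̂ :+ ! 0 ≼ ĉ ∷ # 1 :+ ! 1 := m̂ :+ ! 0 ∷ [] ⊢ ! 1 ≺ ĉ) (1 ∷ 1 ∷ 1 ∷ []) (c & e))
  clear (inj₂ c) = inj₂ c
  not : _ → ¬ Up (suc k) A
  not (inj₁ f) (_ , _ , r , _ , _) = refute (A ∷ i ∷ k ∷ []) (# 1 :+ (! 0 :+ 2 :* (m̂ :+ ! 1)) := L̂ ∷ # 1 :+ ! 2 := m̂ :+ ! 1 ∷ ! 0 :+ 2 :* (# 1 :+ ! 2) :+ # 2 ≼ L̂ ∷ []) (0 ∷ 1 ∷ 0 ∷ 2 ∷ 1 ∷ []) (f & e & r)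
  not (inj₂ (_ , c , l)) (_ , _ , _ , _ , inj₁ c′) = refute (i ∷ k ∷ []) (ĉ ≼ m̂ :+ ! 0 ∷ # 1 :+ ! 1 := m̂ :+ ! 0 ∷ # 1 :+ ! 1 ≺ ĉ ∷ []) (1 ∷ 0 ∷ 1 ∷ 1 ∷ []) (c & e & c′)
  not (inj₂ (_ , c , l)) (_ , _ , _ , _ , inj₂ l′) = refute (A ∷ []) (d̂ ≼ ! 0 ∷ ! 0 ≺ d̂ ∷ []) (1 ∷ 1 ∷ []) (l & l′)

 Down⇒Emitted : ∀ {i k A} → suc k ≡ m + i → Down k A → ¬ Up (suc k) A → Emitted i A
 Down⇒Emitted {i} {k} {A} e (A<k , p , r , s , c) ¬u = p , linear (A ∷ k ∷ i ∷ []) (2 :* t̂ ≼ # 1 :+ (! 0 :+ ! 1) ∷ # 1 :+ ! 1 := m̂ :+ ! 2 ∷ [] ⊢ 2 :* t̂ ≼ ! 0 :+ (m̂ :+ ! 2)) (1 ∷ 1 ∷ 1 ∷ []) (s & e) , clear c , fits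
  where
  clear : Clear k A → m + i ≤ c₀ ⊎ A < d
  clear (inj₁ c) = inj₁ (linear (k ∷ i ∷ []) (! 0 ≺ ĉ ∷ # 1 :+ ! 0 := m̂ :+ ! 1 ∷ [] ⊢ m̂ :+ ! 1 ≼ ĉ) (1 ∷ 1 ∷ 0 ∷ 1 ∷ []) (c & e))
  clear (inj₂ c) = inj₂ c
  fits : suc (A + 2 * (m + i)) ≡ L ⊎ (suc (A + 2 * (m + i)) ≤ L × c₀ ≤ m + i × d ≤ A)
  fits with suc (A + 2 * (m + i)) NP.≟ L
  ... | yes f = inj₁ f
  ... | no ¬f with A + 2 * suc k + 2 ≤? L | clear? (suc k) A
  ... | yes f | yes c′ = ⊥-elim (¬u (linear (A ∷ k ∷ []) (! 0 ≺ ! 1 ∷ [] ⊢ ! 0 ≺ # 1 :+ ! 1) (1 ∷ 1 ∷ []) A<k , p , f , linear (A ∷ k ∷ []) (ŷ :+ ẑ :+ (# 1 :+ (ŷ :+ ẑ :+ # 0)) ≺ # 1 :+ (! 0 :+ ! 1) ∷ [] ⊢ ŷ :+ ẑ :+ (# 1 :+ (ŷ :+ ẑ :+ # 0)) ≺ ! 0 :+ (# 1 :+ ! 1)) (1 ∷ 1 ∷ []) s , c′))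
  ... | no f | _ = ⊥-elim (¬f (equal (A ∷ k ∷ i ∷ []) (! 0 :+ (# 1 :+ (! 1 :+ (# 1 :+ (! 1 :+ # 0)))) :+ # 2 ⋠ L̂ ∷ ! 0 :+ 2 :* ! 1 :+ # 3 ≼ L̂ ∷ # 1 :+ ! 1 := m̂ :+ ! 2 ∷ []) (# 1 :+ (! 0 :+ 2 :* (m̂ :+ ! 2))) L̂ (1 ∷ 0 ∷ 1 ∷ 0 ∷ 2 ∷ []) (1 ∷ 1 ∷ 0 ∷ 2 ∷ []) (f & r & e)))
  ... | yes f | no ¬c′ = inj₂ (linear (A ∷ k ∷ i ∷ []) (! 0 :+ 2 :* ! 1 :+ # 3 ≼ L̂ ∷ # 1 :+ ! 1 := m̂ :+ ! 2 ∷ [] ⊢ ! 0 :+ 2 :* (m̂ :+ ! 2) ≺ L̂) (1 ∷ 1 ∷ 0 ∷ 2 ∷ []) (r & e) , ≮⇒≥ (λ (l : m + i < c₀) → ¬c′ (inj₁ (linear (i ∷ k ∷ []) (m̂ :+ ! 0 ≺ ĉ ∷ # 1 :+ ! 1 := m̂ :+ ! 0 ∷ [] ⊢ # 1 :+ ! 1 ≺ ĉ) (1 ∷ 1 ∷ 1 ∷ []) (l & e)))) , ≮⇒≥ (λ l → ¬c′ (inj₂ l)))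

 -- New paths start beyond all those under way, so they can be put in front of a decreasing list.
 Up<Emitted : ∀ {i k A B} → suc k ≡ m + i → Emitted i A → Up (suc k) B → B < A
 Up<Emitted {i} {k} {A} {B} e (_ , _ , _ , inj₁ f) (_ , _ , r , _ , _) = linear (A ∷ i ∷ k ∷ B ∷ []) (# 1 :+ (! 0 :+ 2 :* (m̂ :+ ! 1)) := L̂ ∷ # 1 :+ ! 2 := m̂ :+ ! 1 ∷ ! 3 :+ 2 :* (# 1 :+ ! 2) :+ # 2 ≼ L̂ ∷ [] ⊢ ! 3 ≺ ! 0) (1 ∷ 0 ∷ 1 ∷ 0 ∷ 2 ∷ 1 ∷ []) (f & e & r)
 Up<Emitted {i} {k} {A} {B} e (_ , _ , _ , inj₂ (_ , c , l)) (_ , _ , _ , _ , inj₁ c′) = linear (i ∷ k ∷ B ∷ A ∷ []) (ĉ ≼ m̂ :+ ! 0 ∷ # 1 :+ ! 1 := m̂ :+ ! 0 ∷ # 1 :+ ! 1 ≺ ĉ ∷ [] ⊢ ! 2 ≺ ! 3) (0 ∷ 1 ∷ 0 ∷ 1 ∷ 1 ∷ []) (c & e & c′)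
 Up<Emitted {i} {k} {A} {B} e (_ , _ , _ , inj₂ (_ , c , l)) (_ , _ , _ , _ , inj₂ l′) = linear (A ∷ B ∷ []) (d̂ ≼ ! 0 ∷ ! 1 ≺ d̂ ∷ [] ⊢ ! 1 ≺ ! 0) (1 ∷ 1 ∷ 1 ∷ []) (l & l′)

 emitted-none : ∀ i → (∀ A → ¬ Emitted i A) → emitted i ≡ []
 emitted-none i none = Below-unique (select-Below (emitted? i) m) [] (λ A A∈ → ⊥-elim (none A (proj₂ (∈-select⁻ (emitted? i) m A∈)))) (λ _ ())

 emitted-list : ∀ i P → Below m P → (∀ A → A ∈ P → Emitted i A) → (∀ A → Emitted i A → A ∈ P) → emitted i ≡ P
 emitted-list i P below f g = Below-unique (select-Below (emitted? i) m) below (λ A A∈ → g A (proj₂ (∈-select⁻ (emitted? i) m A∈)))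
  (λ A A∈ → ∈-select⁺ (emitted? i) m (Below-∈ below A∈) (f A A∈))

 open Rows m

 bin-large : ∀ n r → n < r → bin n (+ r) ≡ 0ℚ
 bin-large zero (suc r) _ = refl
 bin-large (suc n) (suc r) (s≤s n<r) = cong₂ ℚ._+_ (bin-large n (suc r) (m<n⇒m<1+n n<r)) (bin-large n r n<r)

 row-neg : ∀ β A j → m ≤ A + j → row β A j ≡ 0ℚ
 row-neg β A j m≤ = trans (cong (bin ((β + j) ∸ m))
   (trans (cong (λ k → + m ℤ.- + suc k) (sym (m+[n∸m]≡n m≤))) (lemma (+ m) (+ (A + j ∸ m)))))
  (bin-neg ((β + j) ∸ m) (A + j ∸ m))
  where
  lemma : ∀ m e → m ℤ.- (+ 1 ℤ.+ (m ℤ.+ e)) ≡ ℤ.- (+ 1 ℤ.+ e)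
  lemma = solve-ℤ

 row-diff : ∀ β A j r → r + suc (A + j) ≡ m → row β A j ≡ bin ((β + j) ∸ m) (+ r)
 row-diff β A j r e = cong (bin ((β + j) ∸ m)) (trans (cong (λ m → + m ℤ.- + suc (A + j)) (sym e)) (lemma (+ r) (+ suc (A + j))))
  where
  lemma : ∀ r s → r ℤ.+ s ℤ.- s ≡ r
  lemma = solve-ℤ

 row-large : ∀ β A j → suc A + β + (j + j) < m + m → suc (A + j) ≤ m → m ≤ β + j → row β A j ≡ 0ℚ
 row-large β A j l l′ m≤ = trans (row-diff β A j (m ∸ suc (A + j)) (m∸n+n≡m l′))
  (bin-large ((β + j) ∸ m) (m ∸ suc (A + j)) (arith ((β + j) ∸ m) (m ∸ suc (A + j)) (m∸n+n≡m m≤) (m∸n+n≡m l′)))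
  where
  arith : ∀ u w → u + m ≡ β + j → w + suc (A + j) ≡ m → u < w
  arith u w e f = go m e f l
   where
   go : ∀ m → u + m ≡ β + j → w + suc (A + j) ≡ m → suc A + β + (j + j) < m + m → u < w
   go m e f l = linear (u ∷ m ∷ β ∷ j ∷ w ∷ A ∷ []) (! 0 :+ ! 1 := ! 2 :+ ! 3 ∷ ! 4 :+ (# 1 :+ (! 5 :+ ! 3)) := ! 1 ∷ # 1 :+ ! 5 :+ ! 2 :+ (! 3 :+ ! 3) ≺ ! 1 :+ ! 1 ∷ [] ⊢ ! 0 ≺ ! 4) (1 ∷ 1 ∷ 0 ∷ 0 ∷ 1 ∷ 1 ∷ []) (e & f & l)

 _≈ʳ_ : List Row → List Row → Set
 _≈ʳ_ = Pointwise (λ r s → ∀ k → r k ≡ s k)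

 ≈ʳ-refl : ∀ l → l ≈ʳ l
 ≈ʳ-refl l = PW.refl (λ _ → refl)

 D-≈ʳ : ∀ j n {l l′} → l ≈ʳ l′ → D j n l ≡ D j n l′
 D-≈ʳ j n p = D-pointwise j j n (PW.map (λ e k _ → e (j + k)) p)

 -- Rows of the paths with starting index `i`, ..., `i + n − 1`. In the induction over the strips
 -- they belong to the paths that start further down and have not appeared yet.
 emit : ℕ → ℕ → List Row
 emit i zero = []
 emit i (suc n) = map (row (m + i)) (emitted i) ++ emit (suc i) n

 emit-++ : ∀ i p n → emit i (p + n) ≡ emit i p ++ emit (i + p) n
 emit-++ i zero n = cong (λ k → emit k n) (sym (NP.+-identityʳ i))
 emit-++ i (suc p) n = trans
  (cong (map (row (m + i)) (emitted i) ++_) (trans (emit-++ (suc i) p n) (cong (λ k → emit (suc i) p ++ emit k n) (sym (+-suc i p)))))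
  (sym (LP.++-assoc (map (row (m + i)) (emitted i)) (emit (suc i) p) _))

 emit-none : ∀ i n → (∀ k → i ≤ k → k < i + n → ∀ A → ¬ Emitted k A) → emit i n ≡ []
 emit-none i zero none = refl
 emit-none i (suc n) none = cong₂ _++_ (cong (map (row (m + i))) (emitted-none i (none i ≤-refl (m<m+n i (s≤s z≤n)))))
  (emit-none (suc i) n (λ k l l′ → none k (<⇒≤ l) (subst (k <_) (sym (+-suc i n)) l′)))

 none-before : ∀ i → i < x → ∀ A → ¬ Emitted i A
 none-before i i<x A (p , _ , _ , inj₁ f) = refute (i ∷ A ∷ []) (! 0 ≺ x̂ ∷ ! 1 ≺ m̂ ∷ # 1 :+ (! 1 :+ 2 :* (m̂ :+ ! 0)) := L̂ ∷ []) (2 ∷ 1 ∷ 0 ∷ 1 ∷ []) (i<x & p & f)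
 none-before i i<x A (p , _ , _ , inj₂ (_ , f , _)) = refute (i ∷ []) (! 0 ≺ x̂ ∷ ĉ ≼ m̂ :+ ! 0 ∷ []) (1 ∷ 1 ∷ []) (i<x & f)

 none-between : ∀ j → y < j → j < y + a → ∀ A → ¬ Emitted (x + j) A
 none-between j l l′ A (_ , _ , inj₁ c , _) = refute (j ∷ []) (ŷ ≺ ! 0 ∷ m̂ :+ (x̂ :+ ! 0) ≼ ĉ ∷ []) (1 ∷ 1 ∷ []) (l & c)
 none-between j l l′ A (_ , _ , inj₂ c , inj₁ f) = refute (j ∷ A ∷ []) (ŷ ≺ ! 0 ∷ ! 0 ≺ ŷ :+ â ∷ ! 1 ≺ d̂ ∷ # 1 :+ (! 1 :+ 2 :* (m̂ :+ (x̂ :+ ! 0))) := L̂ ∷ []) (0 ∷ 2 ∷ 1 ∷ 0 ∷ 1 ∷ []) (l & l′ & c & f)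
 none-between j l l′ A (_ , _ , inj₂ c , inj₂ (_ , _ , f)) = refute (A ∷ []) (! 0 ≺ d̂ ∷ d̂ ≼ ! 0 ∷ []) (1 ∷ 1 ∷ []) (c & f)

 -- Away from the satellite, paths start at the axis `b = c` only, and on this axis the strip
 -- determines the position.
 single : ∀ j A → A + suc (j + j) ≡ m → j < y ⊎ y + a ≤ j → emitted (x + j) ≡ [ A ]
 single j A e s = emitted-list (x + j) [ A ] (linear (A ∷ j ∷ []) (! 0 :+ (# 1 :+ (! 1 :+ ! 1)) := m̂ ∷ [] ⊢ ! 0 ≺ m̂) (1 ∷ 1 ∷ []) e ∷ []) (λ { _ (here refl) → linear (A ∷ j ∷ []) (! 0 :+ (# 1 :+ (! 1 :+ ! 1)) := m̂ ∷ [] ⊢ ! 0 ≺ m̂) (1 ∷ 1 ∷ []) e , early , clear s , inj₁ (equal (A ∷ j ∷ []) (! 0 :+ (# 1 :+ (! 1 :+ ! 1)) := m̂ ∷ []) (# 1 :+ (! 0 :+ 2 :* (m̂ :+ (x̂ :+ ! 1)))) L̂ (1 ∷ 1 ∷ []) (1 ∷ 0 ∷ 1 ∷ []) e) }) unique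
  where
  early : 2 * t ≤ A + (m + (x + j))
  early = linear (A ∷ j ∷ []) (! 0 :+ (# 1 :+ (! 1 :+ ! 1)) := m̂ ∷ [] ⊢ 2 :* t̂ ≼ ! 0 :+ (m̂ :+ (x̂ :+ ! 1))) (1 ∷ []) e
  clear : _ → m + (x + j) ≤ c₀ ⊎ A < d
  clear (inj₁ s) = inj₁ (linear (j ∷ []) (! 0 ≺ ŷ ∷ [] ⊢ m̂ :+ (x̂ :+ ! 0) ≼ ĉ) (1 ∷ 1 ∷ []) s)
  clear (inj₂ s) = inj₂ (linear (j ∷ A ∷ []) (ŷ :+ â ≼ ! 0 ∷ ! 1 :+ (# 1 :+ (! 0 :+ ! 0)) := m̂ ∷ [] ⊢ ! 1 ≺ d̂) (1 ∷ 2 ∷ 1 ∷ []) (s & e))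
  eq : ∀ B → B ≡ A → B ∈ [ A ]
  eq B refl = here refl
  unique : ∀ B → Emitted (x + j) B → B ∈ [ A ]
  unique B (_ , _ , _ , inj₁ f) = eq B (equal (B ∷ j ∷ A ∷ []) (# 1 :+ (! 0 :+ 2 :* (m̂ :+ (x̂ :+ ! 1))) := L̂ ∷ ! 2 :+ (# 1 :+ (! 1 :+ ! 1)) := m̂ ∷ []) (! 0) (! 2) (1 ∷ 1 ∷ 0 ∷ 0 ∷ 1 ∷ []) (1 ∷ 0 ∷ 1 ∷ 1 ∷ []) (f & e))
  unique B (_ , _ , _ , inj₂ (f , c , l)) = ⊥-elim (not s)
   where
   not : j < y ⊎ y + a ≤ j → ⊥
   not (inj₁ s) = refute (j ∷ []) (! 0 ≺ ŷ ∷ ĉ ≼ m̂ :+ (x̂ :+ ! 0) ∷ []) (1 ∷ 1 ∷ []) (s & c)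
   not (inj₂ s) = refute (j ∷ B ∷ []) (ŷ :+ â ≼ ! 0 ∷ ! 1 :+ 2 :* (m̂ :+ (x̂ :+ ! 0)) ≺ L̂ ∷ d̂ ≼ ! 1 ∷ []) (2 ∷ 1 ∷ 1 ∷ []) (s & f & l)

 emit-Zs : ∀ j n → (∀ k → j ≤ k → k < j + n → suc (k + k) ≤ m × (k < y ⊎ y + a ≤ k)) → emit (x + j) n ≈ʳ Zs x j n
 emit-Zs j zero ok = []
 emit-Zs j (suc n) ok with ok j ≤-refl (m<m+n j (s≤s z≤n))
 ... | le , side = subst (λ l → (map (row (m + (x + j))) l ++ emit (suc (x + j)) n) ≈ʳ Zs x j (suc n))
  (sym (single j (m ∸ suc (j + j)) (m∸n+n≡m le) side))
  ((λ k → row-v (m ∸ suc (j + j)) (j + j) (x + j) k (shuffle (m ∸ suc (j + j)) m (m∸n+n≡m le)))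
   ∷ subst (λ i → emit i n ≈ʳ Zs x (suc j) n) (+-suc x j)
     (emit-Zs (suc j) n (λ k l l′ → ok k (<⇒≤ l) (subst (k <_) (sym (+-suc j n)) l′))))
  where
  shuffle : ∀ A m → A + suc (j + j) ≡ m → j + j + suc A ≡ m
  shuffle A m e = equal (A ∷ j ∷ m ∷ []) (! 0 :+ (# 1 :+ (! 1 :+ ! 1)) := ! 2 ∷ []) (! 1 :+ ! 1 :+ (# 1 :+ ! 0)) (! 2) (1 ∷ 1 ∷ []) (1 ∷ 0 ∷ 1 ∷ []) e

 descent : ℕ → List ℕ
 descent zero = []
 descent (suc n) = d + n ∷ descent n

 descent-Below : ∀ n → Below (d + n) (descent n)
 descent-Below zero = []
 descent-Below (suc n) = NP.+-monoʳ-< d (NP.n<1+n n) ∷ descent-Below n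

 ∈-descent⁻ : ∀ n {A} → A ∈ descent n → d ≤ A
 ∈-descent⁻ (suc n) (here refl) = m≤m+n d n
 ∈-descent⁻ (suc n) (there A∈) = ∈-descent⁻ n A∈

 ∈-descent⁺ : ∀ n {A} → d ≤ A → A < d + n → A ∈ descent n
 ∈-descent⁺ zero {A} l l′ = ⊥-elim (<⇒≱ (subst (A <_) (NP.+-identityʳ d) l′) l)
 ∈-descent⁺ (suc n) {A} l l′ with A NP.≟ d + n
 ... | yes refl = here refl
 ... | no A≢ = there (∈-descent⁺ n l (≤∧≢⇒< (≤-pred (subst (suc A ≤_) (+-suc d n) l′)) A≢))

 -- The strip `c₀ − 1` runs along a side of the satellite, and each of its `2a` down triangles there
 -- starts a path; the one at the largest position is also the one at the axis.
 emitted-satellite : 0 < a → emitted (x + y) ≡ descent (a + a)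
 emitted-satellite 0<a = emitted-list (x + y) (descent (a + a)) (Below-weaken fits (descent-Below (a + a)))
  (λ A A∈ → inside A (∈-descent⁻ (a + a) A∈) (Below-∈ (descent-Below (a + a)) A∈))
  (λ A e → let (l , l′) = outside A e in ∈-descent⁺ (a + a) l l′)
  where
  fits : d + (a + a) ≤ m
  fits = linear [] (# 0 ≺ â ∷ [] ⊢ d̂ :+ (â :+ â) ≼ m̂) (1 ∷ []) 0<a
  inside : ∀ A → d ≤ A → A < d + (a + a) → Emitted (x + y) A
  inside A l l′ = linear (A ∷ []) (! 0 ≺ d̂ :+ (â :+ â) ∷ [] ⊢ ! 0 ≺ m̂) (1 ∷ 1 ∷ []) l′ , linear (A ∷ []) (d̂ ≼ ! 0 ∷ [] ⊢ 2 :* t̂ ≼ ! 0 :+ (m̂ :+ (x̂ :+ ŷ))) (1 ∷ []) l , inj₁ (linear (A ∷ []) (d̂ ≼ ! 0 ∷ [] ⊢ m̂ :+ (x̂ :+ ŷ) ≼ ĉ) (1 ∷ []) l) , inj₂ (linear (A ∷ []) (! 0 ≺ d̂ :+ (â :+ â) ∷ [] ⊢ ! 0 :+ 2 :* (m̂ :+ (x̂ :+ ŷ)) ≺ L̂) (1 ∷ 1 ∷ []) l′ , linear (A ∷ []) (d̂ ≼ ! 0 ∷ [] ⊢ ĉ ≼ m̂ :+ (x̂ :+ ŷ)) (1 ∷ []) l , l)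
  outside : ∀ A → Emitted (x + y) A → d ≤ A × A < d + (a + a)
  outside A (_ , _ , _ , inj₁ f) = linear (A ∷ []) (# 1 :+ (! 0 :+ 2 :* (m̂ :+ (x̂ :+ ŷ))) := L̂ ∷ # 1 :+ # 0 ≼ â ∷ [] ⊢ d̂ ≼ ! 0) (1 ∷ 0 ∷ 1 ∷ 2 ∷ []) (f & 0<a) , linear (A ∷ []) (# 1 :+ (! 0 :+ 2 :* (m̂ :+ (x̂ :+ ŷ))) := L̂ ∷ # 1 :+ # 0 ≼ â ∷ [] ⊢ ! 0 ≺ d̂ :+ (â :+ â)) (1 ∷ 1 ∷ []) (f & 0<a)
  outside A (_ , _ , _ , inj₂ (f , _ , l)) = l , linear (A ∷ []) (! 0 :+ 2 :* (m̂ :+ (x̂ :+ ŷ)) ≺ L̂ ∷ # 1 :+ # 0 ≼ â ∷ [] ⊢ ! 0 ≺ d̂ :+ (â :+ â)) (1 ∷ 1 ∷ []) (f & 0<a)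

 descent-sat : ∀ n s → s + n ≡ y + y + (a + a) → map (row (m + (x + y))) (descent n) ≈ʳ sat s (x + y) n
 descent-sat zero s e = []
 descent-sat (suc n) s e = (λ k → row-v (d + n) s (x + y) k (equal (s ∷ n ∷ []) (! 0 :+ (# 1 :+ ! 1) := ŷ :+ ŷ :+ (â :+ â) ∷ []) (! 0 :+ (# 1 :+ (d̂ :+ ! 1))) m̂ (1 ∷ 1 ∷ []) (1 ∷ 0 ∷ 1 ∷ []) e)) ∷ descent-sat n (suc s) (trans (sym (+-suc s n)) e)

 emit-sat : ∀ n → n < a → emit (x + y) (suc n) ≈ʳ sat (y + y) (x + y) (a + a)
 emit-sat n n<a = subst₂ (λ l l′ → (map (row (m + (x + y))) l ++ l′) ≈ʳ sat (y + y) (x + y) (a + a))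
  (sym (emitted-satellite (≤-trans (s≤s z≤n) n<a))) (sym (emit-none (suc (x + y)) n empty))
  (subst (_≈ʳ sat (y + y) (x + y) (a + a)) (sym (LP.++-identityʳ _)) (descent-sat (a + a) (y + y) refl))
  where
  empty : ∀ k → suc (x + y) ≤ k → k < suc (x + y) + n → ∀ A → ¬ Emitted k A
  empty k l l′ A = subst (λ k → ¬ Emitted k A) (m+[n∸m]≡n x≤k)
   (none-between (k ∸ x) (arith₁ (k ∸ x) (m+[n∸m]≡n x≤k)) (arith₂ (k ∸ x) (m+[n∸m]≡n x≤k)) A)
   where
   x≤k : x ≤ k
   x≤k = linear (k ∷ []) (x̂ :+ ŷ ≺ ! 0 ∷ [] ⊢ x̂ ≼ ! 0) (1 ∷ 1 ∷ []) l
   arith₁ : ∀ u → x + u ≡ k → y < u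
   arith₁ u e = linear (u ∷ k ∷ []) (x̂ :+ ! 0 := ! 1 ∷ x̂ :+ ŷ ≺ ! 1 ∷ [] ⊢ ŷ ≺ ! 0) (1 ∷ 0 ∷ 1 ∷ 1 ∷ []) (e & l)
   arith₂ : ∀ u → x + u ≡ k → u < y + a
   arith₂ u e = linear (u ∷ k ∷ n ∷ []) (x̂ :+ ! 0 := ! 1 ∷ ! 1 ≺ # 1 :+ (x̂ :+ ŷ) :+ ! 2 ∷ ! 2 ≺ â ∷ [] ⊢ ! 0 ≺ ŷ :+ â) (1 ∷ 1 ∷ 0 ∷ 1 ∷ 1 ∷ []) (e & l′ & n<a)

 emit-middle : ∀ n → n ≡ a → emit (x + y) n ≈ʳ sat (y + y) (x + y) (a + a)
 emit-middle zero e = subst (λ a → [] ≈ʳ sat (y + y) (x + y) (a + a)) e []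
 emit-middle (suc n) e = emit-sat n (≤-reflexive e)

 emit-upto : ∀ n → emit 0 (x + n) ≡ emit x n
 emit-upto n = trans (emit-++ 0 x n) (cong (_++ emit x n) (emit-none 0 x (λ k _ l → none-before k l)))

 emit-first : emit x y ≈ʳ Zs x 0 y
 emit-first = subst (λ i → emit i y ≈ʳ Zs x 0 y) (NP.+-identityʳ x) (emit-Zs 0 y (λ k _ l → linear (k ∷ []) (! 0 ≺ # 0 :+ ŷ ∷ [] ⊢ ! 0 :+ ! 0 ≺ m̂) (1 ∷ 2 ∷ []) l , inj₁ l))

 emit-satellite : ∀ n → n < a → emit 0 (x + (y + suc n)) ≈ʳ (Zs x 0 y ++ sat (y + y) (x + y) (a + a))
 emit-satellite n n<a = subst (_≈ʳ (Zs x 0 y ++ sat (y + y) (x + y) (a + a)))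
  (sym (trans (emit-upto (y + suc n)) (emit-++ x y (suc n)))) (PW.++⁺ emit-first (emit-sat n n<a))

 emit-all : emit 0 (x + (y + (a + suc z))) ≈ʳ Qrows x y z a
 emit-all = subst (_≈ʳ Qrows x y z a)
  (sym (trans (emit-upto (y + (a + suc z))) (trans (emit-++ x y (a + suc z)) (cong (emit x y ++_) (emit-++ (x + y) a (suc z))))))
  (PW.++⁺ emit-first (PW.++⁺ (emit-middle a refl)
   (subst (λ i → emit i (suc z) ≈ʳ Zs x (y + a) (suc z)) (sym (NP.+-assoc x y a)) (emit-Zs (y + a) (suc z) (λ k l l′ → linear (k ∷ []) (! 0 ≺ ŷ :+ â :+ (# 1 :+ ẑ) ∷ [] ⊢ ! 0 :+ ! 0 ≺ m̂) (1 ∷ 2 ∷ []) l′ , inj₂ l)))))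

 open Steps Up Down Up? Down? ub

 -- A path that is unable to stay has reached the cut corner, from where none of the exits that
 -- remain can be attained.
 vanishing-row : ∀ j n b → j + n ≡ W → m ≤ b + j → ∀ {A} → Down b A → ¬ Up b A → ∀ pre post → D j n (pre ++ row b A ∷ post) ≡ 0ℚ
 vanishing-row j n b e m≤ {A} dn ¬u = D-zero-row {row b A} j n (λ k j≤k k< →
  row-large b A k (linear (A ∷ b ∷ j ∷ n ∷ k ∷ []) (! 0 :+ ! 1 ≺ 2 :* t̂ ∷ ! 2 :+ ! 3 := Ŵ ∷ ! 4 ≺ ! 2 :+ ! 3 ∷ [] ⊢ # 1 :+ ! 0 :+ ! 1 :+ (! 4 :+ ! 4) ≺ m̂ :+ m̂) (1 ∷ 1 ∷ 2 ∷ 0 ∷ 2 ∷ []) (¬Up {b} {A} dn ¬u & e & k<)) (linear (A ∷ b ∷ j ∷ n ∷ k ∷ []) (! 0 :+ ! 1 ≺ 2 :* t̂ ∷ ! 2 :+ ! 3 := Ŵ ∷ ! 4 ≺ ! 2 :+ ! 3 ∷ m̂ ≼ ! 1 :+ ! 2 ∷ ! 2 ≼ ! 4 ∷ [] ⊢ ! 0 :+ ! 4 ≺ m̂) (1 ∷ 1 ∷ 2 ∷ 0 ∷ 2 ∷ 1 ∷ 1 ∷ []) (¬Up {b} {A} dn ¬u & e & k< & m≤ & j≤k)) (≤-trans m≤ (+-monoʳ-≤ b j≤k)))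

 -- A move beyond the wall. At the axis and at the core the lower index becomes negative. At the
 -- satellite the entries need not vanish, but by `sat-span` the row depends on the rows of the
 -- paths that start at the satellite further down, and these stand among the emitted ones.
 top-row : ∀ i b → b ≡ m + i → ∀ {A} → Down b A → suc A ≡ ub b → ∀ post → D 0 W (emit 0 (suc i) ++ row b (suc A) ∷ post) ≡ 0ℚ
 top-row i b refl {A} dn e post with at-ub {b} {A} dn e
 ... | inj₁ f = D-zero-row {row b (suc A)} 0 W (λ k _ _ → row-neg b (suc A) k (linear (A ∷ i ∷ k ∷ []) (# 1 :+ ! 0 := m̂ :+ ! 1 ∷ [] ⊢ m̂ ≼ # 1 :+ ! 0 :+ ! 2) (1 ∷ 0 ∷ 1 ∷ []) f)) (emit 0 (suc i)) post
 ... | inj₂ (inj₁ f) = D-zero-row {row b (suc A)} 0 W (λ k _ _ → row-neg b (suc A) k (linear (A ∷ k ∷ []) (# 1 :+ ! 0 := m̂ ∷ [] ⊢ m̂ ≼ # 1 :+ ! 0 :+ ! 1) (1 ∷ 0 ∷ 1 ∷ []) f)) (emit 0 (suc i)) post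
 ... | inj₂ (inj₂ (c , f)) = begin
  D 0 W (emit 0 (suc i) ++ row b (suc A) ∷ post)
   ≡⟨ cong (λ n → D 0 W (emit 0 n ++ row b (suc A) ∷ post)) n≡ ⟩
  D 0 W (emit 0 (x + (y + suc j)) ++ row b (suc A) ∷ post)
   ≡⟨ D-≈ʳ 0 W (PW.++⁺ (emit-satellite j j<a) ((λ k → row-same k) ∷ ≈ʳ-refl post)) ⟩
  D 0 W ((Zs x 0 y ++ sat (y + y) (x + y) (a + a)) ++ v (y + y + (a + a ∸ 1)) (j + (x + y)) ∷ post)
   ≡⟨ cong (D 0 W) (LP.++-assoc (Zs x 0 y) (sat (y + y) (x + y) (a + a)) _) ⟩
  D 0 W (Zs x 0 y ++ sat (y + y) (x + y) (a + a) ++ v (y + y + (a + a ∸ 1)) (j + (x + y)) ∷ post)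
   ≡⟨ sat-span W (Zs x 0 y) (y + y) (x + y) (a + a) (a + a ∸ 1) j post (small (a + a ∸ 1) pred≡) (late (a + a ∸ 1) pred≡) ⟩
  0ℚ ∎
  where
  open ≡-Reasoning
  j : ℕ
  j = b ∸ c₀
  j≡ : c₀ + j ≡ b
  j≡ = m+[n∸m]≡n c
  bound : A + 2 * b + 3 ≤ L
  bound = proj₁ (proj₂ (proj₂ dn))
  arith : ∀ w → c₀ + w ≡ m + i → suc w ≤ a × suc i ≡ x + (y + suc w) × w + (x + y) ≡ i
  arith w g = linear (w ∷ i ∷ A ∷ []) (ĉ :+ ! 0 := m̂ :+ ! 1 ∷ ! 2 :+ 2 :* (m̂ :+ ! 1) :+ # 3 ≼ L̂ ∷ # 1 :+ ! 2 := d̂ ∷ [] ⊢ ! 0 ≺ â) (2 ∷ 2 ∷ 0 ∷ 1 ∷ 0 ∷ 1 ∷ []) (g & bound & f) , equal (w ∷ i ∷ []) (ĉ :+ ! 0 := m̂ :+ ! 1 ∷ []) (# 1 :+ ! 1) (x̂ :+ (ŷ :+ (# 1 :+ ! 0))) (1 ∷ 0 ∷ 1 ∷ []) (1 ∷ 1 ∷ []) g , equal (w ∷ i ∷ []) (ĉ :+ ! 0 := m̂ :+ ! 1 ∷ []) (! 0 :+ (x̂ :+ ŷ)) (! 1) (1 ∷ 1 ∷ []) (1 ∷ 0 ∷ 1 ∷ []) g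
  j<a : j < a
  j<a = proj₁ (arith j j≡)
  n≡ : suc i ≡ x + (y + suc j)
  n≡ = proj₁ (proj₂ (arith j j≡))
  i≡ : j + (x + y) ≡ i
  i≡ = proj₂ (proj₂ (arith j j≡))
  pred≡ : 1 + (a + a ∸ 1) ≡ a + a
  pred≡ = m+[n∸m]≡n {1} {a + a} (≤-trans (≤-trans (s≤s z≤n) j<a) (m≤m+n a a))
  small : ∀ w → 1 + w ≡ a + a → w < a + a
  small w g = ≤-reflexive g
  late : ∀ w → 1 + w ≡ a + a → j ≤ w
  late w g = go j j<a
   where
   go : ∀ j → j < a → j ≤ w
   go j j<a = linear (w ∷ j ∷ []) (# 1 :+ ! 0 := â :+ â ∷ ! 1 ≺ â ∷ [] ⊢ ! 1 ≼ ! 0) (1 ∷ 0 ∷ 1 ∷ 1 ∷ []) (g & j<a)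
  position-d : ∀ w → 1 + w ≡ a + a → y + y + w + suc (suc A) ≡ m
  position-d w g = equal (w ∷ A ∷ []) (# 1 :+ ! 0 := â :+ â ∷ # 1 :+ ! 1 := d̂ ∷ []) (ŷ :+ ŷ :+ ! 0 :+ (# 1 :+ (# 1 :+ ! 1))) m̂ (1 ∷ 1 ∷ 0 ∷ 1 ∷ []) (1 ∷ 0 ∷ 1 ∷ 0 ∷ 1 ∷ []) (g & f)
  row-same : ∀ k → row b (suc A) k ≡ v (y + y + (a + a ∸ 1)) (j + (x + y)) k
  row-same k = trans (row-v (suc A) (y + y + (a + a ∸ 1)) i k (position-d (a + a ∸ 1) pred≡))
   (cong (λ c → v (y + y + (a + a ∸ 1)) c k) (sym i≡))

 Below-extend : ∀ {hi P} → Below hi P → ∀ {n} → (∀ {A} → A ∈ P → A < n) → Below n P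
 Below-extend [] f = []
 Below-extend (p ∷ ps) f = f (here refl) ∷ ps

 Below-join : ∀ {hi P Q} → Below hi P → Below hi Q → (∀ {A B} → A ∈ P → B ∈ Q → B < A) → Below hi (P ++ Q)
 Below-join [] qs f = qs
 Below-join (p ∷ ps) qs f = p ∷ Below-join ps (Below-extend qs (f (here refl))) (λ A∈ → f (there A∈))

 count : ℕ → List ℕ → ℚ
 count b P = q (length (paths b P))

 -- The step shared by the strips above and below `m`. What differs there is passed as an argument:
 -- the behaviour at the wall, and the continuation into the next strip.
 strip-sum : ∀ k j n pre → j + n ≡ W → m ≤ suc k + j →
  (∀ {A} → Down (suc k) A → suc A ≡ ub (suc k) → ∀ post → D j n (pre ++ row (suc k) (suc A) ∷ post) ≡ 0ℚ) →
  (∀ e → Below (ub (suc k)) (map dst e) → All (Up (suc k)) (map dst e) →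
   q (length (continue k e)) ≡ D j n (pre ++ map (row (suc k)) (map dst e))) →
  ∀ P → Below (ub (suc k)) P → All (Down (suc k)) P → count (suc k) P ≡ D j n (pre ++ map (row (suc (suc k))) P)
 strip-sum k j n pre e m≤ top rest P below dns = begin
  count (suc k) P
   ≡⟨ length-concatMap (continue k) (steps (suc k) (ub (suc k)) P) ⟩
  sumOver (λ e → q (length (continue k e))) (steps (suc k) (ub (suc k)) P)
   ≡⟨ sumOver-cong (steps (suc k) (ub (suc k)) P) (λ {e} e∈ → rest e (steps-Below (suc k) (ub (suc k)) P e∈) (steps-U (suc k) (ub (suc k)) P e∈)) ⟩
  sumOver (λ e → D j n (pre ++ map (row (suc k)) (map dst e))) (steps (suc k) (ub (suc k)) P)
   ≡⟨ sum-steps j n (suc k) (row (suc (suc k))) (row (suc k))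
      (λ A i j≤i _ → row-pascal (suc k) A i (≤-trans m≤ (+-monoʳ-≤ (suc k) j≤i)))
      (ub (suc k)) P pre below
      (λ {A} A∈ ¬u → vanishing-row j n (suc k) e m≤ {A} (All.lookup dns A∈) ¬u)
      (λ {A} A∈ lt → Up-suc {suc k} {A} (All.lookup dns A∈) lt)
      (λ {A} A∈ f → top {A} (All.lookup dns A∈) f) ⟩
  D j n (pre ++ map (row (suc (suc k))) P) ∎
  where open ≡-Reasoning

 next-Down : ∀ k P′ → All (Down k) (next k P′)
 next-Down k P′ = All.tabulate (λ A∈ → proj₁ (proj₂ (next⁻ k P′ A∈)))

 high-step : ∀ k i → suc k ≡ m + i → m ≤ k ⊎ (suc k ≡ m × x ≡ 0) →
  (∀ P′ → Below (ub (suc k)) P′ → All (Up (suc k)) P′ → count k (next k P′) ≡ D 0 W (emit 0 (suc i) ++ map (row (suc k)) P′)) →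
  ∀ P → Below (ub (suc k)) P → All (Down (suc k)) P → count (suc k) P ≡ D 0 W (emit 0 (suc i) ++ map (row (suc (suc k))) P)
 high-step k i e side ih = strip-sum k 0 W (emit 0 (suc i)) refl (≤-trans (subst (m ≤_) (sym e) (m≤m+n m i)) (m≤m+n (suc k) 0))
  (λ {A} → top-row i (suc k) e {A})
  (λ w below ups → trans (cong q (length-continue k w (Closed⁺ k (map dst w) (λ A _ u ¬d → ⊥-elim (¬d (Up⇒Down-high {k} {A} side u)))))) (ih (map dst w) below ups))

 next-high : ∀ k i → k ≡ m + i → ∀ P′ → Below (ub (suc k)) P′ → All (Up (suc k)) P′ → next k P′ ≡ emitted (suc i) ++ P′
 next-high k i e P′ below ups = Below-unique (next-Below k P′)
  (Below-join (Below-extend (select-Below (emitted? (suc i)) m) (λ {A} A∈ → Down-ub {k} {A} (down A∈)))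
        (Below-extend below (λ {A} A∈ → Down-ub {k} {A} (fall A∈)))
        (λ {A} {B} A∈ B∈ → Up<Emitted {suc i} {k} {A} {B} e′ (proj₂ (∈-select⁻ (emitted? (suc i)) m A∈)) (All.lookup ups B∈)))
  to from
  where
  e′ : suc k ≡ m + suc i
  e′ = trans (cong suc e) (sym (+-suc m i))
  below-k : ∀ {A} → A < m → A < k
  below-k l = ≤-trans l (subst (m ≤_) (sym e) (m≤m+n m i))
  down : ∀ {A} → A ∈ emitted (suc i) → Down k A
  down {A} A∈ = let (lt , em) = ∈-select⁻ (emitted? (suc i)) m A∈ in proj₁ (Emitted⇒Down {suc i} {k} {A} e′ (below-k lt) em)
  fall : ∀ {A} → A ∈ P′ → Down k A
  fall {A} A∈ = Up⇒Down-high {k} {A} (inj₁ (subst (m ≤_) (sym e) (m≤m+n m i))) (All.lookup ups A∈)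
  to : ∀ A → A ∈ next k P′ → A ∈ emitted (suc i) ++ P′
  to A A∈ with next⁻ k P′ A∈
  ... | _ , dn , inj₁ ¬u = ∈-++⁺ˡ (∈-select⁺ (emitted? (suc i)) m (proj₁ (proj₂ dn)) (Down⇒Emitted {suc i} {k} {A} e′ dn ¬u))
  ... | _ , dn , inj₂ A∈′ = ∈-++⁺ʳ (emitted (suc i)) A∈′
  from : ∀ A → A ∈ emitted (suc i) ++ P′ → A ∈ next k P′
  from A A∈ with ∈-++⁻ (emitted (suc i)) A∈
  ... | inj₂ A∈′ = next⁺ k P′ (Down-ub {k} {A} (fall A∈′)) (fall A∈′) (inj₂ A∈′)
  ... | inj₁ A∈′ = let (lt , em) = ∈-select⁻ (emitted? (suc i)) m A∈′ in
   next⁺ k P′ (Down-ub {k} {A} (down A∈′)) (down A∈′) (inj₁ (proj₂ (Emitted⇒Down {suc i} {k} {A} e′ (below-k lt) em)))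

 emit-snoc : ∀ n → emit 0 (suc n) ≡ emit 0 n ++ map (row (m + n)) (emitted n)
 emit-snoc n = trans (cong (emit 0) (NP.+-comm 1 n)) (trans (emit-++ 0 n 1) (cong (emit 0 n ++_) (LP.++-identityʳ _)))

 -- With `row-inner`: in the column of an exit only the path standing at that exit has a nonzero
 -- entry, so the determinant loses this row and this column.
 row-exit : ∀ k j → suc k + j ≡ m → row (suc k) k j ≡ 1ℚ
 row-exit k j e = trans (row-diff (suc k) k j 0 e) (cong (λ n → bin n (+ 0)) (trans (cong (_∸ m) e) (NP.n∸n≡0 m)))

 row-inner : ∀ k j A → suc k + j ≡ m → A < k → row (suc k) A j ≡ 0ℚ
 row-inner k j A e A<k = trans (row-diff (suc k) A j (k ∸ A) (trans (+-suc (k ∸ A) (A + j))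
   (trans (cong suc (trans (sym (NP.+-assoc (k ∸ A) A j)) (cong (_+ j) (m∸n+n≡m (<⇒≤ A<k))))) e)))
  (trans (cong (λ n → bin n (+ (k ∸ A))) (trans (cong (_∸ m) e) (NP.n∸n≡0 m))) (bin-large 0 (k ∸ A) (NP.m<n⇒0<n∸m A<k)))

 empty-list : ∀ {X : Set} {xs : List X} → (∀ {e} → ¬ e ∈ xs) → xs ≡ []
 empty-list {xs = []} none = refl
 empty-list {xs = _ ∷ _} none = ⊥-elim (none (here refl))

 no-Up : ∀ b A → b ≤ t → ¬ Up b A
 no-Up b A b≤t (p , _ , _ , r , _) = refute (b ∷ A ∷ []) (! 0 ≼ t̂ ∷ ! 1 ≺ ! 0 ∷ 2 :* t̂ ≼ ! 1 :+ ! 0 ∷ []) (2 ∷ 1 ∷ 1 ∷ []) (b≤t & p & r)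

 next-low : ∀ k → k < t → next k [] ≡ []
 next-low k k<t = empty-list none
  where
  none : ∀ {A} → ¬ A ∈ next k []
  none {A} A∈ with next⁻ k [] A∈
  ... | _ , (p , _ , _ , r , _) , _ = refute (k ∷ A ∷ []) (! 0 ≺ t̂ ∷ ! 1 ≺ ! 0 ∷ ŷ :+ ẑ :+ (# 1 :+ (ŷ :+ ẑ :+ # 0)) ≺ # 1 :+ (! 1 :+ ! 0) ∷ []) (2 ∷ 1 ∷ 1 ∷ []) (k<t & p & r)

 count-low : ∀ b → b ≤ t → count b [] ≡ 1ℚ
 count-low zero _ = refl
 count-low (suc k) k<t = trans (length-concatMap (continue k) ([] ∷ []))
  (trans (QP.+-identityʳ _) (trans (cong q (length-continue k [] (Closed⁺ k [] (λ A _ u _ → ⊥-elim (no-Up (suc k) A k<t u)))))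
   (trans (cong (count k) (next-low k k<t)) (count-low k (<⇒≤ k<t)))))

 count-dead : ∀ A P → count t (A ∷ P) ≡ 0ℚ
 count-dead A P = cong (λ es → q (length (concatMap (continue (y + z)) es))) (empty-list {xs = steps t (ub t) (A ∷ P)} none)
  where
  none : ∀ {e} → ¬ e ∈ steps t (ub t) (A ∷ P)
  none e∈ with steps-∷ t (ub t) A P e∈
  ... | s , _ , _ , _ , _ , u = no-Up t (dst (A , s)) ≤-refl u

 -- The up triangle of strip `k + 1` at position `k` lies next to the axis `A = b`. The triangle
 -- beneath it is outside the chamber, so a path has to leave through it. The condition `1 ≤ j + x`
 -- ensures that this up triangle does not fall out of the chamber across the axis `b = c`.
 module Exit (k j : ℕ) (e : suc k + j ≡ m) (t≤k : t ≤ k) (1≤ : 1 ≤ j + x) where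
  Up-k : Up (suc k) k
  Up-k = ≤-refl , linear (k ∷ j ∷ []) (# 1 :+ ! 0 :+ ! 1 := m̂ ∷ [] ⊢ ! 0 ≺ m̂) (1 ∷ 1 ∷ []) e , linear (k ∷ j ∷ []) (# 1 :+ ! 0 :+ ! 1 := m̂ ∷ # 1 ≼ ! 1 :+ x̂ ∷ [] ⊢ ! 0 :+ 2 :* (# 1 :+ ! 0) :+ # 2 ≼ L̂) (1 ∷ 3 ∷ 0 ∷ 2 ∷ []) (e & 1≤) , linear (k ∷ []) (t̂ ≼ ! 0 ∷ [] ⊢ 2 :* t̂ ≼ ! 0 :+ (# 1 :+ ! 0)) (1 ∷ 2 ∷ []) t≤k , clear
   where
   clear : Clear (suc k) k
   clear with suc k <? c₀
   ... | yes l = inj₁ l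
   ... | no ¬l = inj₁ (linear (k ∷ j ∷ []) (# 1 :+ (! 0 :+ ! 1) := m̂ ∷ # 1 ≼ ! 1 :+ x̂ ∷ # 1 :+ ! 0 ⊀ ĉ ∷ [] ⊢ # 1 :+ ! 0 ≺ ĉ) (1 ∷ 1 ∷ 0 ∷ 1 ∷ []) (e & 1≤ & ¬l))
  Closed-exit : ∀ P → k ∈ P → Closed k P
  Closed-exit P k∈ = Closed⁺ k P found
   where
   found : ∀ A → A < ub (suc k) → Up (suc k) A → ¬ Down k A → A ∈ P
   found A _ u ¬d with A NP.≟ k
   ... | yes refl = k∈
   ... | no A≢k = ⊥-elim (¬d (Up⇒Down {k} {A} (≤∧≢⇒< (≤-pred (proj₁ u)) A≢k) u))
  open-exit : ∀ P → ¬ k ∈ P → ¬ Closed k P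
  open-exit P k∉ cl = Closed⁻ k P cl k (Up-ub {suc k} {k} Up-k) Up-k (λ dn → <-irrefl refl (proj₁ dn)) k∉
  next-exit : ∀ P → Below k P → All (Up (suc k)) P → next k (k ∷ P) ≡ P
  next-exit P below ups = Below-unique (next-Below k (k ∷ P)) (Below-extend below (λ {A} A∈ → Down-ub {k} {A} (fall A∈))) to
   (λ A A∈ → next⁺ k (k ∷ P) (Down-ub {k} {A} (fall A∈)) (fall A∈) (inj₂ (there A∈)))
   where
   fall : ∀ {A} → A ∈ P → Down k A
   fall {A} A∈ = Up⇒Down {k} {A} (Below-∈ below A∈) (All.lookup ups A∈)
   to : ∀ A → A ∈ next k (k ∷ P) → A ∈ P
   to A A∈ with next⁻ k (k ∷ P) A∈
   ... | _ , dn , inj₂ (here refl) = ⊥-elim (<-irrefl refl (proj₁ dn))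
   ... | _ , dn , inj₂ (there A∈′) = A∈′
   ... | _ , dn@(p , q , r , s , c) , inj₁ ¬u = ⊥-elim (¬u (m<n⇒m<1+n p , q , linear (A ∷ k ∷ j ∷ []) (! 0 ≺ ! 1 ∷ # 1 :+ (! 1 :+ ! 2) := m̂ ∷ # 1 ≼ ! 2 :+ x̂ ∷ [] ⊢ ! 0 :+ (# 1 :+ (! 1 :+ (# 1 :+ (! 1 :+ # 0)))) :+ # 2 ≼ L̂) (1 ∷ 1 ∷ 3 ∷ []) (p & e & 1≤) , subst (2 * t ≤_) (sym (+-suc A k)) s , clear))
    where
    clear : Clear (suc k) A
    clear with suc k <? c₀
    ... | yes l = inj₁ l
    ... | no ¬l = inj₁ (linear (k ∷ j ∷ []) (# 1 :+ (! 0 :+ ! 1) := m̂ ∷ # 1 ≼ ! 1 :+ x̂ ∷ # 1 :+ ! 0 ⊀ ĉ ∷ [] ⊢ # 1 :+ ! 0 ≺ ĉ) (1 ∷ 1 ∷ 0 ∷ 1 ∷ []) (e & 1≤ & ¬l))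

 -- Between the strips t and m exactly one path leaves the region at every strip.
 low : ∀ n j b → n + j ≡ W → b ≡ t + n → 1 ≤ j + x → ∀ P → Below (ub b) P → All (Down b) P →
  count b P ≡ D j n (map (row (suc b)) P)
 low zero j b e refl 1≤ P below dns = subst (λ b → count b P ≡ D j 0 (map (row (suc b)) P)) (sym (NP.+-identityʳ t)) (bottom P)
  where
  bottom : ∀ P → count t P ≡ D j 0 (map (row (suc t)) P)
  bottom [] = count-low t ≤-refl
  bottom (A ∷ P) = count-dead A P
 low (suc n) j (suc k) e f 1≤ = strip-sum k j (suc n) [] (trans (NP.+-comm j (suc n)) e) (≤-reflexive (sym sum≡)) edge rest
  where
  sum≡ : suc k + j ≡ m
  sum≡ = equal (n ∷ j ∷ k ∷ []) (# 1 :+ ! 0 :+ ! 1 := Ŵ ∷ # 1 :+ ! 2 := t̂ :+ (# 1 :+ ! 0) ∷ []) (# 1 :+ ! 2 :+ ! 1) m̂ (1 ∷ 1 ∷ 0 ∷ 1 ∷ []) (1 ∷ 0 ∷ 1 ∷ 0 ∷ 1 ∷ []) (e & f)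
  k≡ : k ≡ t + n
  k≡ = equal (k ∷ n ∷ []) (# 1 :+ ! 0 := t̂ :+ (# 1 :+ ! 1) ∷ []) (! 0) (t̂ :+ ! 1) (1 ∷ 1 ∷ []) (1 ∷ 0 ∷ 1 ∷ []) f
  open Exit k j sum≡ (linear (k ∷ n ∷ []) (! 0 := t̂ :+ ! 1 ∷ [] ⊢ t̂ ≼ ! 0) (1 ∷ 0 ∷ 1 ∷ []) k≡) 1≤
  edge : ∀ {A} → Down (suc k) A → suc A ≡ ub (suc k) → ∀ post → D j (suc n) (row (suc k) (suc A) ∷ post) ≡ 0ℚ
  edge {A} dn g post with at-ub {suc k} {A} dn g
  ... | inj₁ h = D-zero-row {row (suc k) (suc A)} j (suc n) (λ i j≤i _ → row-neg (suc k) (suc A) i (linear (A ∷ k ∷ j ∷ i ∷ []) (# 1 :+ ! 0 := # 1 :+ ! 1 ∷ # 1 :+ ! 1 :+ ! 2 := m̂ ∷ ! 2 ≼ ! 3 ∷ [] ⊢ m̂ ≼ # 1 :+ ! 0 :+ ! 3) (1 ∷ 0 ∷ 1 ∷ 0 ∷ 1 ∷ 1 ∷ []) (h & sum≡ & j≤i))) [] post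
  ... | inj₂ (inj₁ h) = D-zero-row {row (suc k) (suc A)} j (suc n) (λ i j≤i _ → row-neg (suc k) (suc A) i (linear (A ∷ i ∷ []) (# 1 :+ ! 0 := m̂ ∷ [] ⊢ m̂ ≼ # 1 :+ ! 0 :+ ! 1) (1 ∷ 0 ∷ 1 ∷ []) h)) [] post
  ... | inj₂ (inj₂ (h , _)) = (refute (k ∷ j ∷ []) (ĉ ≼ # 1 :+ ! 0 ∷ # 1 :+ ! 0 :+ ! 1 := m̂ ∷ # 1 ≼ ! 1 :+ x̂ ∷ []) (1 ∷ 1 ∷ 0 ∷ 1 ∷ []) (h & sum≡ & 1≤))
  rest : ∀ w → Below (ub (suc k)) (map dst w) → All (Up (suc k)) (map dst w) →
   q (length (continue k w)) ≡ D j (suc n) (map (row (suc k)) (map dst w))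
  rest [] _ _ = cong q (length-open k [] (open-exit [] (λ ())))
  rest (p ∷ w) (l ∷ below) (u ∷ ups) = exit p w below u ups (dst p NP.≟ k)
   where
   exit : ∀ p w → Below (dst p) (map dst w) → Up (suc k) (dst p) → All (Up (suc k)) (map dst w) → Dec (dst p ≡ k) →
    q (length (continue k (p ∷ w))) ≡ D j (suc n) (row (suc k) (dst p) ∷ map (row (suc k)) (map dst w))
   -- Without a path at the exit the word is discarded, and correspondingly the column of that exit
   -- is zero.
   exit p w below u ups (no p≢k) = trans (cong q (length-open k (p ∷ w) (open-exit _ k∉)))
     (sym (∧-zeroˡ {col j} {D (suc j) n} {row (suc k) (dst p) ∷ map (row (suc k)) (map dst w)} (AllP.map⁺ {f = row (suc k)} (All.tabulate (λ {A} A∈ → row-inner k j A sum≡ (inner A∈))))))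
    where
    p<k : dst p < k
    p<k = ≤∧≢⇒< (≤-pred (proj₁ u)) p≢k
    inner : ∀ {A} → A ∈ dst p ∷ map dst w → A < k
    inner (here refl) = p<k
    inner (there A∈) = <-trans (Below-∈ below A∈) p<k
    k∉ : ¬ k ∈ dst p ∷ map dst w
    k∉ k∈ = <-irrefl refl (inner k∈)
   exit p w below u ups (yes refl) = begin
    q (length (continue k (p ∷ w))) ≡⟨ cong q (length-continue k (p ∷ w) (Closed-exit _ (here refl))) ⟩
    count k (next k (dst p ∷ map dst w)) ≡⟨ cong (count k) (next-exit (map dst w) below ups) ⟩
    count k (map dst w) ≡⟨ low n (suc j) k (trans (+-suc n j) e) k≡ (s≤s z≤n) (map dst w)
                              (subst (Below (ub k)) (next-exit (map dst w) below ups) (next-Below k _))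
                              (subst (All (Down k)) (next-exit (map dst w) below ups) (next-Down k _)) ⟩
    D (suc j) n (map (row (suc k)) (map dst w)) ≡⟨ D-pop j n {row (suc k) (dst p)} {map (row (suc k)) (map dst w)} (row-exit k j sum≡)
                              (AllP.map⁺ {f = row (suc k)} (All.tabulate (λ {A} A∈ → row-inner k j A sum≡ (Below-∈ below A∈)))) ⟨
    D j (suc n) (row (suc k) (dst p) ∷ map (row (suc k)) (map dst w)) ∎
    where open ≡-Reasoning

 -- For x = 0 the path that would start at m − 1 is missing; its row is a unit vector.
 base′ : ∀ b → b ≡ m → ∀ P → Below (ub b) P → All (Down b) P → Dec (x ≡ 0) → count b P ≡ D 0 W (emit 0 1 ++ map (row (suc b)) P)
 base : ∀ b → b ≡ m → ∀ P → Below (ub b) P → All (Down b) P → count b P ≡ D 0 W (emit 0 1 ++ map (row (suc b)) P)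
 base b b≡m P below dns = base′ b b≡m P below dns (x NP.≟ 0)
 base′ b b≡m P below dns (no x≢0) = trans (low W 0 b (NP.+-identityʳ W) (trans b≡m (arith)) (NP.n≢0⇒n>0 x≢0) P below dns)
  (cong (λ l → D 0 W (l ++ map (row (suc b)) P)) (sym (emit-none 0 1 (λ { zero _ _ → none-before 0 (NP.n≢0⇒n>0 x≢0); (suc k) _ (s≤s ()) }))))
  where
  arith : m ≡ t + W
  arith = equal [] [] m̂ (t̂ :+ Ŵ) (1 ∷ []) (1 ∷ []) _
 base′ zero b≡m P below dns (yes x≡0) = (refute [] (# 0 := m̂ ∷ []) (0 ∷ 1 ∷ []) b≡m)
 base′ (suc k) b≡m P below dns (yes x≡0) = high-step k 0 (trans b≡m (sym (NP.+-identityʳ m))) (inj₂ (b≡m , x≡0)) ih P below dns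
  where
  e : suc k ≡ m + 0
  e = trans b≡m (sym (NP.+-identityʳ m))
  open ≡-Reasoning
  Emitted-k : Emitted 0 k
  Emitted-k = linear (k ∷ []) (# 1 :+ ! 0 := m̂ ∷ [] ⊢ ! 0 ≺ m̂) (1 ∷ 1 ∷ []) b≡m , linear (k ∷ []) (# 1 :+ ! 0 := m̂ ∷ [] ⊢ 2 :* t̂ ≼ ! 0 :+ (m̂ :+ # 0)) (1 ∷ []) b≡m , inj₁ (linear (k ∷ []) (# 1 :+ ! 0 := m̂ ∷ [] ⊢ m̂ :+ # 0 ≼ ĉ) (1 ∷ []) b≡m) , inj₁ (equal (k ∷ []) (# 1 :+ ! 0 := m̂ ∷ x̂ := # 0 ∷ []) (# 1 :+ (! 0 :+ 2 :* (m̂ :+ # 0))) L̂ (1 ∷ 1 ∷ []) (1 ∷ 0 ∷ 1 ∷ 2 ∷ []) (b≡m & x≡0))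
  merge : ∀ P′ → All (Up (suc k)) P′ → Below (ub (suc k)) P′ → k ∷ next k P′ ≡ emitted 0 ++ P′
  merge P′ ups below′ = Below-unique {m} (linear (k ∷ []) (# 1 :+ ! 0 := m̂ ∷ [] ⊢ ! 0 ≺ m̂) (1 ∷ 1 ∷ []) b≡m ∷ Below-extend (next-Below k P′) (λ A∈ → proj₁ (proj₁ (proj₂ (next⁻ k P′ A∈)))))
   (Below-join (select-Below (emitted? 0) m) (Below-extend below′ (λ A∈ → proj₁ (proj₂ (All.lookup ups A∈))))
    (λ {A} {B} A∈ B∈ → Up<Emitted {0} {k} {A} {B} e (proj₂ (∈-select⁻ (emitted? 0) m A∈)) (All.lookup ups B∈)))
   to from
   where
   to : ∀ A → A ∈ k ∷ next k P′ → A ∈ emitted 0 ++ P′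
   to A (here refl) = ∈-++⁺ˡ (∈-select⁺ (emitted? 0) m (proj₁ Emitted-k) Emitted-k)
   to A (there A∈) with next⁻ k P′ A∈
   ... | _ , dn , inj₁ ¬u = ∈-++⁺ˡ (∈-select⁺ (emitted? 0) m (proj₁ (proj₂ dn)) (Down⇒Emitted {0} {k} {A} e dn ¬u))
   ... | _ , dn , inj₂ A∈′ = ∈-++⁺ʳ (emitted 0) A∈′
   from : ∀ A → A ∈ emitted 0 ++ P′ → A ∈ k ∷ next k P′
   from A A∈ with ∈-++⁻ (emitted 0) A∈
   ... | inj₂ A∈′ = let dn = Up⇒Down-high {k} {A} (inj₂ (b≡m , x≡0)) (All.lookup ups A∈′) in there (next⁺ k P′ (Down-ub {k} {A} dn) dn (inj₂ A∈′))
   ... | inj₁ A∈′ with A NP.≟ k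
   ... | yes refl = here refl
   ... | no A≢k =
    let (lt , em) = ∈-select⁻ (emitted? 0) m A∈′ in
    let (dn , ¬u) = Emitted⇒Down {0} {k} {A} e (≤∧≢⇒< (≤-pred (subst (A <_) (sym b≡m) lt)) A≢k) em
    in there (next⁺ k P′ (Down-ub {k} {A} dn) dn (inj₁ ¬u))
  low-k : ∀ P → Below (ub k) P → All (Down k) P → count k P ≡ D 1 (y + z + (a + a)) (map (row (suc k)) P)
  low-k = low (y + z + (a + a)) 1 k (NP.+-comm (y + z + (a + a)) 1) (equal (k ∷ []) (# 1 :+ ! 0 := m̂ ∷ []) (! 0) (t̂ :+ (ŷ :+ ẑ :+ (â :+ â))) (1 ∷ 1 ∷ []) (1 ∷ 0 ∷ 1 ∷ []) b≡m) (s≤s z≤n)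
  unit-row : ∀ i → row (suc k) k i ≡ v 0 0 i
  unit-row i = trans (cong (λ b → row b k i) e) (row-v k 0 0 i b≡m)
  ih : ∀ P′ → Below (ub (suc k)) P′ → All (Up (suc k)) P′ → count k (next k P′) ≡ D 0 W (emit 0 1 ++ map (row (suc k)) P′)
  ih P′ below′ ups = begin
   count k (next k P′)
    ≡⟨ low-k (next k P′) (next-Below k P′) (next-Down k P′) ⟩
   D 1 (y + z + (a + a)) (map (row (suc k)) (next k P′))
    ≡⟨ D-unit-row 0 (y + z + (a + a)) (row (suc k) k) (map (row (suc k)) (next k P′)) (trans (unit-row 0) (v-0-0 0))
       (λ { (suc i) _ → trans (unit-row (suc i)) (v-0-suc 0 i) }) ⟨
   D 0 W (map (row (suc k)) (k ∷ next k P′))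
    ≡⟨ cong (λ l → D 0 W (map (row (suc k)) l)) (merge P′ ups below′) ⟩
   D 0 W (map (row (suc k)) (emitted 0 ++ P′))
    ≡⟨ cong (D 0 W) (LP.map-++ (row (suc k)) (emitted 0) P′) ⟩
   D 0 W (map (row (suc k)) (emitted 0) ++ map (row (suc k)) P′)
    ≡⟨ cong (λ b → D 0 W (map (row b) (emitted 0) ++ map (row (suc k)) P′)) e ⟩
   D 0 W (map (row (m + 0)) (emitted 0) ++ map (row (suc k)) P′)
    ≡⟨ cong (λ l → D 0 W (l ++ map (row (suc k)) P′)) (LP.++-identityʳ (map (row (m + 0)) (emitted 0))) ⟨
   D 0 W (emit 0 1 ++ map (row (suc k)) P′) ∎

 -- The Lindström-Gessel-Viennot count for the strips from `m` upwards: the emitted rows stand for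
 -- the paths still to start, the list `P` for those under way, and the columns for the common
 -- exits.
 high : ∀ i b → b ≡ m + i → ∀ P → Below (ub b) P → All (Down b) P → count b P ≡ D 0 W (emit 0 (suc i) ++ map (row (suc b)) P)
 high zero b e = base b (trans e (NP.+-identityʳ m))
 high (suc i) zero e = (refute (i ∷ []) (# 0 := m̂ :+ (# 1 :+ ! 0) ∷ []) (0 ∷ 1 ∷ []) e)
 high (suc i) (suc k) e = high-step k (suc i) e (inj₁ (subst (m ≤_) (sym k≡) (m≤m+n m i))) ih
  where
  k≡ : k ≡ m + i
  k≡ = NP.suc-injective (trans e (+-suc m i))
  open ≡-Reasoning
  ih : ∀ P′ → Below (ub (suc k)) P′ → All (Up (suc k)) P′ → count k (next k P′) ≡ D 0 W (emit 0 (suc (suc i)) ++ map (row (suc k)) P′)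
  ih P′ below ups = begin
   count k (next k P′)
    ≡⟨ high i k k≡ (next k P′) (next-Below k P′) (next-Down k P′) ⟩
   D 0 W (emit 0 (suc i) ++ map (row (suc k)) (next k P′))
    ≡⟨ cong (λ l → D 0 W (emit 0 (suc i) ++ map (row (suc k)) l)) (next-high k i k≡ P′ below ups) ⟩
   D 0 W (emit 0 (suc i) ++ map (row (suc k)) (emitted (suc i) ++ P′))
    ≡⟨ cong (λ l → D 0 W (emit 0 (suc i) ++ l)) (LP.map-++ (row (suc k)) (emitted (suc i)) P′) ⟩
   D 0 W (emit 0 (suc i) ++ map (row (suc k)) (emitted (suc i)) ++ map (row (suc k)) P′)
    ≡⟨ cong (D 0 W) (LP.++-assoc (emit 0 (suc i)) _ _) ⟨
   D 0 W ((emit 0 (suc i) ++ map (row (suc k)) (emitted (suc i))) ++ map (row (suc k)) P′)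
    ≡⟨ cong (λ b → D 0 W ((emit 0 (suc i) ++ map (row b) (emitted (suc i))) ++ map (row (suc k)) P′)) e ⟩
   D 0 W ((emit 0 (suc i) ++ map (row (m + suc i)) (emitted (suc i))) ++ map (row (suc k)) P′)
    ≡⟨ cong (λ l → D 0 W (l ++ map (row (suc k)) P′)) (emit-snoc (suc i)) ⟨
   D 0 W (emit 0 (suc (suc i)) ++ map (row (suc k)) P′) ∎

 -- No down triangle of the chamber lies in this strip, so the enumeration can begin without any
 -- path.
 top : ℕ
 top = m + (x + (y + (a + z)))

 path-count : count top [] ≡ Q x y z a
 path-count = begin
  count top [] ≡⟨ high (x + (y + (a + z))) top refl [] [] [] ⟩
  D 0 W (emit 0 (suc (x + (y + (a + z)))) ++ []) ≡⟨ cong (D 0 W) (LP.++-identityʳ (emit 0 (suc (x + (y + (a + z)))))) ⟩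
  D 0 W (emit 0 (suc (x + (y + (a + z))))) ≡⟨ cong (λ n → D 0 W (emit 0 n)) shift ⟩
  D 0 W (emit 0 (x + (y + (a + suc z)))) ≡⟨ D-≈ʳ 0 W emit-all ⟩
  Q x y z a ∎
  where
  open ≡-Reasoning
  shift : suc (x + (y + (a + z))) ≡ x + (y + (a + suc z))
  shift = equal [] [] (# 1 :+ (x̂ :+ (ŷ :+ (â :+ ẑ)))) (x̂ :+ (ŷ :+ (â :+ (# 1 :+ ẑ)))) (1 ∷ []) (1 ∷ []) _

-- Words of paths and perfect matchings of the chamber.

module DirectionWords where
 open import Data.Nat using (_≤_; _<_; _<?_)
 open import Data.Bool using (if_then_else_)
 import Data.List.Membership.DecPropositional as DecMem
 open PathWords
 open PathSums using (module Steps)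

 open DecMem ℕ._≟_ using (_∈?_)

 -- The partner of a down triangle with `A < b < c` is obtained by raising one coordinate: `b` for
 -- `up`, `c` for `stay`, `A` for `move`. The paths run through the lozenges of the last two kinds.
 data Direction : Set where
  up stay move : Direction

 _≟ᵈ_ : (δ ε : Direction) → Dec (δ ≡ ε)
 up ≟ᵈ up = yes refl
 up ≟ᵈ stay = no λ ()
 up ≟ᵈ move = no λ ()
 stay ≟ᵈ up = no λ ()
 stay ≟ᵈ stay = yes refl
 stay ≟ᵈ move = no λ ()
 move ≟ᵈ up = no λ ()
 move ≟ᵈ stay = no λ ()
 move ≟ᵈ move = yes refl

 Directions : Set
 Directions = ℕ → ℕ → Direction

 moves? : Direction → Bool
 moves? move = true
 moves? _ = false

 mark : (ℕ → Direction) → List ℕ → Entry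
 mark δ = map (λ A → A , moves? (δ A))

 -- A down triangle that no path enters is matched with the triangle above it, hence the default
 -- `up`.
 look : Entry → ℕ → Direction
 look [] A = up
 look ((B , s) ∷ e) A with A NP.≟ B
 ... | yes _ = if s then move else stay
 ... | no _ = look e A

 look-absent : ∀ e A → ¬ A ∈ map proj₁ e → look e A ≡ up
 look-absent [] A ∉ = refl
 look-absent ((B , s) ∷ e) A ∉ with A NP.≟ B
 ... | yes refl = ⊥-elim (∉ (here refl))
 ... | no _ = look-absent e A (λ ∈ → ∉ (there ∈))

 look-present : ∀ e {A} → A ∈ map proj₁ e → look e A ≢ up
 look-present ((B , true) ∷ e) {A} A∈ eq with A NP.≟ B
 look-present ((B , true) ∷ e) {A} A∈ () | yes _
 look-present ((B , true) ∷ e) {A} (here refl) eq | no ≢ = ≢ refl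
 look-present ((B , true) ∷ e) {A} (there A∈) eq | no _ = look-present e A∈ eq
 look-present ((B , false) ∷ e) {A} A∈ eq with A NP.≟ B
 look-present ((B , false) ∷ e) {A} A∈ () | yes _
 look-present ((B , false) ∷ e) {A} (here refl) eq | no ≢ = ≢ refl
 look-present ((B , false) ∷ e) {A} (there A∈) eq | no _ = look-present e A∈ eq

 look-mark : ∀ δ P A → (A ∈ P → δ A ≢ up) → (δ A ≢ up → A ∈ P) → look (mark δ P) A ≡ δ A
 look-mark δ [] A f g with δ A in eq
 ... | up = refl
 ... | stay with () ← g (λ ())
 ... | move with () ← g (λ ())
 look-mark δ (B ∷ P) A f g with A NP.≟ B
 ... | no A≢B = look-mark δ P A (λ A∈ → f (there A∈)) (λ n → tail (g n))
  where
  tail : A ∈ B ∷ P → A ∈ P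
  tail (here refl) = ⊥-elim (A≢B refl)
  tail (there A∈) = A∈
 ... | yes refl with δ A | f (here refl)
 ... | up | n = ⊥-elim (n refl)
 ... | stay | n = refl
 ... | move | n = refl

 mark-look : ∀ e {hi} → Below hi (map proj₁ e) → mark (look e) (map proj₁ e) ≡ e
 mark-look e below = go e below (λ _ _ → refl)
  where
  bit : Entry → ℕ → Bool
  bit e A = moves? (look e A)
  bit-head : ∀ A s e → bit ((A , s) ∷ e) A ≡ s
  bit-head A s e with A NP.≟ A
  bit-head A false e | yes _ = refl
  bit-head A true e | yes _ = refl
  bit-head A s e | no ≢ = ⊥-elim (≢ refl)
  look-tail : ∀ {A B s} e → B < A → look ((A , s) ∷ e) B ≡ look e B
  look-tail {A} {B} e B<A with B NP.≟ A
  ... | yes refl = ⊥-elim (<-irrefl refl B<A)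
  ... | no _ = refl
  go : ∀ e {hi δ} → Below hi (map proj₁ e) → (∀ A → A ∈ map proj₁ e → δ A ≡ look e A) → mark δ (map proj₁ e) ≡ e
  go [] _ f = refl
  go ((A , s) ∷ e) (_ ∷ below) f = cong₂ _∷_ (cong (A ,_) (trans (cong moves? (f A (here refl))) (bit-head A s e)))
   (go e below (λ B B∈ → trans (f B (there B∈)) (look-tail {s = s} e (Below-∈ below B∈))))

 mark-cong : ∀ {δ ε} P → (∀ {A} → A ∈ P → δ A ≡ ε A) → mark δ P ≡ mark ε P
 mark-cong [] f = refl
 mark-cong (A ∷ P) f = cong₂ _∷_ (cong (λ s → A , moves? s) (f (here refl))) (mark-cong P (λ A∈ → f (there A∈)))

 module Words (U D : ℕ → ℕ → Set) (U? : ∀ b A → Dec (U b A)) (D? : ∀ b A → Dec (D b A)) (ub : ℕ → ℕ)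
  (U-bound : ∀ b A → U b A → A < ub b) (D-bound : ∀ b A → D b A → A < ub b) (U-none : ∀ A → ¬ U 0 A) (D-none : ∀ A → ¬ D 0 A) where
  open Steps U D U? D? ub
  U-ub : ∀ {b A} → U b A → A < ub b
  U-ub {b} {A} = U-bound b A
  D-ub : ∀ {b A} → D b A → A < ub b
  D-ub {b} {A} = D-bound b A
  ¬U-zero : ∀ {A} → ¬ U 0 A
  ¬U-zero {A} = U-none A
  ¬D-zero : ∀ {A} → ¬ D 0 A
  ¬D-zero {A} = D-none A
  -- A matching of the strips up to `n` in which the down triangles of strip `n` outside `P` have
  -- their partners above, beyond these strips. The last three fields exclude two partners for one
  -- up triangle.
  record Valid (n : ℕ) (P : List ℕ) (δ : Directions) : Set where
   field
    enter⁻ : ∀ {A} → A ∈ P → D n A × δ n A ≢ up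
    enter⁺ : ∀ {A} → D n A → δ n A ≢ up → A ∈ P
    ups : ∀ {k A} → k < n → D k A → δ k A ≡ up → U (suc k) A
    stays : ∀ {b A} → b ≤ n → D b A → δ b A ≡ stay → U b A
    moves : ∀ {b A} → b ≤ n → D b A → δ b A ≡ move → U b (suc A)
    cover : ∀ {b A} → b ≤ n → U b A →
     (∃ λ k → b ≡ suc k × D k A × δ k A ≡ up) ⊎ (D b A × δ b A ≡ stay) ⊎ (∃ λ B → A ≡ suc B × D b B × δ b B ≡ move)
    up-stay : ∀ {k A} → k < n → D k A → δ k A ≡ up → D (suc k) A → ¬ δ (suc k) A ≡ stay
    up-move : ∀ {k B} → k < n → D k (suc B) → δ k (suc B) ≡ up → D (suc k) B → ¬ δ (suc k) B ≡ move
    stay-move : ∀ {b B} → b ≤ n → D b (suc B) → δ b (suc B) ≡ stay → D b B → ¬ δ b B ≡ move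
  open Valid
  not-up : ∀ δ → (δ ≡ stay ⊎ δ ≡ move) → δ ≢ up
  not-up stay _ ()
  not-up move _ ()
  not-up up (inj₁ ()) refl
  not-up up (inj₂ ()) refl
  landing⁺ˢ : ∀ {δ : ℕ → Direction} {P A} → A ∈ P → δ A ≡ stay → A ∈ map dst (mark δ P)
  landing⁺ˢ {δ} {P} {A} A∈ e = subst (λ s → dst (A , moves? s) ∈ map dst (mark δ P)) e (∈-map⁺ dst (∈-map⁺ _ A∈))
  landing⁺ᵐ : ∀ {δ : ℕ → Direction} {P A} → A ∈ P → δ A ≡ move → suc A ∈ map dst (mark δ P)
  landing⁺ᵐ {δ} {P} {A} A∈ e = subst (λ s → dst (A , moves? s) ∈ map dst (mark δ P)) e (∈-map⁺ dst (∈-map⁺ _ A∈))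
  landing⁻ : ∀ {δ : ℕ → Direction} {P A} → (∀ {A} → A ∈ P → δ A ≢ up) → A ∈ map dst (mark δ P) →
   (A ∈ P × δ A ≡ stay) ⊎ (∃ λ B → A ≡ suc B × B ∈ P × δ B ≡ move)
  landing⁻ {δ} {P} {A} n A∈ with ∈-map⁻ dst A∈
  ... | p , p∈ , refl with ∈-map⁻ (λ A → A , moves? (δ A)) p∈
  ... | B , B∈ , refl with δ B in eq
  ... | up = ⊥-elim (n B∈ eq)
  ... | stay = inj₁ (B∈ , eq)
  ... | move = inj₂ (B , refl , B∈ , eq)
  Below-dst : ∀ {hi} e → Below hi (map dst e) → ∀ {p r} → p ∈ e → r ∈ e → dst p ≡ dst r → p ≡ r
  Below-dst (s ∷ e) (_ ∷ below) (here refl) (here refl) _ = refl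
  Below-dst (s ∷ e) (_ ∷ below) (here refl) (there r∈) eq = ⊥-elim (<-irrefl (sym eq) (Below-∈ below (∈-map⁺ dst r∈)))
  Below-dst (s ∷ e) (_ ∷ below) (there p∈) (here refl) eq = ⊥-elim (<-irrefl eq (Below-∈ below (∈-map⁺ dst p∈)))
  Below-dst (s ∷ e) (_ ∷ below) (there p∈) (there r∈) eq = Below-dst e below p∈ r∈ eq
  ≤-cases : ∀ {b k} → b ≤ suc k → b ≡ suc k ⊎ b ≤ k
  ≤-cases b≤ with m≤n⇒m<n∨m≡n b≤
  ... | inj₁ (s≤s l) = inj₂ l
  ... | inj₂ e = inj₁ e
  -- Adds a strip on top of a matching: membership in `steps` supplies the partners inside the new
  -- strip, and `Closed` covers the up triangles that have nothing below them.
  extend : ∀ k P δ → (∀ {A} → A ∈ P → D (suc k) A × δ (suc k) A ≢ up) → (∀ {A} → D (suc k) A → δ (suc k) A ≢ up → A ∈ P) →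
   mark (δ (suc k)) P ∈ steps (suc k) (ub (suc k)) P → Closed k (map dst (mark (δ (suc k)) P)) →
   Valid k (next k (map dst (mark (δ (suc k)) P))) δ → Valid (suc k) P δ
  extend k P δ in⁻ in⁺ e∈ cl V = record
   { enter⁻ = in⁻ ; enter⁺ = in⁺ ; ups = ups′ ; stays = stays′ ; moves = moves′ ; cover = cover′
   ; up-stay = up-stay′ ; up-move = up-move′ ; stay-move = stay-move′ }
   where
   ε = δ (suc k)
   P′ = map dst (mark ε P)
   U-P′ : ∀ {A} → A ∈ P′ → U (suc k) A
   U-P′ A∈ = All.lookup (steps-U (suc k) (ub (suc k)) P e∈) A∈
   land-stay : ∀ {A} → D (suc k) A → ε A ≡ stay → A ∈ P′
   land-stay dn e = landing⁺ˢ {ε} (in⁺ dn (not-up _ (inj₁ e))) e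
   land-move : ∀ {A} → D (suc k) A → ε A ≡ move → suc A ∈ P′
   land-move dn e = landing⁺ᵐ {ε} (in⁺ dn (not-up _ (inj₂ e))) e
   up-next : ∀ {A} → D k A → δ k A ≡ up → ¬ (¬ U (suc k) A ⊎ A ∈ P′)
   up-next dn e s = proj₂ (enter⁻ V (next⁺ k P′ (D-ub dn) dn s)) e
   ups′ : ∀ {k′ A} → k′ < suc k → D k′ A → δ k′ A ≡ up → U (suc k′) A
   ups′ {k′} {A} (s≤s l) dn e with m≤n⇒m<n∨m≡n l
   ... | inj₁ l′ = ups V l′ dn e
   ... | inj₂ refl with U? (suc k) A
   ... | yes u = u
   ... | no ¬u = ⊥-elim (up-next dn e (inj₁ ¬u))
   stays′ : ∀ {b A} → b ≤ suc k → D b A → δ b A ≡ stay → U b A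
   stays′ l dn e with ≤-cases l
   ... | inj₂ l′ = stays V l′ dn e
   ... | inj₁ refl = U-P′ (land-stay dn e)
   moves′ : ∀ {b A} → b ≤ suc k → D b A → δ b A ≡ move → U b (suc A)
   moves′ l dn e with ≤-cases l
   ... | inj₂ l′ = moves V l′ dn e
   ... | inj₁ refl = U-P′ (land-move dn e)
   cover′ : ∀ {b A} → b ≤ suc k → U b A →
     (∃ λ k → b ≡ suc k × D k A × δ k A ≡ up) ⊎ (D b A × δ b A ≡ stay) ⊎ (∃ λ B → A ≡ suc B × D b B × δ b B ≡ move)
   cover′ {b} {A} l u with ≤-cases l
   ... | inj₂ l′ = cover V l′ u
   ... | inj₁ refl with A ∈? P′ | D? k A
   ... | no A∉ | no ¬dn = ⊥-elim (Closed⁻ k P′ cl A (U-ub u) u ¬dn A∉)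
   ... | no A∉ | yes dn with δ k A ≟ᵈ up
   ... | yes e = inj₁ (k , refl , dn , e)
   ... | no n with next⁻ k P′ (enter⁺ V dn n)
   ... | _ , _ , inj₁ ¬u = ⊥-elim (¬u u)
   ... | _ , _ , inj₂ A∈ = ⊥-elim (A∉ A∈)
   cover′ {b} {A} l u | inj₁ refl | yes A∈ | _ with landing⁻ {ε} (λ A∈ → proj₂ (in⁻ A∈)) A∈
   ... | inj₁ (A∈P , e) = inj₂ (inj₁ (proj₁ (in⁻ A∈P) , e))
   ... | inj₂ (B , e′ , B∈ , e) = inj₂ (inj₂ (B , e′ , proj₁ (in⁻ B∈) , e))
   up-stay′ : ∀ {k′ A} → k′ < suc k → D k′ A → δ k′ A ≡ up → D (suc k′) A → ¬ δ (suc k′) A ≡ stay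
   up-stay′ (s≤s l) dn e dn′ e′ with m≤n⇒m<n∨m≡n l
   ... | inj₁ l′ = up-stay V l′ dn e dn′ e′
   ... | inj₂ refl = up-next dn e (inj₂ (land-stay dn′ e′))
   up-move′ : ∀ {k′ B} → k′ < suc k → D k′ (suc B) → δ k′ (suc B) ≡ up → D (suc k′) B → ¬ δ (suc k′) B ≡ move
   up-move′ (s≤s l) dn e dn′ e′ with m≤n⇒m<n∨m≡n l
   ... | inj₁ l′ = up-move V l′ dn e dn′ e′
   ... | inj₂ refl = up-next dn e (inj₂ (land-move dn′ e′))
   stay-move′ : ∀ {b B} → b ≤ suc k → D b (suc B) → δ b (suc B) ≡ stay → D b B → ¬ δ b B ≡ move
   stay-move′ {b} {B} l dn e dn′ e′ with ≤-cases l
   ... | inj₂ l′ = stay-move V l′ dn e dn′ e′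
   -- Exits of a word in `steps` are strictly decreasing, so two entries with a common exit would be
   -- the same entry.
   ... | inj₁ refl = NP.1+n≢n (cong proj₁ (Below-dst (mark ε P) (steps-Below (suc k) (ub (suc k)) P e∈)
    (∈-map⁺ (λ A → A , moves? (ε A)) (in⁺ dn (not-up _ (inj₁ e)))) (∈-map⁺ (λ A → A , moves? (ε A)) (in⁺ dn′ (not-up _ (inj₂ e′))))
    (trans (cong (λ s → dst (suc B , moves? s)) e) (sym (cong (λ s → dst (B , moves? s)) e′)))))
  choose⁺ : ∀ b hi p P {e} → dst p < hi → U b (dst p) → e ∈ steps b (dst p) P → p ∷ e ∈ choose b hi p P
  choose⁺ b hi p P l u e∈ with (dst p NP.<? hi) ×-dec U? b (dst p)
  ... | yes _ = ∈-map⁺ (p ∷_) e∈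
  ... | no n = ⊥-elim (n (l , u))
  steps⁺ : ∀ b hi A s P {e} → dst (A , s) < hi → U b (dst (A , s)) → e ∈ steps b (dst (A , s)) P → (A , s) ∷ e ∈ steps b hi (A ∷ P)
  steps⁺ b hi A false P l u e∈ = ∈-++⁺ˡ (choose⁺ b hi (A , false) P l u e∈)
  steps⁺ b hi A true P l u e∈ = ∈-++⁺ʳ (choose b hi (A , false) P) (choose⁺ b hi (A , true) P l u e∈)
  mark-∈ : ∀ b hi h P (ε : ℕ → Direction) → Below h P → (∀ {A} → A ∈ P → dst (A , moves? (ε A)) < hi) →
   (∀ {A} → A ∈ P → U b (dst (A , moves? (ε A)))) →
   (∀ {A B} → A ∈ P → B ∈ P → B < A → dst (B , moves? (ε B)) < dst (A , moves? (ε A))) → mark ε P ∈ steps b hi P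
  mark-∈ b hi h [] ε below f g s = here refl
  mark-∈ b hi h (A ∷ P) ε (_ ∷ below) f g s = steps⁺ b hi A (moves? (ε A)) P (f (here refl)) (g (here refl))
   (mark-∈ b _ A P ε below (λ B∈ → s (here refl) (there B∈) (Below-∈ below B∈)) (λ B∈ → g (there B∈)) (λ A∈ B∈ → s (there A∈) (there B∈)))
  -- The converse of `extend`: the top strip of a matching is a word that the enumeration produces,
  -- and the strips below form a matching again.
  module Restrict {k : ℕ} {P : List ℕ} {δ : Directions} (below : Below (ub (suc k)) P) (V : Valid (suc k) P δ) where
   ε = δ (suc k)
   P′ = map dst (mark ε P)
   U-dst : ∀ {A} → A ∈ P → U (suc k) (dst (A , moves? (ε A)))
   U-dst {A} A∈ with enter⁻ V A∈
   ... | dn , n with ε A in eq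
   ... | up = ⊥-elim (n refl)
   ... | stay = stays V ≤-refl dn eq
   ... | move = moves V ≤-refl dn eq
   strict : ∀ {A B} → A ∈ P → B ∈ P → B < A → dst (B , moves? (ε B)) < dst (A , moves? (ε A))
   strict {A} {B} A∈ B∈ B<A with enter⁻ V A∈ | enter⁻ V B∈
   ... | dA , nA | dB , nB with ε A in eA | ε B in eB
   ... | up | _ = ⊥-elim (nA refl)
   ... | stay | up = ⊥-elim (nB refl)
   ... | move | up = ⊥-elim (nB refl)
   ... | stay | stay = B<A
   ... | move | stay = m<n⇒m<1+n B<A
   ... | move | move = s≤s B<A
   ... | stay | move with m≤n⇒m<n∨m≡n B<A
   ... | inj₁ l = l
   ... | inj₂ refl = ⊥-elim (stay-move V ≤-refl dA eA dB eB)
   entry-∈ : mark ε P ∈ steps (suc k) (ub (suc k)) P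
   entry-∈ = mark-∈ (suc k) (ub (suc k)) (ub (suc k)) P ε below (λ A∈ → U-ub (U-dst A∈)) U-dst strict
   covered : ∀ {A} → U (suc k) A → (D k A × δ k A ≡ up) ⊎ A ∈ P′
   covered {A} u with cover V ≤-refl u
   ... | inj₁ (_ , refl , dn , e) = inj₁ (dn , e)
   ... | inj₂ (inj₁ (dn , e)) = inj₂ (landing⁺ˢ {ε} (enter⁺ V dn (not-up _ (inj₁ e))) e)
   ... | inj₂ (inj₂ (B , refl , dn , e)) = inj₂ (landing⁺ᵐ {ε} (enter⁺ V dn (not-up _ (inj₂ e))) e)
   closed : Closed k P′
   closed = Closed⁺ k P′ found
    where
    found : ∀ A → A < ub (suc k) → U (suc k) A → ¬ D k A → A ∈ P′
    found A _ u ¬dn with covered u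
    ... | inj₁ (dn , _) = ⊥-elim (¬dn dn)
    ... | inj₂ A∈ = A∈
   restricted : Valid k (next k P′) δ
   restricted = record
    { enter⁻ = in⁻ ; enter⁺ = in⁺
    ; ups = λ l → ups V (m<n⇒m<1+n l) ; stays = λ l → stays V (m≤n⇒m≤1+n l) ; moves = λ l → moves V (m≤n⇒m≤1+n l)
    ; cover = λ l → cover V (m≤n⇒m≤1+n l) ; up-stay = λ l → up-stay V (m<n⇒m<1+n l) ; up-move = λ l → up-move V (m<n⇒m<1+n l)
    ; stay-move = λ l → stay-move V (m≤n⇒m≤1+n l) }
    where
    in⁻ : ∀ {A} → A ∈ next k P′ → D k A × δ k A ≢ up
    in⁻ {A} A∈ with next⁻ k P′ A∈
    ... | _ , dn , inj₁ ¬u = dn , λ e → ¬u (ups V ≤-refl dn e)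
    ... | _ , dn , inj₂ A∈′ = dn , blocked (landing⁻ {ε} (λ A∈ → proj₂ (enter⁻ V A∈)) A∈′)
     where
     blocked : _ → δ k A ≢ up
     blocked (inj₁ (A∈P , e′)) e = up-stay V ≤-refl dn e (proj₁ (enter⁻ V A∈P)) e′
     blocked (inj₂ (B , refl , B∈ , e′)) e = up-move V ≤-refl dn e (proj₁ (enter⁻ V B∈)) e′
    in⁺ : ∀ {A} → D k A → δ k A ≢ up → A ∈ next k P′
    in⁺ {A} dn n with U? (suc k) A
    ... | no ¬u = next⁺ k P′ (D-ub dn) dn (inj₁ ¬u)
    ... | yes u with covered u
    ... | inj₁ (_ , e) = ⊥-elim (n e)
    ... | inj₂ A∈ = next⁺ k P′ (D-ub dn) dn (inj₂ A∈)

-- Bijection between the enumerated words and the matchings.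

module Enumeration where
 open import Data.Nat using (_≤_; _<_; _<?_)
 open import Data.Fin using (Fin; zero; suc)
 open import Data.List using (lookup)
 open import Data.List.Properties using (∷-injectiveˡ; ∷-injectiveʳ)
 open import Data.List.Membership.Propositional using (lose; find)
 open import Data.List.Membership.Propositional.Properties using (∈-concatMap⁺; ∈-concatMap⁻; ∈-lookup)
 import Data.List.Membership.DecPropositional as DecMem
 open import Data.List.Relation.Unary.Any using (index)
 open import Data.List.Relation.Unary.Any.Properties using (lookup-index)
 open import Data.List.Relation.Unary.Unique.Propositional using (Unique)
 open import Data.List.Relation.Unary.AllPairs using ([]; _∷_)
 import Data.List.Relation.Unary.Unique.Propositional.Properties as Unique
 open PathWords
 open PathSums using (module Steps)
 open DirectionWords

 open DecMem ℕ._≟_ using (_∈?_)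

 lookup-injective : ∀ {X : Set} {xs : List X} → Unique xs → ∀ i j → lookup xs i ≡ lookup xs j → i ≡ j
 lookup-injective {xs = x ∷ xs} _ zero zero _ = refl
 lookup-injective {xs = x ∷ xs} (u ∷ us) zero (suc j) e = ⊥-elim (All.lookup u (∈-lookup j) e)
 lookup-injective {xs = x ∷ xs} (u ∷ us) (suc i) zero e = ⊥-elim (All.lookup u (∈-lookup i) (sym e))
 lookup-injective {xs = x ∷ xs} (u ∷ us) (suc i) (suc j) e = cong suc (lookup-injective us i j e)

 Unique-concatMap : ∀ {X Y : Set} {f : X → List Y} → (∀ x → Unique (f x)) → (∀ {x y w} → w ∈ f x → w ∈ f y → x ≡ y) →
  ∀ {xs} → Unique xs → Unique (concatMap f xs)
 Unique-concatMap {f = f} u inj [] = []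
 Unique-concatMap {f = f} u inj {x ∷ xs} (x∉ ∷ us) = Unique.++⁺ (u x) (Unique-concatMap u inj us) disjoint
  where
  disjoint : ∀ {w} → ¬ (w ∈ f x × w ∈ concatMap f xs)
  disjoint (w∈ , w∈′) with find (∈-concatMap⁻ f {xs = xs} w∈′)
  ... | y , y∈ , w∈″ = All.lookup x∉ y∈ (inj w∈ w∈″)

 pick : ∀ {P : Set} → Dec P → Direction → Direction → Direction
 pick (yes _) δ ε = δ
 pick (no _) δ ε = ε

 dirOf : ℕ → List Entry → Directions
 dirOf zero w b A = up
 dirOf (suc k) [] b A = up
 dirOf (suc k) (e ∷ w) b A = pick (b NP.≟ suc k) (look e A) (dirOf k w b A)

 dirOf-top : ∀ k e w A → dirOf (suc k) (e ∷ w) (suc k) A ≡ look e A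
 dirOf-top k e w A with suc k NP.≟ suc k
 ... | yes _ = refl
 ... | no n = ⊥-elim (n refl)

 dirOf-below : ∀ k e w {b} A → b ≤ k → dirOf (suc k) (e ∷ w) b A ≡ dirOf k w b A
 dirOf-below k e w {b} A b≤k with b NP.≟ suc k
 ... | yes refl = ⊥-elim (<-irrefl refl b≤k)
 ... | no _ = refl

 module Enumerate (U D : ℕ → ℕ → Set) (U? : ∀ b A → Dec (U b A)) (D? : ∀ b A → Dec (D b A)) (ub : ℕ → ℕ)
  (U-bound : ∀ b A → U b A → A < ub b) (D-bound : ∀ b A → D b A → A < ub b) (U-none : ∀ A → ¬ U 0 A) (D-none : ∀ A → ¬ D 0 A) where
  open Steps U D U? D? ub
  open Words U D U? D? ub U-bound D-bound U-none D-none
  open Valid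
  Unique-choose : ∀ b hi p P → (∀ hi → Unique (steps b hi P)) → Unique (choose b hi p P)
  Unique-choose b hi p P u with (dst p NP.<? hi) ×-dec U? b (dst p)
  ... | yes _ = Unique.map⁺ ∷-injectiveʳ (u (dst p))
  ... | no _ = []
  Unique-steps : ∀ b hi P → Unique (steps b hi P)
  Unique-steps b hi [] = [] ∷ []
  Unique-steps b hi (A ∷ P) = Unique.++⁺ (Unique-choose b hi (A , false) P (λ hi → Unique-steps b hi P))
   (Unique-choose b hi (A , true) P (λ hi → Unique-steps b hi P)) disjoint
   where
   disjoint : ∀ {e} → ¬ (e ∈ choose b hi (A , false) P × e ∈ choose b hi (A , true) P)
   disjoint (e∈ , e∈′) with choose-∷ b hi (A , false) P e∈ | choose-∷ b hi (A , true) P e∈′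
   ... | _ , refl , _ | _ , () , _
  continue⁻ : ∀ k e {w} → w ∈ continue k e → Closed k (map dst e) × ∃ λ w′ → w ≡ e ∷ w′ × w′ ∈ paths k (next k (map dst e))
  continue⁻ k e w∈ with closed? k (map dst e)
  ... | yes cl with ∈-map⁻ (e ∷_) w∈
  ... | w′ , w′∈ , refl = cl , w′ , refl , w′∈
  continue⁺ : ∀ k e {w} → Closed k (map dst e) → w ∈ paths k (next k (map dst e)) → e ∷ w ∈ continue k e
  continue⁺ k e cl w∈ with closed? k (map dst e)
  ... | yes _ = ∈-map⁺ (e ∷_) w∈
  ... | no n = ⊥-elim (n cl)
  Unique-paths : ∀ n P → Unique (paths n P)
  Unique-paths zero P = [] ∷ []
  Unique-paths (suc k) P = Unique-concatMap Unique-continue same (Unique-steps (suc k) (ub (suc k)) P)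
   where
   Unique-continue : ∀ e → Unique (continue k e)
   Unique-continue e with closed? k (map dst e)
   ... | yes _ = Unique.map⁺ ∷-injectiveʳ (Unique-paths k _)
   ... | no _ = []
   same : ∀ {e e′ w} → w ∈ continue k e → w ∈ continue k e′ → e ≡ e′
   same {e} {e′} w∈ w∈′ with continue⁻ k e w∈ | continue⁻ k e′ w∈′
   ... | _ , _ , refl , _ | _ , _ , eq , _ = ∷-injectiveˡ eq
  wordOf : ℕ → List ℕ → Directions → List Entry
  wordOf zero P δ = []
  wordOf (suc k) P δ = mark (δ (suc k)) P ∷ wordOf k (next k (map dst (mark (δ (suc k)) P))) δ
  -- Directions are compared at the down triangles of the chamber, where they describe lozenges;
  -- plain equality of functions would be too fine for a bijection.
  Agree : ℕ → Directions → Directions → Set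
  Agree n δ ε = ∀ b A → b ≤ n → D b A → δ b A ≡ ε b A
  next-D : ∀ k P′ → All (D k) (next k P′)
  next-D k P′ = All.tabulate (λ A∈ → proj₁ (proj₂ (next⁻ k P′ A∈)))
  wordOf-cong : ∀ n P {δ ε} → Agree n δ ε → All (D n) P → wordOf n P δ ≡ wordOf n P ε
  wordOf-cong zero P f dns = refl
  wordOf-cong (suc k) P {δ} {ε} f dns = cong₂ _∷_ same
   (trans (cong (λ e → wordOf k (next k (map dst e)) δ) same) (wordOf-cong k _ (λ b A l → f b A (m≤n⇒m≤1+n l)) (next-D k _)))
   where
   same : mark (δ (suc k)) P ≡ mark (ε (suc k)) P
   same = mark-cong P (λ {A} A∈ → f (suc k) A ≤-refl (All.lookup dns A∈))
  complete : ∀ n P δ → Below (ub n) P → Valid n P δ → wordOf n P δ ∈ paths n P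
  complete zero P δ below V = here refl
  complete (suc k) P δ below V = ∈-concatMap⁺ (continue k) (lose entry-∈ (continue⁺ k _ closed (complete k _ δ (next-Below k _) restricted)))
   where open Restrict below V
  dirOf-wordOf : ∀ n P δ → Below (ub n) P → Valid n P δ → Agree n (dirOf n (wordOf n P δ)) δ
  dirOf-wordOf zero P δ below V zero A z≤n dn = ⊥-elim (¬D-zero dn)
  dirOf-wordOf (suc k) P δ below V b A l dn with ≤-cases l
  ... | inj₁ refl = trans (dirOf-top k (mark (δ (suc k)) P) _ A) (look-mark (δ (suc k)) P A (λ A∈ → proj₂ (enter⁻ V A∈)) (enter⁺ V dn))
  ... | inj₂ l′ = trans (dirOf-below k (mark (δ (suc k)) P) _ A l′) (dirOf-wordOf k _ δ (next-Below k _) (Restrict.restricted below V) b A l′ dn)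
  Valid-cong : ∀ {n P δ ε} → (∀ {b} A → b ≤ n → ε b A ≡ δ b A) → Valid n P δ → Valid n P ε
  Valid-cong {n} {P} {δ} {ε} f V = record
   { enter⁻ = λ {A} A∈ → proj₁ (enter⁻ V A∈) , λ e → proj₂ (enter⁻ V A∈) (trans (sym (f A ≤-refl)) e)
   ; enter⁺ = λ {A} dn n → enter⁺ V dn (λ e → n (trans (f A ≤-refl) e))
   ; ups = λ l dn e → ups V l dn (back (<⇒≤ l) e)
   ; stays = λ l dn e → stays V l dn (back l e)
   ; moves = λ l dn e → moves V l dn (back l e)
   ; cover = λ l u → forth l (cover V l u)
   ; up-stay = λ l dn e dn′ e′ → up-stay V l dn (back (<⇒≤ l) e) dn′ (back l e′)
   ; up-move = λ l dn e dn′ e′ → up-move V l dn (back (<⇒≤ l) e) dn′ (back l e′)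
   ; stay-move = λ l dn e dn′ e′ → stay-move V l dn (back l e) dn′ (back l e′) }
   where
   back : ∀ {b A c} → b ≤ n → ε b A ≡ c → δ b A ≡ c
   back {A = A} l e = trans (sym (f A l)) e
   forth : ∀ {b A} → b ≤ n → (∃ λ k → b ≡ suc k × D k A × δ k A ≡ up) ⊎ (D b A × δ b A ≡ stay) ⊎ (∃ λ B → A ≡ suc B × D b B × δ b B ≡ move) →
    (∃ λ k → b ≡ suc k × D k A × ε k A ≡ up) ⊎ (D b A × ε b A ≡ stay) ⊎ (∃ λ B → A ≡ suc B × D b B × ε b B ≡ move)
   forth {A = A} l (inj₁ (k , refl , dn , e)) = inj₁ (k , refl , dn , trans (f A (<⇒≤ l)) e)
   forth {A = A} l (inj₂ (inj₁ (dn , e))) = inj₂ (inj₁ (dn , trans (f A l) e))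
   forth l (inj₂ (inj₂ (B , refl , dn , e))) = inj₂ (inj₂ (B , refl , dn , trans (f B l) e))
  Valid-zero : ∀ {δ} → Valid 0 [] δ
  Valid-zero = record
   { enter⁻ = λ () ; enter⁺ = λ dn _ → ⊥-elim (¬D-zero dn) ; ups = λ () ; stays = λ { z≤n dn _ → ⊥-elim (¬D-zero dn) }
   ; moves = λ { z≤n dn _ → ⊥-elim (¬D-zero dn) } ; cover = λ { z≤n u → ⊥-elim (¬U-zero u) } ; up-stay = λ () ; up-move = λ ()
   ; stay-move = λ { z≤n dn _ → ⊥-elim (¬D-zero dn) } }
  -- Together with `complete` and `dirOf-wordOf` this makes words and matchings correspond one to
  -- one, so the length of the list of words is the number of matchings.
  sound : ∀ n P w → w ∈ paths n P → Below (ub n) P → All (D n) P → Valid n P (dirOf n w) × wordOf n P (dirOf n w) ≡ w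
  sound zero [] .[] (here refl) below dns = Valid-zero , refl
  sound zero (A ∷ P) w w∈ below (dn ∷ _) = ⊥-elim (¬D-zero dn)
  sound (suc k) P w w∈ below dns with find (∈-concatMap⁻ (continue k) {xs = steps (suc k) (ub (suc k)) P} w∈)
  ... | e , e∈ , w∈′ with continue⁻ k e w∈′
  ... | cl , w′ , refl , w′∈ with sound k (next k (map dst e)) w′ w′∈ (next-Below k _) (next-D k _)
  ... | V , word≡ = valid , cong₂ _∷_ mark≡ (trans (cong (λ e → wordOf k (next k (map dst e)) δ) mark≡) (trans (wordOf-cong k _ agree (next-D k _)) word≡))
   where
   δ : Directions
   δ = dirOf (suc k) (e ∷ w′)
   source : map proj₁ e ≡ P
   source = steps-source (suc k) (ub (suc k)) P e∈
   agree : Agree k δ (dirOf k w′)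
   agree b A l _ = dirOf-below k e w′ A l
   mark≡ : mark (δ (suc k)) P ≡ e
   mark≡ = trans (mark-cong P (λ {A} _ → dirOf-top k e w′ A))
    (trans (cong (mark (look e)) (sym source)) (mark-look e (subst (Below (ub (suc k))) (sym source) below)))
   absent : ∀ {A} → D (suc k) A → δ (suc k) A ≢ up → A ∈ P
   absent {A} _ n with A ∈? P
   ... | yes A∈ = A∈
   ... | no A∉ = ⊥-elim (n (trans (dirOf-top k e w′ A) (look-absent e A (λ A∈ → A∉ (subst (A ∈_) source A∈)))))
   valid : Valid (suc k) P δ
   valid = extend k P δ
    (λ {A} A∈ → All.lookup dns A∈ , λ eq → look-present e (subst (A ∈_) (sym source) A∈) (trans (sym (dirOf-top k e w′ A)) eq))
    absent
    (subst (_∈ steps (suc k) (ub (suc k)) P) (sym mark≡) e∈)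
    (subst (λ e → Closed k (map dst e)) (sym mark≡) cl)
    (subst (λ e → Valid k (next k (map dst e)) δ) (sym mark≡) (Valid-cong (λ A l → dirOf-below k e w′ A l) V))
  module _ (n : ℕ) where
   direction : Fin (length (paths n [])) → Directions
   direction i = dirOf n (lookup (paths n []) i)
   direction-valid : ∀ i → Valid n [] (direction i)
   direction-valid i = proj₁ (sound n [] (lookup (paths n []) i) (∈-lookup i) [] [])
   direction-injective : ∀ i j → Agree n (direction i) (direction j) → i ≡ j
   direction-injective i j f = lookup-injective (Unique-paths n []) i j
    (trans (sym (word i)) (trans (wordOf-cong n [] f []) (word j)))
    where
    word : ∀ i → wordOf n [] (direction i) ≡ lookup (paths n []) i
    word i = proj₂ (sound n [] (lookup (paths n []) i) (∈-lookup i) [] [])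
   direction-surjective : ∀ δ → Valid n [] δ → ∃ λ i → Agree n (direction i) δ
   direction-surjective δ V = index w∈ , subst (λ w → Agree n (dirOf n w) δ) (lookup-index w∈) (dirOf-wordOf n [] δ [] V)
    where
    w∈ : wordOf n [] δ ∈ paths n []
    w∈ = complete n [] δ [] V

-- The whole region in strip coordinates, its symmetries and its axes.

module Triples (y z a x : ℕ) where
 open import Data.Nat using (_≤_; _<_; _<?_; _∸_; _+_; _*_)
 open Farkas using (#_; _:+_; _:*_; _≼_; _≺_; _:=_; _⋠_; _⊀_; _&_; _⊢_; !_; ŷ; ẑ; â; x̂; t̂; d̂; m̂; L̂; ĉ; Ŵ; T̂; μ̂; ŝ; module Linear)
 open Linear y z a x using (linear; equal; refute)
 open Strips y z a x using (Clear; Down; L; Up; c₀; d; m; t)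

 -- Unlike `Up` and `Down`, these conditions make no choice of a chamber, and their invariance under
 -- permutations is visible.
 record Inside (p q r : ℕ) : Set where
  field
   far₁ : p + 2 * t < L
   far₂ : q + 2 * t < L
   far₃ : r + 2 * t < L
   core : ¬ (m ≤ p × m ≤ q × m ≤ r)
   sat₁ : ¬ (d ≤ p × c₀ ≤ q × c₀ ≤ r)
   sat₂ : ¬ (c₀ ≤ p × d ≤ q × c₀ ≤ r)
   sat₃ : ¬ (c₀ ≤ p × c₀ ≤ q × d ≤ r)
 open Inside

 Inside-rot : ∀ {p q r} → Inside p q r → Inside q r p
 Inside-rot i = record { far₁ = far₂ i ; far₂ = far₃ i ; far₃ = far₁ i ; core = λ (u , w , v) → core i (v , u , w)
  ; sat₁ = λ (u , w , v) → sat₂ i (v , u , w) ; sat₂ = λ (u , w , v) → sat₃ i (v , u , w) ; sat₃ = λ (u , w , v) → sat₁ i (v , u , w) }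

 Inside-swap : ∀ {p q r} → Inside p q r → Inside p r q
 Inside-swap i = record { far₁ = far₁ i ; far₂ = far₃ i ; far₃ = far₂ i ; core = λ (u , w , v) → core i (u , v , w)
  ; sat₁ = λ (u , w , v) → sat₁ i (u , v , w) ; sat₂ = λ (u , w , v) → sat₃ i (u , v , w) ; sat₃ = λ (u , w , v) → sat₂ i (u , v , w) }

 -- For sorted coordinates the strictest corner condition is the one on the largest, and the two
 -- satellites with `d` on a larger coordinate are implied by the first; `Inside⁻` is the converse.
 Inside⁺ : ∀ {A b c} → A ≤ b → b ≤ c → A < m → c + 2 * t < L → Clear b A → Inside A b c
 Inside⁺ {A} {b} {c} A≤b b≤c A<m far clear = record
  { far₁ = linear (A ∷ b ∷ c ∷ []) (! 0 ≼ ! 1 ∷ ! 1 ≼ ! 2 ∷ ! 2 :+ 2 :* t̂ ≺ L̂ ∷ [] ⊢ ! 0 :+ 2 :* t̂ ≺ L̂) (1 ∷ 1 ∷ 1 ∷ 1 ∷ []) (A≤b & b≤c & far) ; far₂ = linear (b ∷ c ∷ []) (! 0 ≼ ! 1 ∷ ! 1 :+ 2 :* t̂ ≺ L̂ ∷ [] ⊢ ! 0 :+ 2 :* t̂ ≺ L̂) (1 ∷ 1 ∷ 1 ∷ []) (b≤c & far) ; far₃ = far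
  ; core = λ (u , _) → refute (A ∷ []) (m̂ ≼ ! 0 ∷ ! 0 ≺ m̂ ∷ []) (1 ∷ 1 ∷ []) (u & A<m) ; sat₁ = λ (u , w , _) → no-sat u w
  ; sat₂ = λ (u , _ , _) → no-sat (linear (A ∷ []) (ĉ ≼ ! 0 ∷ [] ⊢ d̂ ≼ ! 0) (1 ∷ 1 ∷ []) u) (linear (A ∷ b ∷ []) (ĉ ≼ ! 0 ∷ ! 0 ≼ ! 1 ∷ [] ⊢ ĉ ≼ ! 1) (1 ∷ 1 ∷ 1 ∷ []) (u & A≤b)) ; sat₃ = λ (u , w , _) → no-sat (linear (A ∷ []) (ĉ ≼ ! 0 ∷ [] ⊢ d̂ ≼ ! 0) (1 ∷ 1 ∷ []) u) w }
  where
  blocked : Clear b A → d ≤ A → ¬ c₀ ≤ b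
  blocked (inj₁ l) u w = refute (b ∷ []) (! 0 ≺ ĉ ∷ ĉ ≼ ! 0 ∷ []) (1 ∷ 1 ∷ []) (l & w)
  blocked (inj₂ l) u w = refute (A ∷ []) (! 0 ≺ d̂ ∷ d̂ ≼ ! 0 ∷ []) (1 ∷ 1 ∷ []) (l & u)
  no-sat : d ≤ A → ¬ c₀ ≤ b
  no-sat = blocked clear

 Inside⁻ : ∀ {A b c} → A ≤ b → b ≤ c → Inside A b c → A < m × c + 2 * t < L × Clear b A
 Inside⁻ {A} {b} {c} A≤b b≤c i = A<m , far₃ i , clear
  where
  A<m : A < m
  A<m with A <? m
  ... | yes l = l
  ... | no ¬l = ⊥-elim (core i (linear (A ∷ []) (! 0 ⊀ m̂ ∷ [] ⊢ m̂ ≼ ! 0) (1 ∷ 1 ∷ []) ¬l , linear (A ∷ b ∷ []) (! 0 ⊀ m̂ ∷ ! 0 ≼ ! 1 ∷ [] ⊢ m̂ ≼ ! 1) (1 ∷ 1 ∷ 1 ∷ []) (¬l & A≤b) , linear (A ∷ b ∷ c ∷ []) (! 0 ⊀ m̂ ∷ ! 0 ≼ ! 1 ∷ ! 1 ≼ ! 2 ∷ [] ⊢ m̂ ≼ ! 2) (1 ∷ 1 ∷ 1 ∷ 1 ∷ []) (¬l & A≤b & b≤c)))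
  clear : Clear b A
  clear with b <? c₀ | A <? d
  ... | yes l | _ = inj₁ l
  ... | no _ | yes l = inj₂ l
  ... | no ¬l | no ¬l′ = ⊥-elim (sat₁ i (linear (A ∷ []) (! 0 ⊀ d̂ ∷ [] ⊢ d̂ ≼ ! 0) (1 ∷ 1 ∷ []) ¬l′ , linear (b ∷ []) (! 0 ⊀ ĉ ∷ [] ⊢ ĉ ≼ ! 0) (1 ∷ 1 ∷ []) ¬l , linear (b ∷ c ∷ []) (! 0 ⊀ ĉ ∷ ! 0 ≼ ! 1 ∷ [] ⊢ ĉ ≼ ! 1) (1 ∷ 1 ∷ 1 ∷ []) (¬l & b≤c)))

 DownT UpT : ℕ → ℕ → ℕ → Set
 DownT p q r = p + q + r + 2 ≡ L × Inside p q r
 UpT p q r = p + q + r + 1 ≡ L × Inside p q r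

 rot-sum : ∀ p q r → q + r + p ≡ p + q + r
 rot-sum p q r = equal (q ∷ r ∷ p ∷ []) [] (! 0 :+ ! 1 :+ ! 2) (! 2 :+ ! 0 :+ ! 1) (1 ∷ []) (1 ∷ []) _

 swap-sum : ∀ p q r → p + r + q ≡ p + q + r
 swap-sum p q r = equal (p ∷ r ∷ q ∷ []) [] (! 0 :+ ! 1 :+ ! 2) (! 0 :+ ! 2 :+ ! 1) (1 ∷ []) (1 ∷ []) _

 DownT-rot : ∀ {p q r} → DownT p q r → DownT q r p
 DownT-rot {p} {q} {r} (e , i) = trans (cong (_+ 2) (rot-sum p q r)) e , Inside-rot i

 DownT-swap : ∀ {p q r} → DownT p q r → DownT p r q
 DownT-swap {p} {q} {r} (e , i) = trans (cong (_+ 2) (swap-sum p q r)) e , Inside-swap i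

 UpT-rot : ∀ {p q r} → UpT p q r → UpT q r p
 UpT-rot {p} {q} {r} (e , i) = trans (cong (_+ 1) (rot-sum p q r)) e , Inside-rot i

 UpT-swap : ∀ {p q r} → UpT p q r → UpT p r q
 UpT-swap {p} {q} {r} (e , i) = trans (cong (_+ 1) (swap-sum p q r)) e , Inside-swap i

 Down⇒DownT : ∀ {b A c} → Down b A → A + b + c + 2 ≡ L → DownT A b c × b < c
 Down⇒DownT {b} {A} {c} (p , q , r , s , cl) e = (e , Inside⁺ (<⇒≤ p) (<⇒≤ b<c) q (linear (A ∷ b ∷ c ∷ []) (! 0 :+ ! 1 :+ ! 2 :+ # 2 := L̂ ∷ 2 :* t̂ ≼ # 1 :+ (! 0 :+ ! 1) ∷ [] ⊢ ! 2 :+ 2 :* t̂ ≺ L̂) (1 ∷ 1 ∷ 0 ∷ 1 ∷ []) (e & s)) cl) , b<c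
  where
  b<c : b < c
  b<c = linear (A ∷ b ∷ c ∷ []) (! 0 :+ ! 1 :+ ! 2 :+ # 2 := L̂ ∷ ! 0 :+ 2 :* ! 1 :+ # 3 ≼ L̂ ∷ [] ⊢ ! 1 ≺ ! 2) (1 ∷ 0 ∷ 1 ∷ 1 ∷ []) (e & r)

 DownT⇒Down : ∀ {b A c} → A < b → b < c → DownT A b c → Down b A
 DownT⇒Down {b} {A} {c} p b<c (e , i) with Inside⁻ (<⇒≤ p) (<⇒≤ b<c) i
 ... | q , far , cl = p , q , linear (A ∷ b ∷ c ∷ []) (! 0 :+ ! 1 :+ ! 2 :+ # 2 := L̂ ∷ ! 1 ≺ ! 2 ∷ [] ⊢ ! 0 :+ 2 :* ! 1 :+ # 3 ≼ L̂) (1 ∷ 1 ∷ 0 ∷ 1 ∷ []) (e & b<c) , linear (A ∷ b ∷ c ∷ []) (! 0 :+ ! 1 :+ ! 2 :+ # 2 := L̂ ∷ ! 2 :+ (# 1 :+ (ŷ :+ ẑ :+ (# 1 :+ (ŷ :+ ẑ :+ # 0)))) ≺ L̂ ∷ [] ⊢ ŷ :+ ẑ :+ (# 1 :+ (ŷ :+ ẑ :+ # 0)) ≺ # 1 :+ (! 0 :+ ! 1)) (1 ∷ 0 ∷ 1 ∷ 1 ∷ []) (e & far) , cl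

 Up⇒UpT : ∀ {b A c} → Up b A → A + b + c + 1 ≡ L → UpT A b c × b < c
 Up⇒UpT {b} {A} {c} (p , q , r , s , cl) e = (e , Inside⁺ (<⇒≤ p) (<⇒≤ b<c) q (linear (A ∷ b ∷ c ∷ []) (! 0 :+ ! 1 :+ ! 2 :+ # 1 := L̂ ∷ 2 :* t̂ ≼ ! 0 :+ ! 1 ∷ [] ⊢ ! 2 :+ 2 :* t̂ ≺ L̂) (1 ∷ 1 ∷ 0 ∷ 1 ∷ []) (e & s)) cl) , b<c
  where
  b<c : b < c
  b<c = linear (A ∷ b ∷ c ∷ []) (! 0 :+ ! 1 :+ ! 2 :+ # 1 := L̂ ∷ ! 0 :+ 2 :* ! 1 :+ # 2 ≼ L̂ ∷ [] ⊢ ! 1 ≺ ! 2) (1 ∷ 0 ∷ 1 ∷ 1 ∷ []) (e & r)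

 UpT⇒Up : ∀ {b A c} → A < b → b < c → UpT A b c → Up b A
 UpT⇒Up {b} {A} {c} p b<c (e , i) with Inside⁻ (<⇒≤ p) (<⇒≤ b<c) i
 ... | q , far , cl = p , q , linear (A ∷ b ∷ c ∷ []) (! 0 :+ ! 1 :+ ! 2 :+ # 1 := L̂ ∷ ! 1 ≺ ! 2 ∷ [] ⊢ ! 0 :+ 2 :* ! 1 :+ # 2 ≼ L̂) (1 ∷ 1 ∷ 0 ∷ 1 ∷ []) (e & b<c) , linear (A ∷ b ∷ c ∷ []) (! 0 :+ ! 1 :+ ! 2 :+ # 1 := L̂ ∷ ! 2 :+ (# 1 :+ (ŷ :+ ẑ :+ (# 1 :+ (ŷ :+ ẑ :+ # 0)))) ≺ L̂ ∷ [] ⊢ ŷ :+ ẑ :+ (# 1 :+ (ŷ :+ ẑ :+ # 0)) ≺ ! 0 :+ ! 1) (1 ∷ 0 ∷ 1 ∷ 1 ∷ []) (e & far) , cl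

 Exactly : Set → Set → Set → Set
 Exactly X Y Z = (X ⊎ Y ⊎ Z) × ¬ (X × Y) × ¬ (Y × Z) × ¬ (Z × X)

 Exactly-rot : ∀ {X Y Z} → Exactly X Y Z → Exactly Y Z X
 Exactly-rot (c , n₁ , n₂ , n₃) = turn c , n₂ , n₃ , n₁
  where
  turn : ∀ {X Y Z : Set} → X ⊎ Y ⊎ Z → Y ⊎ Z ⊎ X
  turn (inj₁ u) = inj₂ (inj₂ u)
  turn (inj₂ (inj₁ u)) = inj₁ u
  turn (inj₂ (inj₂ u)) = inj₂ (inj₁ u)

 Exactly-swap : ∀ {X Y Z X′ Y′ Z′ : Set} → (X → X′) → (Y → Y′) → (Z → Z′) → (X′ → X) → (Y′ → Y) → (Z′ → Z) → Exactly X Y Z → Exactly X′ Z′ Y′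
 Exactly-swap f g h f′ g′ h′ (c , n₁ , n₂ , n₃) = turn c , (λ (z , y) → n₃ (h′ y , f′ z)) , (λ (u , w) → n₂ (g′ w , h′ u)) , (λ (u , w) → n₁ (f′ w , g′ u))
  where
  turn : _ → _
  turn (inj₁ u) = inj₁ (f u)
  turn (inj₂ (inj₁ u)) = inj₂ (inj₂ (g u))
  turn (inj₂ (inj₂ u)) = inj₂ (inj₁ (h u))

 -- The device by which statements on the region are reduced to the closed chamber.
 sorted : (P : ℕ → ℕ → ℕ → Set) → (∀ {p q r} → P p q r → P q r p) → (∀ {p q r} → P p q r → P p r q) →
  (∀ {p q r} → p ≤ q → q ≤ r → P p q r) → ∀ p q r → P p q r
 sorted P rot sw s p q r with ≤-total p q | ≤-total q r | ≤-total p r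
 ... | inj₁ pq | inj₁ qr | _ = s pq qr
 ... | inj₁ pq | inj₂ rq | inj₁ pr = sw (s pr rq)
 ... | inj₁ pq | inj₂ rq | inj₂ rp = rot (s rp pq)
 ... | inj₂ qp | inj₁ qr | inj₁ pr = rot (rot (sw (s qp pr)))
 ... | inj₂ qp | inj₁ qr | inj₂ rp = rot (rot (s qr rp))
 ... | inj₂ qp | inj₂ rq | _ = rot (sw (s rq qp))

 -- M p q r: the down triangle (p, q, r) is matched with the up triangle (p + 1, q, r).
 Shifted : (ℕ → ℕ → ℕ → Set) → ℕ → ℕ → ℕ → Set
 Shifted M p q r = ∃ λ p′ → p ≡ suc p′ × M p′ q r

 -- A symmetric tiling in coordinates. Rotation invariance is part of the encoding: `M q r p` and
 -- `M r p q` say that the second and the third coordinate of the down triangle `(p, q, r)` is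
 -- raised. Reflection invariance is `M-swap`.
 record Matching (M : ℕ → ℕ → ℕ → Set) : Set where
  field
   M? : ∀ p q r → Dec (M p q r)
   M-swap : ∀ {p q r} → M p q r → M p r q
   M-down : ∀ {p q r} → M p q r → DownT p q r
   M-up : ∀ {p q r} → M p q r → UpT (suc p) q r
   down-once : ∀ {p q r} → DownT p q r → Exactly (M p q r) (M q r p) (M r p q)
   up-once : ∀ {p q r} → UpT p q r → Exactly (Shifted M p q r) (Shifted M q r p) (Shifted M r p q)
  shift-swap : ∀ {p q r} → Shifted M p q r → Shifted M p r q
  shift-swap (p′ , e , i) = p′ , e , M-swap i
  -- On an axis, the reflection would turn such a partner into a second one.
  down-axis : ∀ {p q} → ¬ M p p q
  down-axis i = proj₁ (proj₂ (down-once (M-down i))) (i , M-swap i)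
  up-axis : ∀ {p q} → UpT p p q → ¬ Shifted M p p q
  up-axis u i = proj₁ (proj₂ (up-once u)) (i , shift-swap i)

 module _ {M N : ℕ → ℕ → ℕ → Set} (μ : Matching M) (ν : Matching N) (M⊆N : ∀ {p q r} → M p q r → N p q r) where
  open Matching
  -- Every down triangle has exactly one partner in either matching, so an inclusion is an equality.
  Matching-⊇ : ∀ {p q r} → N p q r → M p q r
  Matching-⊇ {p} {q} {r} n with proj₁ (down-once μ (M-down ν n))
  ... | inj₁ i = i
  ... | inj₂ (inj₁ i) = ⊥-elim (proj₁ (proj₂ (down-once ν (M-down ν n))) (n , M⊆N i))
  ... | inj₂ (inj₂ i) = ⊥-elim (proj₂ (proj₂ (proj₂ (down-once ν (M-down ν n)))) (M⊆N i , n))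

 ½m : ℕ
 ½m = suc (z + y + a)

 -- The side `L` is even. A coordinate on an axis therefore cannot stop just short of an even
 -- threshold, which is used for the partners along the axis.
 even : ∀ {A b} → A + b + b + 2 ≡ L → ∃ λ e → A ≡ 2 * e
 even {A} {b} h = e , go e (m+[n∸m]≡n le)
  where
  le : suc b ≤ 3 * ½m + x
  le = linear (A ∷ b ∷ []) (! 0 :+ ! 1 :+ ! 1 :+ # 2 := L̂ ∷ [] ⊢ ! 1 ≺ 3 :* μ̂ :+ x̂) (2 ∷ 1 ∷ []) h
  e : ℕ
  e = 3 * ½m + x ∸ suc b
  go : ∀ e → suc b + e ≡ 3 * ½m + x → A ≡ 2 * e
  go e g = equal (b ∷ e ∷ A ∷ []) (# 1 :+ ! 0 :+ ! 1 := 3 :* μ̂ :+ x̂ ∷ ! 2 :+ ! 0 :+ ! 0 :+ # 2 := L̂ ∷ []) (! 2) (2 :* ! 1) (1 ∷ 0 ∷ 2 ∷ 1 ∷ []) (1 ∷ 2 ∷ 0 ∷ 0 ∷ 1 ∷ []) (g & h)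

 -- The triangles on the symmetry axes pair up: L, m, d and 2t are even.
 axis-down₁ : ∀ {A c} → A ≤ c → DownT A A c → UpT A A (suc c) × A < c
 axis-down₁ {A} {c} A≤c (e , i) with Inside⁻ ≤-refl A≤c i | even {c} {A} (equal (A ∷ c ∷ []) (! 0 :+ ! 0 :+ ! 1 :+ # 2 := L̂ ∷ []) (! 1 :+ ! 0 :+ ! 0 :+ # 2) L̂ (1 ∷ 1 ∷ []) (1 ∷ 0 ∷ 1 ∷ []) e)
 ... | q , far , cl | h , f = (equal (A ∷ c ∷ []) (! 0 :+ ! 0 :+ ! 1 :+ # 2 := L̂ ∷ []) (! 0 :+ ! 0 :+ (# 1 :+ ! 1) :+ # 1) L̂ (1 ∷ 1 ∷ []) (1 ∷ 0 ∷ 1 ∷ []) e , Inside⁺ ≤-refl (m≤n⇒m≤1+n A≤c) q (linear (h ∷ c ∷ []) (! 0 :+ t̂ ≺ 3 :* μ̂ :+ x̂ ∷ ! 1 := 2 :* ! 0 ∷ [] ⊢ # 1 :+ ! 1 :+ 2 :* t̂ ≺ L̂) (1 ∷ 2 ∷ 1 ∷ []) (step & f)) cl) , linear (A ∷ c ∷ []) (! 0 :+ ! 0 :+ ! 1 :+ # 2 := L̂ ∷ ! 0 ≺ m̂ ∷ [] ⊢ ! 0 ≺ ! 1) (1 ∷ 0 ∷ 1 ∷ 3 ∷ []) (e & q)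
  where
  step : h + t < 3 * ½m + x
  step = linear (c ∷ h ∷ []) (! 0 :+ (# 1 :+ (ŷ :+ ẑ :+ (# 1 :+ (ŷ :+ ẑ :+ # 0)))) ≺ L̂ ∷ ! 0 := 2 :* ! 1 ∷ [] ⊢ ! 1 :+ t̂ ≺ 3 :* μ̂ :+ x̂) (2 ∷ 1 ∷ 0 ∷ 1 ∷ []) (far & f)

 axis-down₂ : ∀ {A b} → A < b → DownT A b b → UpT (suc A) b b
 axis-down₂ {A} {b} A<b (e , i) with Inside⁻ (<⇒≤ A<b) ≤-refl i | even {A} {b} e
 ... | q , far , cl | h , f = equal (A ∷ b ∷ []) (! 0 :+ ! 1 :+ ! 1 :+ # 2 := L̂ ∷ []) (# 1 :+ (! 0 :+ ! 1 :+ ! 1 :+ # 1)) L̂ (1 ∷ 1 ∷ []) (1 ∷ 0 ∷ 1 ∷ []) e , Inside⁺ A<b ≤-refl (linear (h ∷ A ∷ []) (! 0 ≺ μ̂ ∷ ! 1 := 2 :* ! 0 ∷ [] ⊢ # 1 :+ ! 1 ≺ m̂) (1 ∷ 2 ∷ 1 ∷ []) (step & f)) far (clear cl)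
  where
  step : h < ½m
  step = linear (A ∷ h ∷ []) (! 0 ≺ m̂ ∷ ! 0 := 2 :* ! 1 ∷ [] ⊢ ! 1 ≺ μ̂) (2 ∷ 1 ∷ 0 ∷ 1 ∷ []) (q & f)
  clear : Clear b A → Clear b (suc A)
  clear (inj₁ l) = inj₁ l
  clear (inj₂ l) = inj₂ (linear (h ∷ A ∷ []) (! 0 ≺ # 1 :+ ẑ ∷ ! 1 := 2 :* ! 0 ∷ [] ⊢ # 1 :+ ! 1 ≺ d̂) (1 ∷ 2 ∷ 1 ∷ []) (small & f))
   where
   small : h < suc z
   small = linear (A ∷ h ∷ []) (! 0 ≺ d̂ ∷ ! 0 := 2 :* ! 1 ∷ [] ⊢ ! 1 ≺ # 1 :+ ẑ) (2 ∷ 1 ∷ 0 ∷ 1 ∷ []) (l & f)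

 axis-up₁ : ∀ {A c} → A ≤ c → UpT A A c → ∃ λ c′ → c ≡ suc c′ × DownT A A c′ × A < c′
 axis-up₁ {A} {zero} A≤c (e , i) with Inside⁻ ≤-refl A≤c i
 ... | q , _ = (refute (A ∷ []) (! 0 :+ ! 0 :+ # 0 :+ # 1 := L̂ ∷ ! 0 ≺ m̂ ∷ ! 0 ≼ # 0 ∷ []) (0 ∷ 1 ∷ 3 ∷ []) (e & q & A≤c))
 axis-up₁ {A} {suc c} A≤c (e , i) with Inside⁻ ≤-refl A≤c i
 ... | q , far , cl = c , refl , (equal (A ∷ c ∷ []) (! 0 :+ ! 0 :+ (# 1 :+ ! 1) :+ # 1 := L̂ ∷ []) (! 0 :+ ! 0 :+ ! 1 :+ # 2) L̂ (1 ∷ 1 ∷ []) (1 ∷ 0 ∷ 1 ∷ []) e , Inside⁺ ≤-refl (<⇒≤ A<c) q (linear (c ∷ []) (# 1 :+ (! 0 :+ (# 1 :+ (ŷ :+ ẑ :+ (# 1 :+ (ŷ :+ ẑ :+ # 0))))) ≺ L̂ ∷ [] ⊢ ! 0 :+ 2 :* t̂ ≺ L̂) (1 ∷ 1 ∷ []) far) cl) , A<c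
  where
  A<c : A < c
  A<c = linear (A ∷ c ∷ []) (! 0 :+ ! 0 :+ (# 1 :+ ! 1) :+ # 1 := L̂ ∷ ! 0 ≺ m̂ ∷ [] ⊢ ! 0 ≺ ! 1) (1 ∷ 0 ∷ 1 ∷ 3 ∷ []) (e & q)

 axis-up₂ : ∀ {A b} → A < b → UpT A b b → ∃ λ A′ → A ≡ suc A′ × DownT A′ b b
 axis-up₂ {zero} {suc b} A<b (e , i) = ⊥-elim (odd (even {1} {b} (equal (b ∷ []) (# 0 :+ (# 1 :+ ! 0) :+ (# 1 :+ ! 0) :+ # 1 := L̂ ∷ []) (# 1 :+ ! 0 :+ ! 0 :+ # 2) L̂ (1 ∷ 1 ∷ []) (1 ∷ 0 ∷ 1 ∷ []) e)))
  where
  odd : ¬ ∃ λ h → 1 ≡ 2 * h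
  odd (zero , ())
  odd (suc h , f) = refute (h ∷ []) (# 1 := 2 :* (# 1 :+ ! 0) ∷ []) (0 ∷ 1 ∷ []) f
 axis-up₂ {suc A} {b} A<b (e , i) with Inside⁻ (<⇒≤ A<b) ≤-refl i
 ... | q , far , cl = A , refl , equal (A ∷ b ∷ []) (# 1 :+ (! 0 :+ ! 1 :+ ! 1 :+ # 1) := L̂ ∷ []) (! 0 :+ ! 1 :+ ! 1 :+ # 2) L̂ (1 ∷ 1 ∷ []) (1 ∷ 0 ∷ 1 ∷ []) e , Inside⁺ (linear (A ∷ b ∷ []) (# 1 :+ ! 0 ≺ ! 1 ∷ [] ⊢ ! 0 ≼ ! 1) (1 ∷ 1 ∷ []) A<b) ≤-refl (linear (A ∷ []) (# 1 :+ ! 0 ≺ m̂ ∷ [] ⊢ ! 0 ≺ m̂) (1 ∷ 1 ∷ []) q) far (clear cl)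
  where
  clear : Clear b (suc A) → Clear b A
  clear (inj₁ l) = inj₁ l
  clear (inj₂ l) = inj₂ (linear (A ∷ []) (# 1 :+ ! 0 ≺ d̂ ∷ [] ⊢ ! 0 ≺ d̂) (1 ∷ 1 ∷ []) l)

 centre-down : ∀ {A} → ¬ DownT A A A
 centre-down {A} u = <-irrefl refl (proj₂ (axis-down₁ ≤-refl u))

 centre-up : ∀ {A} → ¬ UpT A A A
 centre-up {A} u with axis-up₁ ≤-refl u
 ... | c , e , _ , l = refute (A ∷ c ∷ []) (! 0 := # 1 :+ ! 1 ∷ ! 0 ≺ ! 1 ∷ []) (0 ∷ 1 ∷ 1 ∷ []) (e & l)

-- From directions on the chamber to a symmetric matching of the region.

module DirectedMatchings (y z a x : ℕ) where
 open import Data.Nat using (_≤_; _<_; _≤?_; _<?_; _∸_; _+_)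
 open import Data.Sum using (swap)
 open Farkas using (#_; _:+_; _:*_; _≼_; _≺_; _:=_; _⋠_; _⊀_; _&_; _⊢_; !_; ŷ; ẑ; â; x̂; t̂; d̂; m̂; L̂; ĉ; Ŵ; T̂; μ̂; ŝ; module Linear)
 open Linear y z a x using (linear; equal; refute)
 open DirectionWords
 open Strips y z a x using (Down; Down-ub; Down?; L; Up; Up-ub; Up?; d; ub; top)
 open Triples y z a x

 ¬Up-zero : ∀ A → ¬ Up 0 A
 ¬Up-zero A (() , _)

 ¬Down-zero : ∀ A → ¬ Down 0 A
 ¬Down-zero A (() , _)

 Up-bound : ∀ b A → Up b A → A < ub b
 Up-bound b A = Up-ub {b} {A}

 Down-bound : ∀ b A → Down b A → A < ub b
 Down-bound b A = Down-ub {b} {A}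

 open Words Up Down Up? Down? ub Up-bound Down-bound ¬Up-zero ¬Down-zero public

 Up-top : ∀ {b A} → Up b A → b ≤ top
 Up-top {b} {A} (_ , _ , r , _) = linear (A ∷ b ∷ []) (! 0 :+ 2 :* ! 1 :+ # 2 ≼ L̂ ∷ [] ⊢ ! 1 ≼ m̂ :+ (x̂ :+ (ŷ :+ (â :+ ẑ)))) (2 ∷ 1 ∷ []) r

 Down-top : ∀ {b A} → Down b A → b < top
 Down-top {b} {A} (_ , _ , r , _) = linear (A ∷ b ∷ []) (! 0 :+ 2 :* ! 1 :+ # 3 ≼ L̂ ∷ [] ⊢ ! 1 ≺ m̂ :+ (x̂ :+ (ŷ :+ (â :+ ẑ)))) (2 ∷ 1 ∷ []) r

 thirdᵈ : ∀ {b A} → Down b A → ∃ λ c → A + b + c + 2 ≡ L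
 thirdᵈ {b} {A} (_ , _ , r , _) = L ∸ (A + b + 2) , go (L ∸ (A + b + 2)) (m+[n∸m]≡n {A + b + 2} (linear (A ∷ b ∷ []) (! 0 :+ 2 :* ! 1 :+ # 3 ≼ L̂ ∷ [] ⊢ ! 0 :+ ! 1 :+ # 2 ≼ L̂) (1 ∷ 1 ∷ []) r))
  where
  go : ∀ c → A + b + 2 + c ≡ L → A + b + c + 2 ≡ L
  go c e = equal (A ∷ b ∷ c ∷ []) (! 0 :+ ! 1 :+ # 2 :+ ! 2 := L̂ ∷ []) (! 0 :+ ! 1 :+ ! 2 :+ # 2) L̂ (1 ∷ 1 ∷ []) (1 ∷ 0 ∷ 1 ∷ []) e

 thirdᵘ : ∀ {b A} → Up b A → ∃ λ c → A + b + c + 1 ≡ L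
 thirdᵘ {b} {A} (_ , _ , r , _) = L ∸ (A + b + 1) , go (L ∸ (A + b + 1)) (m+[n∸m]≡n {A + b + 1} (linear (A ∷ b ∷ []) (! 0 :+ 2 :* ! 1 :+ # 2 ≼ L̂ ∷ [] ⊢ ! 0 :+ ! 1 :+ # 1 ≼ L̂) (1 ∷ 1 ∷ []) r))
  where
  go : ∀ c → A + b + 1 + c ≡ L → A + b + c + 1 ≡ L
  go c e = equal (A ∷ b ∷ c ∷ []) (! 0 :+ ! 1 :+ # 1 :+ ! 2 := L̂ ∷ []) (! 0 :+ ! 1 :+ ! 2 :+ # 1) L̂ (1 ∷ 1 ∷ []) (1 ∷ 0 ∷ 1 ∷ []) e

 module FromDirections (δ : Directions) where
  -- For the down triangle with coordinates `v`, `p`, `q`, the coordinate `v` is raised. The rank of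
  -- `v` among the three selects the direction to consult; if the other two agree, the triangle is
  -- on an axis and its partner is forced.
  data Inc′ (v p q : ℕ) : Set where
   low : v < p → p < q → δ p v ≡ move → Inc′ v p q
   axis : p ≡ q → v ≢ p → Inc′ v p q
   high : p < q → q < v → δ q p ≡ stay → Inc′ v p q
   mid : p < v → v < q → δ v p ≡ up → Inc′ v p q
  inc′? : ∀ v p q → Dec (Inc′ v p q)
  inc′? v p q = map′ to from
   (((v <? p) ×-dec (p <? q) ×-dec (δ p v ≟ᵈ move)) ⊎-dec ((p NP.≟ q) ×-dec ¬? (v NP.≟ p)) ⊎-dec
    ((p <? q) ×-dec (q <? v) ×-dec (δ q p ≟ᵈ stay)) ⊎-dec ((p <? v) ×-dec (v <? q) ×-dec (δ v p ≟ᵈ up)))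
   where
   to : _ → Inc′ v p q
   to (inj₁ (l , l′ , e)) = low l l′ e
   to (inj₂ (inj₁ (e , n))) = axis e n
   to (inj₂ (inj₂ (inj₁ (l , l′ , e)))) = high l l′ e
   to (inj₂ (inj₂ (inj₂ (l , l′ , e)))) = mid l l′ e
   from : Inc′ v p q → _
   from (low l l′ e) = inj₁ (l , l′ , e)
   from (axis e n) = inj₂ (inj₁ (e , n))
   from (high l l′ e) = inj₂ (inj₂ (inj₁ (l , l′ , e)))
   from (mid l l′ e) = inj₂ (inj₂ (inj₂ (l , l′ , e)))
  Inc : ℕ → ℕ → ℕ → Set
  Inc v p q = Inc′ v p q ⊎ Inc′ v q p
  inc-low : ∀ {v p q} → v < p → p < q → Inc v p q → δ p v ≡ move
  inc-low u w (inj₁ (low _ _ e)) = e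
  inc-low u w (inj₁ (axis refl _)) = ⊥-elim (<-irrefl refl w)
  inc-low u w (inj₁ (high _ l _)) = ⊥-elim (<-asym l (<-trans u w))
  inc-low u w (inj₁ (mid l _ _)) = ⊥-elim (<-asym l u)
  inc-low u w (inj₂ (low _ l _)) = ⊥-elim (<-asym l w)
  inc-low u w (inj₂ (axis refl _)) = ⊥-elim (<-irrefl refl w)
  inc-low u w (inj₂ (high l _ _)) = ⊥-elim (<-asym l w)
  inc-low u w (inj₂ (mid l _ _)) = ⊥-elim (<-asym l (<-trans u w))
  inc-high : ∀ {v p q} → p < q → q < v → Inc v p q → δ q p ≡ stay
  inc-high u w (inj₁ (high _ _ e)) = e
  inc-high u w (inj₁ (axis refl _)) = ⊥-elim (<-irrefl refl u)
  inc-high u w (inj₁ (low l _ _)) = ⊥-elim (<-asym l (<-trans u w))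
  inc-high u w (inj₁ (mid _ l _)) = ⊥-elim (<-asym l w)
  inc-high u w (inj₂ (low _ l _)) = ⊥-elim (<-asym l u)
  inc-high u w (inj₂ (axis refl _)) = ⊥-elim (<-irrefl refl u)
  inc-high u w (inj₂ (high l _ _)) = ⊥-elim (<-asym l u)
  inc-high u w (inj₂ (mid _ l _)) = ⊥-elim (<-asym l (<-trans u w))
  inc-mid : ∀ {v p q} → p < v → v < q → Inc v p q → δ v p ≡ up
  inc-mid u w (inj₁ (mid _ _ e)) = e
  inc-mid u w (inj₁ (axis refl _)) = ⊥-elim (<-asym u w)
  inc-mid u w (inj₁ (low l _ _)) = ⊥-elim (<-asym l u)
  inc-mid u w (inj₁ (high _ l _)) = ⊥-elim (<-asym l w)
  inc-mid u w (inj₂ (mid l _ _)) = ⊥-elim (<-asym l w)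
  inc-mid u w (inj₂ (axis refl _)) = ⊥-elim (<-asym u w)
  inc-mid u w (inj₂ (low _ l _)) = ⊥-elim (<-asym l (<-trans u w))
  inc-mid u w (inj₂ (high l _ _)) = ⊥-elim (<-asym l (<-trans u w))
  ¬inc′ : ∀ {v q} → v ≢ q → ¬ Inc′ v v q
  ¬inc′ n (low l _ _) = <-irrefl refl l
  ¬inc′ n (axis e _) = n e
  ¬inc′ n (high l l′ _) = <-asym l l′
  ¬inc′ n (mid l _ _) = <-irrefl refl l
  ¬inc″ : ∀ {v q} → v ≢ q → ¬ Inc′ v q v
  ¬inc″ n (low l l′ _) = <-asym l l′
  ¬inc″ n (axis e _) = n (sym e)
  ¬inc″ n (high _ l _) = <-irrefl refl l
  ¬inc″ n (mid _ l _) = <-irrefl refl l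
  ¬inc : ∀ {v q} → v ≢ q → ¬ Inc v v q
  ¬inc n (inj₁ i) = ¬inc′ n i
  ¬inc n (inj₂ i) = ¬inc″ n i
  M : ℕ → ℕ → ℕ → Set
  M p q r = DownT p q r × UpT (suc p) q r × Inc p q r
  M-sym : ∀ {p q r} → M p q r → M p r q
  M-sym (d , u , i) = DownT-swap d , UpT-swap u , swap i
  inside? : ∀ p q r → Dec (Inside p q r)
  inside? p q r = map′
   (λ (f₁ , f₂ , f₃ , c , s₁ , s₂ , s₃) → record { far₁ = f₁ ; far₂ = f₂ ; far₃ = f₃ ; core = c ; sat₁ = s₁ ; sat₂ = s₂ ; sat₃ = s₃ })
   (λ i → let open Inside i in far₁ , far₂ , far₃ , core , sat₁ , sat₂ , sat₃)
   ((_ <? _) ×-dec (_ <? _) ×-dec (_ <? _) ×-dec ¬? ((_ ≤? _) ×-dec (_ ≤? _) ×-dec (_ ≤? _)) ×-dec ¬? ((_ ≤? _) ×-dec (_ ≤? _) ×-dec (_ ≤? _))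
    ×-dec ¬? ((_ ≤? _) ×-dec (_ ≤? _) ×-dec (_ ≤? _)) ×-dec ¬? ((_ ≤? _) ×-dec (_ ≤? _) ×-dec (_ ≤? _)))
  M-dec : ∀ p q r → Dec (M p q r)
  M-dec p q r = ((p + q + r + 2 NP.≟ L) ×-dec inside? p q r) ×-dec ((suc p + q + r + 1 NP.≟ L) ×-dec inside? (suc p) q r)
   ×-dec (inc′? p q r ⊎-dec inc′? p r q)
  only₁ : ∀ {X Y Z : Set} → X → ¬ Y → ¬ Z → Exactly X Y Z
  only₁ u n n′ = inj₁ u , (λ (_ , w) → n w) , (λ (w , _) → n w) , (λ (w , _) → n′ w)
  only₂ : ∀ {X Y Z : Set} → Y → ¬ Z → ¬ X → Exactly X Y Z
  only₂ u n n′ = Exactly-rot (Exactly-rot (only₁ u n n′))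
  only₃ : ∀ {X Y Z : Set} → Z → ¬ X → ¬ Y → Exactly X Y Z
  only₃ u n n′ = Exactly-rot (only₁ u n n′)
  module _ (V : Valid top [] δ) where
   open Valid V
   module Strict {A b c : ℕ} (A<b : A < b) (b<c : b < c) where
    A<c : A < c
    A<c = <-trans A<b b<c
    down-once-strict : DownT A b c → Exactly (M A b c) (M b c A) (M c A b)
    down-once-strict dn@(s , _) = go (δ b A) refl
     where
     D₀ : Down b A
     D₀ = DownT⇒Down A<b b<c dn
     low-e : M A b c → δ b A ≡ move
     low-e (_ , _ , i) = inc-low A<b b<c i
     mid-e : M b c A → δ b A ≡ up
     mid-e (_ , _ , i) = inc-mid A<b b<c (swap i)
     high-e : M c A b → δ b A ≡ stay
     high-e (_ , _ , i) = inc-high A<b b<c i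
     differ : ∀ {ε ε′} → ε ≢ ε′ → δ b A ≡ ε → δ b A ≡ ε′ → ⊥
     differ n e e′ = n (trans (sym e) e′)
     go : ∀ ε → δ b A ≡ ε → Exactly (M A b c) (M b c A) (M c A b)
     go up e = only₂ (DownT-rot dn , UpT-rot (proj₁ (Up⇒UpT (ups (Down-top D₀) D₀ e) (trans (shift A b c) s))) , inj₂ (mid A<b b<c e))
      (λ i → differ (λ ()) e (high-e i)) (λ i → differ (λ ()) e (low-e i))
      where
      shift : ∀ A b c → A + suc b + c + 1 ≡ A + b + c + 2
      shift A b c = equal (A ∷ b ∷ c ∷ []) [] (! 0 :+ (# 1 :+ ! 1) :+ ! 2 :+ # 1) (! 0 :+ ! 1 :+ ! 2 :+ # 2) (1 ∷ []) (1 ∷ []) _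
     go stay e = only₃ (DownT-rot (DownT-rot dn) , UpT-rot (UpT-rot (proj₁ (Up⇒UpT (stays (<⇒≤ (Down-top D₀)) D₀ e) (trans (shift A b c) s)))) , inj₁ (high A<b b<c e))
      (λ i → differ (λ ()) e (low-e i)) (λ i → differ (λ ()) e (mid-e i))
      where
      shift : ∀ A b c → A + b + suc c + 1 ≡ A + b + c + 2
      shift A b c = equal (A ∷ b ∷ c ∷ []) [] (! 0 :+ ! 1 :+ (# 1 :+ ! 2) :+ # 1) (! 0 :+ ! 1 :+ ! 2 :+ # 2) (1 ∷ []) (1 ∷ []) _
     go move e = only₁ (dn , proj₁ (Up⇒UpT (moves (<⇒≤ (Down-top D₀)) D₀ e) (trans (shift A b c) s)) , inj₁ (low A<b b<c e))
      (λ i → differ (λ ()) e (mid-e i)) (λ i → differ (λ ()) e (high-e i))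
      where
      shift : ∀ A b c → suc A + b + c + 1 ≡ A + b + c + 2
      shift A b c = equal (A ∷ b ∷ c ∷ []) [] (# 1 :+ ! 0 :+ ! 1 :+ ! 2 :+ # 1) (! 0 :+ ! 1 :+ ! 2 :+ # 2) (1 ∷ []) (1 ∷ []) _
    low⁻ : Shifted M A b c → ∃ λ B → A ≡ suc B × Down b B × δ b B ≡ move
    low⁻ (B , e , dn , _ , i) = B , e , DownT⇒Down B<b b<c dn , inc-low B<b b<c i
     where
     B<b : B < b
     B<b = <-trans (subst (B <_) (sym e) ≤-refl) A<b
    mid⁻ : Shifted M b c A → ∃ λ k → b ≡ suc k × Down k A × δ k A ≡ up
    mid⁻ (k , refl , dn , _ , i) with m≤n⇒m<n∨m≡n (≤-pred A<b)
    ... | inj₁ l = k , refl , DownT⇒Down l (<⇒≤ b<c) (DownT-rot (DownT-rot dn)) , inc-mid l (<⇒≤ b<c) (swap i)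
    ... | inj₂ refl = ⊥-elim (¬inc (<⇒≢ A<c) (swap i))
    high⁻ : Shifted M c A b → Down b A × δ b A ≡ stay
    high⁻ (c′ , refl , dn , _ , i) with m≤n⇒m<n∨m≡n (≤-pred b<c)
    ... | inj₁ l = DownT⇒Down A<b l (DownT-rot dn) , inc-high A<b l i
    ... | inj₂ refl = ⊥-elim (¬inc (λ e → <⇒≢ A<b (sym e)) (swap i))
    up-once-strict : UpT A b c → Exactly (Shifted M A b c) (Shifted M b c A) (Shifted M c A b)
    up-once-strict u@(s , _) = found (cover (Up-top U₀) U₀) , low-mid , mid-high , high-low
     where
     U₀ : Up b A
     U₀ = UpT⇒Up A<b b<c u
     low-mid : ¬ (Shifted M A b c × Shifted M b c A)
     low-mid (i , j) with low⁻ i | mid⁻ j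
     ... | B , refl , dB , eB | k , refl , dk , ek = up-move (Up-top U₀) dk ek dB eB
     mid-high : ¬ (Shifted M b c A × Shifted M c A b)
     mid-high (i , j) with mid⁻ i | high⁻ j
     ... | k , refl , dk , ek | dA , eA = up-stay (Up-top U₀) dk ek dA eA
     high-low : ¬ (Shifted M c A b × Shifted M A b c)
     high-low (i , j) with high⁻ i | low⁻ j
     ... | dA , eA | B , refl , dB , eB = stay-move (Up-top U₀) dA eA dB eB
     found : (∃ λ k → b ≡ suc k × Down k A × δ k A ≡ up) ⊎ (Down b A × δ b A ≡ stay) ⊎ (∃ λ B → A ≡ suc B × Down b B × δ b B ≡ move) →
      Shifted M A b c ⊎ Shifted M b c A ⊎ Shifted M c A b
     found (inj₁ (k , refl , dk , e)) = inj₂ (inj₁ (k , refl , DownT-rot dn , UpT-rot u , inj₂ (mid (proj₁ dk) (<⇒≤ b<c) e)))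
      where
      dn : DownT A k c
      dn = proj₁ (Down⇒DownT {c = c} dk (equal (A ∷ k ∷ c ∷ []) (! 0 :+ (# 1 :+ ! 1) :+ ! 2 :+ # 1 := L̂ ∷ []) (! 0 :+ ! 1 :+ ! 2 :+ # 2) L̂ (1 ∷ 1 ∷ []) (1 ∷ 0 ∷ 1 ∷ []) s))
     found (inj₂ (inj₁ (dA , e))) = inj₂ (inj₂ (third c b<c u))
      where
      third : ∀ c → b < c → UpT A b c → Shifted M c A b
      third (suc c) _ u@(s , _) = let (dn , b<c) = Down⇒DownT {c = c} dA (equal (A ∷ b ∷ c ∷ []) (! 0 :+ ! 1 :+ (# 1 :+ ! 2) :+ # 1 := L̂ ∷ []) (! 0 :+ ! 1 :+ ! 2 :+ # 2) L̂ (1 ∷ 1 ∷ []) (1 ∷ 0 ∷ 1 ∷ []) s) in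
       c , refl , DownT-rot (DownT-rot dn) , UpT-rot (UpT-rot u) , inj₁ (high A<b b<c e)
     found (inj₂ (inj₂ (B , refl , dB , e))) = inj₁ (B , refl , proj₁ (Down⇒DownT {c = c} dB (equal (B ∷ b ∷ c ∷ []) (# 1 :+ ! 0 :+ ! 1 :+ ! 2 :+ # 1 := L̂ ∷ []) (! 0 :+ ! 1 :+ ! 2 :+ # 2) L̂ (1 ∷ 1 ∷ []) (1 ∷ 0 ∷ 1 ∷ []) s)) , u , inj₁ (low (proj₁ dB) b<c e))
   -- Inside the chamber the direction decides. On a wall the only possible partner is along the
   -- axis, and it exists by parity; at the centre there is no triangle.
   down-once-sorted : ∀ {A b c} → A ≤ b → b ≤ c → DownT A b c → Exactly (M A b c) (M b c A) (M c A b)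
   down-once-sorted A≤b b≤c dn with m≤n⇒m<n∨m≡n A≤b | m≤n⇒m<n∨m≡n b≤c
   ... | inj₁ A<b | inj₁ b<c = Strict.down-once-strict A<b b<c dn
   ... | inj₂ refl | inj₂ refl = ⊥-elim (centre-down dn)
   ... | inj₂ refl | inj₁ A<c = let (u , _) = axis-down₁ b≤c dn in
    only₃ (DownT-rot (DownT-rot dn) , UpT-rot (UpT-rot u) , inj₁ (axis refl (λ e → <⇒≢ A<c (sym e))))
     (λ (_ , _ , i) → ¬inc (<⇒≢ A<c) i) (λ (_ , _ , i) → ¬inc (<⇒≢ A<c) (swap i))
   ... | inj₁ A<b | inj₂ refl = only₁ (dn , axis-down₂ A<b dn , inj₁ (axis refl (<⇒≢ A<b)))
     (λ (_ , _ , i) → ¬inc (λ e → <⇒≢ A<b (sym e)) i) (λ (_ , _ , i) → ¬inc (λ e → <⇒≢ A<b (sym e)) (swap i))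
   shift-sym : ∀ {p q r} → Shifted M p q r → Shifted M p r q
   shift-sym (p′ , e , i) = p′ , e , M-sym i
   up-once-sorted : ∀ {A b c} → A ≤ b → b ≤ c → UpT A b c → Exactly (Shifted M A b c) (Shifted M b c A) (Shifted M c A b)
   up-once-sorted A≤b b≤c u with m≤n⇒m<n∨m≡n A≤b | m≤n⇒m<n∨m≡n b≤c
   ... | inj₁ A<b | inj₁ b<c = Strict.up-once-strict A<b b<c u
   ... | inj₂ refl | inj₂ refl = ⊥-elim (centre-up u)
   up-once-sorted {A} A≤b b≤c u | inj₂ refl | inj₁ A<c with axis-up₁ b≤c u
   ... | c′ , refl , dn , A<c′ = only₃ (c′ , refl , DownT-rot (DownT-rot dn) , UpT-rot (UpT-rot u) , inj₁ (axis refl (λ e → <⇒≢ A<c′ (sym e))))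
     no-low (λ i → no-low (shift-sym i))
    where
    -- A `move` that ends on the axis is excluded by `moves`, because `Up` contains no triangle with
    -- `A = b`.
    no-low : ¬ Shifted M A A (suc c′)
    no-low (B , refl , dn , _ , i) = <-irrefl refl (proj₁ (moves (<⇒≤ (Down-top D₀)) D₀ (inc-low ≤-refl A<c i)))
     where
     D₀ : Down (suc B) B
     D₀ = DownT⇒Down ≤-refl A<c dn
   up-once-sorted {A} {b} A≤b b≤c u@(s , _) | inj₁ A<b | inj₂ refl with axis-up₂ A<b u
   ... | A′ , e , dn = only₁ (A′ , e , dn , subst (λ A → UpT A b b) e u , inj₁ (axis refl (<⇒≢ (<-trans (subst (A′ <_) (sym e) ≤-refl) A<b))))
     no-high (λ i → no-high (shift-sym i))
    where
    no-high : ¬ Shifted M b b A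
    no-high (k , refl , dn , _ , i) with m≤n⇒m<n∨m≡n (≤-pred A<b)
    ... | inj₂ refl = ¬inc (λ e → <⇒≢ A<b e) (swap i)
    ... | inj₁ l = clash (ups (Down-top D₀) D₀ (inc-mid l ≤-refl (swap i)))
     where
     D₀ : Down k A
     D₀ = DownT⇒Down l ≤-refl (DownT-rot (DownT-rot dn))
     clash : ¬ Up (suc k) A
     clash (_ , _ , r , _) = refute (A ∷ k ∷ []) (! 0 :+ 2 :* (# 1 :+ ! 1) :+ # 2 ≼ L̂ ∷ ! 0 :+ (# 1 :+ ! 1) :+ (# 1 :+ ! 1) :+ # 1 := L̂ ∷ []) (1 ∷ 0 ∷ 1 ∷ []) (r & s)
   matching : Matching M
   matching = record
    { M? = M-dec ; M-swap = M-sym ; M-down = proj₁ ; M-up = λ (_ , u , _) → u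
    ; down-once = λ {p} {q} {r} → sorted (λ p q r → DownT p q r → Exactly (M p q r) (M q r p) (M r p q))
      (λ f dn → Exactly-rot (f (DownT-rot (DownT-rot dn))))
      (λ f dn → Exactly-swap M-sym M-sym M-sym M-sym M-sym M-sym (f (DownT-swap dn))) down-once-sorted p q r
    ; up-once = λ {p} {q} {r} → sorted (λ p q r → UpT p q r → Exactly (Shifted M p q r) (Shifted M q r p) (Shifted M r p q))
      (λ f u → Exactly-rot (f (UpT-rot (UpT-rot u))))
      (λ f u → Exactly-swap shift-sym shift-sym shift-sym shift-sym shift-sym shift-sym (f (UpT-swap u))) up-once-sorted p q r }

-- From a symmetric matching back to directions on the chamber.

module MatchedDirections (y z a x : ℕ) where
 open import Data.Nat using (_≤_; _∸_; _+_)
 open import Data.Sum using (swap)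
 open Farkas using (#_; _:+_; _:*_; _≼_; _≺_; _:=_; _⋠_; _⊀_; _&_; _⊢_; !_; ŷ; ẑ; â; x̂; t̂; d̂; m̂; L̂; ĉ; Ŵ; T̂; μ̂; ŝ; module Linear)
 open Linear y z a x using (linear; equal; refute)
 open PathWords
 open DirectionWords
 open Enumeration
 open Strips y z a x using (Down; Down?; L; Up; Up?; ub; top)
 open Triples y z a x
 open DirectedMatchings y z a x

 open Matching

 choose₂ : ∀ {P Q : Set} → Dec P → Dec Q → Direction
 choose₂ (yes _) _ = up
 choose₂ (no _) (yes _) = stay
 choose₂ (no _) (no _) = move

 module ToDirections {K : ℕ → ℕ → ℕ → Set} (μ : Matching K) where
  -- The third coordinate is recovered by subtraction; `move` is what remains when the other two
  -- partners are excluded.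
  direct : Directions
  direct b A = choose₂ (M? μ b (L ∸ (A + b + 2)) A) (M? μ (L ∸ (A + b + 2)) A b)
  third≡ : ∀ {A b c} → A + b + c + 2 ≡ L → L ∸ (A + b + 2) ≡ c
  third≡ {A} {b} {c} e = trans (cong (_∸ (A + b + 2)) (trans (sym e) (shift A b c))) (NP.m+n∸m≡n (A + b + 2) c)
   where
   shift : ∀ A b c → A + b + c + 2 ≡ A + b + 2 + c
   shift A b c = equal (A ∷ b ∷ c ∷ []) [] (! 0 :+ ! 1 :+ ! 2 :+ # 2) (! 0 :+ ! 1 :+ # 2 :+ ! 2) (1 ∷ []) (1 ∷ []) _
  module At {A b c : ℕ} (dn : DownT A b c) where
   once = down-once μ dn
   direct≡ : direct b A ≡ choose₂ (M? μ b c A) (M? μ c A b)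
   direct≡ = cong (λ c → choose₂ (M? μ b c A) (M? μ c A b)) (third≡ {A} {b} {c} (proj₁ dn))
   up⁻ : direct b A ≡ up → K b c A
   up⁻ e with M? μ b c A | M? μ c A b | trans (sym direct≡) e
   ... | yes i | _ | _ = i
   ... | no _ | yes _ | ()
   ... | no _ | no _ | ()
   stay⁻ : direct b A ≡ stay → K c A b
   stay⁻ e with M? μ b c A | M? μ c A b | trans (sym direct≡) e
   ... | no _ | yes i | _ = i
   ... | yes _ | _ | ()
   ... | no _ | no _ | ()
   move⁻ : direct b A ≡ move → K A b c
   move⁻ e with M? μ b c A | M? μ c A b | trans (sym direct≡) e
   ... | yes _ | _ | ()
   ... | no _ | yes _ | ()
   ... | no n | no n′ | _ with proj₁ once
   ... | inj₁ i = i
   ... | inj₂ (inj₁ i) = ⊥-elim (n i)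
   ... | inj₂ (inj₂ i) = ⊥-elim (n′ i)
   up⁺ : K b c A → direct b A ≡ up
   up⁺ i with M? μ b c A | direct≡
   ... | yes _ | e = e
   ... | no n | _ = ⊥-elim (n i)
   stay⁺ : K c A b → direct b A ≡ stay
   stay⁺ i with M? μ b c A | M? μ c A b | direct≡
   ... | yes j | _ | _ = ⊥-elim (proj₁ (proj₂ (proj₂ once)) (j , i))
   ... | no _ | yes _ | e = e
   ... | no _ | no n | _ = ⊥-elim (n i)
   move⁺ : K A b c → direct b A ≡ move
   move⁺ i with M? μ b c A | M? μ c A b | direct≡
   ... | yes j | _ | _ = ⊥-elim (proj₁ (proj₂ once) (i , j))
   ... | no _ | yes j | _ = ⊥-elim (proj₂ (proj₂ (proj₂ once)) (j , i))
   ... | no _ | no _ | e = e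
  -- The partner of a triangle of the open chamber stays in the open chamber: one on an axis would
  -- acquire a second partner by reflection, as `down-axis` and `up-axis` express.
  direct-valid : Valid top [] direct
  direct-valid = record
   { enter⁻ = λ () ; enter⁺ = λ {A} dn _ → ⊥-elim (<-irrefl refl (Down-top dn))
   ; ups = λ _ dn e → ups′ dn e ; stays = λ _ dn e → stays′ dn e ; moves = λ _ dn e → moves′ dn e
   ; cover = λ _ u → cover′ u
   ; up-stay = λ _ dn e dn′ e′ → up-stay′ dn e dn′ e′ ; up-move = λ _ dn e dn′ e′ → up-move′ dn e dn′ e′
   ; stay-move = λ _ dn e dn′ e′ → stay-move′ dn e dn′ e′ }
   where
   ups′ : ∀ {k A} → Down k A → direct k A ≡ up → Up (suc k) A
   ups′ {k} {A} D₀ e with thirdᵈ D₀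
   ... | c , s with Down⇒DownT D₀ s
   ... | dn , k<c with m≤n⇒m<n∨m≡n k<c
   ... | inj₁ l = UpT⇒Up (m<n⇒m<1+n (proj₁ D₀)) l (UpT-rot (UpT-rot (M-up μ (At.up⁻ dn e))))
   ... | inj₂ refl = ⊥-elim (up-axis μ (M-up μ (At.up⁻ dn e)) (k , refl , At.up⁻ dn e))
   stays′ : ∀ {b A} → Down b A → direct b A ≡ stay → Up b A
   stays′ D₀ e with thirdᵈ D₀
   ... | c , s with Down⇒DownT D₀ s
   ... | dn , b<c = UpT⇒Up (proj₁ D₀) (m<n⇒m<1+n b<c) (UpT-rot (M-up μ (At.stay⁻ dn e)))
   moves′ : ∀ {b A} → Down b A → direct b A ≡ move → Up b (suc A)
   moves′ {b} {A} D₀ e with thirdᵈ D₀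
   ... | c , s with Down⇒DownT D₀ s
   ... | dn , b<c with m≤n⇒m<n∨m≡n (proj₁ D₀)
   ... | inj₁ l = UpT⇒Up l b<c (M-up μ (At.move⁻ dn e))
   ... | inj₂ refl = ⊥-elim (up-axis μ (M-up μ (At.move⁻ dn e)) (A , refl , At.move⁻ dn e))
   cover′ : ∀ {b A} → Up b A → (∃ λ k → b ≡ suc k × Down k A × direct k A ≡ up) ⊎ (Down b A × direct b A ≡ stay) ⊎ (∃ λ B → A ≡ suc B × Down b B × direct b B ≡ move)
   cover′ {b} {A} U₀ with thirdᵘ U₀
   ... | c , s with Up⇒UpT U₀ s
   ... | u , b<c with proj₁ (up-once μ u)
   ... | inj₁ (B , refl , i) = inj₂ (inj₂ (B , refl , DownT⇒Down (<-trans ≤-refl (proj₁ U₀)) b<c (M-down μ i) , At.move⁺ (M-down μ i) i))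
   ... | inj₂ (inj₁ (k , refl , i)) with m≤n⇒m<n∨m≡n (≤-pred (proj₁ U₀))
   ... | inj₁ l = let dn = DownT-rot (DownT-rot (M-down μ i)) in inj₁ (k , refl , DownT⇒Down l (<⇒≤ b<c) dn , At.up⁺ dn i)
   ... | inj₂ refl = ⊥-elim (down-axis μ (M-swap μ i))
   cover′ {b} {A} U₀ | c , s | u , b<c | inj₂ (inj₂ (c′ , refl , i)) with m≤n⇒m<n∨m≡n (≤-pred b<c)
   ... | inj₁ l = let dn = DownT-rot (M-down μ i) in inj₂ (inj₁ (DownT⇒Down (proj₁ U₀) l dn , At.stay⁺ dn i))
   ... | inj₂ refl = ⊥-elim (down-axis μ (M-swap μ i))
   up-stay′ : ∀ {k A} → Down k A → direct k A ≡ up → Down (suc k) A → ¬ direct (suc k) A ≡ stay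
   up-stay′ {k} {A} D₀ e D₁ e′ with thirdᵈ D₁
   ... | c , s with Down⇒DownT D₁ s | Down⇒DownT {c = suc c} D₀ (trans (shift A k c) s)
    where
    shift : ∀ A k c → A + k + suc c + 2 ≡ A + suc k + c + 2
    shift A k c = equal (A ∷ k ∷ c ∷ []) [] (! 0 :+ ! 1 :+ (# 1 :+ ! 2) :+ # 2) (! 0 :+ (# 1 :+ ! 1) :+ ! 2 :+ # 2) (1 ∷ []) (1 ∷ []) _
   ... | dn₁ , _ | dn₀ , _ = proj₁ (proj₂ (proj₂ (up-once μ (UpT-rot (UpT-rot (M-up μ (At.up⁻ dn₀ e)))))))
    ((k , refl , At.up⁻ dn₀ e) , (c , refl , At.stay⁻ dn₁ e′))
   up-move′ : ∀ {k B} → Down k (suc B) → direct k (suc B) ≡ up → Down (suc k) B → ¬ direct (suc k) B ≡ move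
   up-move′ {k} {B} D₀ e D₁ e′ with thirdᵈ D₁
   ... | c , s with Down⇒DownT D₁ s | Down⇒DownT {c = c} D₀ (trans (shift B k c) s)
    where
    shift : ∀ B k c → suc B + k + c + 2 ≡ B + suc k + c + 2
    shift B k c = equal (B ∷ k ∷ c ∷ []) [] (# 1 :+ ! 0 :+ ! 1 :+ ! 2 :+ # 2) (! 0 :+ (# 1 :+ ! 1) :+ ! 2 :+ # 2) (1 ∷ []) (1 ∷ []) _
   ... | dn₁ , _ | dn₀ , _ = proj₁ (proj₂ (up-once μ (UpT-rot (UpT-rot (M-up μ (At.up⁻ dn₀ e))))))
    ((B , refl , At.move⁻ dn₁ e′) , (k , refl , At.up⁻ dn₀ e))
   stay-move′ : ∀ {b B} → Down b (suc B) → direct b (suc B) ≡ stay → Down b B → ¬ direct b B ≡ move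
   stay-move′ {b} {B} D₀ e D₁ e′ with thirdᵈ D₀
   ... | c , s with Down⇒DownT D₀ s | Down⇒DownT {c = suc c} D₁ (trans (shift B b c) s)
    where
    shift : ∀ B b c → B + b + suc c + 2 ≡ suc B + b + c + 2
    shift B b c = equal (B ∷ b ∷ c ∷ []) [] (! 0 :+ ! 1 :+ (# 1 :+ ! 2) :+ # 2) (# 1 :+ ! 0 :+ ! 1 :+ ! 2 :+ # 2) (1 ∷ []) (1 ∷ []) _
   ... | dn₀ , _ | dn₁ , _ = proj₂ (proj₂ (proj₂ (up-once μ (M-up μ (At.move⁻ dn₁ e′)))))
    ((c , refl , At.stay⁻ dn₀ e) , (B , refl , At.move⁻ dn₁ e′))
  module _ (δ : Directions) (agree : ∀ b A → b ≤ top → Down b A → δ b A ≡ direct b A) where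
   open FromDirections δ
   Three : ℕ → ℕ → ℕ → Set
   Three p q r = (M p q r → K p q r) × (M q r p → K q r p) × (M r p q → K r p q)
   ⊆-sorted : ∀ {A b c} → A ≤ b → b ≤ c → Three A b c
   ⊆-sorted {A} {b} {c} A≤b b≤c with m≤n⇒m<n∨m≡n A≤b | m≤n⇒m<n∨m≡n b≤c
   ... | inj₁ A<b | inj₁ b<c = (λ (dn , _ , i) → At.move⁻ dn (trans (same dn) (inc-low A<b b<c i)))
     , (λ (dn , _ , i) → At.up⁻ (back dn) (trans (same (back dn)) (inc-mid A<b b<c (swap i))))
     , (λ (dn , _ , i) → At.stay⁻ (DownT-rot dn) (trans (same (DownT-rot dn)) (inc-high A<b b<c i)))
    where
    back : DownT b c A → DownT A b c
    back dn = DownT-rot (DownT-rot dn)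
    same : DownT A b c → direct b A ≡ δ b A
    same dn = let D₀ = DownT⇒Down A<b b<c dn in sym (agree b A (<⇒≤ (Down-top D₀)) D₀)
   ... | inj₂ refl | inj₂ refl = (λ (dn , _) → ⊥-elim (centre-down dn)) , (λ (dn , _) → ⊥-elim (centre-down dn)) , (λ (dn , _) → ⊥-elim (centre-down dn))
   ... | inj₂ refl | inj₁ A<c = (λ (_ , _ , i) → ⊥-elim (¬inc (<⇒≢ A<c) i)) , (λ (_ , _ , i) → ⊥-elim (¬inc (<⇒≢ A<c) (swap i))) , (λ (dn , _) → last dn)
    where
    last : DownT c A A → K c A A
    last dn with proj₁ (down-once μ dn)
    ... | inj₁ i = i
    ... | inj₂ (inj₁ i) = ⊥-elim (down-axis μ i)
    ... | inj₂ (inj₂ i) = ⊥-elim (down-axis μ (M-swap μ i))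
   ... | inj₁ A<b | inj₂ refl = (λ (dn , _) → first dn) , (λ (_ , _ , i) → ⊥-elim (¬inc (λ e → <⇒≢ A<b (sym e)) i)) , (λ (_ , _ , i) → ⊥-elim (¬inc (λ e → <⇒≢ A<b (sym e)) (swap i)))
    where
    first : DownT A b b → K A b b
    first dn with proj₁ (down-once μ dn)
    ... | inj₁ i = i
    ... | inj₂ (inj₁ i) = ⊥-elim (down-axis μ i)
    ... | inj₂ (inj₂ i) = ⊥-elim (down-axis μ (M-swap μ i))
   M⊆K : ∀ {p q r} → M p q r → K p q r
   M⊆K {p} {q} {r} = proj₁ (sorted Three (λ (f , g , h) → g , h , f)
    (λ (f , g , h) → (λ i → M-swap μ (f (M-sym i))) , (λ i → M-swap μ (h (M-sym i))) , (λ i → M-swap μ (g (M-sym i)))) ⊆-sorted p q r)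

 open Enumerate Up Down Up? Down? ub Up-bound Down-bound ¬Up-zero ¬Down-zero
  using (direction; direction-valid; direction-injective; direction-surjective; Agree)

 N : ℕ
 N = length (Paths.paths Up Down Up? Down? ub top [])

 M[_] : Directions → ℕ → ℕ → ℕ → Set
 M[ δ ] = FromDirections.M δ

 M-matching : ∀ i → Matching M[ direction top i ]
 M-matching i = FromDirections.matching (direction top i) (direction-valid top i)

 M-injective : ∀ i j → (∀ {p q r} → M[ direction top i ] p q r → M[ direction top j ] p q r) → i ≡ j
 M-injective i j sub = direction-injective top i j agree
  where
  module I = FromDirections (direction top i)
  module J = FromDirections (direction top j)
  agree : Agree top (direction top i) (direction top j)
  agree b A _ D₀ with thirdᵈ D₀
  ... | c , s with Down⇒DownT D₀ s
  ... | dn , b<c with proj₁ (down-once (M-matching i) dn)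
  ... | inj₁ k = trans (I.inc-low (proj₁ D₀) b<c (proj₂ (proj₂ k))) (sym (J.inc-low (proj₁ D₀) b<c (proj₂ (proj₂ (sub k)))))
  ... | inj₂ (inj₁ k) = trans (I.inc-mid (proj₁ D₀) b<c (swap (proj₂ (proj₂ k)))) (sym (J.inc-mid (proj₁ D₀) b<c (swap (proj₂ (proj₂ (sub k))))))
  ... | inj₂ (inj₂ k) = trans (I.inc-high (proj₁ D₀) b<c (proj₂ (proj₂ k))) (sym (J.inc-high (proj₁ D₀) b<c (proj₂ (proj₂ (sub k)))))

 M-surjective : ∀ {K} → Matching K → ∃ λ i → ∀ {p q r} → M[ direction top i ] p q r → K p q r
 M-surjective μ with direction-surjective top (ToDirections.direct μ) (ToDirections.direct-valid μ)
 ... | i , agree = i , ToDirections.M⊆K μ (direction top i) agree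

-- Symmetric matchings and symmetric tilings of `ℋ₂`.

module Tilings (y z a x : ℕ) where
 open import Data.Nat using (_≤_; _<_; _<?_; _+_; _*_)
 open import Relation.Nullary.Decidable using (dec-true)
 open Farkas using (#_; _:+_; _:*_; _≼_; _≺_; _:=_; _⋠_; _⊀_; _&_; _⊢_; !_; ŷ; ẑ; â; x̂; t̂; d̂; m̂; L̂; ĉ; Ŵ; T̂; μ̂; ŝ; module Linear)
 open Linear y z a x using (linear; equal; refute)
 open Strips y z a x using (L; c₀; d; m; t)
 open Triples y z a x

 open Inside
 open Matching

 R : Region
 R = ℋ₂ t y a x

 ≤-shift⁻ : ∀ l n r → + l ℤ.- + n ℤ.≤ + r → l ≤ r + n
 ≤-shift⁻ l n r p = ZP.drop‿+≤+ (subst (ℤ._≤ + (r + n)) (lemma (+ l) (+ n)) (ZP.+-monoˡ-≤ (+ n) p))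
  where
  lemma : ∀ l n → l ℤ.- n ℤ.+ n ≡ l
  lemma = solve-ℤ

 ≤-shift⁺ : ∀ l n r → l ≤ r + n → + l ℤ.- + n ℤ.≤ + r
 ≤-shift⁺ l n r p = subst (+ l ℤ.- + n ℤ.≤_) (lemma (+ r) (+ n)) (ZP.+-monoˡ-≤ (ℤ.- + n) (ℤ.+≤+ p))
  where
  lemma : ∀ r n → r ℤ.+ n ℤ.- n ≡ r
  lemma = solve-ℤ

 ≡-shift⁻ : ∀ l n s → + s ≡ + l ℤ.- + n → s + n ≡ l
 ≡-shift⁻ l n s e = ZP.+-injective (trans (cong (ℤ._+ + n) e) (lemma (+ l) (+ n)))
  where
  lemma : ∀ l n → l ℤ.- n ℤ.+ n ≡ l
  lemma = solve-ℤ

 ≡-shift⁺ : ∀ l n s → s + n ≡ l → + s ≡ + l ℤ.- + n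
 ≡-shift⁺ l n s e = trans (lemma (+ s) (+ n)) (cong (λ l → + l ℤ.- + n) e)
  where
  lemma : ∀ s n → s ≡ s ℤ.+ n ℤ.- n
  lemma = solve-ℤ

 0≤ : ∀ {n} → + 0 ℤ.≤ + n
 0≤ = ℤ.+≤+ z≤n

 side : ℕ
 side = 6 * t + 2 * x + 6 * a

 side≡ : side ≡ L
 side≡ = equal [] [] ŝ L̂ (1 ∷ []) (1 ∷ []) _

 far⁻ : ∀ r → ¬ (+ side ℤ.- + (2 * t) ℤ.≤ + r) → r + 2 * t < L
 far⁻ r n with r + 2 * t <? L
 ... | yes l = l
 ... | no ¬l = ⊥-elim (n (≤-shift⁺ side (2 * t) r (≤-trans (≤-reflexive side≡) (≮⇒≥ ¬l))))

 far⁺ : ∀ r → r + 2 * t < L → ¬ (+ side ℤ.- + (2 * t) ℤ.≤ + r)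
 far⁺ r l p = <⇒≱ l (≤-trans (≤-reflexive (sym side≡)) (≤-shift⁻ side (2 * t) r p))

 m⁺ : ∀ {p} → m ≤ p → + (2 * t + 2 * a) ℤ.≤ + p
 m⁺ {p} l = ℤ.+≤+ (linear (p ∷ []) (m̂ ≼ ! 0 ∷ [] ⊢ 2 :* t̂ :+ 2 :* â ≼ ! 0) (1 ∷ 1 ∷ []) l)

 m⁻ : ∀ {p} → + (2 * t + 2 * a) ℤ.≤ + p → m ≤ p
 m⁻ {p} l = go (ZP.drop‿+≤+ l)
  where
  go : 2 * t + 2 * a ≤ p → m ≤ p
  go l = linear (p ∷ []) (2 :* t̂ :+ 2 :* â ≼ ! 0 ∷ [] ⊢ m̂ ≼ ! 0) (1 ∷ 1 ∷ []) l

 c⁺ : ∀ {p} → c₀ ≤ p → + (2 * t + 2 * a + x + y) ℤ.≤ + p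
 c⁺ {p} l = ℤ.+≤+ (linear (p ∷ []) (ĉ ≼ ! 0 ∷ [] ⊢ 2 :* t̂ :+ 2 :* â :+ x̂ :+ ŷ ≼ ! 0) (1 ∷ 1 ∷ []) l)

 c⁻ : ∀ {p} → + (2 * t + 2 * a + x + y) ℤ.≤ + p → c₀ ≤ p
 c⁻ {p} l = go (ZP.drop‿+≤+ l)
  where
  go : 2 * t + 2 * a + x + y ≤ p → c₀ ≤ p
  go l = linear (p ∷ []) (2 :* t̂ :+ 2 :* â :+ x̂ :+ ŷ ≼ ! 0 ∷ [] ⊢ ĉ ≼ ! 0) (1 ∷ 1 ∷ []) l

 d⁺ : ∀ {p} → d ≤ p → + (2 * t) ℤ.- + (2 * y) ℤ.≤ + p
 d⁺ {p} l = ≤-shift⁺ (2 * t) (2 * y) p (linear (p ∷ []) (d̂ ≼ ! 0 ∷ [] ⊢ 2 :* t̂ ≼ ! 0 :+ 2 :* ŷ) (1 ∷ 1 ∷ []) l)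

 d⁻ : ∀ {p} → + (2 * t) ℤ.- + (2 * y) ℤ.≤ + p → d ≤ p
 d⁻ {p} l = go (≤-shift⁻ (2 * t) (2 * y) p l)
  where
  go : 2 * t ≤ p + 2 * y → d ≤ p
  go l = linear (p ∷ []) (2 :* t̂ ≼ ! 0 :+ 2 :* ŷ ∷ [] ⊢ d̂ ≼ ! 0) (1 ∷ 1 ∷ []) l

 cell : ℕ → ℕ → ℕ → Tri
 cell p q r = tri (+ p) (+ q) (+ r)

 region⁻ : ∀ p q r → R (cell p q r) → DownT p q r ⊎ UpT p q r
 region⁻ p q r (unit , _ , n₃ , n₂ , n₁ , nm , s₁ , s₂ , s₃) = split unit
  where
  inside : Inside p q r
  inside = record
   { far₁ = far⁻ p (λ l → n₁ (l , 0≤ , 0≤)) ; far₂ = far⁻ q (λ l → n₂ (0≤ , l , 0≤)) ; far₃ = far⁻ r (λ l → n₃ (0≤ , 0≤ , l))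
   ; core = λ (u , v , w) → nm (m⁺ u , m⁺ v , m⁺ w) ; sat₁ = λ (u , v , w) → s₁ (d⁺ u , c⁺ v , c⁺ w)
   ; sat₂ = λ (u , v , w) → s₂ (c⁺ u , d⁺ v , c⁺ w) ; sat₃ = λ (u , v , w) → s₃ (c⁺ u , c⁺ v , d⁺ w) }
  split : _ → DownT p q r ⊎ UpT p q r
  split (inj₁ e) = inj₂ (trans (≡-shift⁻ side 1 (p + q + r) e) side≡ , inside)
  split (inj₂ e) = inj₁ (trans (≡-shift⁻ side 2 (p + q + r) e) side≡ , inside)

 region⁺ : ∀ {p q r} → DownT p q r ⊎ UpT p q r → R (cell p q r)
 region⁺ {p} {q} {r} s = unit s , (0≤ , 0≤ , 0≤) , (λ (_ , _ , l) → far⁺ r (far₃ i) l) , (λ (_ , l , _) → far⁺ q (far₂ i) l)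
  , (λ (l , _ , _) → far⁺ p (far₁ i) l) , (λ (u , v , w) → core i (m⁻ u , m⁻ v , m⁻ w)) , (λ (u , v , w) → sat₁ i (d⁻ u , c⁻ v , c⁻ w))
  , (λ (u , v , w) → sat₂ i (c⁻ u , d⁻ v , c⁻ w)) , (λ (u , v , w) → sat₃ i (c⁻ u , c⁻ v , d⁻ w))
  where
  inside : DownT p q r ⊎ UpT p q r → Inside p q r
  inside (inj₁ (_ , i)) = i
  inside (inj₂ (_ , i)) = i
  i = inside s
  unit : DownT p q r ⊎ UpT p q r → IsUnitTriangle (ℓ side) (cell p q r)
  unit (inj₁ (e , _)) = inj₂ (≡-shift⁺ side 2 (p + q + r) (trans e (sym side≡)))
  unit (inj₂ (e , _)) = inj₁ (≡-shift⁺ side 1 (p + q + r) (trans e (sym side≡)))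

 region-cell : ∀ τ → R τ → ∃ λ p → ∃ λ q → ∃ λ r → τ ≡ cell p q r
 region-cell (tri (+ p) (+ q) (+ r)) _ = p , q , r , refl
 region-cell (tri -[1+ _ ] _ _) (_ , (() , _) , _)
 region-cell (tri (+ _) -[1+ _ ] _) (_ , (_ , () , _) , _)
 region-cell (tri (+ _) (+ _) -[1+ _ ]) (_ , (_ , _ , ()) , _)

 up-down : ∀ {p q r} → UpT p q r → ¬ DownT p q r
 up-down {p} {q} {r} (e , _) (f , _) = refute (p ∷ q ∷ r ∷ []) (! 0 :+ ! 1 :+ ! 2 :+ # 1 := L̂ ∷ ! 0 :+ ! 1 :+ ! 2 :+ # 2 := L̂ ∷ []) (0 ∷ 1 ∷ 1 ∷ []) (e & f)

 -- By rotation invariance the three orientations of a lozenge are read off from one relation, with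
 -- its arguments rotated.
 data Lozenge (K : ℕ → ℕ → ℕ → Set) : Tri → Tri → Set where
  at₁ : ∀ {p q r} → K p q r → Lozenge K (cell (suc p) q r) (cell p q r)
  at₂ : ∀ {p q r} → K q r p → Lozenge K (cell p (suc q) r) (cell p q r)
  at₃ : ∀ {p q r} → K r p q → Lozenge K (cell p q (suc r)) (cell p q r)

 _≟ᵗ_ : (τ σ : Tri) → Dec (τ ≡ σ)
 tri i j k ≟ᵗ tri i′ j′ k′ = map′ (λ { (refl , refl , refl) → refl }) (λ { refl → refl , refl , refl })
  ((i ZP.≟ i′) ×-dec (j ZP.≟ j′) ×-dec (k ZP.≟ k′))

 does-cong : ∀ {P Q : Set} (P? : Dec P) (Q? : Dec Q) → (P → Q) → (Q → P) → does P? ≡ does Q?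
 does-cong (yes p) (yes q) f g = refl
 does-cong (yes p) (no ¬q) f g = ⊥-elim (¬q (f p))
 does-cong (no ¬p) (yes q) f g = ⊥-elim (¬p (g q))
 does-cong (no ¬p) (no ¬q) f g = refl

 witness : ∀ {P : Set} (P? : Dec P) → does P? ≡ true → P
 witness (yes p) _ = p

 bool-cong : ∀ {b c : Bool} → (b ≡ true → c ≡ true) → (c ≡ true → b ≡ true) → b ≡ c
 bool-cong {true} {true} f g = refl
 bool-cong {true} {false} f g = sym (f refl)
 bool-cong {false} {true} f g = g refl
 bool-cong {false} {false} f g = refl

 module _ {K : ℕ → ℕ → ℕ → Set} where
  lozenge? : (∀ p q r → Dec (K p q r)) → ∀ τ σ → Dec (Lozenge K τ σ)
  lozenge? K? τ (tri -[1+ _ ] _ _) = no λ ()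
  lozenge? K? τ (tri (+ _) -[1+ _ ] _) = no λ ()
  lozenge? K? τ (tri (+ _) (+ _) -[1+ _ ]) = no λ ()
  lozenge? K? τ (tri (+ p) (+ q) (+ r)) = map′
   (λ { (inj₁ (refl , k)) → at₁ k ; (inj₂ (inj₁ (refl , k))) → at₂ k ; (inj₂ (inj₂ (refl , k))) → at₃ k })
   (λ { (at₁ k) → inj₁ (refl , k) ; (at₂ k) → inj₂ (inj₁ (refl , k)) ; (at₃ k) → inj₂ (inj₂ (refl , k)) })
   (((τ ≟ᵗ cell (suc p) q r) ×-dec K? p q r) ⊎-dec ((τ ≟ᵗ cell p (suc q) r) ×-dec K? q r p) ⊎-dec ((τ ≟ᵗ cell p q (suc r)) ×-dec K? r p q))
  lozenge-rot : ∀ {τ σ} → Lozenge K τ σ → Lozenge K (rot120 τ) (rot120 σ)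
  lozenge-rot (at₁ k) = at₃ k
  lozenge-rot (at₂ k) = at₁ k
  lozenge-rot (at₃ k) = at₂ k
  module _ (μ : Matching K) where
   lozenge-refl : ∀ {τ σ} → Lozenge K τ σ → Lozenge K (reflV τ) (reflV σ)
   lozenge-refl (at₁ k) = at₁ (M-swap μ k)
   lozenge-refl (at₂ k) = at₃ (M-swap μ k)
   lozenge-refl (at₃ k) = at₂ (M-swap μ k)
   lozenge-adjacent : ∀ {τ σ} → Lozenge K τ σ → Adjacent τ σ
   lozenge-adjacent (at₁ k) = inj₁ refl
   lozenge-adjacent (at₂ k) = inj₂ (inj₁ refl)
   lozenge-adjacent (at₃ k) = inj₂ (inj₂ refl)
   lozenge-down : ∀ {τ σ} → Lozenge K τ σ → ∃ λ p → ∃ λ q → ∃ λ r → σ ≡ cell p q r × DownT p q r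
   lozenge-down (at₁ {p} {q} {r} k) = p , q , r , refl , M-down μ k
   lozenge-down (at₂ {p} {q} {r} k) = p , q , r , refl , DownT-rot (DownT-rot (M-down μ k))
   lozenge-down (at₃ {p} {q} {r} k) = p , q , r , refl , DownT-rot (M-down μ k)
   lozenge-up : ∀ {τ σ} → Lozenge K τ σ → ∃ λ p → ∃ λ q → ∃ λ r → τ ≡ cell p q r × UpT p q r
   lozenge-up (at₁ {p} {q} {r} k) = suc p , q , r , refl , M-up μ k
   lozenge-up (at₂ {p} {q} {r} k) = p , suc q , r , refl , UpT-rot (UpT-rot (M-up μ k))
   lozenge-up (at₃ {p} {q} {r} k) = p , q , suc r , refl , UpT-rot (M-up μ k)
   down≢up : ∀ {τ σ τ′ σ′} → Lozenge K τ σ → Lozenge K τ′ σ′ → σ ≢ τ′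
   down≢up l l′ e with lozenge-down l | lozenge-up l′
   down≢up l l′ refl | _ , _ , _ , refl , dn | _ , _ , _ , refl , u = up-down u dn
   same-down : ∀ {τ τ′ σ} → Lozenge K τ σ → Lozenge K τ′ σ → τ ≡ τ′
   same-down (at₁ k) (at₁ _) = refl
   same-down (at₂ k) (at₂ _) = refl
   same-down (at₃ k) (at₃ _) = refl
   same-down (at₁ k) (at₂ k′) = ⊥-elim (proj₁ (proj₂ (down-once μ (M-down μ k))) (k , k′))
   same-down (at₂ k) (at₁ k′) = ⊥-elim (proj₁ (proj₂ (down-once μ (M-down μ k′))) (k′ , k))
   same-down (at₂ k) (at₃ k′) = ⊥-elim (proj₁ (proj₂ (down-once μ (M-down μ k))) (k , k′))
   same-down (at₃ k) (at₂ k′) = ⊥-elim (proj₁ (proj₂ (down-once μ (M-down μ k′))) (k′ , k))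
   same-down (at₃ k) (at₁ k′) = ⊥-elim (proj₁ (proj₂ (down-once μ (M-down μ k))) (k , k′))
   same-down (at₁ k) (at₃ k′) = ⊥-elim (proj₁ (proj₂ (down-once μ (M-down μ k′))) (k′ , k))
   clash : ∀ {p q r} → K p (suc q) r → ¬ K q r (suc p)
   clash {p} {q} {r} k k′ = proj₁ (proj₂ (up-once μ (M-up μ k))) ((p , refl , k) , (q , refl , k′))
   same-up : ∀ {τ σ σ′} → Lozenge K τ σ → Lozenge K τ σ′ → σ ≡ σ′
   same-up (at₁ k) (at₁ _) = refl
   same-up (at₂ k) (at₂ _) = refl
   same-up (at₃ k) (at₃ _) = refl
   same-up (at₁ k) (at₂ k′) = ⊥-elim (clash k k′)
   same-up (at₂ k) (at₁ k′) = ⊥-elim (clash k′ k)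
   same-up (at₂ k) (at₃ k′) = ⊥-elim (clash k k′)
   same-up (at₃ k) (at₂ k′) = ⊥-elim (clash k′ k)
   same-up (at₃ k) (at₁ k′) = ⊥-elim (clash k k′)
   same-up (at₁ k) (at₃ k′) = ⊥-elim (clash k′ k)
   tiles : LozengeSet
   tiles τ σ = does (lozenge? (M? μ) τ σ)
   tiles⁻ : ∀ {τ σ} → tiles τ σ ≡ true → Lozenge K τ σ
   tiles⁻ {τ} {σ} = witness (lozenge? (M? μ) τ σ)
   tiles⁺ : ∀ {τ σ} → Lozenge K τ σ → tiles τ σ ≡ true
   tiles⁺ {τ} {σ} = dec-true (lozenge? (M? μ) τ σ)
   tiling : SymTiling R
   tiling = tiles , ((λ τ σ s → proper (tiles⁻ s)) , covers , (λ ρ τ σ τ′ σ′ s s′ → once (tiles⁻ s) (tiles⁻ s′)))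
    -- For the converse implication the rotation is applied twice more, its third power being the
    -- identity.
    , (λ τ σ → does-cong (lozenge? (M? μ) (rot120 τ) (rot120 σ)) (lozenge? (M? μ) τ σ) (λ l → lozenge-rot {rot120 (rot120 τ)} {rot120 (rot120 σ)} (lozenge-rot {rot120 τ} {rot120 σ} l)) lozenge-rot)
    , (λ τ σ → does-cong (lozenge? (M? μ) (reflV τ) (reflV σ)) (lozenge? (M? μ) τ σ) (lozenge-refl {reflV τ} {reflV σ}) lozenge-refl)
    where
    proper : ∀ {τ σ} → Lozenge K τ σ → Adjacent τ σ × R τ × R σ
    proper l with lozenge-up l | lozenge-down l
    ... | _ , _ , _ , refl , u | _ , _ , _ , refl , dn = lozenge-adjacent l , region⁺ (inj₂ u) , region⁺ (inj₁ dn)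
    covers : ∀ ρ → R ρ → Σ Tri λ τ → Σ Tri λ σ → tiles τ σ ≡ true × ρ ∈L (τ , σ)
    covers ρ ρ∈ with region-cell ρ ρ∈
    ... | p , q , r , refl with region⁻ p q r ρ∈
    ... | inj₁ dn with proj₁ (down-once μ dn)
    ... | inj₁ k = cell (suc p) q r , cell p q r , tiles⁺ (at₁ k) , inj₂ refl
    ... | inj₂ (inj₁ k) = cell p (suc q) r , cell p q r , tiles⁺ (at₂ k) , inj₂ refl
    ... | inj₂ (inj₂ k) = cell p q (suc r) , cell p q r , tiles⁺ (at₃ k) , inj₂ refl
    covers ρ ρ∈ | p , q , r , refl | inj₂ u with proj₁ (up-once μ u)
    ... | inj₁ (p′ , refl , k) = cell p q r , cell p′ q r , tiles⁺ (at₁ k) , inj₁ refl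
    ... | inj₂ (inj₁ (q′ , refl , k)) = cell p q r , cell p q′ r , tiles⁺ (at₂ k) , inj₁ refl
    ... | inj₂ (inj₂ (r′ , refl , k)) = cell p q r , cell p q r′ , tiles⁺ (at₃ k) , inj₁ refl
    once : ∀ {ρ τ σ τ′ σ′} → Lozenge K τ σ → Lozenge K τ′ σ′ → ρ ∈L (τ , σ) → ρ ∈L (τ′ , σ′) → τ ≡ τ′ × σ ≡ σ′
    once l l′ (inj₁ refl) (inj₁ refl) = refl , same-up l l′
    once l l′ (inj₂ refl) (inj₂ refl) = same-down l l′ , refl
    once l l′ (inj₁ refl) (inj₂ e) = ⊥-elim (down≢up l′ l (sym e))
    once l l′ (inj₂ refl) (inj₁ e) = ⊥-elim (down≢up l l′ e)

 module FromTiling (S : LozengeSet) (T : IsTiling R S) (S-rot : InvariantUnder rot120 S) (S-refl : InvariantUnder reflV S) where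
  -- Lozenges of one orientation suffice; those of the other two are their rotations.
  K : ℕ → ℕ → ℕ → Set
  K p q r = S (cell (suc p) q r) (cell p q r) ≡ true
  lozenge⁻ : ∀ {τ σ} → Lozenge K τ σ → S τ σ ≡ true
  lozenge⁻ (at₁ k) = k
  lozenge⁻ (at₂ k) = trans (sym (S-rot _ _)) k
  lozenge⁻ (at₃ k) = trans (sym (S-rot _ _)) (trans (sym (S-rot _ _)) k)
  pred⁻ : ∀ i p → + p ≡ i ℤ.- + 1 → i ≡ + suc p
  pred⁻ i p e = trans (lemma i) (trans (cong (ℤ._+ + 1) (sym e)) (cong +_ (NP.+-comm p 1)))
   where
   lemma : ∀ i → i ≡ i ℤ.- + 1 ℤ.+ + 1
   lemma = solve-ℤ
  lozenge⁺ : ∀ {τ σ} → S τ σ ≡ true → Lozenge K τ σ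
  lozenge⁺ {tri i j k} {σ} s with proj₁ T (tri i j k) σ s
  ... | adj , _ , σ∈ with region-cell σ σ∈
  ... | p , q , r , refl = shape adj
   where
   shape : Adjacent (tri i j k) (cell p q r) → Lozenge K (tri i j k) (cell p q r)
   shape (inj₁ e) with pred⁻ i p (cong u₁ e) | cong u₂ e | cong u₃ e
   ... | refl | refl | refl = at₁ s
   shape (inj₂ (inj₁ e)) with cong u₁ e | pred⁻ j q (cong u₂ e) | cong u₃ e
   ... | refl | refl | refl = at₂ (trans (S-rot _ _) s)
   shape (inj₂ (inj₂ e)) with cong u₁ e | cong u₂ e | pred⁻ k r (cong u₃ e)
   ... | refl | refl | refl = at₃ (trans (S-rot _ _) (trans (S-rot _ _) s))
  sides : ∀ {p q r} → K p q r → DownT p q r × UpT (suc p) q r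
  sides {p} {q} {r} k with proj₁ T (cell (suc p) q r) (cell p q r) k
  ... | _ , τ∈ , σ∈ with region⁻ (suc p) q r τ∈ | region⁻ p q r σ∈
  ... | inj₂ u | inj₁ dn = dn , u
  ... | inj₁ (e , _) | inj₁ (f , _) = refute (p ∷ q ∷ r ∷ []) (# 1 :+ (! 0 :+ ! 1 :+ ! 2 :+ # 2) := L̂ ∷ ! 0 :+ ! 1 :+ ! 2 :+ # 2 := L̂ ∷ []) (1 ∷ 0 ∷ 0 ∷ 1 ∷ []) (e & f)
  ... | inj₁ (e , _) | inj₂ (f , _) = refute (p ∷ q ∷ r ∷ []) (# 1 :+ (! 0 :+ ! 1 :+ ! 2 :+ # 2) := L̂ ∷ ! 0 :+ ! 1 :+ ! 2 :+ # 1 := L̂ ∷ []) (1 ∷ 0 ∷ 0 ∷ 1 ∷ []) (e & f)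
  ... | inj₂ (e , _) | inj₂ (f , _) = refute (p ∷ q ∷ r ∷ []) (# 1 :+ (! 0 :+ ! 1 :+ ! 2 :+ # 1) := L̂ ∷ ! 0 :+ ! 1 :+ ! 2 :+ # 1 := L̂ ∷ []) (1 ∷ 0 ∷ 0 ∷ 1 ∷ []) (e & f)
  K-swap : ∀ {p q r} → K p q r → K p r q
  K-swap k = trans (S-refl _ _) k
  unique-down : ∀ {τ τ′ σ} → Lozenge K τ σ → Lozenge K τ′ σ → τ ≡ τ′
  unique-down {σ = σ} l l′ = proj₁ (proj₂ (proj₂ T) σ _ _ _ _ (lozenge⁻ l) (lozenge⁻ l′) (inj₂ refl) (inj₂ refl))
  unique-up : ∀ {τ σ σ′} → Lozenge K τ σ → Lozenge K τ σ′ → σ ≡ σ′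
  unique-up {τ} l l′ = proj₂ (proj₂ (proj₂ T) τ _ _ _ _ (lozenge⁻ l) (lozenge⁻ l′) (inj₁ refl) (inj₁ refl))
  not-suc : ∀ {n} → + suc n ≢ + n
  not-suc e = NP.1+n≢n (ZP.+-injective e)
  down-exactly : ∀ {p q r} → DownT p q r → Exactly (K p q r) (K q r p) (K r p q)
  down-exactly {p} {q} {r} dn with proj₁ (proj₂ T) (cell p q r) (region⁺ (inj₁ dn))
  ... | τ , σ , s , ρ∈ = found (lozenge⁺ s) ρ∈
    , (λ (k , k′) → not-suc (cong u₁ (unique-down (at₁ k) (at₂ {p = p} {q = q} {r = r} k′))))
    , (λ (k , k′) → not-suc (cong u₂ (unique-down (at₂ {p = p} {q = q} {r = r} k) (at₃ k′))))
    , (λ (k , k′) → not-suc (cong u₃ (unique-down (at₃ {p = p} {q = q} {r = r} k) (at₁ k′))))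
   where
   found : ∀ {τ σ} → Lozenge K τ σ → cell p q r ∈L (τ , σ) → K p q r ⊎ K q r p ⊎ K r p q
   found (at₁ k) (inj₂ refl) = inj₁ k
   found (at₂ k) (inj₂ refl) = inj₂ (inj₁ k)
   found (at₃ k) (inj₂ refl) = inj₂ (inj₂ k)
   found (at₁ k) (inj₁ refl) = ⊥-elim (up-down (proj₂ (sides k)) dn)
   found (at₂ k) (inj₁ refl) = ⊥-elim (up-down (proj₂ (sides k)) (DownT-rot dn))
   found (at₃ k) (inj₁ refl) = ⊥-elim (up-down (proj₂ (sides k)) (DownT-rot (DownT-rot dn)))
  up-exactly : ∀ {p q r} → UpT p q r → Exactly (Shifted K p q r) (Shifted K q r p) (Shifted K r p q)
  up-exactly {p} {q} {r} u with proj₁ (proj₂ T) (cell p q r) (region⁺ (inj₂ u))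
  ... | τ , σ , s , ρ∈ = found (lozenge⁺ s) ρ∈
    , (λ { ((p′ , refl , k) , (q′ , refl , k′)) → not-suc (sym (cong u₁ (unique-up (at₁ {p = p′} {q = suc q′} {r = r} k) (at₂ {p = suc p′} {q = q′} {r = r} k′)))) })
    , (λ { ((q′ , refl , k) , (r′ , refl , k′)) → not-suc (sym (cong u₂ (unique-up (at₂ {p = p} {q = q′} {r = suc r′} k) (at₃ {p = p} {q = suc q′} {r = r′} k′)))) })
    , (λ { ((r′ , refl , k) , (p′ , refl , k′)) → not-suc (sym (cong u₃ (unique-up (at₃ {p = suc p′} {q = q} {r = r′} k) (at₁ {p = p′} {q = q} {r = suc r′} k′)))) })
   where
   found : ∀ {τ σ} → Lozenge K τ σ → cell p q r ∈L (τ , σ) → Shifted K p q r ⊎ Shifted K q r p ⊎ Shifted K r p q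
   found (at₁ k) (inj₁ refl) = inj₁ (_ , refl , k)
   found (at₂ k) (inj₁ refl) = inj₂ (inj₁ (_ , refl , k))
   found (at₃ k) (inj₁ refl) = inj₂ (inj₂ (_ , refl , k))
   found (at₁ k) (inj₂ refl) = ⊥-elim (up-down u (proj₁ (sides k)))
   found (at₂ k) (inj₂ refl) = ⊥-elim (up-down (UpT-rot u) (proj₁ (sides k)))
   found (at₃ k) (inj₂ refl) = ⊥-elim (up-down (UpT-rot (UpT-rot u)) (proj₁ (sides k)))
  matching : Matching K
  matching = record
   { M? = λ p q r → S (cell (suc p) q r) (cell p q r) Bool.≟ true
   ; M-swap = λ {p} {q} {r} → K-swap {p} {q} {r} ; M-down = λ {p} {q} {r} k → proj₁ (sides {p} {q} {r} k)
   ; M-up = λ {p} {q} {r} k → proj₂ (sides {p} {q} {r} k)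
   ; down-once = down-exactly ; up-once = up-exactly }

-- The number of symmetric tilings as the length of the list of words.

open import Data.Nat using (_<_; _∸_; _+_)
open PathRows using (Q)
open SecondProduct using (P₁-closed)
open Strips using (path-count)
open Triples using (Matching; Matching-⊇)
-- Taking `z` as a parameter, with `t = y + z + 1`, keeps truncated subtraction out of the whole
-- argument. The words index the tilings, `path-count` gives their number as a determinant, and
-- `P₁-closed` its value.
theorem2p3′ : ∀ y z a x → Σ ℕ λ N → NumSymTilings (ℋ₂ (suc (y + z)) y a x) N × ι (+ N) ≡ P₁ (suc x) y z a
theorem2p3′ y z a x = N , (enumerate , injective , surjective) , trans (path-count y z a x) (sym (P₁-closed x y z a))
  where
  open MatchedDirections y z a x
  open Tilings y z a x
  enumerate : _ → SymTiling R
  enumerate i = tiling (M-matching i)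
  injective : ∀ i j → enumerate i ≈T enumerate j → i ≡ j
  injective i j same = M-injective i j (λ {p} {q} {r} k → at₁⁻ (tiles⁻ (M-matching j) (trans (sym (same (cell (suc p) q r) (cell p q r))) (tiles⁺ (M-matching i) (at₁ k)))))
    where
    at₁⁻ : ∀ {K p q r} → Lozenge K (cell (suc p) q r) (cell p q r) → K p q r
    at₁⁻ (at₁ k) = k
  surjective : ∀ s → Σ _ λ i → s ≈T enumerate i
  surjective (S , T , S-rot , S-refl) = i , λ τ σ → bool-cong
      -- `M-surjective` provides an inclusion of matchings; as both are perfect, it can be reversed.
      (λ s → tiles⁺ (M-matching i) (convert (λ {p} {q} {r} → Matching-⊇ y z a x (M-matching i) matching M⊆K {p} {q} {r}) (lozenge⁺ s)))
      (λ s → lozenge⁻ (convert M⊆K (tiles⁻ (M-matching i) s)))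
    where
    open FromTiling S T S-rot S-refl
    i = proj₁ (M-surjective matching)
    M⊆K : ∀ {p q r} → M[ _ ] p q r → K p q r
    M⊆K = proj₂ (M-surjective matching)
    convert : ∀ {K K′ τ σ} → (∀ {p q r} → K p q r → K′ p q r) → Lozenge K τ σ → Lozenge K′ τ σ
    convert f (at₁ k) = at₁ (f k)
    convert f (at₂ k) = at₂ (f k)
    convert f (at₃ k) = at₃ (f k)

theorem2p3 : (t y a x : ℕ) → y < t →
    Σ ℕ λ N → NumSymTilings (ℋ₂ t y a x) N × ι (+ N) ≡ P₁ (suc x) y (t ∸ y ∸ 1) a
theorem2p3 t y a x y<t = subst (λ t′ → Σ ℕ λ N → NumSymTilings (ℋ₂ t′ y a x) N × ι (+ N) ≡ P₁ (suc x) y (t ∸ y ∸ 1) a)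
  t≡ (theorem2p3′ y (t ∸ y ∸ 1) a x)
  where
  t≡ : suc (y + (t ∸ y ∸ 1)) ≡ t
  t≡ = trans (cong (λ s → suc (y + s)) (NP.∸-+-assoc t y 1)) (trans (cong (λ s → suc (y + (t ∸ s))) (NP.+-comm y 1)) (m+[n∸m]≡n y<t))
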